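{- Let $n\ge2$ and let $\Phi$ be the root system of type $B_n$ with coroot lattice $\check Q=\{x\in\mathbb Z^n:\sum_ix_i\in2\mathbb Z\}$ and uniform zeta map $\zeta:\check Q/(2n+1)\check Q\to\operatorname{Park}(\Phi)$. Then $\zeta\circ\psi=\varphi\circ\zeta_B$ as maps $\operatorname{Vert}(B_n)\to\operatorname{Park}(\Phi)$, where $\psi(\pi,v)=u\cdot\lambda+(2n+1)\check Q$, $\varphi(\beta,w)=[w,A_\beta]$, and $\zeta_B(\pi,v)=(\zeta_B(\pi),d_B(\pi,v))$.
   Context: Uniform setting: $\Phi$ irreducible crystallographic root system in Euclidean $V$, positive roots $\Phi^+$, simple roots $\Delta$, highest root $\tilde\alpha$, Weyl group $W$, Coxeter number $h$, coroot lattice $\check Q$ (span of $2\alpha/\langle\alpha,\alpha\rangle$). $H_{\alpha,k}=\{x:\langle x,\alpha\rangle=k\}$; the affine Weyl group $\widetilde W$ (generated by reflections in all $H_{\alpha,k}$) acts simply transitively on alcoves; $A_\circ=\{x:\langle x,\alpha\rangle>0\ \forall\alpha\in\Delta,\langle x,\tilde\alpha\rangle<1\}$; $C=\{x:\langle x,\alpha\rangle>0\ \forall\alpha\in\Delta\}$, chambers are $wC$. Shi arrangement: $H_{\alpha,k}$, $\alpha\in\Phi^+$, $k\in\{0,1\}$; each region $R$ contains a unique alcove closest to the origin, $\widetilde w_RA_\circ$. $\widetilde w_f\in\widetilde W$ with $\widetilde w_fA_\circ=\{x:\langle x,\alpha\rangle>1\ \forall\alpha\in\Delta,\langle x,\tilde\alpha\rangle<h\}$.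 Anderson map $\mathcal A(\widetilde w_R)=-\widetilde w_R\widetilde w_f^{ -1}(0)+(h+1)\check Q$ (a bijection). Floors of an alcove: hyperplanes $H_{\alpha,k}$ supporting a facet, not through the origin, separating it from the origin. Root poset: $\alpha\le\beta$ iff $\beta-\alpha$ is a sum of positive roots. $\operatorname{Park}(\Phi)$: classes $[w,A]$, $w\in W$, $A$ an antichain, $(w,A)\sim(w',A')$ iff $A=A'$ and $wH=w'H$, $H=\langle s_\alpha:\alpha\in A\rangle$. $\Theta^{ -1}(\widetilde w_R)=[w,A]$ with $\widetilde w_RA_\circ\subseteq wC$, $A=\{\alpha\in\Phi^+:H_{\alpha,1}$ a floor of $w^{ -1}\widetilde w_RA_\circ\}$ (a bijection); $\zeta=\Theta^{ -1}\circ\mathcal A^{ -1}$. Type $B_n$: $\Phi^+=\{\pm e_i+e_j:i<j\}\cup\{e_i\}$, $\Delta=\{e_1\}\cup\{e_{i+1}-e_i:1\le i<n\}$, $\tilde\alpha=e_{n-1}+e_n$, $h=2n$, $W=\mathfrak S_n^B$ (bijections $w$ of $\{\pm1,\dots,\pm n\}$ with $w(-i)=-w(i)$; set $w(0)=0$) acting by $w\cdot e_i=e_{w(i)}$, $e_{ -i}=-e_i$. Combinatorics: $\mathcal L_{n,n}$, words with $n$ $E$'s and $n$ $N$'s; $\mathcal B_{2n}$, length-$2n$ words whose prefixes have at least as many $N$'s as $E$'s; rise $i$: $i$-th $N$ followed by $N$; valley $(i,j)$: $i$-th $E$ followed by $j$-th $N$, plus $(i,j+1)$ if a ballot path with $i$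 $E$'s and $j$ $N$'s ends with $E$. $\operatorname{Vert}(B_n)$: $(\pi,v)$, $v\in\mathfrak S_n^B$, $v(i)<v(i+1)$ for rises $i$, $v(1)>0$ if $\pi$ starts with $N$. $\pi_i$ = number of $E$'s before the $i$-th $N$; $\lambda_i=\pi_i$ ($i<n$), $\lambda_n=2\pi_n-\pi_{n-1}$ if $\pi_1+\dots+\pi_{n-2}$ even, $2n+1-2\pi_n+\pi_{n-1}$ if odd; $u\in\mathfrak S_n^B$: $u(i)=v(i)$ ($i<n$), $u(n)=(-1)^{\lambda_{n-1}+\lambda_n}v(n)$. Area vector: $\mu_i=\lambda_i-i$ ($i<n$), $\mu_n=\lambda_n-n$ if $n\equiv0,3\pmod4$, $n+1-\lambda_n$ if $n\equiv1,2\pmod4$. $\overrightarrow{S}^\pm_j,\overleftarrow{S}^\pm_j$ ($j\ge0$): read $a\in\mathbb Z^n$ left to right resp. right to left, writing $N$ for entries $j$ (resp. $-j$) and $E$ for entries $j+1$ (resp. $-j-1$). $\zeta_B(\pi)=\overleftarrow{S}^-_{2n}(\mu)\overrightarrow{S}^+_{2n}(\mu)\cdots\overleftarrow{S}^-_1(\mu)\overrightarrow{S}^+_1(\mu)\overleftarrow{S}^-_0(\mu)(N\overrightarrow{S}^+_0(\mu))^\circ$, $(\cdot)^\circ$ deleting the last letter. $d_B(\pi,v)$: for $i=0,1,\dots$ write $v(j)$ for $j$ with $\mu_j=-i$ (increasing $j$), then $-v(j)$ for $j$ with $\mu_j=i+1$ (decreasing $j$); if $\mu_{n-1}+\mu_n$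 is even change the sign of the entry from row $n$. For a valley $(i,j)$ of $\beta\in\mathcal B_{2n}$: $\alpha_{i,j}=e_{n+1-i}-e_{n+1-j}$ ($j<n+1$), $e_{n+1-i}$ ($j=n+1$), $e_{n+1-i}+e_{j-n-1}$ ($j>n+1$); $A_\beta$ the set of these. $\operatorname{Diag}(B_n)$: $(\beta,w)$, $w\in\mathfrak S_n^B$, with $w(n+1-i)>w(n+1-j)$ for every valley $(i,j)$. -}

module Defs where

open import Data.Nat as ℕ using (ℕ; zero; suc)
open import Data.Integer as ℤ using (ℤ; +_; -[1+_]; _/ℕ_; ∣_∣)
open import Data.Integer.Properties using () renaming (_≟_ to _≟ℤ_)
open import Data.Fin using (Fin; toℕ; inject₁) renaming (zero to fz; suc to fs)
open import Data.List using (List; []; _∷_; _++_; map; foldr; concatMap; reverse; upTo; allFin)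
open import Data.List.Relation.Unary.All using (All)
open import Data.List.Relation.Unary.Any using (Any)
open import Data.Bool using (Bool; true; false; if_then_else_)
open import Data.Maybe using (Maybe; just; nothing)
open import Data.Product using (Σ; _×_; _,_)
open import Data.Sum using (_⊎_)
open import Relation.Nullary.Decidable using (does)
open import Relation.Binary.PropositionalEquality using (_≡_)

Iff : Set → Set → Set
Iff A B = (A → B) × (B → A)

eqℤ : ℤ → ℤ → Bool
eqℤ a b = does (a ≟ℤ b)

eqℕ : ℕ → ℕ → Bool
eqℕ a b = does (a ℕ.≟ b)

ltℕ : ℕ → ℕ → Bool
ltℕ a b = does (suc a ℕ.≤? b)

evenℕ : ℕ → Bool
evenℕ m = eqℕ (m ℕ.% 2) 0

sumℤ : List ℤ → ℤ
sumℤ = foldr ℤ._+_ (+ 0)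

sumℕ : List ℕ → ℕ
sumℕ = foldr ℕ._+_ 0

-- 1-indexed lookup with default
nthℕ : List ℕ → ℕ → ℕ
nthℕ []       _             = 0
nthℕ (x ∷ xs) zero          = 0
nthℕ (x ∷ xs) (suc zero)    = x
nthℕ (x ∷ xs) (suc (suc k)) = nthℕ xs (suc k)

nthℤ : List ℤ → ℕ → ℤ
nthℤ []       _       = + 0
nthℤ (x ∷ xs) zero    = x
nthℤ (x ∷ xs) (suc k) = nthℤ xs k

-- Vectors in ℤ^n (coordinates w.r.t. e_1,…,e_n; Fin index k is e_{k+1})

Vecℤ : ℕ → Set
Vecℤ n = Fin n → ℤ

_≈v_ : ∀ {n} → Vecℤ n → Vecℤ n → Set
x ≈v y = ∀ i → x i ≡ y i

_+v_ : ∀ {n} → Vecℤ n → Vecℤ n → Vecℤ n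
(x +v y) i = x i ℤ.+ y i

negv : ∀ {n} → Vecℤ n → Vecℤ n
negv x i = ℤ.- x i

_-v_ : ∀ {n} → Vecℤ n → Vecℤ n → Vecℤ n
x -v y = x +v negv y

_·v_ : ∀ {n} → ℤ → Vecℤ n → Vecℤ n
(c ·v x) i = c ℤ.* x i

Σf : ∀ n → (Fin n → ℤ) → ℤ
Σf n f = sumℤ (map f (allFin n))

⟪_,_⟫ : ∀ {n} → Vecℤ n → Vecℤ n → ℤ
⟪_,_⟫ {n} x y = Σf n (λ i → x i ℤ.* y i)

Σv : ∀ n {m} → (Fin n → Vecℤ m) → Vecℤ m
Σv n f j = Σf n (λ i → f i j)

-- e_k for a signed index k ∈ {±1,…,±n}, with e_{-k} = -e_k (zero vector otherwise)
e : ∀ {n} → ℤ → Vecℤ n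
e k j = if eqℤ k (+ suc (toℕ j)) then + 1
        else (if eqℤ k (ℤ.- (+ suc (toℕ j))) then ℤ.- (+ 1) else + 0)

-- 1-indexed coordinate of a vector (0 if out of range)
ix : ∀ {n} → Vecℤ n → ℕ → ℤ
ix {n} x m = Σf n (λ k → if eqℕ (suc (toℕ k)) m then x k else + 0)

-- Signed permutations (hyperoctahedral group 𝔖ₙᴮ = W(Bₙ)) in one-line
-- notation: w k = w(k+1) ∈ {±1,…,±n}.

SP : ℕ → Set
SP n = Fin n → ℤ

IsSP : ∀ {n} → SP n → Set
IsSP {n} w = (∀ i → (1 ℕ.≤ ∣ w i ∣) × (∣ w i ∣ ℕ.≤ n))
           × (∀ i j → ∣ w i ∣ ≡ ∣ w j ∣ → i ≡ j)

extSP : ∀ {n} → SP n → ℤ → ℤ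
extSP w (+ zero)  = + 0
extSP w (+ suc m) = ix w (suc m)
extSP w -[1+ m ]  = ℤ.- ix w (suc m)

compSP : ∀ {n} → SP n → SP n → SP n
compSP w v i = extSP w (v i)

invSP : ∀ {n} → SP n → SP n
invSP {n} w k = Σf n (λ i →
  if eqℤ (w i) (+ suc (toℕ k)) then + suc (toℕ i)
  else (if eqℤ (w i) (ℤ.- (+ suc (toℕ k))) then ℤ.- (+ suc (toℕ i)) else + 0))

actV : ∀ {n} → SP n → Vecℤ n → Vecℤ n
actV {n} w x = Σv n (λ i → x i ·v e (w i))

eI : ∀ {n} → Fin n → Vecℤ n
eI i = e (+ suc (toℕ i))

data PosRoot (n : ℕ) : Set where
  short : Fin n → PosRoot n
  minus : (i j : Fin n) → toℕ i ℕ.< toℕ j → PosRoot n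
  plus  : (i j : Fin n) → toℕ i ℕ.< toℕ j → PosRoot n

rootVec : ∀ {n} → PosRoot n → Vecℤ n
rootVec (short i)     = eI i
rootVec (minus i j _) = eI j -v eI i
rootVec (plus i j _)  = eI i +v eI j

private
  pairRoots : ∀ {n} → Fin n → Fin n → List (PosRoot n)
  pairRoots i j with suc (toℕ i) ℕ.≤? toℕ j
  ... | Relation.Nullary.Decidable.yes p = minus i j p ∷ plus i j p ∷ []
  ... | Relation.Nullary.Decidable.no _  = []

posRoots : ∀ n → List (PosRoot n)
posRoots n = map short (allFin n)
  ++ concatMap (λ i → concatMap (λ j → pairRoots i j) (allFin n)) (allFin n)

simpleRoot : ∀ {n} → Fin n → Vecℤ n
simpleRoot {suc m} fz     = eI {suc m} fz
simpleRoot {suc m} (fs k) = eI (fs k) -v eI (inject₁ k)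

highest : ∀ n → Vecℤ n
highest n = e (+ (n ℕ.∸ 1)) +v e (+ n)

cox : ℕ → ℕ
cox n = 2 ℕ.* n

-- ⟨x, α^∨⟩ = 2⟨x,α⟩/⟨α,α⟩ for a root α of Bₙ (⟨α,α⟩ ∈ {1,2})
corootPair : ∀ {n} → Vecℤ n → Vecℤ n → ℤ
corootPair x α = if eqℤ ⟪ α , α ⟫ (+ 1) then + 2 ℤ.* ⟪ x , α ⟫ else ⟪ x , α ⟫

refl : ∀ {n} → Vecℤ n → Vecℤ n → Vecℤ n
refl α x = x -v (corootPair x α ·v α)

InQ : ∀ {n} → Vecℤ n → Set
InQ {n} t = Σ ℤ (λ k → Σf n t ≡ + 2 ℤ.* k)

record AffW (n : ℕ) : Set where
  constructor aff
  field
    lin : SP n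
    tr  : Vecℤ n
open AffW public

IsAffW : ∀ {n} → AffW n → Set
IsAffW a = IsSP (lin a) × InQ (tr a)

act : ∀ {n} → AffW n → Vecℤ n → Vecℤ n
act a x = actV (lin a) x +v tr a

-- Alcoves are represented through an interior point.  We use scaled
-- coordinates: a point x is stored as Nsc·x with Nsc = 4n+4.  The point
-- p = (1,3,5,…,2n-1)/(4n+4) lies in the interior of A∘ and lies on no
-- affine hyperplane H_{α,k}.
Nsc : ℕ → ℕ
Nsc n = suc (suc (suc (suc (4 ℕ.* n))))

pS : ∀ {n} → Vecℤ n
pS i = + suc (2 ℕ.* toℕ i)

-- (scaled) interior point of the alcove a·A∘
ptS : ∀ {n} → AffW n → Vecℤ n
ptS {n} a = actV (lin a) pS +v ((+ Nsc n) ·v tr a)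

-- ⌊⟨x,α⟩⌋ for x = a·p, from scaled coordinates
flr : ∀ n → ℤ → ℤ
flr n z = z /ℕ Nsc n

-- walls of A∘: H_{α,0} (α ∈ Δ, `just k`) and H_{α̃,1} (`nothing`)
wallRoot : ∀ {n} → Maybe (Fin n) → Vecℤ n
wallRoot (just k) = simpleRoot k
wallRoot {n} nothing = highest n

wallConst : ∀ {n} → Maybe (Fin n) → ℤ
wallConst (just k) = + 0
wallConst nothing  = + 1

-- a·H_{α,c} = H_{wα, c + ⟨t,wα⟩}  (a = (w,t))
wallImgRoot : ∀ {n} → AffW n → Maybe (Fin n) → Vecℤ n
wallImgRoot a W = actV (lin a) (wallRoot W)

wallImgConst : ∀ {n} → AffW n → Maybe (Fin n) → ℤ
wallImgConst a W = wallConst W ℤ.+ ⟪ tr a , wallImgRoot a W ⟫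

HypEq : ∀ {n} → Vecℤ n → ℤ → Vecℤ n → ℤ → Set
HypEq β k γ c = (β ≈v γ × k ≡ c) ⊎ (β ≈v negv γ × k ≡ ℤ.- c)

-- H_{β,k} is a floor of the alcove a·A∘: it supports a facet, does not
-- pass through 0, and separates the alcove from the origin.
IsFloor : ∀ {n} → AffW n → Vecℤ n → ℤ → Set
IsFloor {n} a β k =
  Σ (Maybe (Fin n)) (λ W → HypEq β k (wallImgRoot a W) (wallImgConst a W))
  × ((+ 0 ℤ.< k × (+ Nsc n) ℤ.* k ℤ.< ⟪ ptS a , β ⟫)
     ⊎ (k ℤ.< + 0 × ⟪ ptS a , β ⟫ ℤ.< (+ Nsc n) ℤ.* k))

InC : ∀ {n} → Vecℤ n → Set
InC x = ∀ k → + 0 ℤ.< ⟪ x , simpleRoot k ⟫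

InChamber : ∀ {n} → SP n → AffW n → Set
InChamber w a = InC (actV (invSP w) (ptS a))

-- w̃_f : w̃_f A∘ = {x : ⟨x,α⟩ > 1 (α ∈ Δ), ⟨x,α̃⟩ < h}
IsWf : ∀ {n} → AffW n → Set
IsWf {n} a = IsAffW a
  × (∀ k → (+ Nsc n) ℤ.< ⟪ ptS a , simpleRoot k ⟫)
  × (⟪ ptS a , highest n ⟫ ℤ.< + (cox n ℕ.* Nsc n))

SameShiRegion : ∀ {n} → AffW n → AffW n → Set
SameShiRegion {n} a b = ∀ (r : PosRoot n) →
  Iff (⟪ ptS a , rootVec r ⟫ ℤ.< + 0) (⟪ ptS b , rootVec r ⟫ ℤ.< + 0)
  × Iff (⟪ ptS a , rootVec r ⟫ ℤ.< + Nsc n) (⟪ ptS b , rootVec r ⟫ ℤ.< + Nsc n)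

-- number of affine hyperplanes H_{α,k} (α ∈ Φ⁺, k ∈ ℤ) separating a·A∘ from A∘
dist : ∀ {n} → AffW n → ℕ
dist {n} a = sumℕ (map (λ r → ∣ flr n ⟪ ptS a , rootVec r ⟫ ∣) (posRoots n))

ShiMin : ∀ {n} → AffW n → Set
ShiMin a = IsAffW a × (∀ b → IsAffW b → SameShiRegion a b → dist a ℕ.≤ dist b)

CongMod : ∀ {n} → ℤ → Vecℤ n → Vecℤ n → Set
CongMod {n} m x y = Σ (Vecℤ n) (λ z → InQ z × ((x -v y) ≈v (m ·v z)))

-- Anderson map: 𝒜(w̃) = -w̃ w̃_f⁻¹(0) + (h+1)Q^∨ equals the class of x
AndersonIs : ∀ {n} → AffW n → AffW n → Vecℤ n → Set
AndersonIs {n} wf a x =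
  CongMod (+ suc (cox n)) (negv (act a (negv (actV (invSP (lin wf)) (tr wf))))) x

Subset : ℕ → Set₁
Subset n = PosRoot n → Set

reflList : ∀ {n} → List (PosRoot n) → Vecℤ n → Vecℤ n
reflList rs x = foldr (λ r y → refl (rootVec r) y) x rs

-- [w,A] = [w',A'] : A = A' and w' ∈ w⟨s_α : α ∈ A⟩
ParkEq : ∀ {n} → SP n → Subset n → SP n → Subset n → Set
ParkEq {n} w A w' A' = (∀ r → Iff (A r) (A' r))
  × Σ (List (PosRoot n)) (λ rs → All A rs
      × (∀ x → actV w' x ≈v actV w (reflList rs x)))

-- Θ⁻¹(w̃) = [w', A'] : with w̃A∘ ⊆ wC, [w, {α : H_{α,1} floor of w⁻¹w̃A∘}] = [w',A']
ThetaInvIs : ∀ {n} → AffW n → SP n → Subset n → Set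
ThetaInvIs {n} a w' A' = Σ (SP n) (λ w → IsSP w × InChamber w a
  × ParkEq w (λ r → IsFloor (aff (compSP (invSP w) (lin a)) (actV (invSP w) (tr a)))
                             (rootVec r) (+ 1))
           w' A')

data Letter : Set where
  Nl El : Letter

Word : Set
Word = List Letter

countN : Word → ℕ
countN []        = 0
countN (Nl ∷ w) = suc (countN w)
countN (El ∷ w) = countN w

countE : Word → ℕ
countE []        = 0
countE (Nl ∷ w) = countE w
countE (El ∷ w) = suc (countE w)

InL : ℕ → Word → Set
InL n π = countN π ≡ n × countE π ≡ n

piList : Word → List ℕ
piList = go 0
  where
  go : ℕ → Word → List ℕ
  go c []        = []
  go c (El ∷ w) = go (suc c) w
  go c (Nl ∷ w) = c ∷ go c w

piAt : Word → ℕ → ℕ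
piAt π i = nthℕ (piList π) i

rises : Word → List ℕ
rises = go 0
  where
  go : ℕ → Word → List ℕ
  go k []               = []
  go k (El ∷ w)        = go k w
  go k (Nl ∷ Nl ∷ w)  = suc k ∷ go (suc k) (Nl ∷ w)
  go k (Nl ∷ El ∷ w)  = go (suc k) (El ∷ w)
  go k (Nl ∷ [])       = []

InVert : ∀ n → Word → SP n → Set
InVert n π v = InL n π × IsSP v
  × (∀ (i j : Fin n) → toℕ j ≡ suc (toℕ i) → Any (_≡_ (suc (toℕ i))) (rises π) → v i ℤ.< v j)
  × (∀ w → π ≡ Nl ∷ w → ∀ (i : Fin n) → toℕ i ≡ 0 → + 0 ℤ.< v i)

lamLast : ℕ → Word → ℤ
lamLast n π =
  if evenℕ (sumℕ (map (λ k → piAt π (suc k)) (upTo (n ℕ.∸ 2))))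
  then + (2 ℕ.* piAt π n) ℤ.- + piAt π (n ℕ.∸ 1)
  else + (suc (2 ℕ.* n)) ℤ.- + (2 ℕ.* piAt π n) ℤ.+ + piAt π (n ℕ.∸ 1)

lam : ∀ n → Word → Vecℤ n
lam n π i = if ltℕ (suc (toℕ i)) n then + piAt π (suc (toℕ i)) else lamLast n π

uSP : ∀ n → Word → SP n → SP n
uSP n π v i =
  if ltℕ (suc (toℕ i)) n then v i
  else (if evenℕ ∣ ix (lam n π) (n ℕ.∸ 1) ℤ.+ ix (lam n π) n ∣ then v i else ℤ.- v i)

-- ψ(π,v) = u·λ (representative of its class mod (2n+1)Q^∨)
psi : ∀ n → Word → SP n → Vecℤ n
psi n π v = actV (uSP n π v) (lam n π)

mu : ∀ n → Word → Vecℤ n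
mu n π i =
  if ltℕ (suc (toℕ i)) n then lam n π i ℤ.- + suc (toℕ i)
  else (if eqℕ (n ℕ.% 4) 0 then lam n π i ℤ.- + n
        else (if eqℕ (n ℕ.% 4) 3 then lam n π i ℤ.- + n
              else + suc n ℤ.- lam n π i))

sweepR⁺ : ℕ → List ℤ → Word
sweepR⁺ j a = concatMap (λ x → if eqℤ x (+ j) then Nl ∷ []
                               else (if eqℤ x (+ suc j) then El ∷ [] else [])) a

sweepL⁻ : ℕ → List ℤ → Word
sweepL⁻ j a = concatMap (λ x → if eqℤ x (ℤ.- (+ j)) then Nl ∷ []
                               else (if eqℤ x (ℤ.- (+ suc j)) then El ∷ [] else [])) (reverse a)

dropLast : Word → Word
dropLast []            = []
dropLast (x ∷ [])      = []
dropLast (x ∷ y ∷ xs) = x ∷ dropLast (y ∷ xs)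

muList : ∀ n → Word → List ℤ
muList n π = map (mu n π) (allFin n)

zetaB : ℕ → Word → Word
zetaB n π =
  concatMap (λ j → sweepL⁻ j (muList n π) ++ sweepR⁺ j (muList n π))
            (map (λ k → cox n ℕ.∸ k) (upTo (cox n)))
  ++ sweepL⁻ 0 (muList n π) ++ dropLast (Nl ∷ sweepR⁺ 0 (muList n π))

dBpairs : ∀ n → Word → SP n → List (Fin n × ℤ)
dBpairs n π v = concatMap step (upTo (suc (cox n)))
  where
  step : ℕ → List (Fin n × ℤ)
  step i = concatMap (λ j → if eqℤ (mu n π j) (ℤ.- (+ i)) then (j , v j) ∷ [] else []) (allFin n)
        ++ concatMap (λ j → if eqℤ (mu n π j) (+ suc i) then (j , ℤ.- v j) ∷ [] else []) (reverse (allFin n))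

dB : ∀ n → Word → SP n → SP n
dB n π v k = nthℤ (map fix (dBpairs n π v)) (toℕ k)
  where
  fix : Fin n × ℤ → ℤ
  fix (j , x) = if eqℕ (suc (toℕ j)) n
                then (if evenℕ ∣ ix (mu n π) (n ℕ.∸ 1) ℤ.+ ix (mu n π) n ∣ then ℤ.- x else x)
                else x

valleys : Word → List (ℕ × ℕ)
valleys β = go 0 0 β ++ final β
  where
  go : ℕ → ℕ → Word → List (ℕ × ℕ)
  go e k []              = []
  go e k (El ∷ Nl ∷ w) = (suc e , suc k) ∷ go (suc e) k (Nl ∷ w)
  go e k (El ∷ El ∷ w) = go (suc e) k (El ∷ w)
  go e k (El ∷ [])      = []
  go e k (Nl ∷ w)       = go e (suc k) w
  lastIsE : Word → Bool
  lastIsE []             = false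
  lastIsE (El ∷ [])     = true
  lastIsE (Nl ∷ [])     = false
  lastIsE (x ∷ y ∷ w)  = lastIsE (y ∷ w)
  final : Word → List (ℕ × ℕ)
  final w = if lastIsE w then (countE w , suc (countN w)) ∷ [] else []

alphaV : ∀ n → ℕ → ℕ → Vecℤ n
alphaV n i j =
  if ltℕ j (suc n) then e (+ (suc n ℕ.∸ i)) -v e (+ (suc n ℕ.∸ j))
  else (if eqℕ j (suc n) then e (+ (suc n ℕ.∸ i))
        else e (+ (suc n ℕ.∸ i)) +v e (+ (j ℕ.∸ suc n)))

Abeta : ∀ n → Word → Subset n
Abeta n β r = Any (λ ij → alphaV n (Data.Product.proj₁ ij) (Data.Product.proj₂ ij) ≈v rootVec r) (valleys β)

{-# OPTIONS --safe #-}

-- Let p = (1, 3, …, 2n - 1) be the base point of A∘ in coordinates scaled by N = 4n + 4, and put X(t) = p(t) - N μ(t) for signed indices t.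
-- An element a = (w, x) of the affine Weyl group with w⁻¹x = -μ sends p to the point whose coordinates in the frame w are X.  Its alcove is
-- minimal in its Shi region exactly when w⁻¹p + N (μ + (1, …, n)) lies in the dilated alcove N (2n + 1) A∘: in that case every hyperplane
-- recorded by X is a chain of floors, and otherwise the reflection in an offending wall lowers the distance without leaving the region.  The
-- dilated alcove being a fundamental domain of W ⋉ (2n + 1) Q∨, an Anderson class determines its minimal alcove; the class ψ(π, v) belongs to
-- the area vector μ and, up to the sign of the last entry, to w = v.
-- Sorting the signed rows of μ by X yields both components of the zeta map.  The positive half of the order is d_B(π, v), hence the chamber of
-- the alcove.  An E of ζ_B(π) is a signed row at height X and an N one at height X + N, so a valley is a consecutive pair with
-- X(c) + N < X(d), and by an intermediate value argument this means that the difference of the rows is a floor at height one.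

module Submission where

open import Defs hiding (refl)
open import Data.Nat as ℕ using (ℕ; zero; suc; _≤_; z≤n; s≤s)
import Data.Nat.Properties as ℕP
open import Data.Integer as ℤ using (ℤ; +_; -[1+_]; ∣_∣; +≤+; +<+; -<+)
import Data.Integer.Properties as ℤP
import Data.Integer.DivMod as ℤD
open import Data.Fin using (Fin; toℕ; fromℕ; fromℕ<; inject₁; cast) renaming (zero to fz; suc to fs)
import Data.Fin.Properties as FP
open import Data.List using (List; []; _∷_; _++_; map; concatMap; reverse; length; lookup; allFin; upTo; applyUpTo; InitLast; initLast; _∷ʳ′_)
import Data.List.Properties as LP
open import Data.List.Membership.Propositional using (_∈_; find)
import Data.List.Membership.Propositional.Properties as ∈P
open import Data.List.Relation.Unary.Any using (Any; here; there)
import Data.List.Relation.Unary.Any as Any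
open import Data.Bool using (Bool; true; false; if_then_else_)
open import Data.Maybe using (Maybe; just; nothing)
open import Data.Product using (Σ; ∃; _×_; _,_; proj₁; proj₂)
open import Data.Sum using (_⊎_; inj₁; inj₂)
open import Data.Empty using (⊥; ⊥-elim)
open import Function using (_∘_; id; _∋_)
open import Relation.Nullary using (Dec; yes; no; ¬_)
open import Relation.Binary using (Tri; tri<; tri≈; tri>)
open import Relation.Binary.PropositionalEquality using (_≡_; _≢_; refl; sym; trans; cong; cong₂; subst; subst₂; module ≡-Reasoning)
open import Data.Integer.Tactic.RingSolver using (solve-∀)
open import Relation.Nullary.Decidable using (dec-false; dec-true)
open import Data.Fin.Permutation.Components using (transpose; transpose-inverse)
import Data.Nat.DivMod as ℕD
import Data.List.Relation.Unary.Any.Properties as AnyP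
import Data.List.Relation.Unary.All as All
import Data.List.Relation.Unary.All.Properties as AllP
open import Data.List.Relation.Unary.All using (All; []; _∷_)
open import Data.List.Relation.Unary.AllPairs using (AllPairs; []; _∷_)
import Data.List.Relation.Unary.AllPairs.Properties as APP

-- With `e 0 = 0` and `e (- t) = - e t`, every root of Bₙ is a difference of two `e`'s whose signed
-- indices are neither equal nor opposite. Short and long roots then need no separate treatment, and
-- a statement on affine walls becomes one on neighbours in a cyclic order. Two defects of this
-- picture shape the proof. First, 2eₙ is no root, so n and -n are not neighbours, and the highest
-- wall appears as two mirror pairs crossing each other. A target -n is therefore reached through
-- the mirror pair, and parity limits what the crossing can leave inside a gap. Second, the coroot
-- lattice has index two in the integer lattice: (1, ..., n) lies in it only for n congruent to 0 or
-- 3 modulo 4, and otherwise the translation by it must be corrected by the symmetry of A∘ that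
-- sends xₙ to 1 - xₙ. This is what the conventions for λₙ, μₙ and the sign of row n compensate. The
-- scale N exceeds twice every |p(t)|; hence X determines the levels of μ up to one, and 2X never
-- equals N, so that cutting the word at N/2 is unambiguous.

-- Linear arithmetic over the integers by reflection.

module LinearArithmetic where
  open import Data.Bool using (_∧_; _∨_; T)
  open import Data.Unit using (tt)
  open import Data.Vec as Vec using (Vec)
  open import Data.Vec.N-ary using (N-ary; _$ⁿ_; ∀ⁿ; curryⁿ)

  infixl 7 _:*_
  infixl 6 _:+_ _:-_
  infix  8 :-_
  infix  4 _:<_ _:≤_ _:=_
  infixr 3 _⇒_
  infix  3 ⊢_

  data Tm (n : ℕ) : Set where
    var : ℕ → Tm n
    con : ℤ → Tm n
    _:+_ _:*_ _:-_ : Tm n → Tm n → Tm n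
    :-_ : Tm n → Tm n

  data Fm (n : ℕ) : Set where
    _:<_ _:≤_ _:=_ : Tm n → Tm n → Fm n
    :⊥ : Fm n

  data Seq (n : ℕ) : Set where
    _⇒_ : Fm n → Seq n → Seq n
    ⊢_ : Fm n → Seq n

  # : ∀ {n} → ℕ → Tm n
  # k = con (+ k)

  val : ∀ {n} → Vec ℤ n → ℕ → ℤ
  val Vec.[] _ = + 0
  val (x Vec.∷ ρ) zero = x
  val (x Vec.∷ ρ) (suc k) = val ρ k

  ⟦_⟧t : ∀ {n} → Tm n → Vec ℤ n → ℤ
  ⟦ var i ⟧t ρ = val ρ i
  ⟦ con c ⟧t ρ = c
  ⟦ a :+ b ⟧t ρ = ⟦ a ⟧t ρ ℤ.+ ⟦ b ⟧t ρ
  ⟦ a :* b ⟧t ρ = ⟦ a ⟧t ρ ℤ.* ⟦ b ⟧t ρ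
  ⟦ a :- b ⟧t ρ = ⟦ a ⟧t ρ ℤ.- ⟦ b ⟧t ρ
  ⟦ :- a ⟧t ρ = ℤ.- ⟦ a ⟧t ρ

  ⟦_⟧f : ∀ {n} → Fm n → Vec ℤ n → Set
  ⟦ a :< b ⟧f ρ = ⟦ a ⟧t ρ ℤ.< ⟦ b ⟧t ρ
  ⟦ a :≤ b ⟧f ρ = ⟦ a ⟧t ρ ℤ.≤ ⟦ b ⟧t ρ
  ⟦ a := b ⟧f ρ = ⟦ a ⟧t ρ ≡ ⟦ b ⟧t ρ
  ⟦ :⊥ ⟧f ρ = ⊥

  ⟦_⟧s : ∀ {n} → Seq n → Vec ℤ n → Set
  ⟦ f ⇒ s ⟧s ρ = ⟦ f ⟧f ρ → ⟦ s ⟧s ρ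
  ⟦ ⊢ f ⟧s ρ = ⟦ f ⟧f ρ

  Mono : Set
  Mono = List ℕ

  Poly : Set
  Poly = List (Mono × ℤ)

  eqᵇ : Mono → Mono → Bool
  eqᵇ [] [] = true
  eqᵇ [] (_ ∷ _) = false
  eqᵇ (_ ∷ _) [] = false
  eqᵇ (u ∷ a) (v ∷ b) = (u ℕ.≡ᵇ v) ∧ eqᵇ a b

  eqᵇ-sound : ∀ a b → T (eqᵇ a b) → a ≡ b
  eqᵇ-sound [] [] t = refl
  eqᵇ-sound (u ∷ a) (v ∷ b) t with u ℕ.≡ᵇ v in e
  ... | true = cong₂ _∷_ (ℕP.≡ᵇ⇒≡ u v (subst T (sym e) tt)) (eqᵇ-sound a b t)

  coef=0 : ℤ → Bool
  coef=0 (+ zero) = true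
  coef=0 _ = false

  -- Cancelled terms have to disappear, because `negConst` recognises a contradiction only in the
  -- shape of a single constant term.
  addTerm : Mono → ℤ → Poly → Poly
  addTerm m c p = if coef=0 c then p else (m , c) ∷ p

  ins : Mono → ℤ → Poly → Poly
  ins m c [] = (m , c) ∷ []
  ins m c ((m' , c') ∷ p) = if eqᵇ m m' then addTerm m (c ℤ.+ c') p else (m' , c') ∷ ins m c p

  _⊕_ : Poly → Poly → Poly
  [] ⊕ q = q
  ((m , c) ∷ p) ⊕ q = ins m c (p ⊕ q)

  insv : ℕ → Mono → Mono
  insv v [] = v ∷ []
  insv v (u ∷ m) = if v ℕ.≤ᵇ u then v ∷ u ∷ m else u ∷ insv v m

  _⊗m_ : Mono → Mono → Mono
  [] ⊗m b = b
  (v ∷ a) ⊗m b = insv v (a ⊗m b)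

  mulTerm : Mono → ℤ → Poly → Poly
  mulTerm m c [] = []
  mulTerm m c ((m' , c') ∷ p) = ins (m ⊗m m') (c ℤ.* c') (mulTerm m c p)

  _⊛_ : Poly → Poly → Poly
  [] ⊛ q = []
  ((m , c) ∷ p) ⊛ q = mulTerm m c q ⊕ (p ⊛ q)

  scale : ℤ → Poly → Poly
  scale c [] = []
  scale c ((m , d) ∷ p) = (m , c ℤ.* d) ∷ scale c p

  norm : ∀ {n} → Tm n → Poly
  norm (var i) = (i ∷ [] , + 1) ∷ []
  norm (con c) = addTerm [] c []
  norm (a :+ b) = norm a ⊕ norm b
  norm (a :* b) = norm a ⊛ norm b
  norm (a :- b) = norm a ⊕ scale (-[1+ 0 ]) (norm b)
  norm (:- a) = scale (-[1+ 0 ]) (norm a)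

  module _ {n : ℕ} (ρ : Vec ℤ n) where
    ⟦_⟧m : Mono → ℤ
    ⟦ [] ⟧m = + 1
    ⟦ v ∷ m ⟧m = val ρ v ℤ.* ⟦ m ⟧m

    ⟦_⟧p : Poly → ℤ
    ⟦ [] ⟧p = + 0
    ⟦ (m , c) ∷ p ⟧p = c ℤ.* ⟦ m ⟧m ℤ.+ ⟦ p ⟧p

    addTerm-sound : ∀ m c p → ⟦ addTerm m c p ⟧p ≡ c ℤ.* ⟦ m ⟧m ℤ.+ ⟦ p ⟧p
    addTerm-sound m (+ zero) p = sym (trans (cong (ℤ._+ ⟦ p ⟧p) (ℤP.*-zeroˡ ⟦ m ⟧m)) (ℤP.+-identityˡ _))
    addTerm-sound m (+ suc _) p = refl
    addTerm-sound m -[1+ _ ] p = refl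

    ins-sound : ∀ m c p → ⟦ ins m c p ⟧p ≡ c ℤ.* ⟦ m ⟧m ℤ.+ ⟦ p ⟧p
    ins-sound m c [] = refl
    ins-sound m c ((m' , c') ∷ p) with eqᵇ m m' in e
    ... | true with eqᵇ-sound m m' (subst T (sym e) tt)
    ...   | refl = trans (addTerm-sound m (c ℤ.+ c') p) (eq c c' ⟦ m ⟧m ⟦ p ⟧p)
      where eq : ∀ c c' m p → (c ℤ.+ c') ℤ.* m ℤ.+ p ≡ c ℤ.* m ℤ.+ (c' ℤ.* m ℤ.+ p)
            eq = solve-∀
    ins-sound m c ((m' , c') ∷ p) | false = trans (cong (λ z → c' ℤ.* ⟦ m' ⟧m ℤ.+ z) (ins-sound m c p)) (eq (c' ℤ.* ⟦ m' ⟧m) (c ℤ.* ⟦ m ⟧m) ⟦ p ⟧p)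
      where eq : ∀ a b p → a ℤ.+ (b ℤ.+ p) ≡ b ℤ.+ (a ℤ.+ p)
            eq = solve-∀

    ⊕-sound : ∀ p q → ⟦ p ⊕ q ⟧p ≡ ⟦ p ⟧p ℤ.+ ⟦ q ⟧p
    ⊕-sound [] q = sym (ℤP.+-identityˡ _)
    ⊕-sound ((m , c) ∷ p) q = trans (ins-sound m c (p ⊕ q))
      (trans (cong (λ z → c ℤ.* ⟦ m ⟧m ℤ.+ z) (⊕-sound p q)) (sym (ℤP.+-assoc (c ℤ.* ⟦ m ⟧m) ⟦ p ⟧p ⟦ q ⟧p)))

    insv-sound : ∀ v m → ⟦ insv v m ⟧m ≡ val ρ v ℤ.* ⟦ m ⟧m
    insv-sound v [] = refl
    insv-sound v (u ∷ m) with v ℕ.≤ᵇ u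
    ... | true = refl
    ... | false = trans (cong (val ρ u ℤ.*_) (insv-sound v m)) (eq (val ρ u) (val ρ v) ⟦ m ⟧m)
      where eq : ∀ a b c → a ℤ.* (b ℤ.* c) ≡ b ℤ.* (a ℤ.* c)
            eq = solve-∀

    ⊗m-sound : ∀ a b → ⟦ a ⊗m b ⟧m ≡ ⟦ a ⟧m ℤ.* ⟦ b ⟧m
    ⊗m-sound [] b = sym (ℤP.*-identityˡ _)
    ⊗m-sound (v ∷ a) b = trans (insv-sound v (a ⊗m b))
      (trans (cong (val ρ v ℤ.*_) (⊗m-sound a b)) (sym (ℤP.*-assoc (val ρ v) ⟦ a ⟧m ⟦ b ⟧m)))

    mulTerm-sound : ∀ m c p → ⟦ mulTerm m c p ⟧p ≡ (c ℤ.* ⟦ m ⟧m) ℤ.* ⟦ p ⟧p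
    mulTerm-sound m c [] = sym (ℤP.*-zeroʳ (c ℤ.* ⟦ m ⟧m))
    mulTerm-sound m c ((m' , c') ∷ p) = trans (ins-sound (m ⊗m m') (c ℤ.* c') (mulTerm m c p))
      (trans (cong₂ (λ x y → c ℤ.* c' ℤ.* x ℤ.+ y) (⊗m-sound m m') (mulTerm-sound m c p))
             (eq c c' ⟦ m ⟧m ⟦ m' ⟧m ⟦ p ⟧p))
      where eq : ∀ c c' m m' p → c ℤ.* c' ℤ.* (m ℤ.* m') ℤ.+ c ℤ.* m ℤ.* p ≡ c ℤ.* m ℤ.* (c' ℤ.* m' ℤ.+ p)
            eq = solve-∀

    ⊛-sound : ∀ p q → ⟦ p ⊛ q ⟧p ≡ ⟦ p ⟧p ℤ.* ⟦ q ⟧p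
    ⊛-sound [] q = sym (ℤP.*-zeroˡ ⟦ q ⟧p)
    ⊛-sound ((m , c) ∷ p) q = trans (⊕-sound (mulTerm m c q) (p ⊛ q))
      (trans (cong₂ ℤ._+_ (mulTerm-sound m c q) (⊛-sound p q))
             (sym (ℤP.*-distribʳ-+ ⟦ q ⟧p (c ℤ.* ⟦ m ⟧m) ⟦ p ⟧p)))

    scale-sound : ∀ c p → ⟦ scale c p ⟧p ≡ c ℤ.* ⟦ p ⟧p
    scale-sound c [] = sym (ℤP.*-zeroʳ c)
    scale-sound c ((m , d) ∷ p) = trans (cong (λ z → c ℤ.* d ℤ.* ⟦ m ⟧m ℤ.+ z) (scale-sound c p)) (eq c d ⟦ m ⟧m ⟦ p ⟧p)
      where eq : ∀ c d m p → c ℤ.* d ℤ.* m ℤ.+ c ℤ.* p ≡ c ℤ.* (d ℤ.* m ℤ.+ p)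
            eq = solve-∀

    norm-sound : ∀ t → ⟦ norm t ⟧p ≡ ⟦ t ⟧t ρ
    norm-sound (var i) = eq (val ρ i)
      where eq : ∀ x → + 1 ℤ.* (x ℤ.* + 1) ℤ.+ + 0 ≡ x
            eq = solve-∀
    norm-sound (con c) = trans (addTerm-sound [] c []) (eq c)
      where eq : ∀ x → x ℤ.* + 1 ℤ.+ + 0 ≡ x
            eq = solve-∀
    norm-sound (a :+ b) = trans (⊕-sound (norm a) (norm b)) (cong₂ ℤ._+_ (norm-sound a) (norm-sound b))
    norm-sound (a :* b) = trans (⊛-sound (norm a) (norm b)) (cong₂ ℤ._*_ (norm-sound a) (norm-sound b))
    norm-sound (a :- b) = trans (⊕-sound (norm a) (scale (-[1+ 0 ]) (norm b)))
      (cong₂ ℤ._+_ (norm-sound a) (trans (scale-sound (-[1+ 0 ]) (norm b))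
        (trans (ℤP.-1*i≡-i _) (cong ℤ.-_ (norm-sound b)))))
    norm-sound (:- a) = trans (scale-sound (-[1+ 0 ]) (norm a))
        (trans (ℤP.-1*i≡-i _) (cong ℤ.-_ (norm-sound a)))

  -- Fourier–Motzkin elimination on the inequalities 0 ≤ p, monomials being treated as unknowns.

  coef : Mono → Poly → ℤ
  coef m [] = + 0
  coef m ((m' , c) ∷ p) = if eqᵇ m m' then c else coef m p

  coef>0 coef<0 : ℤ → Bool
  coef>0 (+ suc _) = true
  coef>0 _ = false
  coef<0 -[1+ _ ] = true
  coef<0 _ = false

  comb : Mono → Poly → Poly → Poly
  comb m p q = scale (+ ∣ coef m q ∣) p ⊕ scale (+ ∣ coef m p ∣) q

  zeros : Mono → List Poly → List Poly
  zeros m [] = []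
  zeros m (p ∷ ps) = if coef=0 (coef m p) then p ∷ zeros m ps else zeros m ps

  row : Mono → Poly → List Poly → List Poly
  row m p [] = []
  row m p (q ∷ qs) = if coef<0 (coef m q) then comb m p q ∷ row m p qs else row m p qs

  rows : Mono → List Poly → List Poly → List Poly
  rows m [] qs = []
  rows m (p ∷ ps) qs = if coef>0 (coef m p) then row m p qs ++ rows m ps qs else rows m ps qs

  elim : Mono → List Poly → List Poly
  elim m ps = zeros m ps ++ rows m ps ps

  negConst : Poly → Bool
  negConst (([] , -[1+ _ ]) ∷ []) = true
  negConst _ = false

  anyNeg : List Poly → Bool
  anyNeg [] = false
  anyNeg (p ∷ ps) = negConst p ∨ anyNeg ps

  count : (ℤ → Bool) → Mono → List Poly → ℕ
  count f m [] = 0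
  count f m (p ∷ ps) = if f (coef m p) then suc (count f m ps) else count f m ps

  cost : Mono → List Poly → ℕ
  cost m ps = count coef>0 m ps ℕ.* count coef<0 m ps

  -- Eliminating a monomial creates one inequality for each pair of opposite signs; the greedy
  -- choice of the monomial with the fewest such pairs keeps the system small.
  pick : List Poly → Poly → Maybe (ℕ × Mono)
  pick ps [] = nothing
  pick ps (([] , _) ∷ p) = pick ps p
  pick ps ((m@(_ ∷ _) , _) ∷ p) with pick ps p | cost m ps
  ... | nothing | k = just (k , m)
  ... | just (k' , m') | k = if k ℕ.≤ᵇ k' then just (k , m) else just (k' , m')

  pickAny : List Poly → List Poly → Maybe (ℕ × Mono)
  pickAny ps [] = nothing
  pickAny ps (p ∷ qs) with pick ps p
  ... | nothing = pickAny ps qs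
  ... | just r = just r

  fm : ℕ → List Poly → Bool
  fmAt : ℕ → List Poly → Maybe (ℕ × Mono) → Bool
  fm zero ps = anyNeg ps
  fm (suc k) ps = anyNeg ps ∨ fmAt k ps (pickAny ps ps)
  fmAt k ps nothing = false
  fmAt k ps (just (_ , m)) = fm k (elim m ps)

  -- eliminate m from q using the equation p = 0 in which m has coefficient c
  subst₌ : Mono → ℤ → Poly → Poly → Poly
  subst₌ m c p q = if coef=0 (coef m q) then q
    else (scale (+ ∣ c ∣) q ⊕ scale (ℤ.- (ℤ.sign c ℤ.◃ 1) ℤ.* coef m q) p)

  pivot : Poly → Maybe (Mono × ℤ)
  pivot [] = nothing
  pivot (([] , _) ∷ p) = pivot p
  pivot ((m@(_ ∷ _) , c) ∷ p) = just (m , c)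

  -- Substitution uses up an equation without multiplying the inequalities. An equation whose
  -- monomials have all cancelled may still be a contradiction, so it re-enters as two opposite
  -- inequalities.
  gauss : ℕ → List Poly → List Poly → List Poly
  gaussAt : ℕ → Poly → Maybe (Mono × ℤ) → List Poly → List Poly → List Poly
  gauss (suc k) (p ∷ ps) qs = gaussAt k p (pivot p) ps qs
  gauss _ _ qs = qs
  gaussAt k p nothing ps qs = gauss k ps (p ∷ scale -[1+ 0 ] p ∷ qs)
  gaussAt k p (just (m , c)) ps qs = gauss k (map (subst₌ m c p) ps) (map (subst₌ m c p) qs)

  module _ {n : ℕ} (ρ : Vec ℤ n) where
    NN ZZ : Poly → Set
    NN p = + 0 ℤ.≤ ⟦_⟧p ρ p
    ZZ p = ⟦_⟧p ρ p ≡ + 0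

    scale-nn : ∀ k p → NN p → NN (scale (+ k) p)
    scale-nn k p h = subst (+ 0 ℤ.≤_) (sym (scale-sound ρ (+ k) p))
      (subst (ℤ._≤ + k ℤ.* ⟦_⟧p ρ p) (ℤP.*-zeroʳ (+ k)) (ℤP.*-monoˡ-≤-nonNeg (+ k) h))

    scale-zz : ∀ c p → ZZ p → ZZ (scale c p)
    scale-zz c p h = trans (scale-sound ρ c p) (trans (cong (c ℤ.*_) h) (ℤP.*-zeroʳ c))

    comb-nn : ∀ m p q → NN p → NN q → NN (comb m p q)
    comb-nn m p q hp hq = subst (+ 0 ℤ.≤_) (sym (⊕-sound ρ (scale (+ ∣ coef m q ∣) p) (scale (+ ∣ coef m p ∣) q)))
      (ℤP.+-mono-≤ (scale-nn ∣ coef m q ∣ p hp) (scale-nn ∣ coef m p ∣ q hq))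

    zeros-nn : ∀ m ps → All NN ps → All NN (zeros m ps)
    zeros-nn m [] [] = []
    zeros-nn m (p ∷ ps) (h ∷ hs) with coef=0 (coef m p)
    ... | true = h ∷ zeros-nn m ps hs
    ... | false = zeros-nn m ps hs

    row-nn : ∀ m p qs → NN p → All NN qs → All NN (row m p qs)
    row-nn m p [] hp [] = []
    row-nn m p (q ∷ qs) hp (h ∷ hs) with coef<0 (coef m q)
    ... | true = comb-nn m p q hp h ∷ row-nn m p qs hp hs
    ... | false = row-nn m p qs hp hs

    rows-nn : ∀ m ps qs → All NN ps → All NN qs → All NN (rows m ps qs)
    rows-nn m [] qs [] hq = []
    rows-nn m (p ∷ ps) qs (h ∷ hs) hq with coef>0 (coef m p)
    ... | true = AllP.++⁺ (row-nn m p qs h hq) (rows-nn m ps qs hs hq)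
    ... | false = rows-nn m ps qs hs hq

    negConst-sound : ∀ p → T (negConst p) → NN p → ⊥
    negConst-sound (([] , -[1+ k ]) ∷ []) _ h with subst (+ 0 ℤ.≤_) (trans (ℤP.+-identityʳ _) (ℤP.*-identityʳ -[1+ k ])) h
    ... | ()
    negConst-sound (([] , -[1+ _ ]) ∷ _ ∷ _) ()
    negConst-sound (([] , + _) ∷ _) ()
    negConst-sound ((_ ∷ _ , _) ∷ _) ()
    negConst-sound [] ()

    anyNeg-sound : ∀ ps → T (anyNeg ps) → All NN ps → ⊥
    anyNeg-sound (p ∷ ps) t (h ∷ hs) with negConst p in eq
    ... | true = negConst-sound p (subst T (sym eq) tt) h
    ... | false = anyNeg-sound ps t hs

    T-∨⁻ : ∀ a {b} → T (a ∨ b) → T a ⊎ T b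
    T-∨⁻ true t = inj₁ tt
    T-∨⁻ false t = inj₂ t

    fm-sound : ∀ k ps → T (fm k ps) → All NN ps → ⊥
    fmAt-sound : ∀ k ps b → T (fmAt k ps b) → All NN ps → ⊥
    fm-sound zero ps t h = anyNeg-sound ps t h
    fm-sound (suc k) ps t h with T-∨⁻ (anyNeg ps) t
    ... | inj₁ u = anyNeg-sound ps u h
    ... | inj₂ u = fmAt-sound k ps (pickAny ps ps) u h
    fmAt-sound k ps (just (_ , m)) t h = fm-sound k (elim m ps) t (AllP.++⁺ (zeros-nn m ps h) (rows-nn m ps ps h h))

    -- The multiplier of `q` is the absolute value of the pivot coefficient; being nonnegative, it
    -- serves equations and inequalities alike.
    subst₌-eq : ∀ m c p q → ZZ p → ∃ λ k → ⟦_⟧p ρ (subst₌ m c p q) ≡ + k ℤ.* ⟦_⟧p ρ q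
    subst₌-eq m c p q hp with coef=0 (coef m q)
    ... | true = 1 , sym (ℤP.*-identityˡ _)
    ... | false = ∣ c ∣ , trans (⊕-sound ρ (scale (+ ∣ c ∣) q) (scale (ℤ.- (ℤ.sign c ℤ.◃ 1) ℤ.* coef m q) p))
       (trans (cong₂ ℤ._+_ (scale-sound ρ (+ ∣ c ∣) q) (scale-zz (ℤ.- (ℤ.sign c ℤ.◃ 1) ℤ.* coef m q) p hp)) (ℤP.+-identityʳ _))

    subst₌-nn : ∀ m c p qs → ZZ p → All NN qs → All NN (map (subst₌ m c p) qs)
    subst₌-nn m c p [] hp [] = []
    subst₌-nn m c p (q ∷ qs) hp (h ∷ hs) with subst₌-eq m c p q hp
    ... | k , e = subst (+ 0 ℤ.≤_) (trans (scale-sound ρ (+ k) q) (sym e)) (scale-nn k q h) ∷ subst₌-nn m c p qs hp hs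

    subst₌-zz : ∀ m c p qs → ZZ p → All ZZ qs → All ZZ (map (subst₌ m c p) qs)
    subst₌-zz m c p [] hp [] = []
    subst₌-zz m c p (q ∷ qs) hp (h ∷ hs) with subst₌-eq m c p q hp
    ... | k , e = trans e (trans (cong (+ k ℤ.*_) h) (ℤP.*-zeroʳ (+ k))) ∷ subst₌-zz m c p qs hp hs

    gauss-nn : ∀ k ps qs → All ZZ ps → All NN qs → All NN (gauss k ps qs)
    gaussAt-nn : ∀ k p r ps qs → ZZ p → All ZZ ps → All NN qs → All NN (gaussAt k p r ps qs)
    gauss-nn zero ps qs hp hq = hq
    gauss-nn (suc k) [] qs hp hq = hq
    gauss-nn (suc k) (p ∷ ps) qs (h ∷ hp) hq = gaussAt-nn k p (pivot p) ps qs h hp hq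
    gaussAt-nn k p nothing ps qs h hp hq = gauss-nn k ps _ hp
       (ℤP.≤-reflexive (sym h) ∷ ℤP.≤-reflexive (sym (scale-zz -[1+ 0 ] p h)) ∷ hq)
    gaussAt-nn k p (just (m , c)) ps qs h hp hq = gauss-nn k _ _ (subst₌-zz m c p ps h hp) (subst₌-nn m c p qs h hq)

  -- Integrality enters here: a strict inequality leaves a gap of one. The elimination itself is
  -- rational.
  ltP leP : ∀ {n} → Tm n → Tm n → Poly
  leP a b = norm (b :- a)
  ltP a b = norm (b :- a :- # 1)

  -- The fuel 30 bounds the number of eliminated monomials; exhausted fuel can lose a proof but
  -- never create one.
  refutes : List Poly → List Poly → Bool
  refutes es ps = fm 30 (gauss 30 es ps)

  proves : ∀ {n} → List Poly → List Poly → Fm n → Bool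
  proves es ps (a :< b) = refutes es (leP b a ∷ ps)
  proves es ps (a :≤ b) = refutes es (ltP b a ∷ ps)
  proves es ps (a := b) = refutes es (ltP b a ∷ ps) ∧ refutes es (ltP a b ∷ ps)
  proves es ps :⊥ = refutes es ps

  valid : ∀ {n} → List Poly → List Poly → Seq n → Bool
  valid es ps (a :< b ⇒ s) = valid es (ltP a b ∷ ps) s
  valid es ps (a :≤ b ⇒ s) = valid es (leP a b ∷ ps) s
  valid es ps (a := b ⇒ s) = valid (leP a b ∷ es) ps s
  valid es ps (:⊥ ⇒ s) = true
  valid es ps (⊢ f) = proves es ps f

  module _ {n : ℕ} (ρ : Vec ℤ n) where
    le-nn : ∀ a b → ⟦ a ⟧t ρ ℤ.≤ ⟦ b ⟧t ρ → NN ρ (leP a b)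
    le-nn a b h = subst (+ 0 ℤ.≤_) (sym (norm-sound ρ (b :- a))) (ℤP.i≤j⇒0≤j-i h)

    lt-nn : ∀ a b → ⟦ a ⟧t ρ ℤ.< ⟦ b ⟧t ρ → NN ρ (ltP a b)
    lt-nn a b h = subst (+ 0 ℤ.≤_) (trans (eq (⟦ a ⟧t ρ) (⟦ b ⟧t ρ)) (sym (norm-sound ρ (b :- a :- # 1))))
       (ℤP.i≤j⇒0≤j-i (ℤP.i<j⇒suc[i]≤j h))
      where eq : ∀ a b → b ℤ.- (+ 1 ℤ.+ a) ≡ b ℤ.- a ℤ.- + 1
            eq = solve-∀

    eq-zz : ∀ a b → ⟦ a ⟧t ρ ≡ ⟦ b ⟧t ρ → ZZ ρ (leP a b)
    eq-zz a b h = trans (norm-sound ρ (b :- a)) (ℤP.i≡j⇒i-j≡0 (sym h))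

    refutes-sound : ∀ es ps → T (refutes es ps) → All (ZZ ρ) es → All (NN ρ) ps → ⊥
    refutes-sound es ps t he hp = fm-sound ρ 30 (gauss 30 es ps) t (gauss-nn ρ 30 es ps he hp)

    ∧-fst : ∀ a b → T (a ∧ b) → T a
    ∧-fst true b t = tt

    ∧-snd : ∀ a b → T (a ∧ b) → T b
    ∧-snd true b t = t

    proves-sound : ∀ es ps f → T (proves es ps f) → All (ZZ ρ) es → All (NN ρ) ps → ⟦ f ⟧f ρ
    proves-sound es ps (a :< b) t he h = ℤP.≰⇒> (λ q → refutes-sound es (leP b a ∷ ps) t he (le-nn b a q ∷ h))
    proves-sound es ps (a :≤ b) t he h = ℤP.≮⇒≥ (λ q → refutes-sound es (ltP b a ∷ ps) t he (lt-nn b a q ∷ h))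
    proves-sound es ps (a := b) t he h = ℤP.≤-antisym
      (ℤP.≮⇒≥ (λ q → refutes-sound es (ltP b a ∷ ps) (∧-fst _ (refutes es (ltP a b ∷ ps)) t) he (lt-nn b a q ∷ h)))
      (ℤP.≮⇒≥ (λ q → refutes-sound es (ltP a b ∷ ps) (∧-snd (refutes es (ltP b a ∷ ps)) _ t) he (lt-nn a b q ∷ h)))
    proves-sound es ps :⊥ t he h = refutes-sound es ps t he h

    valid-sound : ∀ es ps s → T (valid es ps s) → All (ZZ ρ) es → All (NN ρ) ps → ⟦ s ⟧s ρ
    valid-sound es ps (a :< b ⇒ s) t he h = λ hf → valid-sound es (ltP a b ∷ ps) s t he (lt-nn a b hf ∷ h)
    valid-sound es ps (a :≤ b ⇒ s) t he h = λ hf → valid-sound es (leP a b ∷ ps) s t he (le-nn a b hf ∷ h)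
    valid-sound es ps (a := b ⇒ s) t he h = λ hf → valid-sound (leP a b ∷ es) ps s t (eq-zz a b hf ∷ he) h
    valid-sound es ps (:⊥ ⇒ s) t he h = λ ()
    valid-sound es ps (⊢ f) t he h = proves-sound es ps f t he h

  vars : ∀ n → Vec (Tm n) n
  vars n = varsFrom n 0
    where varsFrom : ∀ {n} k → ℕ → Vec (Tm n) k
          varsFrom zero i = Vec.[]
          varsFrom (suc k) i = var i Vec.∷ varsFrom k (suc i)

  curryΠ : ∀ n {B : Vec ℤ n → Set} → (∀ ρ → B ρ) → ∀ⁿ n (curryⁿ B)
  curryΠ zero f = f Vec.[]
  curryΠ (suc n) f = λ x → curryΠ n (λ ρ → f (x Vec.∷ ρ))

  abstract
    -- The hidden argument is the verdict of the procedure: on success its type evaluates to the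
    -- unit type and it is filled in silently. Products count as unknowns, so callers supply facts
    -- such as the vanishing of a product as hypotheses. `abstract` keeps the certificates from
    -- being unfolded.
    lia : ∀ n (s : N-ary n (Tm n) (Seq n)) {t : T (valid [] [] (s $ⁿ vars n))} →
          ∀ⁿ n (curryⁿ ⟦ s $ⁿ vars n ⟧s)
    lia n s {t} = curryΠ n (λ ρ → valid-sound ρ [] [] (s $ⁿ vars n) t [] [])

open LinearArithmetic using (Tm; Fm; Seq; con; #; _:+_; _:*_; _:-_; :-_; _:<_; _:≤_; _:=_; :⊥; _⇒_; ⊢_; lia)

-- Signed permutations acting on vectors, and the parity of coordinate sums.

module SignedPermutations where

  Σ-suc : ∀ n (f : Fin (suc n) → ℤ) → Σf (suc n) f ≡ f fz ℤ.+ Σf n (f ∘ fs)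
  Σ-suc n f = cong (λ l → f fz ℤ.+ sumℤ l)
    (trans (LP.map-tabulate fs f) (sym (LP.map-tabulate id (f ∘ fs))))

  Σ-cong : ∀ n {f g : Fin n → ℤ} → (∀ i → f i ≡ g i) → Σf n f ≡ Σf n g
  Σ-cong n h = cong sumℤ (LP.map-cong h (allFin n))

  Σ-zero : ∀ n (f : Fin n → ℤ) → (∀ i → f i ≡ + 0) → Σf n f ≡ + 0
  Σ-zero zero f h = refl
  Σ-zero (suc n) f h = trans (Σ-suc n f) (cong₂ ℤ._+_ (h fz) (Σ-zero n (f ∘ fs) (h ∘ fs)))

  Σ-+ : ∀ n (f g : Fin n → ℤ) → Σf n (λ i → f i ℤ.+ g i) ≡ Σf n f ℤ.+ Σf n g
  Σ-+ zero f g = refl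
  Σ-+ (suc n) f g = begin
    Σf (suc n) (λ i → f i ℤ.+ g i) ≡⟨ Σ-suc n (λ i → f i ℤ.+ g i) ⟩
    (f fz ℤ.+ g fz) ℤ.+ Σf n (λ i → f (fs i) ℤ.+ g (fs i)) ≡⟨ cong (λ z → (f fz ℤ.+ g fz) ℤ.+ z) (Σ-+ n (f ∘ fs) (g ∘ fs)) ⟩
    (f fz ℤ.+ g fz) ℤ.+ (Σf n (f ∘ fs) ℤ.+ Σf n (g ∘ fs)) ≡⟨ lia 4 (λ a b c d → ⊢ (a :+ b) :+ (c :+ d) := (a :+ c) :+ (b :+ d)) (f fz) (g fz) (Σf n (f ∘ fs)) (Σf n (g ∘ fs)) ⟩
    (f fz ℤ.+ Σf n (f ∘ fs)) ℤ.+ (g fz ℤ.+ Σf n (g ∘ fs)) ≡⟨ sym (cong₂ ℤ._+_ (Σ-suc n f) (Σ-suc n g)) ⟩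
    Σf (suc n) f ℤ.+ Σf (suc n) g ∎
    where open ≡-Reasoning

  Σ-* : ∀ n c (f : Fin n → ℤ) → Σf n (λ i → c ℤ.* f i) ≡ c ℤ.* Σf n f
  Σ-* zero c f = sym (ℤP.*-zeroʳ c)
  Σ-* (suc n) c f = trans (Σ-suc n (λ i → c ℤ.* f i)) (trans (cong (λ z → c ℤ.* f fz ℤ.+ z) (Σ-* n c (f ∘ fs)))
    (trans (sym (ℤP.*-distribˡ-+ c (f fz) _)) (cong (c ℤ.*_) (sym (Σ-suc n f)))))

  Σ-swap : ∀ n m (f : Fin n → Fin m → ℤ) → Σf n (λ i → Σf m (f i)) ≡ Σf m (λ j → Σf n (λ i → f i j))
  Σ-swap zero m f = sym (Σ-zero m _ (λ _ → refl))
  Σ-swap (suc n) m f = begin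
    Σf (suc n) (λ i → Σf m (f i)) ≡⟨ Σ-suc n (λ i → Σf m (f i)) ⟩
    Σf m (f fz) ℤ.+ Σf n (λ i → Σf m (f (fs i))) ≡⟨ cong (λ z → Σf m (f fz) ℤ.+ z) (Σ-swap n m (f ∘ fs)) ⟩
    Σf m (f fz) ℤ.+ Σf m (λ j → Σf n (λ i → f (fs i) j)) ≡⟨ sym (Σ-+ m _ _) ⟩
    Σf m (λ j → f fz j ℤ.+ Σf n (λ i → f (fs i) j)) ≡⟨ Σ-cong m (λ j → sym (Σ-suc n (λ i → f i j))) ⟩
    Σf m (λ j → Σf (suc n) (λ i → f i j)) ∎
    where open ≡-Reasoning

  Σ-δ : ∀ n (f : Fin n → ℤ) (k : Fin n) → (∀ i → i ≢ k → f i ≡ + 0) → Σf n f ≡ f k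
  Σ-δ (suc n) f fz h = trans (Σ-suc n f) (trans (cong (λ zz → f fz ℤ.+ zz) (Σ-zero n _ (λ i → h (fs i) (λ ())))) (ℤP.+-identityʳ _))
  Σ-δ (suc n) f (fs k) h = trans (Σ-suc n f) (trans (cong₂ ℤ._+_ (h fz (λ ())) (Σ-δ n (f ∘ fs) k (λ i q → h (fs i) (q ∘ FP.suc-injective)))) (ℤP.+-identityˡ _))

  pos neg : ∀ {n} → Fin n → ℤ
  pos i = + suc (toℕ i)
  neg i = -[1+ toℕ i ]

  pos-inj : ∀ {n} {i j : Fin n} → pos i ≡ pos j → i ≡ j
  pos-inj q = FP.toℕ-injective (ℕP.suc-injective (ℤP.+-injective q))

  eqℕ-refl : ∀ m → eqℕ m m ≡ true
  eqℕ-refl m = dec-true (m ℕ.≟ m) refl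

  eqℤ-refl : ∀ m → eqℤ m m ≡ true
  eqℤ-refl m = dec-true (m ℤP.≟ m) refl

  eqℤ-no : ∀ {a b} → a ≢ b → eqℤ a b ≡ false
  eqℤ-no {a} {b} q = dec-false (a ℤP.≟ b) q

  eqℕ-no : ∀ {a b} → a ≢ b → eqℕ a b ≡ false
  eqℕ-no {a} {b} q = dec-false (a ℕ.≟ b) q

  ix-lookup : ∀ {n} (x : Vecℤ n) (k : Fin n) → ix x (suc (toℕ k)) ≡ x k
  ix-lookup {n} x k = trans (Σ-δ n _ k off) (cong (λ b → if b then x k else + 0) (eqℕ-refl (suc (toℕ k))))
    where off : ∀ i → i ≢ k → (if eqℕ (suc (toℕ i)) (suc (toℕ k)) then x i else + 0) ≡ + 0
          off i q = cong (λ b → if b then x i else + 0) (eqℕ-no (λ r → q (FP.toℕ-injective (ℕP.suc-injective r))))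

  -- One odd extension serves vectors and one-line notations alike, so that composition, coordinates
  -- at signed indices and pairings with `e t` become the same operation.
  ext : ∀ {n} → Vecℤ n → ℤ → ℤ
  ext = extSP

  ext-pos : ∀ {n} (x : Vecℤ n) k → ext x (pos k) ≡ x k
  ext-pos = ix-lookup

  ext-neg : ∀ {n} (x : Vecℤ n) k → ext x (neg k) ≡ ℤ.- x k
  ext-neg x k = cong ℤ.-_ (ix-lookup x k)

  -- A view rather than a bound on the absolute value: matching on it produces the three cases in
  -- which `ext` and `e` can be evaluated.
  data SIdx (n : ℕ) : ℤ → Set where
    ps : (i : Fin n) → SIdx n (pos i)
    zr : SIdx n (+ 0)
    ng : (i : Fin n) → SIdx n (neg i)

  sidx : ∀ {n} t → ∣ t ∣ ℕ.≤ n → SIdx n t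
  sidx (+ zero) h = zr
  sidx {n} (+ suc m) h = subst (λ k → SIdx n (+ suc k)) (FP.toℕ-fromℕ< h) (ps (fromℕ< h))
  sidx {n} (-[1+ m ]) h = subst (λ k → SIdx n (-[1+ k ])) (FP.toℕ-fromℕ< h) (ng (fromℕ< h))

  sidx-bound : ∀ {n t} → SIdx n t → ∣ t ∣ ℕ.≤ n
  sidx-bound (ps i) = FP.toℕ<n i
  sidx-bound zr = z≤n
  sidx-bound (ng i) = FP.toℕ<n i

  sidx-neg : ∀ {n t} → SIdx n t → SIdx n (ℤ.- t)
  sidx-neg (ps i) = ng i
  sidx-neg zr = zr
  sidx-neg (ng i) = ps i

  ext-odd : ∀ {n} (x : Vecℤ n) t → ext x (ℤ.- t) ≡ ℤ.- ext x t
  ext-odd x (+ zero) = refl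
  ext-odd x (+ suc m) = refl
  ext-odd x -[1+ m ] = sym (ℤP.neg-involutive _)

  ext-cong : ∀ {n} {x y : Vecℤ n} → x ≈v y → ∀ {t} → SIdx n t → ext x t ≡ ext y t
  ext-cong {x = x} {y} h (ps i) = trans (ext-pos x i) (trans (h i) (sym (ext-pos y i)))
  ext-cong h zr = refl
  ext-cong {x = x} {y} h (ng i) = trans (ext-neg x i) (trans (cong ℤ.-_ (h i)) (sym (ext-neg y i)))

  e-pos-same : ∀ {n} (i : Fin n) → e (pos i) i ≡ + 1
  e-pos-same i rewrite eqℤ-refl (pos i) = refl

  e-pos-diff : ∀ {n} (i j : Fin n) → i ≢ j → e (pos i) j ≡ + 0
  e-pos-diff i j q rewrite eqℤ-no {pos i} {pos j} (q ∘ pos-inj) | eqℤ-no {pos i} {neg j} (λ ()) = refl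

  e-neg : ∀ {n} (i : Fin n) j → e (neg i) j ≡ ℤ.- e (pos i) j
  e-neg i j with i FP.≟ j
  ... | yes refl rewrite eqℤ-refl (pos i) = refl
  ... | no q rewrite eqℤ-no {pos i} {pos j} (q ∘ pos-inj) = refl

  e-zero : ∀ {n} (j : Fin n) → e (+ 0) j ≡ + 0
  e-zero j = refl

  ⟪,e⟫-pos : ∀ {n} (x : Vecℤ n) i → ⟪ x , e (pos i) ⟫ ≡ x i
  ⟪,e⟫-pos {n} x i = trans (Σ-δ n _ i (λ j q → trans (cong (x j ℤ.*_) (e-pos-diff i j (q ∘ sym))) (ℤP.*-zeroʳ (x j))))
     (trans (cong (x i ℤ.*_) (e-pos-same i)) (ℤP.*-identityʳ (x i)))

  ⟪⟫-cong : ∀ {n} {x x' y y' : Vecℤ n} → x ≈v x' → y ≈v y' → ⟪ x , y ⟫ ≡ ⟪ x' , y' ⟫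
  ⟪⟫-cong {n} h k = Σ-cong n (λ i → cong₂ ℤ._*_ (h i) (k i))

  ⟪⟫-neg : ∀ {n} (x y : Vecℤ n) → ⟪ x , negv y ⟫ ≡ ℤ.- ⟪ x , y ⟫
  ⟪⟫-neg {n} x y = trans (Σ-cong n (λ i → lia 2 (λ a b → ⊢ a :* (:- b) := con -[1+ 0 ] :* (a :* b)) (x i) (y i)))
     (trans (Σ-* n -[1+ 0 ] _) (ℤP.-1*i≡-i _))

  ⟪⟫-+ : ∀ {n} (x y z : Vecℤ n) → ⟪ x , y +v z ⟫ ≡ ⟪ x , y ⟫ ℤ.+ ⟪ x , z ⟫
  ⟪⟫-+ {n} x y z = trans (Σ-cong n (λ i → ℤP.*-distribˡ-+ (x i) (y i) (z i))) (Σ-+ n _ _)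

  ⟪⟫-- : ∀ {n} (x y z : Vecℤ n) → ⟪ x , y -v z ⟫ ≡ ⟪ x , y ⟫ ℤ.- ⟪ x , z ⟫
  ⟪⟫-- x y z = trans (⟪⟫-+ x y (negv z)) (cong (λ z → ⟪ x , y ⟫ ℤ.+ z) (⟪⟫-neg x z))

  ⟪,e⟫ : ∀ {n} (x : Vecℤ n) {t} → SIdx n t → ⟪ x , e t ⟫ ≡ ext x t
  ⟪,e⟫ x (ps i) = trans (⟪,e⟫-pos x i) (sym (ext-pos x i))
  ⟪,e⟫ {n} x zr = Σ-zero n _ (λ i → ℤP.*-zeroʳ (x i))
  ⟪,e⟫ {n} x (ng i) = trans (Σ-cong n (λ j → cong (x j ℤ.*_) (e-neg i j)))
     (trans (⟪⟫-neg x (e (pos i))) (trans (cong ℤ.-_ (⟪,e⟫-pos x i)) (sym (ext-neg x i))))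

  -- `IsSP w` unfolds to a product from which unification cannot recover `w`; the record keeps `w`
  -- inferable from a proof.
  record SPerm {n : ℕ} (w : SP n) : Set where
    constructor sperm
    field isSP : IsSP w
    bd : ∀ i → (1 ℕ.≤ ∣ w i ∣) × (∣ w i ∣ ℕ.≤ n)
    bd = proj₁ isSP
    sp-inj : ∀ i j → ∣ w i ∣ ≡ ∣ w j ∣ → i ≡ j
    sp-inj = proj₂ isSP
  open SPerm public

  sp-sidx : ∀ {n} {w : SP n} → SPerm w → ∀ i → SIdx n (w i)
  sp-sidx {w = w} h i = sidx (w i) (proj₂ (bd h i))

  -- Exchanging the two sums moves the action to the other side, where it is precomposition with
  -- `w`. Testing against `e (w i)` then computes the coordinates of `actV w x`.
  actV-adj : ∀ {n} (w : SP n) → (∀ i → SIdx n (w i)) → ∀ x y → ⟪ actV w x , y ⟫ ≡ ⟪ x , compSP y w ⟫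
  actV-adj {n} w h x y = begin
    Σf n (λ j → Σf n (λ i → x i ℤ.* e (w i) j) ℤ.* y j) ≡⟨ Σ-cong n (λ j → trans (ℤP.*-comm _ (y j)) (sym (Σ-* n (y j) _))) ⟩
    Σf n (λ j → Σf n (λ i → y j ℤ.* (x i ℤ.* e (w i) j))) ≡⟨ Σ-swap n n _ ⟩
    Σf n (λ i → Σf n (λ j → y j ℤ.* (x i ℤ.* e (w i) j))) ≡⟨ Σ-cong n (λ i → trans (Σ-cong n (λ j → lia 3 (λ a b c → ⊢ a :* (b :* c) := b :* (a :* c)) (y j) (x i) (e (w i) j))) (Σ-* n (x i) _)) ⟩
    Σf n (λ i → x i ℤ.* ⟪ y , e (w i) ⟫) ≡⟨ Σ-cong n (λ i → cong (x i ℤ.*_) (⟪,e⟫ y (h i))) ⟩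
    Σf n (λ i → x i ℤ.* ext y (w i)) ∎
    where open ≡-Reasoning

  ext-e-same : ∀ {n} {t} → SIdx n t → 1 ℕ.≤ ∣ t ∣ → ext (e {n} t) t ≡ + 1
  ext-e-same (ps i) _ = trans (ext-pos (e (pos i)) i) (e-pos-same i)
  ext-e-same (ng i) _ = trans (ext-neg (e (neg i)) i) (trans (cong ℤ.-_ (trans (e-neg i i) (cong ℤ.-_ (e-pos-same i)))) refl)
  ext-e-same zr ()

  ext-e-diff : ∀ {n} {s t} → SIdx n s → SIdx n t → ∣ s ∣ ≢ ∣ t ∣ → ext (e {n} s) t ≡ + 0
  ext-e-diff {n} {s} hs (ps j) q = trans (ext-pos (e s) j) (lem hs q)
    where lem : ∀ {s} → SIdx n s → ∣ s ∣ ≢ suc (toℕ j) → e s j ≡ + 0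
          lem (ps i) q = e-pos-diff i j (λ r → q (cong (suc ∘ toℕ) r))
          lem zr q = refl
          lem (ng i) q = trans (e-neg i j) (cong ℤ.-_ (e-pos-diff i j (λ r → q (cong (suc ∘ toℕ) r))))
  ext-e-diff hs zr q = refl
  ext-e-diff {s = s} hs (ng j) q = trans (ext-neg (e s) j) (cong ℤ.-_ (trans (sym (ext-pos (e s) j)) (ext-e-diff hs (ps j) q)))

  ext-actV : ∀ {n} {w : SP n} → SPerm w → ∀ x i → ext (actV w x) (w i) ≡ x i
  ext-actV {n} {w} h x i = begin
    ext (actV w x) (w i) ≡⟨ sym (⟪,e⟫ (actV w x) (sp-sidx h i)) ⟩
    ⟪ actV w x , e (w i) ⟫ ≡⟨ actV-adj w (sp-sidx h) x (e (w i)) ⟩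
    ⟪ x , compSP (e (w i)) w ⟫ ≡⟨ Σ-δ n _ i (λ j q → trans (cong (x j ℤ.*_) (ext-e-diff (sp-sidx h i) (sp-sidx h j) (λ r → q (sym (sp-inj h i j r))))) (ℤP.*-zeroʳ (x j))) ⟩
    x i ℤ.* ext (e (w i)) (w i) ≡⟨ cong (x i ℤ.*_) (ext-e-same (sp-sidx h i) (proj₁ (bd h i))) ⟩
    x i ℤ.* + 1 ≡⟨ ℤP.*-identityʳ (x i) ⟩
    x i ∎
    where open ≡-Reasoning

  ext-comp : ∀ {n} (w : SP n) (v : SP n) {t} → SIdx n t → ext (compSP w v) t ≡ ext w (ext v t)
  ext-comp w v (ps i) = trans (ext-pos (compSP w v) i) (cong (ext w) (sym (ext-pos v i)))
  ext-comp w v zr = refl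
  ext-comp w v (ng i) = trans (ext-neg (compSP w v) i) (trans (sym (ext-odd w (v i))) (cong (ext w) (sym (ext-neg v i))))

  ext-sidx : ∀ {n} {w : SP n} → (∀ i → SIdx n (w i)) → ∀ {t} → SIdx n t → SIdx n (ext w t)
  ext-sidx {n} {w} h (ps i) = subst (SIdx n) (sym (ext-pos w i)) (h i)
  ext-sidx h zr = zr
  ext-sidx {n} {w} h (ng i) = subst (SIdx n) (sym (ext-neg w i)) (sidx-neg (h i))

  ext-actV-ext : ∀ {n} {w : SP n} → SPerm w → ∀ x {t} → SIdx n t → ext (actV w x) (ext w t) ≡ ext x t
  ext-actV-ext {w = w} h x {t} st = trans (sym (ext-comp (actV w x) w st)) (ext-cong (ext-actV h x) st)

  inj⇒surj : ∀ {n} (f : Fin n → Fin n) → (∀ i j → f i ≡ f j → i ≡ j) → ∀ k → ∃ λ i → f i ≡ k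
  inj⇒surj {suc n} f inj k with FP.any? (λ i → f i FP.≟ k)
  ... | yes r = r
  ... | no ¬r = ⊥-elim (ℕP.1+n≰n (FP.injective⇒≤ {f = g} g-inj))
    where
      ne : ∀ i → k ≢ f i
      ne i q = ¬r (i , sym q)
      g : Fin (suc n) → Fin n
      g i = Data.Fin.punchOut (ne i)
        where import Data.Fin
      g-inj : ∀ {i j} → g i ≡ g j → i ≡ j
      g-inj {i} {j} q = inj i j (FP.punchOut-injective (ne i) (ne j) q)

  sp-abs : ∀ {n} {w : SP n} → SPerm w → ∀ i → ∃ λ (k : Fin n) → ∣ w i ∣ ≡ suc (toℕ k)
  sp-abs {n} {w} h i with ∣ w i ∣ | bd h i
  ... | suc m | _ , q = fromℕ< q , cong suc (sym (FP.toℕ-fromℕ< q))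

  sp-surj-abs : ∀ {n} {w : SP n} → SPerm w → ∀ (k : Fin n) → ∃ λ i → ∣ w i ∣ ≡ suc (toℕ k)
  sp-surj-abs {n} {w} h k with inj⇒surj (λ i → proj₁ (sp-abs h i))
       (λ i j q → sp-inj h i j (trans (proj₂ (sp-abs h i)) (trans (cong (suc ∘ toℕ) q) (sym (proj₂ (sp-abs h j)))))) k
  ... | i , q = i , trans (proj₂ (sp-abs h i)) (cong (suc ∘ toℕ) q)

  abs-cases : ∀ z {m} → ∣ z ∣ ≡ m → (z ≡ + m) ⊎ (z ≡ ℤ.- (+ m))
  abs-cases (+ k) refl = inj₁ refl
  abs-cases -[1+ k ] refl = inj₂ refl

  sp-surj : ∀ {n} {w : SP n} → SPerm w → ∀ {t} → SIdx n t → ∃ λ s → SIdx n s × ext w s ≡ t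
  sp-surj {w = w} h zr = + 0 , zr , refl
  sp-surj {w = w} h (ps k) with sp-surj-abs h k
  ... | i , q with abs-cases (w i) q
  ... | inj₁ r = pos i , ps i , trans (ext-pos w i) r
  ... | inj₂ r = neg i , ng i , trans (ext-neg w i) (cong ℤ.-_ r)
  sp-surj {w = w} h (ng k) with sp-surj-abs h k
  ... | i , q with abs-cases (w i) q
  ... | inj₁ r = neg i , ng i , trans (ext-neg w i) (cong ℤ.-_ r)
  ... | inj₂ r = pos i , ps i , trans (ext-pos w i) r

  -- Up to sign the values of `w` exhaust the indices, so vectors may be compared in the frame of
  -- `w`, where `actV w` disappears.
  ≈-via : ∀ {n} {w : SP n} → SPerm w → ∀ {x y : Vecℤ n} → (∀ i → ext x (w i) ≡ ext y (w i)) → x ≈v y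
  ≈-via {n} {w} h {x} {y} q k with sp-surj h (ps k)
  ... | s , ss , r = trans (sym (ext-pos x k)) (trans (cong (ext x) (sym r))
      (trans (trans (sym (ext-comp x w ss)) (trans (ext-cong q ss) (ext-comp y w ss))) (trans (cong (ext y) r) (ext-pos y k))))

  actV-pull : ∀ {n} {w : SP n} → SPerm w → ∀ y → actV w (compSP y w) ≈v y
  actV-pull {w = w} h y = ≈-via h (λ i → ext-actV h (compSP y w) i)

  actV-cong : ∀ {n} {w w' : SP n} {x x' : Vecℤ n} → (∀ i → w i ≡ w' i) → x ≈v x' → actV w x ≈v actV w' x'
  actV-cong {n} h k j = Σ-cong n (λ i → cong₂ (λ a b → a ℤ.* e b j) (k i) (h i))

  actV-+ : ∀ {n} (w : SP n) x y → actV w (x +v y) ≈v (actV w x +v actV w y)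
  actV-+ {n} w x y j = trans (Σ-cong n (λ i → ℤP.*-distribʳ-+ (e (w i) j) (x i) (y i))) (Σ-+ n _ _)

  actV-neg : ∀ {n} (w : SP n) x → actV w (negv x) ≈v negv (actV w x)
  actV-neg {n} w x j = trans (Σ-cong n (λ i → lia 2 (λ a b → ⊢ (:- a) :* b := con -[1+ 0 ] :* (a :* b)) (x i) (e (w i) j)))
     (trans (Σ-* n -[1+ 0 ] _) (ℤP.-1*i≡-i _))

  abs-neg : ∀ z → ∣ ℤ.- z ∣ ≡ ∣ z ∣
  abs-neg = ℤP.∣-i∣≡∣i∣

  invSP-pos : ∀ {n} {w : SP n} → SPerm w → ∀ i k → w i ≡ pos k → invSP w k ≡ pos i
  invSP-pos {n} {w} h i k q = trans (Σ-δ n _ i off) on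
    where
      on : (if eqℤ (w i) (pos k) then pos i else (if eqℤ (w i) (neg k) then neg i else + 0)) ≡ pos i
      on rewrite q | eqℤ-refl (pos k) = refl
      off : ∀ j → j ≢ i → (if eqℤ (w j) (pos k) then pos j else (if eqℤ (w j) (neg k) then neg j else + 0)) ≡ + 0
      off j r rewrite eqℤ-no {w j} {pos k} (λ u → r (sp-inj h j i (cong ∣_∣ (trans u (sym q)))))
                    | eqℤ-no {w j} {neg k} (λ u → r (sp-inj h j i (trans (cong ∣_∣ u) (sym (cong ∣_∣ q))))) = refl

  invSP-neg : ∀ {n} {w : SP n} → SPerm w → ∀ i k → w i ≡ neg k → invSP w k ≡ neg i
  invSP-neg {n} {w} h i k q = trans (Σ-δ n _ i off) on
    where
      on : (if eqℤ (w i) (pos k) then pos i else (if eqℤ (w i) (neg k) then neg i else + 0)) ≡ neg i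
      on rewrite q | eqℤ-no {neg k} {pos k} (λ ()) | eqℤ-refl (neg k) = refl
      off : ∀ j → j ≢ i → (if eqℤ (w j) (pos k) then pos j else (if eqℤ (w j) (neg k) then neg j else + 0)) ≡ + 0
      off j r rewrite eqℤ-no {w j} {pos k} (λ u → r (sp-inj h j i (trans (cong ∣_∣ u) (sym (cong ∣_∣ q)))))
                    | eqℤ-no {w j} {neg k} (λ u → r (sp-inj h j i (trans (cong ∣_∣ u) (sym (cong ∣_∣ q))))) = refl

  ext-invSP : ∀ {n} {w : SP n} → SPerm w → ∀ i → ext (invSP w) (w i) ≡ pos i
  ext-invSP {w = w} h i with sp-abs h i
  ... | k , q with abs-cases (w i) q
  ... | inj₁ r = trans (cong (ext (invSP w)) r) (trans (ext-pos (invSP w) k) (invSP-pos h i k r))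
  ... | inj₂ r = trans (cong (ext (invSP w)) r) (trans (ext-neg (invSP w) k) (cong ℤ.-_ (invSP-neg h i k r)))

  ext-id : ∀ {n t} → SIdx n t → ext {n} pos t ≡ t
  ext-id (ps i) = ext-pos pos i
  ext-id zr = refl
  ext-id (ng i) = ext-neg pos i

  ext-invSP-ext : ∀ {n} {w : SP n} → SPerm w → ∀ {t} → SIdx n t → ext (invSP w) (ext w t) ≡ t
  ext-invSP-ext {w = w} h st = trans (sym (ext-comp (invSP w) w st)) (trans (ext-cong (ext-invSP h) st) (ext-id st))

  invSP-isSP : ∀ {n} {w : SP n} → SPerm w → SPerm (invSP w)
  invSP-isSP {n} {w} h = sperm (bnd , inj)
    where
      val : ∀ k → ∃ λ i → ∣ w i ∣ ≡ suc (toℕ k) × ∣ invSP w k ∣ ≡ suc (toℕ i)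
      val k with sp-surj-abs h k
      ... | i , q with abs-cases (w i) q
      ... | inj₁ r = i , q , cong ∣_∣ (invSP-pos h i k r)
      ... | inj₂ r = i , q , cong ∣_∣ (invSP-neg h i k r)
      bnd : ∀ k → (1 ℕ.≤ ∣ invSP w k ∣) × (∣ invSP w k ∣ ℕ.≤ n)
      bnd k with val k
      ... | i , _ , r = subst (1 ℕ.≤_) (sym r) (s≤s z≤n) , subst (ℕ._≤ n) (sym r) (FP.toℕ<n i)
      inj : ∀ k l → ∣ invSP w k ∣ ≡ ∣ invSP w l ∣ → k ≡ l
      inj k l q with val k | val l
      ... | i , qi , ri | j , qj , rj = FP.toℕ-injective (ℕP.suc-injective (trans (sym qi) (trans (cong (λ z → ∣ w z ∣) ij) qj)))
        where ij : i ≡ j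
              ij = FP.toℕ-injective (ℕP.suc-injective (trans (sym ri) (trans q rj)))

  ext-ext-invSP : ∀ {n} {w : SP n} → SPerm w → ∀ {t} → SIdx n t → ext w (ext (invSP w) t) ≡ t
  ext-ext-invSP {w = w} h st with sp-surj h st
  ... | s , ss , q = trans (cong (ext w ∘ ext (invSP w)) (sym q)) (trans (cong (ext w) (ext-invSP-ext h ss)) q)

  sp-abs-inj : ∀ {n} {w : SP n} → SPerm w → ∀ {s t} → SIdx n s → SIdx n t → ext w s ≡ ext w t → s ≡ t
  sp-abs-inj {w = w} h ss st q = trans (sym (ext-invSP-ext h ss)) (trans (cong (ext (invSP w)) q) (ext-invSP-ext h st))

  actV-invSP : ∀ {n} {w : SP n} → SPerm w → ∀ x → actV (invSP w) x ≈v compSP x w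
  actV-invSP {n} {w} h x k = trans (sym (ext-pos (actV (invSP w) x) k)) (trans (cong (ext (actV (invSP w) x)) (sym (ext-invSP h k)))
     (ext-actV-ext (invSP-isSP h) x (sp-sidx h k)))

  compSP-isSP : ∀ {n} {w v : SP n} → SPerm w → SPerm v → SPerm (compSP w v)
  compSP-isSP {n} {w} {v} hw hv = sperm (bnd , inj)
    where
      ab : ∀ {t} → SIdx n t → 1 ℕ.≤ ∣ t ∣ → ∃ λ k → ∣ t ∣ ≡ suc (toℕ k) × ∣ ext w t ∣ ≡ ∣ w k ∣
      ab (ps i) _ = i , refl , cong ∣_∣ (ext-pos w i)
      ab (ng i) _ = i , refl , trans (cong ∣_∣ (ext-neg w i)) (abs-neg (w i))
      ab zr ()
      bnd : ∀ i → (1 ℕ.≤ ∣ ext w (v i) ∣) × (∣ ext w (v i) ∣ ℕ.≤ n)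
      bnd i with ab (sp-sidx hv i) (proj₁ (bd hv i))
      ... | k , _ , r = subst (1 ℕ.≤_) (sym r) (proj₁ (bd hw k)) , subst (ℕ._≤ n) (sym r) (proj₂ (bd hw k))
      inj : ∀ i j → ∣ ext w (v i) ∣ ≡ ∣ ext w (v j) ∣ → i ≡ j
      inj i j q with ab (sp-sidx hv i) (proj₁ (bd hv i)) | ab (sp-sidx hv j) (proj₁ (bd hv j))
      ... | k , a , r | l , b , s = sp-inj hv i j (trans a (trans (cong (suc ∘ toℕ) (sp-inj hw k l (trans (sym r) (trans q s)))) (sym b)))

  Even : ℤ → Set
  Even z = Σ ℤ λ k → z ≡ + 2 ℤ.* k

  even-sub : ∀ {a b} → Even (a ℤ.- b) → Even b → Even a
  even-sub {a} {b} (k , p) (l , q) = k ℤ.+ l , lia 4 (λ a b k l → a :- b := # 2 :* k ⇒ b := # 2 :* l ⇒ ⊢ a := # 2 :* (k :+ l)) a b k l p q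

  Σ-even : ∀ n (f g : Fin n → ℤ) → (∀ i → Even (f i ℤ.- g i)) → Even (Σf n f ℤ.- Σf n g)
  Σ-even zero f g h = + 0 , refl
  Σ-even (suc n) f g h with h fz | Σ-even n (f ∘ fs) (g ∘ fs) (h ∘ fs)
  ... | k , p | l , q = k ℤ.+ l , trans (cong₂ ℤ._-_ (Σ-suc n f) (Σ-suc n g))
     (lia 6 (λ a b c d k l → a :- b := # 2 :* k ⇒ c :- d := # 2 :* l ⇒ ⊢ (a :+ c) :- (b :+ d) := # 2 :* (k :+ l))
       (f fz) (g fz) (Σf n (f ∘ fs)) (Σf n (g ∘ fs)) k l p q)

  Σe-odd : ∀ {n} {t} → SIdx n t → 1 ℕ.≤ ∣ t ∣ → (Σf n (e t) ≡ + 1) ⊎ (Σf n (e t) ≡ -[1+ 0 ])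
  Σe-odd {n} (ps i) _ = inj₁ (trans (Σ-δ n _ i (λ j q → e-pos-diff i j (q ∘ sym))) (e-pos-same i))
  Σe-odd {n} (ng i) _ = inj₂ (trans (Σ-δ n _ i (λ j q → trans (e-neg i j) (cong ℤ.-_ (e-pos-diff i j (q ∘ sym))))) (trans (e-neg i i) (cong ℤ.-_ (e-pos-same i))))
  Σe-odd zr ()

  -- Each `e (w i)` has coordinate sum 1 or -1, and changing the sign of a coordinate alters the sum
  -- by twice that coordinate. Invariance of the coroot lattice follows, but also a comparison for
  -- vectors outside it.
  actV-even : ∀ {n} {w : SP n} → SPerm w → ∀ x → Even (Σf n (actV w x) ℤ.- Σf n x)
  actV-even {n} {w} h x = subst (λ z → Even (z ℤ.- Σf n x)) (sym eq) (Σ-even n _ x term)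
    where
      eq : Σf n (actV w x) ≡ Σf n (λ i → x i ℤ.* Σf n (e (w i)))
      eq = trans (Σ-swap n n (λ j i → x i ℤ.* e (w i) j)) (Σ-cong n (λ i → Σ-* n (x i) (e (w i))))
      term : (i : Fin n) → Even (x i ℤ.* Σf n (e (w i)) ℤ.- x i)
      term i with Σe-odd (sp-sidx h i) (proj₁ (bd h i))
      ... | inj₁ q = + 0 , trans (cong (λ z → x i ℤ.* z ℤ.- x i) q) (lia 1 (λ a → ⊢ a :* # 1 :- a := # 2 :* # 0) (x i))
      ... | inj₂ q = ℤ.- x i , trans (cong (λ z → x i ℤ.* z ℤ.- x i) q) (lia 1 (λ a → ⊢ a :* con -[1+ 0 ] :- a := # 2 :* (:- a)) (x i))

  InQ-actV : ∀ {n} {w : SP n} → SPerm w → ∀ {x} → InQ x → InQ (actV w x)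
  InQ-actV h {x} q = even-sub (actV-even h x) q

  InQ-pull : ∀ {n} {w : SP n} → SPerm w → ∀ {y} → InQ y → InQ (compSP y w)
  InQ-pull {n} {w} h {y} q = even-sub {b = Σf n y} (neg-even (subst (λ z → Even (z ℤ.- Σf n (compSP y w))) (Σ-cong n (actV-pull h y)) (actV-even h (compSP y w)))) q
    where neg-even : Even (Σf n y ℤ.- Σf n (compSP y w)) → Even (Σf n (compSP y w) ℤ.- Σf n y)
          neg-even (k , p) = ℤ.- k , lia 3 (λ a b k → a :- b := # 2 :* k ⇒ ⊢ b :- a := # 2 :* (:- k)) (Σf n y) (Σf n (compSP y w)) k p

open SignedPermutations

-- The base point of A∘, roots as pairs of signed indices, and levels of root values.

module Points where

  N : ℕ → ℤ
  N n = + Nsc n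

  N-def : ∀ n → N n ≡ + 4 ℤ.+ + 4 ℤ.* + n
  N-def n = lia 1 (λ n → ⊢ # 4 :+ (n :+ (n :+ (n :+ (n :+ # 0)))) := # 4 :+ # 4 :* n) (+ n)

  0≤ : ∀ k → + 0 ℤ.≤ + k
  0≤ k = +≤+ z≤n

  pt : ∀ n → ℤ → ℤ
  pt n t = ext {n} pS t

  data PtView (n : ℕ) (t : ℤ) : Set where
    isPos : + 1 ℤ.≤ t → t ℤ.≤ + n → pt n t ≡ + 2 ℤ.* t ℤ.- + 1 → PtView n t
    isZero : t ≡ + 0 → pt n t ≡ + 0 → PtView n t
    isNeg : t ℤ.≤ -[1+ 0 ] → ℤ.- (+ n) ℤ.≤ t → pt n t ≡ + 2 ℤ.* t ℤ.+ + 1 → PtView n t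

  ptView : ∀ {n t} → SIdx n t → PtView n t
  ptView {n} (ps i) = isPos (+≤+ (s≤s z≤n)) (+≤+ (FP.toℕ<n i)) (trans (ext-pos (pS {n}) i)
     (lia 1 (λ i → ⊢ # 1 :+ (i :+ (i :+ # 0)) := # 2 :* (# 1 :+ i) :- # 1) (+ toℕ i)))
  ptView zr = isZero refl refl
  ptView {n} (ng i) = isNeg (lia 1 (λ i → # 0 :≤ i ⇒ ⊢ :- (# 1 :+ i) :≤ con -[1+ 0 ]) (+ toℕ i) (0≤ _))
     (lia 2 (λ i n → # 1 :+ i :≤ n ⇒ ⊢ :- n :≤ :- (# 1 :+ i)) (+ toℕ i) (+ n) (+≤+ (FP.toℕ<n i)))
     (trans (ext-neg (pS {n}) i)
       (lia 1 (λ i → ⊢ :- (# 1 :+ (i :+ (i :+ # 0))) := # 2 :* (:- (# 1 :+ i)) :+ # 1) (+ toℕ i)))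

  pt-mono : ∀ {n s t} → SIdx n s → SIdx n t → s ℤ.< t → pt n s ℤ.< pt n t
  pt-mono {n} {s} {t} ss st h with ptView ss | ptView st
  ... | isPos _ _ p | isPos _ _ q = lia 4 (λ s t a b → s :< t ⇒ a := # 2 :* s :- # 1 ⇒ b := # 2 :* t :- # 1 ⇒ ⊢ a :< b) s t _ _ h p q
  ... | isPos u _ p | isZero v q = ⊥-elim (lia 2 (λ s t → s :< t ⇒ # 1 :≤ s ⇒ t := # 0 ⇒ ⊢ :⊥) s t h u v)
  ... | isPos u _ p | isNeg v _ q = ⊥-elim (lia 2 (λ s t → s :< t ⇒ # 1 :≤ s ⇒ t :≤ con -[1+ 0 ] ⇒ ⊢ :⊥) s t h u v)
  ... | isZero _ p | isPos u _ q = lia 3 (λ t a b → # 1 :≤ t ⇒ a := # 0 ⇒ b := # 2 :* t :- # 1 ⇒ ⊢ a :< b) t _ _ u p q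
  ... | isZero u p | isZero v q = ⊥-elim (lia 2 (λ s t → s :< t ⇒ s := # 0 ⇒ t := # 0 ⇒ ⊢ :⊥) s t h u v)
  ... | isZero u p | isNeg v _ q = ⊥-elim (lia 2 (λ s t → s :< t ⇒ s := # 0 ⇒ t :≤ con -[1+ 0 ] ⇒ ⊢ :⊥) s t h u v)
  ... | isNeg u _ p | isPos v _ q = lia 4 (λ s t a b → s :≤ con -[1+ 0 ] ⇒ # 1 :≤ t ⇒ a := # 2 :* s :+ # 1 ⇒ b := # 2 :* t :- # 1 ⇒ ⊢ a :< b) s t _ _ u v p q
  ... | isNeg u _ p | isZero v q = lia 3 (λ s a b → s :≤ con -[1+ 0 ] ⇒ a := # 2 :* s :+ # 1 ⇒ b := # 0 ⇒ ⊢ a :< b) s _ _ u p q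
  ... | isNeg _ _ p | isNeg _ _ q = lia 4 (λ s t a b → s :< t ⇒ a := # 2 :* s :+ # 1 ⇒ b := # 2 :* t :+ # 1 ⇒ ⊢ a :< b) s t _ _ h p q

  pt-bound : ∀ {n t} → SIdx n t → (+ 2 ℤ.* pt n t ℤ.< N n) × (ℤ.- N n ℤ.< + 2 ℤ.* pt n t)
  pt-bound {n} {t} st with ptView st
  ... | isPos u v p = lia 4 (λ n N t a → t :≤ n ⇒ a := # 2 :* t :- # 1 ⇒ N := # 4 :+ # 4 :* n ⇒ ⊢ # 2 :* a :< N) (+ n) (N n) t _ v p (N-def n)
                    , lia 4 (λ n N t a → # 1 :≤ t ⇒ a := # 2 :* t :- # 1 ⇒ # 0 :≤ n ⇒ N := # 4 :+ # 4 :* n ⇒ ⊢ :- N :< # 2 :* a) (+ n) (N n) t _ u p (0≤ n) (N-def n)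
  ... | isZero _ p = lia 3 (λ n N a → a := # 0 ⇒ # 0 :≤ n ⇒ N := # 4 :+ # 4 :* n ⇒ ⊢ # 2 :* a :< N) (+ n) (N n) _ p (0≤ n) (N-def n)
                   , lia 3 (λ n N a → a := # 0 ⇒ # 0 :≤ n ⇒ N := # 4 :+ # 4 :* n ⇒ ⊢ :- N :< # 2 :* a) (+ n) (N n) _ p (0≤ n) (N-def n)
  ... | isNeg u v p = lia 4 (λ n N t a → t :≤ con -[1+ 0 ] ⇒ a := # 2 :* t :+ # 1 ⇒ # 0 :≤ n ⇒ N := # 4 :+ # 4 :* n ⇒ ⊢ # 2 :* a :< N) (+ n) (N n) t _ u p (0≤ n) (N-def n)
                    , lia 4 (λ n N t a → :- n :≤ t ⇒ a := # 2 :* t :+ # 1 ⇒ # 0 :≤ n ⇒ N := # 4 :+ # 4 :* n ⇒ ⊢ :- N :< # 2 :* a) (+ n) (N n) t _ v p (0≤ n) (N-def n)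

  N-pos : ∀ n → + 0 ℤ.< N n
  N-pos n = +<+ (s≤s z≤n)

  -- These are the pairs for which e_t - e_s is a root: an index 0 gives the short roots, and the
  -- last field rules out 2e_t.
  record Valid (n : ℕ) (s t : ℤ) : Set where
    constructor valid-pair
    field
      vs : SIdx n s
      vt : SIdx n t
      s≢t : s ≢ t
      s≢-t : s ≢ ℤ.- t
  open Valid public

  valid-swap : ∀ {n s t} → Valid n s t → Valid n t s
  valid-swap {t = t} (valid-pair a b c d) = valid-pair b a (c ∘ sym) (λ q → d (trans (sym (ℤP.neg-involutive _)) (cong ℤ.-_ (sym q))))

  lo hi : ∀ {n} → PosRoot n → ℤ
  lo (short i) = + 0
  lo (minus i j _) = pos i
  lo (plus i j _) = neg i
  hi (short i) = pos i
  hi (minus i j _) = pos j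
  hi (plus i j _) = pos j

  root-valid : ∀ {n} (r : PosRoot n) → Valid n (lo r) (hi r)
  root-valid (short i) = valid-pair zr (ps i) (λ ()) (λ ())
  root-valid (minus i j h) = valid-pair (ps i) (ps j) (λ q → ℕP.<⇒≢ h (cong toℕ (pos-inj q))) (λ ())
  root-valid (plus i j h) = valid-pair (ng i) (ps j) (λ ()) (λ q → ℕP.<⇒≢ h (cong toℕ (pos-inj (cong ℤ.-_ q))))

  lo<hi : ∀ {n} (r : PosRoot n) → lo r ℤ.< hi r
  lo<hi (short i) = +<+ (s≤s z≤n)
  lo<hi (minus i j h) = +<+ (s≤s h)
  lo<hi (plus i j h) = -<+

  ⟪root⟫ : ∀ {n} (x : Vecℤ n) (r : PosRoot n) → ⟪ x , rootVec r ⟫ ≡ ext x (hi r) ℤ.- ext x (lo r)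
  ⟪root⟫ x (short i) = trans (⟪,e⟫ x (ps i)) (sym (ℤP.+-identityʳ _))
  ⟪root⟫ x (minus i j h) = trans (⟪⟫-- x (eI j) (eI i)) (cong₂ ℤ._-_ (⟪,e⟫ x (ps j)) (⟪,e⟫ x (ps i)))
  ⟪root⟫ x (plus i j h) = trans (⟪⟫-+ x (eI i) (eI j)) (trans (cong₂ ℤ._+_ (⟪,e⟫ x (ps i)) (⟪,e⟫ x (ps j)))
     (lia 3 (λ a b c → c := :- a ⇒ ⊢ a :+ b := b :- c) (ext x (pos i)) (ext x (pos j)) (ext x (neg i)) (ext-odd x (pos i))))

  record RootOf (n : ℕ) (s t : ℤ) : Set where
    constructor root-of
    field
      root : PosRoot n
      root-pairing : ∀ (x : Vecℤ n) → ⟪ x , rootVec root ⟫ ≡ ext x t ℤ.- ext x s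
  open RootOf public

  -- A pair and its mirror (-t, -s) span the same root, so whichever of the two matches the
  -- convention of `PosRoot` supplies the name.
  rootOf : ∀ {n s t} → Valid n s t → s ℤ.< t → RootOf n s t
  rootOf {n} {s} {t} (valid-pair a b c d) h = go a b c d h
    where
    flip : ∀ {s t} (x : Vecℤ n) → ext x (ℤ.- s) ℤ.- ext x (ℤ.- t) ≡ ext x t ℤ.- ext x s
    flip {s} {t} x = lia 4 (λ a b c d → c := :- a ⇒ d := :- b ⇒ ⊢ c :- d := b :- a) (ext x s) (ext x t) (ext x (ℤ.- s)) (ext x (ℤ.- t)) (ext-odd x s) (ext-odd x t)
    go : ∀ {s t} → SIdx n s → SIdx n t → s ≢ t → s ≢ ℤ.- t → s ℤ.< t → RootOf n s t
    go (ps i) (ps j) c d (+<+ (s≤s h)) = root-of (minus i j h) (λ x → ⟪root⟫ x (minus i j h))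
    go (ps i) zr c d (+<+ ())
    go (ps i) (ng j) c d ()
    go zr (ps j) c d h = root-of (short j) (λ x → ⟪root⟫ x (short j))
    go zr zr c d h = ⊥-elim (c refl)
    go zr (ng j) c d ()
    go (ng i) (ps j) c d h with ℕP.<-cmp (toℕ i) (toℕ j)
    ... | tri< u _ _ = root-of (plus i j u) (λ x → ⟪root⟫ x (plus i j u))
    ... | tri≈ _ u _ = ⊥-elim (d (cong -[1+_] u))
    ... | tri> _ _ u = root-of (plus j i u) (λ x → trans (⟪root⟫ x (plus j i u)) (flip {neg i} {pos j} x))
    go (ng i) zr c d h = root-of (short i) (λ x → trans (⟪root⟫ x (short i)) (flip {neg i} {+ 0} x))
    go (ng i) (ng j) c d (ℤ.-<- h) = root-of (minus j i h) (λ x → trans (⟪root⟫ x (minus j i h)) (flip {neg i} {neg j} x))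

  -- `pairRoots` is private to its module; unifying with the unfolded `posRoots` recovers it, and
  -- the first component gives it a name.
  pairRoots-spec : Σ (∀ {n} → Fin n → Fin n → List (PosRoot n)) λ F →
    ∀ n → posRoots n ≡ map short (allFin n) ++ concatMap (λ i → concatMap (λ j → F i j) (allFin n)) (allFin n)
  pairRoots-spec = (λ {n} → _) , λ n → refl

  pairRoots-∈ : ∀ {n} (i j : Fin n) (h : toℕ i ℕ.< toℕ j) →
    (minus i j h ∈ proj₁ pairRoots-spec i j) × (plus i j h ∈ proj₁ pairRoots-spec i j)
  pairRoots-∈ i j h with suc (toℕ i) ℕ.≤? toℕ j
  ... | yes q rewrite ℕP.≤-irrelevant h q = here refl , there (here refl)
  ... | no q = ⊥-elim (q h)

  posRoots-complete : ∀ {n} (r : PosRoot n) → r ∈ posRoots n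
  posRoots-complete (short i) = ∈P.∈-++⁺ˡ (∈P.∈-map⁺ short (∈P.∈-allFin i))
  posRoots-complete {n} (minus i j h) = ∈P.∈-++⁺ʳ (map short (allFin n)) (∈P.∈-concatMap⁺ _ (Any.map (λ { refl →
     ∈P.∈-concatMap⁺ _ (Any.map (λ { refl → proj₁ (pairRoots-∈ i j h) }) (∈P.∈-allFin j)) }) (∈P.∈-allFin i)))
  posRoots-complete {n} (plus i j h) = ∈P.∈-++⁺ʳ (map short (allFin n)) (∈P.∈-concatMap⁺ _ (Any.map (λ { refl →
     ∈P.∈-concatMap⁺ _ (Any.map (λ { refl → proj₂ (pairRoots-∈ i j h) }) (∈P.∈-allFin j)) }) (∈P.∈-allFin i)))

  mul-small : ∀ {M k} → + 0 ℤ.< M → M ℤ.* k ℤ.< M → ℤ.- M ℤ.< M ℤ.* k → k ≡ + 0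
  mul-small {M} {+ zero} _ _ _ = refl
  mul-small {M} {+ suc k} p h _ = ⊥-elim (lia 3 (λ M k q → # 0 :< M ⇒ M :* (# 1 :+ k) :< M ⇒ # 0 :≤ M :* k ⇒ ⊢ :⊥) M (+ k) (+ 0) p h
      (subst (ℤ._≤ M ℤ.* + k) (ℤP.*-zeroʳ M) (ℤP.*-monoˡ-≤-nonNeg M {{ℤ.nonNegative (ℤP.<⇒≤ p)}} (0≤ k))))
  mul-small {M} { -[1+ k ]} p _ h = ⊥-elim (lia 2 (λ M k → # 0 :< M ⇒ :- M :< M :* (:- (# 1 :+ k)) ⇒ # 0 :≤ M :* k ⇒ ⊢ :⊥) M (+ k) p h
      (subst (ℤ._≤ M ℤ.* + k) (ℤP.*-zeroʳ M) (ℤP.*-monoˡ-≤-nonNeg M {{ℤ.nonNegative (ℤP.<⇒≤ p)}} (0≤ k))))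

  flr-unique : ∀ n z q k → + 0 ℤ.≤ q → q ℤ.< N n → z ≡ q ℤ.+ N n ℤ.* k → flr n z ≡ k
  flr-unique n z q k h0 h1 e = sym (trans (sym (ℤP.+-identityˡ k)) (trans (cong (ℤ._+ k) (sym dz)) (lia 2 (λ a k → ⊢ a :- k :+ k := a) (flr n z) k)))
    where
    r = + (z ℤ.%ℕ Nsc n)
    eq : z ≡ r ℤ.+ flr n z ℤ.* N n
    eq = ℤD.a≡a%ℕn+[a/ℕn]*n z (Nsc n)
    dz : flr n z ℤ.- k ≡ + 0
    dz = mul-small (N-pos n)
      (lia 6 (λ N z r f q k → z := r :+ f :* N ⇒ z := q :+ N :* k ⇒ # 0 :≤ r ⇒ q :< N ⇒ ⊢ N :* (f :- k) :< N) (N n) z r (flr n z) q k eq e (0≤ _) h1)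
      (lia 6 (λ N z r f q k → z := r :+ f :* N ⇒ z := q :+ N :* k ⇒ # 0 :≤ q ⇒ r :< N ⇒ ⊢ :- N :< N :* (f :- k)) (N n) z r (flr n z) q k eq e h0 (+<+ (ℤD.n%ℕd<d z (Nsc n))))

  sumℕ-mono : ∀ {A : Set} (f g : A → ℕ) (xs : List A) → (∀ x → f x ℕ.≤ g x) → sumℕ (map f xs) ℕ.≤ sumℕ (map g xs)
  sumℕ-mono f g [] h = z≤n
  sumℕ-mono f g (x ∷ xs) h = ℕP.+-mono-≤ (h x) (sumℕ-mono f g xs h)

  sumℕ-strict : ∀ {A : Set} (f g : A → ℕ) (xs : List A) → (∀ x → f x ℕ.≤ g x) → ∀ {y} → y ∈ xs → f y ℕ.< g y → sumℕ (map f xs) ℕ.< sumℕ (map g xs)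
  sumℕ-strict f g (x ∷ xs) h (here refl) q = ℕP.+-mono-<-≤ q (sumℕ-mono f g xs h)
  sumℕ-strict f g (x ∷ xs) h (there m) q = ℕP.+-mono-≤-< (h x) (sumℕ-strict f g xs h m q)

  -- Root values at the chosen alcove points never hit a multiple of N. Recording the remainder with
  -- strict bounds on both sides lets the floor of -z be read off from that of z.
  record Off (n : ℕ) (z : ℤ) : Set where
    constructor off
    field
      fl q : ℤ
      q>0 : + 0 ℤ.< q
      q<N : q ℤ.< N n
      z≡ : z ≡ q ℤ.+ N n ℤ.* fl
    flr≡ : flr n z ≡ fl
    flr≡ = flr-unique n z q fl (ℤP.<⇒≤ q>0) q<N z≡
  open Off public

  Npos-mono : ∀ n {a b} → a ℤ.≤ b → N n ℤ.* a ℤ.≤ N n ℤ.* b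
  Npos-mono n h = ℤP.*-monoˡ-≤-nonNeg (N n) h

  off-neg : ∀ {n z} → (o : Off n z) → Off n (ℤ.- z)
  off-neg {n} {z} (off k q a b e) = off (ℤ.- k ℤ.- + 1) (N n ℤ.- q)
    (lia 2 (λ N q → q :< N ⇒ ⊢ # 0 :< N :- q) (N n) q b) (lia 2 (λ N q → # 0 :< q ⇒ ⊢ N :- q :< N) (N n) q a)
    (lia 4 (λ N q z k → z := q :+ N :* k ⇒ ⊢ :- z := N :- q :+ N :* (:- k :- # 1)) (N n) q z k e)

  off-above : ∀ {n z} (o : Off n z) K → N n ℤ.* K ℤ.< z → K ℤ.≤ fl o
  off-above {n} {z} (off k q a b e) K h with K ℤP.≤? k
  ... | yes p = p
  ... | no p = ⊥-elim (lia 5 (λ N q z k K → z := q :+ N :* k ⇒ N :* K :< z ⇒ q :< N ⇒ N :* (k :+ # 1) :≤ N :* K ⇒ ⊢ :⊥) (N n) q z k K e h b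
      (Npos-mono n (lia 2 (λ k K → k :< K ⇒ ⊢ k :+ # 1 :≤ K) k K (ℤP.≰⇒> p))))

  off-below : ∀ {n z} (o : Off n z) K → K ℤ.≤ fl o → N n ℤ.* K ℤ.< z
  off-below {n} {z} (off k q a b e) K h = lia 5 (λ N q z k K → z := q :+ N :* k ⇒ # 0 :< q ⇒ N :* K :≤ N :* k ⇒ ⊢ N :* K :< z) (N n) q z k K e a (Npos-mono n h)

open Points

-- Dilated alcoves as fundamental domains.

module Alcoves where

  ext-+ : ∀ {n} (x y : Vecℤ n) {t} → SIdx n t → ext (x +v y) t ≡ ext x t ℤ.+ ext y t
  ext-+ x y (ps i) = trans (ext-pos (x +v y) i) (sym (cong₂ ℤ._+_ (ext-pos x i) (ext-pos y i)))
  ext-+ x y zr = refl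
  ext-+ x y (ng i) = trans (ext-neg (x +v y) i) (trans (ℤP.neg-distrib-+ (x i) (y i)) (sym (cong₂ ℤ._+_ (ext-neg x i) (ext-neg y i))))

  ext-· : ∀ {n} c (x : Vecℤ n) {t} → SIdx n t → ext (c ·v x) t ≡ c ℤ.* ext x t
  ext-· c x (ps i) = trans (ext-pos (c ·v x) i) (cong (c ℤ.*_) (sym (ext-pos x i)))
  ext-· c x zr = sym (ℤP.*-zeroʳ c)
  ext-· c x (ng i) = trans (ext-neg (c ·v x) i) (trans (lia 2 (λ c a → ⊢ :- (c :* a) := c :* (:- a)) c (x i)) (cong (c ℤ.*_) (sym (ext-neg x i))))

  ext-negv : ∀ {n} (x : Vecℤ n) {t} → SIdx n t → ext (negv x) t ≡ ℤ.- ext x t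
  ext-negv x (ps i) = trans (ext-pos (negv x) i) (cong ℤ.-_ (sym (ext-pos x i)))
  ext-negv x zr = refl
  ext-negv x (ng i) = trans (ext-neg (negv x) i) (cong ℤ.-_ (sym (ext-neg x i)))

  ⟪simple⟫ : ∀ {n} (x : Vecℤ n) k → ⟪ x , simpleRoot k ⟫ ≡ ext x (pos k) ℤ.- ext x (+ toℕ k)
  ⟪simple⟫ {suc n} x fz = trans (⟪,e⟫ x (ps fz)) (sym (ℤP.+-identityʳ _))
  ⟪simple⟫ {suc n} x (fs k) = trans (⟪⟫-- x (eI (fs k)) (eI (inject₁ k))) (cong₂ ℤ._-_ (⟪,e⟫ x (ps (fs k)))
     (trans (⟪,e⟫ x (ps (inject₁ k))) (cong (λ z → ext x (+ suc z)) (FP.toℕ-inject₁ k))))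

  sidx-ℤ : ∀ {n t} → ℤ.- (+ n) ℤ.≤ t → t ℤ.≤ + n → SIdx n t
  sidx-ℤ {n} {+ k} a (+≤+ b) = sidx (+ k) b
  sidx-ℤ {n} { -[1+ k ]} a b = sidx -[1+ k ] (ℤP.drop‿+≤+ (lia 2 (λ n k → :- n :≤ :- (# 1 :+ k) ⇒ ⊢ # 1 :+ k :≤ n) (+ n) (+ k) a))

  sidx-lo : ∀ {n t} → SIdx n t → ℤ.- (+ n) ℤ.≤ t
  sidx-lo {n} {+ k} s = lia 2 (λ n k → # 0 :≤ n ⇒ # 0 :≤ k ⇒ ⊢ :- n :≤ k) (+ n) (+ k) (0≤ n) (0≤ k)
  sidx-lo {n} { -[1+ k ]} s = lia 2 (λ n k → # 1 :+ k :≤ n ⇒ ⊢ :- n :≤ :- (# 1 :+ k)) (+ n) (+ k) (+≤+ (sidx-bound s))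

  sidx-hi : ∀ {n t} → SIdx n t → t ℤ.≤ + n
  sidx-hi {n} {+ k} s = +≤+ (sidx-bound s)
  sidx-hi {n} { -[1+ k ]} s = ℤ.-≤+

  -- Below zero, the step from -(k + 1) to -k belongs to the same simple root as the step from k to
  -- k + 1.
  step-root : ∀ {n} c → ℤ.- (+ n) ℤ.≤ c → c ℤ.< + n → ∃ λ k → (∀ (x : Vecℤ n) → ⟪ x , simpleRoot k ⟫ ≡ ext x (c ℤ.+ + 1) ℤ.- ext x c)
    × ((c ≡ + toℕ k) ⊎ (c ≡ neg k))
  step-root {n} (+ c) a (+<+ b) = fromℕ< b , (λ x → trans (⟪simple⟫ x (fromℕ< b)) (cong₂ (λ u v → ext x (+ u) ℤ.- ext x (+ v))
     (trans (cong suc (FP.toℕ-fromℕ< b)) (ℕP.+-comm 1 c)) (FP.toℕ-fromℕ< b))) , inj₁ (cong +_ (sym (FP.toℕ-fromℕ< b)))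
  step-root {n} -[1+ c ] a b = k , (λ x → trans (⟪simple⟫ x k) (subst (λ u → ext x (+ suc u) ℤ.- ext x (+ u) ≡ ext x (-[1+ c ] ℤ.+ + 1) ℤ.- ext x -[1+ c ]) (sym (FP.toℕ-fromℕ< h)) (eq x))) , inj₂ (cong -[1+_] (sym (FP.toℕ-fromℕ< h)))
    where
    h = ℤP.drop‿+≤+ (lia 2 (λ n k → :- n :≤ :- (# 1 :+ k) ⇒ ⊢ # 1 :+ k :≤ n) (+ n) (+ c) a)
    k = fromℕ< h
    eq : ∀ x → ext x (+ suc c) ℤ.- ext x (+ c) ≡ ext x (-[1+ c ] ℤ.+ + 1) ℤ.- ext x -[1+ c ]
    eq x = trans (lia 4 (λ a b d f → d := :- a ⇒ f := :- b ⇒ ⊢ a :- b := f :- d) (ext x (+ suc c)) (ext x (+ c)) (ext x -[1+ c ]) (ext x (ℤ.- (+ c))) (ext-odd x (+ suc c)) (ext-odd x (+ c)))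
       (cong (λ z → ext x z ℤ.- ext x -[1+ c ]) (lia 1 (λ c → ⊢ :- c := :- (# 1 :+ c) :+ # 1) (+ c)))

  ℤ-diff : ∀ {s t} → s ℤ.≤ t → ∃ λ k → t ≡ s ℤ.+ + k
  ℤ-diff {s} {t} h = ∣ t ℤ.- s ∣ , trans (lia 2 (λ s t → ⊢ t := s :+ (t :- s)) s t) (cong (ℤ._+_ s) (sym (ℤP.0≤i⇒+∣i∣≡i (ℤP.i≤j⇒0≤j-i h))))

  module _ {m : ℕ} where
    private n = suc (suc m)

    -- Monotonicity over the whole range -n, ..., n packs all simple walls into one condition; `top`
    -- is the remaining wall, that of the highest root.
    record Alcove (M : ℤ) (x : Vecℤ n) : Set where
      field
        mono : ∀ {s t} → SIdx n s → SIdx n t → s ℤ.< t → ext x s ℤ.< ext x t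
        top : ext x (+ suc m) ℤ.+ ext x (+ suc (suc m)) ℤ.< M

      mono≤ : ∀ {s t} → SIdx n s → SIdx n t → s ℤ.≤ t → ext x s ℤ.≤ ext x t
      mono≤ {s} {t} a b h with s ℤP.≟ t
      ... | yes refl = ℤP.≤-refl
      ... | no q = ℤP.<⇒≤ (mono a b (ℤP.≤∧≢⇒< h q))

      pos>0 : ∀ i → + 0 ℤ.< x i
      pos>0 i = subst (+ 0 ℤ.<_) (ext-pos x i) (mono zr (ps i) (+<+ (s≤s z≤n)))

      two-sum< : ∀ i j → toℕ i ℕ.< toℕ j → x i ℤ.+ x j ℤ.< M
      two-sum< i j h = ℤP.≤-<-trans (ℤP.+-mono-≤
          (subst (ℤ._≤ ext x (+ suc m)) (ext-pos x i) (mono≤ (ps i) (sidx (+ suc m) (ℕP.n≤1+n _)) (+≤+ (ℕP.≤-pred (ℕP.≤-trans (s≤s h) (FP.toℕ<n j))))))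
          (subst (ℤ._≤ ext x (+ n)) (ext-pos x j) (mono≤ (ps j) (sidx (+ n) ℕP.≤-refl) (+≤+ (FP.toℕ<n j))))) top

      two-sum : ∀ i j → i ≢ j → x i ℤ.+ x j ℤ.< M
      two-sum i j q with ℕP.<-cmp (toℕ i) (toℕ j)
      ... | tri< h _ _ = two-sum< i j h
      ... | tri≈ _ h _ = ⊥-elim (q (FP.toℕ-injective h))
      ... | tri> _ _ h = subst (ℤ._< M) (ℤP.+-comm (x j) (x i)) (two-sum< j i h)

      x<M : ∀ i → x i ℤ.< M
      x<M fz = lia 3 (λ a b M → # 0 :< b ⇒ a :+ b :< M ⇒ ⊢ a :< M) (x fz) (x (fs fz)) M (pos>0 (fs fz)) (two-sum< fz (fs fz) (s≤s z≤n))
      x<M (fs i) = lia 3 (λ a b M → # 0 :< b ⇒ b :+ a :< M ⇒ ⊢ a :< M) (x (fs i)) (x fz) M (pos>0 fz) (two-sum< fz (fs i) (s≤s z≤n))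

    open Alcove public

    ⟪highest⟫ : ∀ (x : Vecℤ n) → ⟪ x , highest n ⟫ ≡ ext x (+ suc m) ℤ.+ ext x (+ suc (suc m))
    ⟪highest⟫ x = trans (⟪⟫-+ x (e (+ suc m)) (e (+ n))) (cong₂ ℤ._+_ (⟪,e⟫ x (sidx (+ suc m) (ℕP.n≤1+n _))) (⟪,e⟫ x (sidx (+ n) ℕP.≤-refl)))

    steps-mono : ∀ (x : Vecℤ n) → (∀ k → + 0 ℤ.< ⟪ x , simpleRoot k ⟫) → ∀ {s t} → SIdx n s → SIdx n t → s ℤ.< t → ext x s ℤ.< ext x t
    steps-mono x h {s} {t} a b q with ℤ-diff (lia 2 (λ s t → s :< t ⇒ ⊢ s :+ # 1 :≤ t) s t q)
    ... | k , refl = go k b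
      where
      st : ∀ c → ℤ.- (+ n) ℤ.≤ c → c ℤ.< + n → ext x c ℤ.< ext x (c ℤ.+ + 1)
      st c u v with step-root {n} c u v
      ... | k , e , _ = lia 3 (λ a b c → # 0 :< c ⇒ c := b :- a ⇒ ⊢ a :< b) (ext x c) (ext x (c ℤ.+ + 1)) _ (h k) (e x)
      go : ∀ k → SIdx n (s ℤ.+ + 1 ℤ.+ + k) → ext x s ℤ.< ext x (s ℤ.+ + 1 ℤ.+ + k)
      go zero b = subst (λ z → ext x s ℤ.< ext x z) (sym (ℤP.+-identityʳ (s ℤ.+ + 1))) (st s (sidx-lo a)
          (lia 2 (λ s n → s :+ # 1 :+ # 0 :≤ n ⇒ ⊢ s :< n) s (+ n) (sidx-hi b)))
      go (suc k) b = ℤP.<-trans (go k (sidx-ℤ c-lo (ℤP.<⇒≤ c-hi)))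
          (subst (λ z → ext x c ℤ.< ext x z) (lia 2 (λ s k → ⊢ s :+ # 1 :+ k :+ # 1 := s :+ # 1 :+ (# 1 :+ k)) s (+ k)) (st c c-lo c-hi))
        where
        c = s ℤ.+ + 1 ℤ.+ + k
        c-lo = lia 3 (λ s n k → :- n :≤ s ⇒ # 0 :≤ k ⇒ ⊢ :- n :≤ s :+ # 1 :+ k) s (+ n) (+ k) (sidx-lo a) (0≤ k)
        c-hi = lia 3 (λ s n k → s :+ # 1 :+ (# 1 :+ k) :≤ n ⇒ ⊢ s :+ # 1 :+ k :< n) s (+ n) (+ k) (sidx-hi b)

    alcove-walls : ∀ {M} {x : Vecℤ n} → (∀ k → + 0 ℤ.< ⟪ x , simpleRoot k ⟫) → ⟪ x , highest n ⟫ ℤ.< M → Alcove M x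
    alcove-walls {M} {x} h t = record { mono = steps-mono x h ; top = subst (ℤ._< M) (⟪highest⟫ x) t }

    mono⇒id≤ : ∀ (f : Fin n → Fin n) → (∀ {i j} → toℕ i ℕ.< toℕ j → toℕ (f i) ℕ.< toℕ (f j)) → ∀ d i → toℕ i ≡ d → d ℕ.≤ toℕ (f i)
    mono⇒id≤ f h zero i q = z≤n
    mono⇒id≤ f h (suc d) i q = ℕP.≤-<-trans (mono⇒id≤ f h d j jd) (h (subst₂ ℕ._<_ (sym jd) (sym q) ℕP.≤-refl))
      where
      lt : d ℕ.< n
      lt = ℕP.<-trans (subst (d ℕ.<_) (sym q) ℕP.≤-refl) (FP.toℕ<n i)
      j = fromℕ< lt
      jd = FP.toℕ-fromℕ< lt

    odd-not-even : ∀ k → + 1 ≢ + 2 ℤ.* k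
    odd-not-even k q with k ℤP.≤? + 0
    ... | yes h = lia 1 (λ k → # 1 := # 2 :* k ⇒ k :≤ # 0 ⇒ ⊢ :⊥) k q h
    ... | no h = lia 1 (λ k → # 1 := # 2 :* k ⇒ # 0 :< k ⇒ ⊢ :⊥) k q (ℤP.≰⇒> h)

    -- Compare coordinates in the frame of `w`. If `w i` is a value of `w₀`, the lattice part is a
    -- multiple of M of absolute value below M, hence 0; if it is the negative of a value, the two
    -- coordinates add up to M. Two indices of the second kind contradict the bound on sums of two
    -- coordinates, and a single one gives the lattice vector an odd coordinate sum. So every index
    -- is of the first kind, and since both points are increasing, the matching of indices is
    -- increasing as well and never moves an index down.
    fund-half : ∀ {M} {w w₀ : SP n} {P P₀ z : Vecℤ n} → + 0 ℤ.< M → SPerm w → SPerm w₀ → Alcove M P → Alcove M P₀ → InQ z →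
      actV w P ≈v (actV w₀ P₀ +v (M ·v z)) → ∀ i → ∃ λ j → (toℕ i ℕ.≤ toℕ j) × (w i ≡ w₀ j) × (P i ≡ P₀ j)
    fund-half {M} {w} {w₀} {P} {P₀} {z} M>0 hw hw₀ A A₀ zQ eq = λ i → f i , mono⇒id≤ f f-mono _ i refl , proj₁ (proj₂ (pos-only i)) , proj₂ (proj₂ (pos-only i))
      where
      ζ : Fin n → ℤ
      ζ i = ext z (w i)
      val : ∀ i {s} → SIdx n s → ext w₀ s ≡ w i → P i ≡ ext P₀ s ℤ.+ M ℤ.* ζ i
      val i {s} ss q = begin
        P i ≡⟨ sym (ext-actV hw P i) ⟩
        ext (actV w P) (w i) ≡⟨ ext-cong eq (sp-sidx hw i) ⟩
        ext (actV w₀ P₀ +v (M ·v z)) (w i) ≡⟨ ext-+ (actV w₀ P₀) (M ·v z) (sp-sidx hw i) ⟩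
        ext (actV w₀ P₀) (w i) ℤ.+ ext (M ·v z) (w i) ≡⟨ cong₂ ℤ._+_ (trans (cong (ext (actV w₀ P₀)) (sym q)) (ext-actV-ext hw₀ P₀ ss)) (ext-· M z (sp-sidx hw i)) ⟩
        ext P₀ s ℤ.+ M ℤ.* ζ i ∎
        where open ≡-Reasoning
      data Sgn (i : Fin n) : Set where
        plus' : ∀ j → w i ≡ w₀ j → ζ i ≡ + 0 → P i ≡ P₀ j → Sgn i
        minus' : ∀ j → w i ≡ ℤ.- w₀ j → ζ i ≡ + 1 → P i ℤ.+ P₀ j ≡ M → Sgn i
      sgn : ∀ i → Sgn i
      sgn i with sp-surj hw₀ (sp-sidx hw i)
      ... | _ , zr , q = ⊥-elim (ℕP.1+n≰n {0} (subst (1 ℕ.≤_) (cong ∣_∣ (sym q)) (proj₁ (bd hw i))))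
      ... | _ , ps j , q = plus' j (trans (sym q) (ext-pos w₀ j)) ζ0 (lia 4 (λ a b z M → a := b :+ z ⇒ z := # 0 ⇒ ⊢ a := b) (P i) (P₀ j) (M ℤ.* ζ i) M v (trans (cong (M ℤ.*_) ζ0) (ℤP.*-zeroʳ M)))
        where
        v : P i ≡ P₀ j ℤ.+ M ℤ.* ζ i
        v = trans (val i (ps j) q) (cong (λ u → u ℤ.+ M ℤ.* ζ i) (ext-pos P₀ j))
        ζ0 = mul-small M>0 (lia 4 (λ a b z M → a := b :+ M :* z ⇒ a :< M ⇒ # 0 :< b ⇒ ⊢ M :* z :< M) (P i) (P₀ j) (ζ i) M v (x<M A i) (pos>0 A₀ j))
                           (lia 4 (λ a b z M → a := b :+ M :* z ⇒ b :< M ⇒ # 0 :< a ⇒ ⊢ :- M :< M :* z) (P i) (P₀ j) (ζ i) M v (x<M A₀ j) (pos>0 A i))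
      ... | _ , ng j , q = minus' j (trans (sym q) (ext-neg w₀ j)) (lia 1 (λ z → z :- # 1 := # 0 ⇒ ⊢ z := # 1) (ζ i) ζ1)
          (lia 4 (λ a b z M → a := (:- b) :+ M :* z ⇒ M :* (z :- # 1) := # 0 ⇒ ⊢ a :+ b := M) (P i) (P₀ j) (ζ i) M v (trans (cong (M ℤ.*_) ζ1) (ℤP.*-zeroʳ M)))
        where
        v : P i ≡ ℤ.- P₀ j ℤ.+ M ℤ.* ζ i
        v = trans (val i (ng j) q) (cong (λ u → u ℤ.+ M ℤ.* ζ i) (ext-neg P₀ j))
        ζ1 = mul-small M>0 (lia 4 (λ a b z M → a := (:- b) :+ M :* z ⇒ a :< M ⇒ b :< M ⇒ ⊢ M :* (z :- # 1) :< M) (P i) (P₀ j) (ζ i) M v (x<M A i) (x<M A₀ j))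
                           (lia 4 (λ a b z M → a := (:- b) :+ M :* z ⇒ # 0 :< a ⇒ # 0 :< b ⇒ ⊢ :- M :< M :* (z :- # 1)) (P i) (P₀ j) (ζ i) M v (pos>0 A i) (pos>0 A₀ j))
      no-minus : ∀ i j → w i ≡ ℤ.- w₀ j → ζ i ≡ + 1 → P i ℤ.+ P₀ j ≡ M → ⊥
      no-minus i j q z1 r = odd-not-even (proj₁ zE) (trans (sym (trans (Σ-δ n ζ i others) z1)) (proj₂ zE))
        where
        zE = InQ-pull hw {z} zQ
        others : ∀ i' → i' ≢ i → ζ i' ≡ + 0
        others i' ne with sgn i'
        ... | plus' _ _ u _ = u
        ... | minus' j' q' _ r' = ⊥-elim (lia 5 (λ a b c d M → a :+ c := M ⇒ b :+ d := M ⇒ b :+ a :< M ⇒ d :+ c :< M ⇒ ⊢ :⊥) (P i) (P i') (P₀ j) (P₀ j') M r r' (two-sum A i' i ne)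
              (two-sum A₀ j' j (λ jj → ne (sp-inj hw i' i (cong ∣_∣ (trans q' (trans (cong (λ k → ℤ.- w₀ k) jj) (sym q))))))))
      pos-only : ∀ i → ∃ λ j → (w i ≡ w₀ j) × (P i ≡ P₀ j)
      pos-only i with sgn i
      ... | plus' j a _ b = j , a , b
      ... | minus' j a b c = ⊥-elim (no-minus i j a b c)
      f : Fin n → Fin n
      f i = proj₁ (pos-only i)
      f-mono : ∀ {i j} → toℕ i ℕ.< toℕ j → toℕ (f i) ℕ.< toℕ (f j)
      f-mono {i} {j} h with ℕP.<-cmp (toℕ (f i)) (toℕ (f j))
      ... | tri< u _ _ = u
      ... | tri≈ _ u _ = ⊥-elim (ℕP.<⇒≢ h (cong toℕ (sp-inj hw i j (cong ∣_∣ (trans (proj₁ (proj₂ (pos-only i))) (trans (cong w₀ (FP.toℕ-injective u)) (sym (proj₁ (proj₂ (pos-only j))))))))))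
      ... | tri> _ _ u = ⊥-elim (ℤP.<-asym
           (subst₂ ℤ._<_ (trans (ext-pos P i) (proj₂ (proj₂ (pos-only i)))) (trans (ext-pos P j) (proj₂ (proj₂ (pos-only j)))) (mono A (ps i) (ps j) (+<+ (s≤s h))))
           (subst₂ ℤ._<_ (ext-pos P₀ (f j)) (ext-pos P₀ (f i)) (mono A₀ (ps (f j)) (ps (f i)) (+<+ (s≤s u)))))

    -- One application of the half statement gives i ≤ j; exchanging the points and negating the
    -- lattice vector gives j ≤ i.
    fundamental : ∀ {M} {w w₀ : SP n} {P P₀ z : Vecℤ n} → + 0 ℤ.< M → SPerm w → SPerm w₀ → Alcove M P → Alcove M P₀ → InQ z →
      actV w P ≈v (actV w₀ P₀ +v (M ·v z)) → ∀ i → (w i ≡ w₀ i) × (P i ≡ P₀ i)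
    fundamental {M} {w} {w₀} {P} {P₀} {z} M>0 hw hw₀ A A₀ (k , zk) eq i with fund-half {z = z} M>0 hw hw₀ A A₀ (k , zk) eq i
    ... | j , i≤j , a , b with fund-half {z = negv z} M>0 hw₀ hw A₀ A negQ
           (λ l → lia 4 (λ a b M z → a := b :+ M :* z ⇒ ⊢ b := a :+ M :* (:- z)) (actV w P l) (actV w₀ P₀ l) M (z l) (eq l)) j
      where
      negQ : InQ (negv z)
      negQ = ℤ.- k , trans (Σ-cong n (λ i → sym (ℤP.-1*i≡-i (z i)))) (trans (Σ-* n -[1+ 0 ] z) (lia 2 (λ s k → s := # 2 :* k ⇒ ⊢ con -[1+ 0 ] :* s := # 2 :* (:- k)) (Σf n z) k zk))
    ... | i' , j≤i' , c , _ = subst (λ j → w i ≡ w₀ j) ji a , subst (λ j → P i ≡ P₀ j) ji b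
      where
      ii : i' ≡ i
      ii = sp-inj hw i' i (cong ∣_∣ (sym (trans a c)))
      ji : j ≡ i
      ji = FP.toℕ-injective (ℕP.≤-antisym (subst (λ k → toℕ j ℕ.≤ toℕ k) ii j≤i') i≤j)

open Alcoves

-- Walls of the dilated alcove in terms of the area vector, and chains of floors.

module LowPoints where

  N-cancel< : ∀ n {a b} → N n ℤ.* a ℤ.< N n ℤ.* b → a ℤ.< b
  N-cancel< n {a} {b} h = ℤP.≰⇒> (λ q → ℤP.<⇒≱ h (Npos-mono n q))

  ext-ptS : ∀ {n} (a : AffW n) {t} → SIdx n t → ext (ptS a) t ≡ ext (actV (lin a) pS) t ℤ.+ N n ℤ.* ext (tr a) t
  ext-ptS {n} a {t} st = trans (ext-+ (actV (lin a) pS) ((+ Nsc n) ·v tr a) st) (cong (ℤ._+_ (ext (actV (lin a) pS) t)) (ext-· (+ Nsc n) (tr a) st))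

  valid-ext : ∀ {n} {w : SP n} → SPerm w → ∀ {s t} → Valid n s t → Valid n (ext w s) (ext w t)
  valid-ext {w = w} h {s} {t} (valid-pair a b c d) = valid-pair (ext-sidx (sp-sidx h) a) (ext-sidx (sp-sidx h) b)
    (λ q → c (sp-abs-inj h a b q)) (λ q → d (sp-abs-inj h a (sidx-neg b) (trans q (sym (ext-odd w t)))))

  valid-preimage : ∀ {n} {w : SP n} → SPerm w → ∀ {s t} → Valid n s t → ∃ λ s' → ∃ λ t' → Valid n s' t' × ext w s' ≡ s × ext w t' ≡ t
  valid-preimage {w = w} h (valid-pair a b c d) with sp-surj h a | sp-surj h b
  ... | s' , ss , refl | t' , st , refl = s' , t' , valid-pair ss st (λ q → c (cong (ext w) q)) (λ q → d (trans (cong (ext w) q) (ext-odd w t'))) , refl , refl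

  valid-cases : ∀ {n s t} → Valid n s t → (s ℤ.< t) ⊎ (t ℤ.< s)
  valid-cases {n} {s} {t} v with ℤP.<-cmp s t
  ... | tri< h _ _ = inj₁ h
  ... | tri≈ _ h _ = ⊥-elim (s≢t v h)
  ... | tri> _ _ h = inj₂ h

  pt-diff-off : ∀ {n s t} k → Valid n s t → Off n (pt n t ℤ.- pt n s ℤ.+ N n ℤ.* k)
  pt-diff-off {n} {s} {t} k v with valid-cases v | pt-bound (vs v) | pt-bound (vt v)
  ... | inj₁ h | a , b | c , d = off k (pt n t ℤ.- pt n s) (lia 2 (λ s t → s :< t ⇒ ⊢ # 0 :< t :- s) (pt n s) (pt n t) (pt-mono (vs v) (vt v) h))
     (lia 3 (λ s t N → # 2 :* t :< N ⇒ :- N :< # 2 :* s ⇒ ⊢ t :- s :< N) (pt n s) (pt n t) (N n) c b) refl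
  ... | inj₂ h | a , b | c , d = off (k ℤ.- + 1) (pt n t ℤ.- pt n s ℤ.+ N n) (lia 3 (λ s t N → :- N :< # 2 :* t ⇒ # 2 :* s :< N ⇒ ⊢ # 0 :< t :- s :+ N) (pt n s) (pt n t) (N n) d a)
     (lia 3 (λ s t N → t :< s ⇒ ⊢ t :- s :+ N :< N) (pt n s) (pt n t) (N n) (pt-mono (vt v) (vs v) h))
     (lia 3 (λ d N k → ⊢ d :+ N :* k := d :+ N :+ N :* (k :- # 1)) (pt n t ℤ.- pt n s) (N n) k)

  off-subst : ∀ {n a b} → a ≡ b → Off n a → Off n b
  off-subst refl o = o

  -- The alcove is an image of A∘, so the root can be pulled back to one whose value at p is nonzero
  -- and of absolute value below N; the translation only adds a multiple of N.
  alcove-off : ∀ {n} (a : AffW n) → SPerm (lin a) → ∀ {s t} → Valid n s t → Off n (ext (ptS a) t ℤ.- ext (ptS a) s)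
  alcove-off {n} a h {s} {t} v with valid-preimage h v
  ... | s' , t' , v' , refl , refl = off-subst (sym (trans (cong₂ ℤ._-_ (eq (vt v) (vt v')) (eq (vs v) (vs v')))
       (lia 5 (λ p q N u v → ⊢ (p :+ N :* u) :- (q :+ N :* v) := p :- q :+ N :* (u :- v)) (pt n t') (pt n s') (N n) (ext (tr a) t) (ext (tr a) s))))
       (pt-diff-off (ext (tr a) t ℤ.- ext (tr a) s) v')
    where
    eq : ∀ {t} → SIdx n (ext (lin a) t) → SIdx n t → ext (ptS a) (ext (lin a) t) ≡ pt n t ℤ.+ N n ℤ.* ext (tr a) (ext (lin a) t)
    eq {t} st st' = trans (ext-ptS a st) (cong (λ z → z ℤ.+ N n ℤ.* ext (tr a) (ext (lin a) t)) (ext-actV-ext h pS st'))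

  off-ne : ∀ {n z} K → Off n z → z ≢ N n ℤ.* K
  off-ne {n} {z} K (off k q a b e) h = lia 4 (λ N q k K → q :+ N :* k := N :* K ⇒ # 0 :< q ⇒ N :* (K :- k) := # 0 ⇒ ⊢ :⊥) (N n) q k K (trans (sym e) h) a
      (trans (cong (N n ℤ.*_) x0) (ℤP.*-zeroʳ (N n)))
    where
    x0 = mul-small (N-pos n) (lia 4 (λ N q k K → q :+ N :* k := N :* K ⇒ q :< N ⇒ ⊢ N :* (K :- k) :< N) (N n) q k K (trans (sym e) h) b)
       (lia 4 (λ N q k K → q :+ N :* k := N :* K ⇒ # 0 :< q ⇒ # 0 :< N ⇒ ⊢ :- N :< N :* (K :- k)) (N n) q k K (trans (sym e) h) a (N-pos n))

  module _ {m : ℕ} where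
    private n = suc (suc m)

    -- An index t is followed by t + 1; past n the order continues with -n, …, one level up,
    -- but n and -n are incomparable since 2eₙ is not a root.  κ records the change of level.
    data WallPair : ℤ → ℤ → ℤ → Set where
      up    : ∀ {c} → SIdx n c → SIdx n (c ℤ.+ + 1) → WallPair c (c ℤ.+ + 1) (+ 0)
      fork₁ : WallPair (+ suc m) -[1+ suc m ] (+ 1)
      fork₂ : WallPair (+ n) -[1+ m ] (+ 1)

    in-n : SIdx n (+ n)
    in-n = sidx (+ n) ℕP.≤-refl

    in-n-1 : SIdx n (+ suc m)
    in-n-1 = sidx (+ suc m) (ℕP.n≤1+n _)

    wall-valid : ∀ {c d κ} → WallPair c d κ → Valid n c d
    wall-valid {c} (up a b) = valid-pair a b (λ q → lia 1 (λ c → c := c :+ # 1 ⇒ ⊢ :⊥) c q)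
      (λ q → odd-not-even {m} (ℤ.- c) (lia 1 (λ c → c := :- (c :+ # 1) ⇒ ⊢ # 1 := # 2 :* (:- c)) c q))
    wall-valid fork₁ = valid-pair in-n-1 (sidx-neg in-n) (λ ()) (λ q → ℕP.1+n≢n (sym (ℤP.+-injective q)))
    wall-valid fork₂ = valid-pair in-n (sidx-neg in-n-1) (λ ()) (λ q → ℕP.1+n≢n (ℤP.+-injective q))

    pt-n : pt n (+ n) ≡ + 2 ℤ.* + n ℤ.- + 1
    pt-n with ptView in-n
    ... | isPos _ _ e = e
    ... | isZero () _
    ... | isNeg () _ _

    pt-n-1 : pt n (+ suc m) ≡ + 2 ℤ.* + suc m ℤ.- + 1
    pt-n-1 with ptView in-n-1
    ... | isPos _ _ e = e
    ... | isZero () _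
    ... | isNeg () _ _

    -- The bound 8 is attained at the forks, where the gap is N - (2n - 1) - (2n - 3); the other
    -- walls have gap 1 or 2. So p lies beyond each of its walls by less than one level.
    wall-gap : ∀ {c d κ} → WallPair c d κ → (+ 0 ℤ.< pt n d ℤ.- pt n c ℤ.+ N n ℤ.* κ) × (pt n d ℤ.- pt n c ℤ.+ N n ℤ.* κ ℤ.≤ + 8)
    wall-gap {c} (up a b) with ptView a | ptView b
    ... | isPos u _ e | isPos v _ f = lia 4 (λ c p q N → p := # 2 :* c :- # 1 ⇒ q := # 2 :* (c :+ # 1) :- # 1 ⇒ ⊢ # 0 :< q :- p :+ N :* # 0) c _ _ (N n) e f
                                 , lia 4 (λ c p q N → p := # 2 :* c :- # 1 ⇒ q := # 2 :* (c :+ # 1) :- # 1 ⇒ ⊢ q :- p :+ N :* # 0 :≤ # 8) c _ _ (N n) e f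
    ... | isPos u _ e | isZero v f = ⊥-elim (lia 1 (λ c → # 1 :≤ c ⇒ c :+ # 1 := # 0 ⇒ ⊢ :⊥) c u v)
    ... | isPos u _ e | isNeg v _ f = ⊥-elim (lia 1 (λ c → # 1 :≤ c ⇒ c :+ # 1 :≤ con -[1+ 0 ] ⇒ ⊢ :⊥) c u v)
    ... | isZero u e | isPos v _ f = lia 4 (λ c p q N → c := # 0 ⇒ p := # 0 ⇒ q := # 2 :* (c :+ # 1) :- # 1 ⇒ ⊢ # 0 :< q :- p :+ N :* # 0) c _ _ (N n) u e f
                                 , lia 4 (λ c p q N → c := # 0 ⇒ p := # 0 ⇒ q := # 2 :* (c :+ # 1) :- # 1 ⇒ ⊢ q :- p :+ N :* # 0 :≤ # 8) c _ _ (N n) u e f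
    ... | isZero u e | isZero v f = ⊥-elim (lia 1 (λ c → c := # 0 ⇒ c :+ # 1 := # 0 ⇒ ⊢ :⊥) c u v)
    ... | isZero u e | isNeg v _ f = ⊥-elim (lia 1 (λ c → c := # 0 ⇒ c :+ # 1 :≤ con -[1+ 0 ] ⇒ ⊢ :⊥) c u v)
    ... | isNeg u _ e | isPos v _ f = ⊥-elim (lia 1 (λ c → c :≤ con -[1+ 0 ] ⇒ # 1 :≤ c :+ # 1 ⇒ ⊢ :⊥) c u v)
    ... | isNeg u _ e | isZero v f = lia 4 (λ c p q N → c :+ # 1 := # 0 ⇒ p := # 2 :* c :+ # 1 ⇒ q := # 0 ⇒ ⊢ # 0 :< q :- p :+ N :* # 0) c _ _ (N n) v e f
                                 , lia 4 (λ c p q N → c :+ # 1 := # 0 ⇒ p := # 2 :* c :+ # 1 ⇒ q := # 0 ⇒ ⊢ q :- p :+ N :* # 0 :≤ # 8) c _ _ (N n) v e f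
    ... | isNeg u _ e | isNeg v _ f = lia 4 (λ c p q N → p := # 2 :* c :+ # 1 ⇒ q := # 2 :* (c :+ # 1) :+ # 1 ⇒ ⊢ # 0 :< q :- p :+ N :* # 0) c _ _ (N n) e f
                                 , lia 4 (λ c p q N → p := # 2 :* c :+ # 1 ⇒ q := # 2 :* (c :+ # 1) :+ # 1 ⇒ ⊢ q :- p :+ N :* # 0 :≤ # 8) c _ _ (N n) e f
    wall-gap fork₁ = lia 5 (λ m p q q' N → p := # 2 :* (# 1 :+ m) :- # 1 ⇒ q := # 2 :* (# 2 :+ m) :- # 1 ⇒ q' := :- q ⇒ N := # 4 :+ # 4 :* (# 2 :+ m) ⇒ ⊢ # 0 :< q' :- p :+ N :* # 1)
                        (+ m) (pt n (+ suc m)) (pt n (+ n)) (pt n -[1+ suc m ]) (N n) pt-n-1 pt-n (ext-odd (pS {n}) (+ n)) (N-def n)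
                   , lia 5 (λ m p q q' N → p := # 2 :* (# 1 :+ m) :- # 1 ⇒ q := # 2 :* (# 2 :+ m) :- # 1 ⇒ q' := :- q ⇒ N := # 4 :+ # 4 :* (# 2 :+ m) ⇒ ⊢ q' :- p :+ N :* # 1 :≤ # 8)
                        (+ m) (pt n (+ suc m)) (pt n (+ n)) (pt n -[1+ suc m ]) (N n) pt-n-1 pt-n (ext-odd (pS {n}) (+ n)) (N-def n)
    wall-gap fork₂ = lia 5 (λ m p q p' N → p := # 2 :* (# 1 :+ m) :- # 1 ⇒ q := # 2 :* (# 2 :+ m) :- # 1 ⇒ p' := :- p ⇒ N := # 4 :+ # 4 :* (# 2 :+ m) ⇒ ⊢ # 0 :< p' :- q :+ N :* # 1)
                        (+ m) (pt n (+ suc m)) (pt n (+ n)) (pt n -[1+ m ]) (N n) pt-n-1 pt-n (ext-odd (pS {n}) (+ suc m)) (N-def n)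
                   , lia 5 (λ m p q p' N → p := # 2 :* (# 1 :+ m) :- # 1 ⇒ q := # 2 :* (# 2 :+ m) :- # 1 ⇒ p' := :- p ⇒ N := # 4 :+ # 4 :* (# 2 :+ m) ⇒ ⊢ p' :- q :+ N :* # 1 :≤ # 8)
                        (+ m) (pt n (+ suc m)) (pt n (+ n)) (pt n -[1+ m ]) (N n) pt-n-1 pt-n (ext-odd (pS {n}) (+ suc m)) (N-def n)

    N≥12 : + 12 ℤ.≤ N n
    N≥12 = lia 2 (λ m N → # 0 :≤ m ⇒ N := # 4 :+ # 4 :* (# 2 :+ m) ⇒ ⊢ # 12 :≤ N) (+ m) (N n) (0≤ m) (N-def n)

    -- The point of M·A∘, M = (h + 1)N, attached to w⁻¹p + μ.
    simplexPt : SP n → Vecℤ n → Vecℤ n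
    simplexPt w μ i = ext (pS {n}) (w i) ℤ.+ N n ℤ.* (μ i ℤ.+ pos i)

    bigM : ℤ
    bigM = N n ℤ.* (+ 1 ℤ.+ + 2 ℤ.* + n)

    Low : SP n → Vecℤ n → Set
    Low w μ = Alcove bigM (simplexPt w μ)

    ext-simplexPt : ∀ w μ {t} → SIdx n t → ext (simplexPt w μ) t ≡ pt n (ext w t) ℤ.+ N n ℤ.* (ext μ t ℤ.+ t)
    ext-simplexPt w μ {t} st = trans (ext-+ (compSP (pS {n}) w) (N n ·v (μ +v pos)) st) (cong₂ ℤ._+_ (ext-comp (pS {n}) w st)
       (trans (ext-· (N n) (μ +v pos) st) (cong (N n ℤ.*_) (trans (ext-+ μ pos st) (cong (ℤ._+_ (ext μ t)) (ext-id st))))))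

    drop : Vecℤ n → ℤ → ℤ → ℤ → ℤ
    drop μ c d κ = ext μ c ℤ.- ext μ d ℤ.- κ

    -- The consequence of `Low` that no longer mentions `w`; it is what the intermediate value
    -- argument runs on.
    record Steps (μ : Vecℤ n) : Set where
      field drop≤1 : ∀ {c d κ} → WallPair c d κ → drop μ c d κ ℤ.≤ + 1

      step≤ : ∀ {c} → SIdx n c → SIdx n (c ℤ.+ + 1) → ext μ c ℤ.≤ ext μ (c ℤ.+ + 1) ℤ.+ + 1
      step≤ {c} a b = lia 2 (λ u v → u :- v :- # 0 :≤ # 1 ⇒ ⊢ u :≤ v :+ # 1) (ext μ c) (ext μ (c ℤ.+ + 1)) (drop≤1 (up a b))
    open Steps public

    -- The shift by (1, ..., n) and the factor 2n + 1 of `bigM` make all walls look alike: each says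
    -- that the gap at height 1 - `drop` is positive. Both forks are the wall `top`, with either n
    -- or n - 1 moved to the mirror side.
    simplex-gap : ∀ {w μ} → Low w μ → ∀ {c d κ} → WallPair c d κ →
      + 0 ℤ.< pt n (ext w d) ℤ.- pt n (ext w c) ℤ.+ N n ℤ.* (+ 1 ℤ.- drop μ c d κ)
    simplex-gap {w} {μ} A {c} (up a b) = lia 8 (λ c u v p q N x y → u :< v ⇒ u := p :+ N :* (x :+ c) ⇒ v := q :+ N :* (y :+ (c :+ # 1)) ⇒ ⊢ # 0 :< q :- p :+ N :* (# 1 :- (x :- y :- # 0)))
       c _ _ (pt n (ext w c)) (pt n (ext w (c ℤ.+ + 1))) (N n) (ext μ c) (ext μ (c ℤ.+ + 1))
       (mono A a b (lia 1 (λ c → ⊢ c :< c :+ # 1) c)) (ext-simplexPt w μ a) (ext-simplexPt w μ b)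
    simplex-gap {w} {μ} A fork₁ = lia 9 (λ m u v p q q' N x y → u :+ v :< N :* (# 1 :+ # 2 :* (# 2 :+ m)) ⇒ u := p :+ N :* (x :+ (# 1 :+ m)) ⇒ v := q :+ N :* (y :+ (# 2 :+ m)) ⇒ q' := :- q ⇒ ⊢ # 0 :< q' :- p :+ N :* (# 1 :- (x :- (:- y) :- # 1))) (+ m) _ _ (pt n (ext w (+ suc m))) (pt n (ext w (+ n))) (pt n (ext w -[1+ suc m ])) (N n) (ext μ (+ suc m)) (ext μ (+ n))
       (top A) (ext-simplexPt w μ in-n-1) (ext-simplexPt w μ in-n) (trans (cong (pt n) (ext-odd w (+ n))) (ext-odd (pS {n}) (ext w (+ n))))
    simplex-gap {w} {μ} A fork₂ = lia 9 (λ m u v p q p' N x y → u :+ v :< N :* (# 1 :+ # 2 :* (# 2 :+ m)) ⇒ u := p :+ N :* (x :+ (# 1 :+ m)) ⇒ v := q :+ N :* (y :+ (# 2 :+ m)) ⇒ p' := :- p ⇒ ⊢ # 0 :< p' :- q :+ N :* (# 1 :- (y :- (:- x) :- # 1)))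
       (+ m) _ _ (pt n (ext w (+ suc m))) (pt n (ext w (+ n))) (pt n (ext w -[1+ m ])) (N n) (ext μ (+ suc m)) (ext μ (+ n))
       (top A) (ext-simplexPt w μ in-n-1) (ext-simplexPt w μ in-n) (trans (cong (pt n) (ext-odd w (+ suc m))) (ext-odd (pS {n}) (ext w (+ suc m))))

    -- Two values of `pt` differ by less than N, so a drop of two would already make the gap
    -- negative.
    low-steps : ∀ {w μ} → SPerm w → Low w μ → Steps μ
    low-steps {w} {μ} h A .drop≤1 {c} {d} {κ} W = lia 1 (λ x → # 0 :- # 1 :< # 1 :- x ⇒ ⊢ x :≤ # 1) (drop μ c d κ) (N-cancel< n {+ 0 ℤ.- + 1} {+ 1 ℤ.- drop μ c d κ}
      (lia 4 (λ p q N x → # 0 :< q :- p :+ N :* (# 1 :- x) ⇒ # 2 :* q :< N ⇒ :- N :< # 2 :* p ⇒ ⊢ N :* (# 0 :- # 1) :< N :* (# 1 :- x))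
        (pt n (ext w c)) (pt n (ext w d)) (N n) (drop μ c d κ) (simplex-gap A W)
        (proj₁ (pt-bound (ext-sidx (sp-sidx h) (vt (wall-valid W))))) (proj₂ (pt-bound (ext-sidx (sp-sidx h) (vs (wall-valid W)))))))

    -- With drop one the multiple of N vanishes and the gap is a difference of base values. Its sign
    -- shows that the wall belongs to a positive root, and only for those does the Shi arrangement
    -- contain height one.
    low-floor : ∀ {w μ} → SPerm w → Low w μ → ∀ {c d κ} → WallPair c d κ → drop μ c d κ ≡ + 1 → ext w c ℤ.< ext w d
    low-floor {w} {μ} h A {c} {d} {κ} W e = ℤP.≰⇒> (λ q → ℤP.<⇒≱ lt' (le' q))
      where
      lt' : pt n (ext w c) ℤ.< pt n (ext w d)
      lt' = lia 4 (λ p q N x → # 0 :< q :- p :+ N :* (# 1 :- x) ⇒ N :* (# 1 :- x) := # 0 ⇒ ⊢ p :< q) (pt n (ext w c)) (pt n (ext w d)) (N n) (drop μ c d κ) (simplex-gap A W)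
         (trans (cong (λ z → N n ℤ.* (+ 1 ℤ.- z)) e) (ℤP.*-zeroʳ (N n)))
      le' : ext w d ℤ.≤ ext w c → pt n (ext w d) ℤ.≤ pt n (ext w c)
      le' q with ext w d ℤP.≟ ext w c
      ... | yes r = ℤP.≤-reflexive (cong (pt n) r)
      ... | no r = ℤP.<⇒≤ (pt-mono (ext-sidx (sp-sidx h) (vt (wall-valid W))) (ext-sidx (sp-sidx h) (vs (wall-valid W))) (ℤP.≤∧≢⇒< q r))

    X : Vecℤ n → ℤ → ℤ
    X μ t = pt n t ℤ.- N n ℤ.* ext μ t

    X-odd : ∀ μ t → X μ (ℤ.- t) ≡ ℤ.- X μ t
    X-odd μ t = lia 4 (λ p p' y y' → p' := :- p ⇒ y' := :- y ⇒ ⊢ p' :- y' := :- (p :- y)) (pt n t) (pt n (ℤ.- t)) (N n ℤ.* ext μ t) (N n ℤ.* ext μ (ℤ.- t)) (ext-odd (pS {n}) t)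
      (trans (cong (N n ℤ.*_) (ext-odd μ t)) (sym (ℤP.neg-distribʳ-* (N n) (ext μ t))))

    -- Since μ drops by at most one at a step, it passes through every level on its way down.
    ivt : ∀ {μ} → Steps μ → ∀ k a L → SIdx n a → SIdx n (a ℤ.+ + k) → L ℤ.< ext μ a → ext μ (a ℤ.+ + k) ℤ.≤ L →
      ∃ λ c → WallPair c (c ℤ.+ + 1) (+ 0) × a ℤ.≤ c × c ℤ.< a ℤ.+ + k × ext μ c ≡ L ℤ.+ + 1 × ext μ (c ℤ.+ + 1) ≡ L
    ivt {μ} S zero a L sa sb h q = ⊥-elim (ℤP.<⇒≱ h (subst (λ z → ext μ z ℤ.≤ L) (ℤP.+-identityʳ a) q))
    ivt {μ} S (suc k) a L sa sb h q with ext μ (a ℤ.+ + k) ℤP.≤? L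
    ... | yes r = pass (ivt S k a L sa sc h r)
      where
      sc : SIdx n (a ℤ.+ + k)
      sc = sidx-ℤ (lia 3 (λ n a k → :- n :≤ a ⇒ # 0 :≤ k ⇒ ⊢ :- n :≤ a :+ k) (+ n) a (+ k) (sidx-lo sa) (0≤ k))
                 (lia 3 (λ n a k → a :+ (# 1 :+ k) :≤ n ⇒ ⊢ a :+ k :≤ n) (+ n) a (+ k) (sidx-hi sb))
      pass : (∃ λ c → WallPair c (c ℤ.+ + 1) (+ 0) × a ℤ.≤ c × c ℤ.< a ℤ.+ + k × ext μ c ≡ L ℤ.+ + 1 × ext μ (c ℤ.+ + 1) ≡ L) → _
      pass (c , W , u , v , rest) = c , W , u , lia 3 (λ c a k → c :< a :+ k ⇒ ⊢ c :< a :+ (# 1 :+ k)) c a (+ k) v , rest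
    ... | no r = c , up sc sd , lia 2 (λ a k → # 0 :≤ k ⇒ ⊢ a :≤ a :+ k) a (+ k) (0≤ k) , lia 2 (λ a k → ⊢ a :+ k :< a :+ (# 1 :+ k)) a (+ k)
       , lia 3 (λ L u v → L :< u ⇒ v :≤ L ⇒ u :≤ v :+ # 1 ⇒ ⊢ u := L :+ # 1) L (ext μ c) (ext μ (c ℤ.+ + 1)) (ℤP.≰⇒> r) q' (step≤ S sc sd)
       , lia 3 (λ L u v → L :< u ⇒ v :≤ L ⇒ u :≤ v :+ # 1 ⇒ ⊢ v := L) L (ext μ c) (ext μ (c ℤ.+ + 1)) (ℤP.≰⇒> r) q' (step≤ S sc sd)
      where
      c = a ℤ.+ + k
      e' : a ℤ.+ + suc k ≡ c ℤ.+ + 1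
      e' = lia 2 (λ a k → ⊢ a :+ (# 1 :+ k) := a :+ k :+ # 1) a (+ k)
      q' : ext μ (c ℤ.+ + 1) ℤ.≤ L
      q' = subst (λ z → ext μ z ℤ.≤ L) e' q
      sc : SIdx n c
      sc = sidx-ℤ (lia 3 (λ n a k → :- n :≤ a ⇒ # 0 :≤ k ⇒ ⊢ :- n :≤ a :+ k) (+ n) a (+ k) (sidx-lo sa) (0≤ k))
                 (lia 3 (λ n a k → a :+ (# 1 :+ k) :≤ n ⇒ ⊢ a :+ k :≤ n) (+ n) a (+ k) (sidx-hi sb))
      sd : SIdx n (c ℤ.+ + 1)
      sd = subst (SIdx n) e' sb

    -- The target is reached by moving upwards from s, possibly once past n. A wrapped path enters
    -- through `fork₂` at -n + 1, hence the exclusion of -n.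
    Cyclic : ℤ → ℤ → Set
    Cyclic s t = (s ℤ.< t) ⊎ (t ℤ.< s × t ≢ -[1+ suc m ])

    -- One floor near the upper end, preceded by s itself or by a stretch that still has K - 1
    -- levels to cross. An induction on K peels the floors off one at a time.
    record Chain (μ : Vecℤ n) (s t K : ℤ) : Set where
      constructor chain
      field
        {c d κ} : ℤ
        wall : WallPair c d κ
        dropped : drop μ c d κ ≡ + 1
        after : (d ≡ t) ⊎ (X μ d ℤ.< X μ t)
        before : (c ≡ s × K ≡ + 1) ⊎ (Cyclic s c × N n ℤ.* (K ℤ.- + 1) ℤ.< X μ c ℤ.- X μ s)

    gap-bound : ∀ {μ s t K} → SIdx n s → SIdx n t → N n ℤ.* K ℤ.< X μ t ℤ.- X μ s → K ℤ.≤ ext μ s ℤ.- ext μ t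
    gap-bound {μ} {s} {t} {K} a b h = lia 2 (λ K x → K :< x :+ # 1 ⇒ ⊢ K :≤ x) K (ext μ s ℤ.- ext μ t) (N-cancel< n {K} {ext μ s ℤ.- ext μ t ℤ.+ + 1}
      (lia 6 (λ N K p q x y → N :* K :< (q :- N :* y) :- (p :- N :* x) ⇒ # 2 :* q :< N ⇒ :- N :< # 2 :* p ⇒ ⊢ N :* K :< N :* (x :- y :+ # 1))
       (N n) K (pt n s) (pt n t) (ext μ s) (ext μ t) h (proj₁ (pt-bound b)) (proj₂ (pt-bound a))))

    -- If t lies below s, the base values count against the gap, and μ has to make up for one more
    -- level.
    gap-bound′ : ∀ {μ s t K} → SIdx n s → SIdx n t → t ℤ.< s → N n ℤ.* K ℤ.< X μ t ℤ.- X μ s → K ℤ.+ + 1 ℤ.≤ ext μ s ℤ.- ext μ t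
    gap-bound′ {μ} {s} {t} {K} a b l h = lia 2 (λ K x → K :< x ⇒ ⊢ K :+ # 1 :≤ x) K (ext μ s ℤ.- ext μ t) (N-cancel< n {K} {ext μ s ℤ.- ext μ t}
      (lia 6 (λ N K p q x y → N :* K :< (q :- N :* y) :- (p :- N :* x) ⇒ q :< p ⇒ ⊢ N :* K :< N :* (x :- y))
       (N n) K (pt n s) (pt n t) (ext μ s) (ext μ t) h (pt-mono b a l)))

    same-level : ∀ {μ d t} → SIdx n d → SIdx n t → d ℤ.≤ t → ext μ d ≡ ext μ t → (d ≡ t) ⊎ (X μ d ℤ.< X μ t)
    same-level {μ} {d} {t} a b h e with d ℤP.≟ t
    ... | yes q = inj₁ q
    ... | no q = inj₂ (lia 5 (λ p q N x y → p :< q ⇒ N :* (x :- y) := # 0 ⇒ ⊢ p :- N :* x :< q :- N :* y) (pt n d) (pt n t) (N n) (ext μ d) (ext μ t) (pt-mono a b (ℤP.≤∧≢⇒< h q))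
          (trans (cong (N n ℤ.*_) (ℤP.i≡j⇒i-j≡0 e)) (ℤP.*-zeroʳ (N n))))

    later : ∀ {μ s c K} → SIdx n s → SIdx n c → s ℤ.< c → K ℤ.≤ ext μ s ℤ.- ext μ c → N n ℤ.* K ℤ.< X μ c ℤ.- X μ s
    later {μ} {s} {c} {K} a b h q = lia 6 (λ p q N x y K → p :< q ⇒ N :* K :≤ N :* (x :- y) ⇒ ⊢ N :* K :< q :- N :* y :- (p :- N :* x)) (pt n s) (pt n c) (N n) (ext μ s) (ext μ c) K (pt-mono a b h) (Npos-mono n q)

    later′ : ∀ {μ s c K} → SIdx n s → SIdx n c → K ℤ.+ + 1 ℤ.≤ ext μ s ℤ.- ext μ c → N n ℤ.* K ℤ.< X μ c ℤ.- X μ s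
    later′ {μ} {s} {c} {K} a b q = lia 6 (λ p q N x y K → :- N :< # 2 :* q ⇒ # 2 :* p :< N ⇒ N :* (K :+ # 1) :≤ N :* (x :- y) ⇒ ⊢ N :* K :< q :- N :* y :- (p :- N :* x)) (pt n s) (pt n c) (N n) (ext μ s) (ext μ c) K
        (proj₂ (pt-bound b)) (proj₁ (pt-bound a)) (Npos-mono n q)

    find-chain : ∀ {μ} → Steps μ → ∀ {s t K} → SIdx n s → SIdx n t → Cyclic s t → + 1 ℤ.≤ K → N n ℤ.* K ℤ.< X μ t ℤ.- X μ s → Chain μ s t K
    find-chain {μ} S {s} {t} {K} ss st (inj₁ s<t) K≥1 h = go (ℤ-diff (ℤP.<⇒≤ s<t))
      where
      gb = gap-bound {μ} ss st h
      go : (∃ λ k → t ≡ s ℤ.+ + k) → Chain μ s t K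
      go (k , refl) = fin (ivt S k s (ext μ t) ss st (lia 3 (λ K x y → K :≤ x :- y ⇒ # 1 :≤ K ⇒ ⊢ y :< x) K (ext μ s) (ext μ t) gb K≥1) ℤP.≤-refl)
        where
        fin : (∃ λ c → WallPair c (c ℤ.+ + 1) (+ 0) × s ℤ.≤ c × c ℤ.< t × ext μ c ≡ ext μ t ℤ.+ + 1 × ext μ (c ℤ.+ + 1) ≡ ext μ t) → Chain μ s t K
        fin (c , W , s≤c , c<t , e₁ , e₂) = chain W
          (lia 3 (λ x y z → x := z :+ # 1 ⇒ y := z ⇒ ⊢ x :- y :- # 0 := # 1) (ext μ c) (ext μ (c ℤ.+ + 1)) (ext μ t) e₁ e₂)
          (same-level {μ} (vt (wall-valid W)) st (lia 2 (λ c t → c :< t ⇒ ⊢ c :+ # 1 :≤ t) c t c<t) e₂)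
          (bef (c ℤP.≟ s))
          where
          bef : Dec (c ≡ s) → (c ≡ s × K ≡ + 1) ⊎ (Cyclic s c × N n ℤ.* (K ℤ.- + 1) ℤ.< X μ c ℤ.- X μ s)
          bef (yes refl) = inj₁ (refl , lia 3 (λ K x y → K :≤ x :- y ⇒ # 1 :≤ K ⇒ x := y :+ # 1 ⇒ ⊢ K := # 1) K (ext μ s) (ext μ t) gb K≥1 e₁)
          bef (no q) = inj₂ (inj₁ s<c , later {μ} ss (vs (wall-valid W)) s<c (lia 4 (λ K x y z → K :≤ x :- y ⇒ z := y :+ # 1 ⇒ ⊢ K :- # 1 :≤ x :- z) K (ext μ s) (ext μ t) (ext μ c) gb e₁))
            where s<c = ℤP.≤∧≢⇒< s≤c (q ∘ sym)
    find-chain {μ} S {s} {t} {K} ss st (inj₂ (t<s , t≢-n)) K≥1 h = split (ext μ -[1+ m ] ℤP.≤? ext μ t) (ext μ (+ n) ℤP.≤? ext μ t ℤ.+ + 1)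
      where
      gb = gap-bound′ {μ} ss st t<s h
      -n+1≤t : -[1+ m ] ℤ.≤ t
      -n+1≤t = lia 2 (λ m t → :- (# 2 :+ m) :< t ⇒ ⊢ :- (# 1 :+ m) :≤ t) (+ m) t (ℤP.≤∧≢⇒< (sidx-lo st) (t≢-n ∘ sym))
      Goal-before : ℤ → Set
      Goal-before c = (c ≡ s × K ≡ + 1) ⊎ (Cyclic s c × N n ℤ.* (K ℤ.- + 1) ℤ.< X μ c ℤ.- X μ s)
      bef : ∀ {c} → SIdx n c → s ℤ.≤ c → ext μ c ≡ ext μ t ℤ.+ + 1 ℤ.+ + 1 → Dec (c ≡ s) → Goal-before c
      bef sc s≤c e (yes refl) = inj₁ (refl , lia 3 (λ K x y → K :+ # 1 :≤ x :- y ⇒ # 1 :≤ K ⇒ x := y :+ # 1 :+ # 1 ⇒ ⊢ K := # 1) K (ext μ s) (ext μ t) gb K≥1 e)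
      bef {c} sc s≤c e (no q) = inj₂ (inj₁ s<c , later {μ} ss sc s<c (lia 4 (λ K x y z → K :+ # 1 :≤ x :- y ⇒ z := y :+ # 1 :+ # 1 ⇒ ⊢ K :- # 1 :≤ x :- z) K (ext μ s) (ext μ t) (ext μ c) gb e))
        where s<c = ℤP.≤∧≢⇒< s≤c (q ∘ sym)
      -- Going past n costs one extra level, which leaves three places for the floor. If -n + 1 is
      -- still above level `μ t`, it lies between -n + 1 and t; if n is at most one level above
      -- `μ t`, it lies between s and n; otherwise the bound on the drop at `fork₂` forces that fork
      -- to be the floor.
      split : Dec (ext μ -[1+ m ] ℤ.≤ ext μ t) → Dec (ext μ (+ n) ℤ.≤ ext μ t ℤ.+ + 1) → Chain μ s t K
      split (no q) _ = go (ℤ-diff -n+1≤t)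
        where
        go : (∃ λ k → t ≡ -[1+ m ] ℤ.+ + k) → Chain μ s t K
        go (k , e) = fin (ivt S k -[1+ m ] (ext μ t) (sidx-neg in-n-1) (subst (SIdx n) e st) (ℤP.≰⇒> q) (ℤP.≤-reflexive (cong (ext μ) (sym e))))
          where
          fin : (∃ λ c → WallPair c (c ℤ.+ + 1) (+ 0) × -[1+ m ] ℤ.≤ c × c ℤ.< -[1+ m ] ℤ.+ + k × ext μ c ≡ ext μ t ℤ.+ + 1 × ext μ (c ℤ.+ + 1) ≡ ext μ t) → Chain μ s t K
          fin (c , W , lo , hi , e₁ , e₂) = chain W
            (lia 3 (λ x y z → x := z :+ # 1 ⇒ y := z ⇒ ⊢ x :- y :- # 0 := # 1) (ext μ c) (ext μ (c ℤ.+ + 1)) (ext μ t) e₁ e₂)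
            (same-level {μ} (vt (wall-valid W)) st (lia 2 (λ c t → c :< t ⇒ ⊢ c :+ # 1 :≤ t) c t c<t) e₂)
            (inj₂ (inj₂ (ℤP.<-trans c<t t<s , λ q → lia 2 (λ m c → c := :- (# 2 :+ m) ⇒ :- (# 1 :+ m) :≤ c ⇒ ⊢ :⊥) (+ m) c q lo)
              , later′ {μ} ss (vs (wall-valid W)) (lia 4 (λ K x y z → K :+ # 1 :≤ x :- y ⇒ z := y :+ # 1 ⇒ ⊢ K :- # 1 :+ # 1 :≤ x :- z) K (ext μ s) (ext μ t) (ext μ c) gb e₁)))
            where c<t = subst (c ℤ.<_) (sym e) hi
      split (yes q) (yes r) = go (ℤ-diff (sidx-hi ss))
        where
        go : (∃ λ k → + n ≡ s ℤ.+ + k) → Chain μ s t K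
        go (k , e) = fin (ivt S k s (ext μ t ℤ.+ + 1) ss (subst (SIdx n) e in-n) (lia 3 (λ K x y → K :+ # 1 :≤ x :- y ⇒ # 1 :≤ K ⇒ ⊢ y :+ # 1 :< x) K (ext μ s) (ext μ t) gb K≥1) (subst (λ z → ext μ z ℤ.≤ ext μ t ℤ.+ + 1) e r))
          where
          fin : (∃ λ c → WallPair c (c ℤ.+ + 1) (+ 0) × s ℤ.≤ c × c ℤ.< s ℤ.+ + k × ext μ c ≡ ext μ t ℤ.+ + 1 ℤ.+ + 1 × ext μ (c ℤ.+ + 1) ≡ ext μ t ℤ.+ + 1) → Chain μ s t K
          fin (c , W , lo , hi , e₁ , e₂) = chain W
            (lia 3 (λ x y z → x := z :+ # 1 :+ # 1 ⇒ y := z :+ # 1 ⇒ ⊢ x :- y :- # 0 := # 1) (ext μ c) (ext μ (c ℤ.+ + 1)) (ext μ t) e₁ e₂)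
            (inj₂ (lia 3 (λ N u v → N :* # 0 :< v :- u ⇒ ⊢ u :< v) (N n) (X μ (c ℤ.+ + 1)) (X μ t) (later′ {μ} {K = + 0} (vt (wall-valid W)) st (lia 2 (λ x y → x := y :+ # 1 ⇒ ⊢ # 0 :+ # 1 :≤ x :- y) (ext μ (c ℤ.+ + 1)) (ext μ t) e₂))))
            (bef (vs (wall-valid W)) lo e₁ (c ℤP.≟ s))
      split (yes q) (no r) = chain fork₂ (lia 2 (λ x y → x :- y :- # 1 :≤ # 1 ⇒ # 2 :≤ x :- y ⇒ ⊢ x :- y :- # 1 := # 1) (ext μ (+ n)) (ext μ -[1+ m ]) D
            (lia 3 (λ x y z → y :≤ z ⇒ z :+ # 1 :< x ⇒ ⊢ # 2 :≤ x :- y) (ext μ (+ n)) (ext μ -[1+ m ]) (ext μ t) q (ℤP.≰⇒> r)))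
          (same-level {μ} (sidx-neg in-n-1) st -n+1≤t (lia 3 (λ x y z → x :- y :- # 1 :≤ # 1 ⇒ y :≤ z ⇒ z :+ # 1 :< x ⇒ ⊢ y := z) (ext μ (+ n)) (ext μ -[1+ m ]) (ext μ t) D q (ℤP.≰⇒> r)))
          (bef in-n (sidx-hi ss) (lia 3 (λ x y z → x :- y :- # 1 :≤ # 1 ⇒ y :≤ z ⇒ z :+ # 1 :< x ⇒ ⊢ x := z :+ # 1 :+ # 1) (ext μ (+ n)) (ext μ -[1+ m ]) (ext μ t) D q (ℤP.≰⇒> r)) (+ n ℤP.≟ s))
        where D = drop≤1 S fork₂

open LowPoints

-- Low alcoves are minimal in their Shi regions.

module Minimality where

  abs-mono : ∀ k z → + k ℤ.≤ z → k ℕ.≤ ∣ z ∣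
  abs-mono k (+ l) (+≤+ h) = h

  abs-mono-neg : ∀ k z → + k ℤ.≤ ℤ.- z ℤ.- + 1 → suc k ℕ.≤ ∣ z ∣
  abs-mono-neg k z h = subst (suc k ℕ.≤_) (ℤP.∣-i∣≡∣i∣ z) (abs-mono (suc k) (ℤ.- z) (lia 2 (λ k z → k :≤ :- z :- # 1 ⇒ ⊢ # 1 :+ k :≤ :- z) (+ k) z h))

  module _ {m : ℕ} where
    private n = suc (suc m)

    Framed : AffW n → Vecℤ n → Set
    Framed a μ = ∀ i → ext (tr a) (lin a i) ≡ ℤ.- μ i

    frame : ∀ {a μ} → SPerm (lin a) → Framed a μ → ∀ {t} → SIdx n t → ext (ptS a) (ext (lin a) t) ≡ X μ t
    frame {a} {μ} h f {t} st = begin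
      ext (ptS a) (ext (lin a) t) ≡⟨ ext-ptS a (ext-sidx (sp-sidx h) st) ⟩
      ext (actV (lin a) pS) (ext (lin a) t) ℤ.+ N n ℤ.* ext (tr a) (ext (lin a) t) ≡⟨ cong₂ (λ u v → u ℤ.+ N n ℤ.* v) (ext-actV-ext h pS st)
         (trans (sym (ext-comp (tr a) (lin a) st)) (trans (ext-cong f st) (ext-negv μ st))) ⟩
      pt n t ℤ.+ N n ℤ.* (ℤ.- ext μ t) ≡⟨ lia 3 (λ p N x → ⊢ p :+ N :* (:- x) := p :- N :* x) (pt n t) (N n) (ext μ t) ⟩
      X μ t ∎
      where open ≡-Reasoning

    same-sign : ∀ {a b} → SPerm (lin b) → SameShiRegion a b → ∀ {s t} → Valid n s t →
      ext (ptS a) s ℤ.< ext (ptS a) t → ext (ptS b) s ℤ.< ext (ptS b) t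
    same-sign {a} {b} hb S {s} {t} v h with valid-cases v
    ... | inj₁ s<t with rootOf v s<t
    ...   | root-of r pr = ℤP.≤∧≢⇒< (ℤP.≮⇒≥ λ q → ℤP.<-asym h (lia 3 (λ a b r → r := b :- a ⇒ r :< # 0 ⇒ ⊢ b :< a) (ext (ptS a) s) (ext (ptS a) t) _ (pr (ptS a))
            (proj₂ (proj₁ (S r)) (subst (ℤ._< + 0) (sym (pr (ptS b))) (lia 2 (λ a b → b :< a ⇒ ⊢ b :- a :< # 0) (ext (ptS b) s) (ext (ptS b) t) q)))))
          (λ q → off-ne {n} (+ 0) (alcove-off b hb v) (trans (ℤP.i≡j⇒i-j≡0 (sym q)) (sym (ℤP.*-zeroʳ (N n)))))
    same-sign {a} {b} hb S {s} {t} v h | inj₂ t<s with rootOf (valid-swap v) t<s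
    ...   | root-of r pr = lia 2 (λ a b → a :- b :< # 0 ⇒ ⊢ a :< b) (ext (ptS b) s) (ext (ptS b) t) (subst (ℤ._< + 0) (pr (ptS b))
             (proj₁ (proj₁ (S r)) (subst (ℤ._< + 0) (sym (pr (ptS a))) (lia 2 (λ a b → a :< b ⇒ ⊢ a :- b :< # 0) (ext (ptS a) s) (ext (ptS a) t) h))))

    -- Height one belongs to the Shi arrangement for positive roots only, hence the hypothesis on
    -- the order of s and t. Strictness carries over because alcove points avoid the hyperplanes.
    same-floor : ∀ {a b} → SPerm (lin b) → SameShiRegion a b → ∀ {s t} → Valid n s t → s ℤ.< t →
      N n ℤ.< ext (ptS a) t ℤ.- ext (ptS a) s → N n ℤ.< ext (ptS b) t ℤ.- ext (ptS b) s
    same-floor {a} {b} hb S {s} {t} v s<t h with rootOf v s<t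
    ... | root-of r pr = ℤP.≤∧≢⇒< (ℤP.≮⇒≥ λ q → ℤP.<-asym h (subst (ℤ._< N n) (pr (ptS a)) (proj₂ (proj₂ (S r)) (subst (ℤ._< N n) (sym (pr (ptS b))) q))))
          (λ q → off-ne {n} (+ 1) (alcove-off b hb v) (trans (sym q) (sym (ℤP.*-identityʳ (N n)))))

    -- Every separation recorded by the point X of a low alcove is a sum of floors and walls through 0.
    module _ (μ : Vecℤ n) (S : Steps {m} μ) (Z : ℤ → ℤ) (Z-odd : ∀ {t} → SIdx n t → Z (ℤ.- t) ≡ ℤ.- Z t)
      (sgn : ∀ {s t} → SIdx n s → SIdx n t → X μ s ℤ.< X μ t → Z s ℤ.< Z t)
      (flo : ∀ {c d κ} → WallPair {m} c d κ → drop μ c d κ ≡ + 1 → N n ℤ.< Z d ℤ.- Z c) where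

      cyclic : ∀ {s t} → s ≢ t → t ≢ -[1+ suc m ] → Cyclic {m} s t
      cyclic {s} {t} p q with ℤP.<-cmp s t
      ... | tri< h _ _ = inj₁ h
      ... | tri≈ _ h _ = ⊥-elim (p h)
      ... | tri> _ _ h = inj₂ (h , q)

      separates : ∀ K {s t} → SIdx n s → SIdx n t → Cyclic {m} s t → N n ℤ.* + K ℤ.< X μ t ℤ.- X μ s → N n ℤ.* + K ℤ.< Z t ℤ.- Z s
      separates zero {s} {t} ss st C h = lia 3 (λ N a b → a :< b ⇒ ⊢ N :* # 0 :< b :- a) (N n) (Z s) (Z t)
         (sgn ss st (lia 3 (λ N a b → N :* # 0 :< b :- a ⇒ ⊢ a :< b) (N n) (X μ s) (X μ t) h))
      separates (suc K) {s} {t} ss st C h with find-chain S ss st C (+≤+ (s≤s z≤n)) h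
      ... | chain {c} {d} W dr af be = lia 6 (λ N K zs zt zc zd → N :< zd :- zc ⇒ zd :≤ zt ⇒ N :* K :≤ zc :- zs ⇒ ⊢ N :* (# 1 :+ K) :< zt :- zs) (N n) (+ K) (Z s) (Z t) (Z c) (Z d) (flo W dr) (aft af) (bef be)
        where
        aft : (d ≡ t) ⊎ (X μ d ℤ.< X μ t) → Z d ℤ.≤ Z t
        aft (inj₁ refl) = ℤP.≤-refl
        aft (inj₂ q) = ℤP.<⇒≤ (sgn (vt (wall-valid W)) st q)
        bef : (c ≡ s × + suc K ≡ + 1) ⊎ (Cyclic s c × N n ℤ.* (+ suc K ℤ.- + 1) ℤ.< X μ c ℤ.- X μ s) → N n ℤ.* + K ℤ.≤ Z c ℤ.- Z s
        bef (inj₁ (refl , refl)) = lia 2 (λ N z → ⊢ N :* # 0 :≤ z :- z) (N n) (Z s)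
        bef (inj₂ (C' , q)) = ℤP.<⇒≤ (separates K ss (vs (wall-valid W)) C' (subst (λ z → N n ℤ.* z ℤ.< X μ c ℤ.- X μ s) (lia 1 (λ K → ⊢ # 1 :+ K :- # 1 := K) (+ K)) q))

      -- A pair ending in -n is replaced by its mirror, which starts at n and ends at -s; this
      -- target differs from -n because a valid pair excludes s = n.
      separates-valid : ∀ K {s t} → Valid n s t → N n ℤ.* + K ℤ.< X μ t ℤ.- X μ s → N n ℤ.* + K ℤ.< Z t ℤ.- Z s
      separates-valid K {s} {t} v h with t ℤP.≟ -[1+ suc m ]
      ... | no q = separates K (vs v) (vt v) (cyclic (s≢t v) q) h
      ... | yes q = subst (N n ℤ.* + K ℤ.<_) (lia 4 (λ a b c d → c := :- a ⇒ d := :- b ⇒ ⊢ c :- d := b :- a) (Z s) (Z t) (Z (ℤ.- s)) (Z (ℤ.- t)) (Z-odd (vs v)) (Z-odd (vt v)))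
          (separates K (sidx-neg (vt v)) (sidx-neg (vs v)) (cyclic (λ r → s≢t v (sym (ℤP.neg-injective r))) (λ r → s≢-t v (trans (ℤP.neg-injective {s} {+ n} r) (cong ℤ.-_ (sym q)))))
            (subst (N n ℤ.* + K ℤ.<_) (lia 4 (λ a b c d → c := :- a ⇒ d := :- b ⇒ ⊢ b :- a := c :- d) (X μ s) (X μ t) (X μ (ℤ.- s)) (X μ (ℤ.- t)) (X-odd μ s) (X-odd μ t)) h))

    abs-fl-mono : ∀ {A B} (oA : Off n A) (oB : Off n B) → (∀ K → N n ℤ.* + K ℤ.< A → N n ℤ.* + K ℤ.< B) → (∀ K → N n ℤ.* + K ℤ.< ℤ.- A → N n ℤ.* + K ℤ.< ℤ.- B) →
      ∣ fl oA ∣ ℕ.≤ ∣ fl oB ∣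
    abs-fl-mono oA oB f g with fl oA in e
    ... | + k = abs-mono k (fl oB) (off-above oB (+ k) (f k (off-below oA (+ k) (ℤP.≤-reflexive (sym e)))))
    ... | -[1+ k ] = abs-mono-neg k (fl oB) (off-above (off-neg oB) (+ k) (g k (off-below (off-neg oA) (+ k) (ℤP.≤-reflexive
         (lia 2 (λ z k → z := :- (# 1 :+ k) ⇒ ⊢ k := :- z :- # 1) (fl oA) (+ k) e)))))

    -- The distances are compared root by root: each multiple of N that separates the value at `a`
    -- from 0 also separates the value at any `b` of the same region.
    low⇒ShiMin : ∀ {a μ} → IsAffW a → Framed a μ → Low (lin a) μ → ShiMin a
    low⇒ShiMin {a} {μ} ia f A = ia , λ b ib S → sumℕ-mono _ _ (posRoots n) (term b ib S)
      where
      ha : SPerm (lin a)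
      ha = sperm (proj₁ ia)
      St = low-steps ha A
      term : ∀ b → IsAffW b → SameShiRegion a b → ∀ r → ∣ flr n ⟪ ptS a , rootVec r ⟫ ∣ ℕ.≤ ∣ flr n ⟪ ptS b , rootVec r ⟫ ∣
      term b ib S r = subst₂ (λ u v → ∣ u ∣ ℕ.≤ ∣ v ∣) (sym (flr≡ oA)) (sym (flr≡ oB)) (abs-fl-mono oA oB fwd bwd)
        where
        hb : SPerm (lin b)
        hb = sperm (proj₁ ib)
        oA : Off n ⟪ ptS a , rootVec r ⟫
        oA = off-subst (sym (⟪root⟫ (ptS a) r)) (alcove-off a ha (root-valid r))
        oB : Off n ⟪ ptS b , rootVec r ⟫
        oB = off-subst (sym (⟪root⟫ (ptS b) r)) (alcove-off b hb (root-valid r))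
        Z : ℤ → ℤ
        Z t = ext (ptS b) (ext (lin a) t)
        Z-odd : ∀ {t} → SIdx n t → Z (ℤ.- t) ≡ ℤ.- Z t
        Z-odd {t} _ = trans (cong (ext (ptS b)) (ext-odd (lin a) t)) (ext-odd (ptS b) (ext (lin a) t))
        sgn-valid : ∀ {s t} → Valid n s t → X μ s ℤ.< X μ t → Z s ℤ.< Z t
        sgn-valid v h = same-sign {a} {b} hb S (valid-ext ha v) (subst₂ ℤ._<_ (sym (frame {a} {μ} ha f (vs v))) (sym (frame {a} {μ} ha f (vt v))) h)
        sgn : ∀ {s t} → SIdx n s → SIdx n t → X μ s ℤ.< X μ t → Z s ℤ.< Z t
        sgn {s} {t} ss st h with s ℤP.≟ ℤ.- t
        ... | no q = sgn-valid (valid-pair ss st (λ r → ℤP.<-irrefl (cong (X μ) r) h) q) h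
        -- Opposite indices span no root. Since X and Z are odd, the comparison reduces to the sign
        -- at t, which the short root of t decides.
        ... | yes refl with t ℤP.≟ + 0
        ...   | yes refl = ⊥-elim (ℤP.<-irrefl refl h)
        ...   | no q = lia 3 (λ a b c → a := :- b ⇒ c := # 0 ⇒ c :< b ⇒ ⊢ a :< b) (Z (ℤ.- t)) (Z t) (Z (+ 0)) (Z-odd st) refl
                 (sgn-valid (valid-pair zr st (q ∘ sym) (λ r → q (ℤP.neg-injective {t} {+ 0} (sym r))))
                   (lia 3 (λ a b c → a := :- b ⇒ c := # 0 ⇒ a :< b ⇒ ⊢ c :< b) (X μ (ℤ.- t)) (X μ t) (X μ (+ 0)) (X-odd μ t) (lia 1 (λ N → ⊢ # 0 :- N :* # 0 := # 0) (N n)) h))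
        flo : ∀ {c d κ} → WallPair c d κ → drop μ c d κ ≡ + 1 → N n ℤ.< Z d ℤ.- Z c
        flo {c} {d} {κ} W e = same-floor {a} {b} hb S (valid-ext ha (wall-valid W)) (low-floor ha A W e)
           (subst (N n ℤ.<_) (sym (cong₂ ℤ._-_ (frame {a} {μ} ha f (vt (wall-valid W))) (frame {a} {μ} ha f (vs (wall-valid W)))))
             (lia 6 (λ N p q x y κ → # 0 :< q :- p :+ N :* κ ⇒ N :* (x :- y :- κ) := N ⇒ ⊢ N :< q :- N :* y :- (p :- N :* x)) (N n) (pt n c) (pt n d) (ext μ c) (ext μ d) κ (proj₁ (wall-gap W))
               (trans (cong (N n ℤ.*_) e) (ℤP.*-identityʳ (N n)))))
        fwd : ∀ K → N n ℤ.* + K ℤ.< ⟪ ptS a , rootVec r ⟫ → N n ℤ.* + K ℤ.< ⟪ ptS b , rootVec r ⟫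
        bwd : ∀ K → N n ℤ.* + K ℤ.< ℤ.- ⟪ ptS a , rootVec r ⟫ → N n ℤ.* + K ℤ.< ℤ.- ⟪ ptS b , rootVec r ⟫
        core : ∀ K {s t} → Valid n s t → N n ℤ.* + K ℤ.< ext (ptS a) t ℤ.- ext (ptS a) s → N n ℤ.* + K ℤ.< ext (ptS b) t ℤ.- ext (ptS b) s
        core K v h with valid-preimage ha v
        ... | s' , t' , v' , refl , refl = separates-valid μ St Z Z-odd sgn flo K v' (subst (N n ℤ.* + K ℤ.<_) (cong₂ ℤ._-_ (frame {a} {μ} ha f (vt v')) (frame {a} {μ} ha f (vs v'))) h)
        flip : ∀ (x : Vecℤ n) → ℤ.- ⟪ x , rootVec r ⟫ ≡ ext x (lo r) ℤ.- ext x (hi r)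
        flip x = trans (cong ℤ.-_ (⟪root⟫ x r)) (lia 2 (λ a b → ⊢ :- (a :- b) := b :- a) (ext x (hi r)) (ext x (lo r)))
        fwd K h = subst (N n ℤ.* + K ℤ.<_) (sym (⟪root⟫ (ptS b) r)) (core K (root-valid r) (subst (N n ℤ.* + K ℤ.<_) (⟪root⟫ (ptS a) r) h))
        bwd K h = subst (N n ℤ.* + K ℤ.<_) (sym (flip (ptS b))) (core K (valid-swap (root-valid r)) (subst (N n ℤ.* + K ℤ.<_) (flip (ptS a)) h))

open Minimality

-- Crossing an offending wall shortens the distance.

module Reflections where

  off-neg⇔ : ∀ {n z} (o : Off n z) → Iff (z ℤ.< + 0) (fl o ℤ.< + 0)
  off-neg⇔ {n} {z} o = (λ h → ℤP.≰⇒> λ q → ℤP.<-asym h (subst (ℤ._< z) (ℤP.*-zeroʳ (N n)) (off-below o (+ 0) q)))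
    , (λ h → ℤP.≰⇒> λ q → ℤP.<⇒≱ h (off-above o (+ 0) (subst (ℤ._< z) (sym (ℤP.*-zeroʳ (N n))) (ℤP.≤∧≢⇒< q (λ r → off-ne {n} (+ 0) o (trans (sym r) (sym (ℤP.*-zeroʳ (N n)))))))))

  off-N⇔ : ∀ {n z} (o : Off n z) → Iff (z ℤ.< N n) (fl o ℤ.< + 1)
  off-N⇔ {n} {z} o = (λ h → ℤP.≰⇒> λ q → ℤP.<-asym h (subst (ℤ._< z) (ℤP.*-identityʳ (N n)) (off-below o (+ 1) q)))
    , (λ h → ℤP.≰⇒> λ q → ℤP.<⇒≱ h (off-above o (+ 1) (subst (ℤ._< z) (sym (ℤP.*-identityʳ (N n))) (ℤP.≤∧≢⇒< q (λ r → off-ne {n} (+ 1) o (trans (sym r) (sym (ℤP.*-identityʳ (N n)))))))))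

  Iff-trans : ∀ {A B C D : Set} → Iff A B → Iff B C → Iff D C → Iff A D
  Iff-trans (a , b) (c , d) (f , g) = (λ x → g (c (a x))) , (λ x → b (d (f x)))

  -- The values of one root at an alcove and at its reflected copy. The two equivalences keep both
  -- in one Shi region, and `abs≤` controls the contribution of the root to the distance.
  record Closer (n : ℕ) (A B : ℤ) : Set where
    field
      oA : Off n A
      oB : Off n B
      abs≤ : ∣ fl oB ∣ ℕ.≤ ∣ fl oA ∣
      neg-iff : Iff (fl oA ℤ.< + 0) (fl oB ℤ.< + 0)
      one-iff : Iff (fl oA ℤ.< + 1) (fl oB ℤ.< + 1)

  closer-cong : ∀ {n A A' B B'} → A ≡ A' → B ≡ B' → Closer n A B → Closer n A' B'
  closer-cong refl refl c = c

  Strict : ∀ {n A B} → Closer n A B → Set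
  Strict c = ∣ fl (Closer.oB c) ∣ ℕ.< ∣ fl (Closer.oA c) ∣

  -- The affine reflection in a wall of A∘: linear part `σ` with inverse `τ`, translation `y`, and
  -- `P′` for the coordinates of the reflected base point. `others` expresses that two alcoves
  -- sharing a wall are separated by that wall alone; `Exceptional` lists the four index pairs that
  -- span its root up to sign.
  record Reflection {m : ℕ} (c d κ : ℤ) : Set where
    private n = suc (suc m)
    field
      σ τ : SP n
      σ-sp : SPerm σ
      τ-idx : ∀ i → SIdx n (τ i)
      στ : ∀ {t} → SIdx n t → ext σ (ext τ t) ≡ t
      y : Vecℤ n
      yQ : InQ y
    P′ : ℤ → ℤ
    P′ t = pt n (ext τ t) ℤ.+ N n ℤ.* ext y t
    Exceptional : ℤ → ℤ → Set
    Exceptional s t = (s ≡ c × t ≡ d) ⊎ (s ≡ ℤ.- d × t ≡ ℤ.- c) ⊎ (s ≡ d × t ≡ c) ⊎ (s ≡ ℤ.- c × t ≡ ℤ.- d)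
    field
      flipped : P′ d ℤ.- P′ c ℤ.+ N n ℤ.* κ ≡ ℤ.- (pt n d ℤ.- pt n c ℤ.+ N n ℤ.* κ)
      others : ∀ {s t} → Valid n s t → s ℤ.< t → Exceptional s t ⊎ ((+ 0 ℤ.< P′ t ℤ.- P′ s) × (P′ t ℤ.- P′ s ℤ.< N n))
    P′-odd : ∀ t → P′ (ℤ.- t) ≡ ℤ.- P′ t
    P′-odd t = lia 4 (λ p p' y y' → p' := :- p ⇒ y' := :- y ⇒ ⊢ p' :+ y' := :- (p :+ y)) (pt n (ext τ t)) (pt n (ext τ (ℤ.- t))) (N n ℤ.* ext y t) (N n ℤ.* ext y (ℤ.- t))
      (trans (cong (pt n) (ext-odd τ t)) (ext-odd (pS {n}) (ext τ t))) (trans (cong (N n ℤ.*_) (ext-odd y t)) (sym (ℤP.neg-distribʳ-* (N n) (ext y t))))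

  module _ {m : ℕ} where
    private n = suc (suc m)

    module _ {a : AffW n} {μ : Vecℤ n} (ia : IsAffW a) (f : Framed a μ) {c d κ : ℤ} (W : WallPair {m} c d κ) (ρ : Reflection {m} c d κ) where
      open Reflection ρ
      private
        w = lin a
        hw : SPerm w
        hw = sperm (proj₁ ia)
        D = drop {m} μ c d κ
        g = pt n d ℤ.- pt n c ℤ.+ N n ℤ.* κ

      reflected : AffW n
      reflected = aff (compSP w σ) (tr a +v actV w y)

      reflected-affine : IsAffW reflected
      reflected-affine = isSP (compSP-isSP hw σ-sp) , sumQ
        where
        sumQ : InQ (tr a +v actV w y)
        sumQ with proj₂ ia | InQ-actV hw {y} yQ
        ... | k , e | l , e' = k ℤ.+ l , trans (Σ-+ n (tr a) (actV w y)) (trans (cong₂ ℤ._+_ e e') (sym (ℤP.*-distribˡ-+ (+ 2) k l)))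

      Z-value : ∀ {t} → SIdx n t → ext (ptS reflected) (ext w t) ≡ P′ t ℤ.- N n ℤ.* ext μ t
      Z-value {t} st = begin
        ext (ptS reflected) (ext w t) ≡⟨ ext-ptS reflected (ext-sidx (sp-sidx hw) st) ⟩
        ext (actV (compSP w σ) pS) (ext w t) ℤ.+ N n ℤ.* ext (tr a +v actV w y) (ext w t) ≡⟨ cong₂ (λ u v → u ℤ.+ N n ℤ.* v) e₁ e₂ ⟩
        pt n (ext τ t) ℤ.+ N n ℤ.* (ℤ.- ext μ t ℤ.+ ext y t) ≡⟨ lia 4 (λ p N x y → ⊢ p :+ N :* (:- x :+ y) := p :+ N :* y :- N :* x) (pt n (ext τ t)) (N n) (ext μ t) (ext y t) ⟩
        P′ t ℤ.- N n ℤ.* ext μ t ∎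
        where
        open ≡-Reasoning
        sτ : SIdx n (ext τ t)
        sτ = ext-sidx τ-idx st
        e₁ : ext (actV (compSP w σ) pS) (ext w t) ≡ pt n (ext τ t)
        e₁ = trans (cong (ext (actV (compSP w σ) pS)) (trans (cong (ext w) (sym (στ st))) (sym (ext-comp w σ sτ)))) (ext-actV-ext (compSP-isSP hw σ-sp) pS sτ)
        e₂ : ext (tr a +v actV w y) (ext w t) ≡ ℤ.- ext μ t ℤ.+ ext y t
        e₂ = trans (ext-+ (tr a) (actV w y) (ext-sidx (sp-sidx hw) st)) (cong₂ ℤ._+_
          (trans (sym (ext-comp (tr a) w st)) (trans (ext-cong f st) (ext-negv μ st))) (ext-actV-ext hw y st))

      gap : ℤ → ℤ → ℤ × ℤ
      gap s t = (X μ t ℤ.- X μ s) , ((P′ t ℤ.- N n ℤ.* ext μ t) ℤ.- (P′ s ℤ.- N n ℤ.* ext μ s))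

      Close : ℤ → ℤ → Set
      Close s t = Closer n (proj₁ (gap s t)) (proj₂ (gap s t))

      gap-flip : ∀ s t → (proj₁ (gap (ℤ.- t) (ℤ.- s)) ≡ proj₁ (gap s t)) × (proj₂ (gap (ℤ.- t) (ℤ.- s)) ≡ proj₂ (gap s t))
      gap-flip s t = lia 4 (λ a b a' b' → a' := :- a ⇒ b' := :- b ⇒ ⊢ a' :- b' := b :- a) (X μ s) (X μ t) (X μ (ℤ.- s)) (X μ (ℤ.- t)) (X-odd μ s) (X-odd μ t)
        , lia 8 (λ a b a' b' x y x' y' → a' := :- a ⇒ b' := :- b ⇒ x' := :- x ⇒ y' := :- y ⇒ ⊢ (a' :- x') :- (b' :- y') := (b :- y) :- (a :- x)) (P′ s) (P′ t) (P′ (ℤ.- s)) (P′ (ℤ.- t))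
            (N n ℤ.* ext μ s) (N n ℤ.* ext μ t) (N n ℤ.* ext μ (ℤ.- s)) (N n ℤ.* ext μ (ℤ.- t)) (P′-odd s) (P′-odd t) (nm s) (nm t)
        where nm : ∀ s → N n ℤ.* ext μ (ℤ.- s) ≡ ℤ.- (N n ℤ.* ext μ s)
              nm s = trans (cong (N n ℤ.*_) (ext-odd μ s)) (sym (ℤP.neg-distribʳ-* (N n) (ext μ s)))

      g>0 = proj₁ (wall-gap W)
      g<N : g ℤ.< N n
      g<N = ℤP.≤-<-trans (proj₂ (wall-gap W)) (lia 1 (λ N → # 12 :≤ N ⇒ ⊢ # 8 :< N) (N n) (N≥12 {m}))

      gap-cd : (proj₁ (gap c d) ≡ g ℤ.+ N n ℤ.* D) × (proj₂ (gap c d) ≡ N n ℤ.- g ℤ.+ N n ℤ.* (D ℤ.- + 1))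
      gap-cd = lia 6 (λ p q N x y κ → ⊢ (q :- N :* y) :- (p :- N :* x) := (q :- p :+ N :* κ) :+ N :* (x :- y :- κ)) (pt n c) (pt n d) (N n) (ext μ c) (ext μ d) κ
        , lia 7 (λ p q N x y κ g → q :- p :+ N :* κ := :- g ⇒ ⊢ (q :- N :* y) :- (p :- N :* x) := N :- g :+ N :* (x :- y :- κ :- # 1)) (P′ c) (P′ d) (N n) (ext μ c) (ext μ d) κ g flipped

      -- The floor falls from D to D - 1, and D at least 2 keeps it on the same side of height one.
      close-up : + 2 ℤ.≤ D → Σ (Close c d) Strict
      close-up D≥2 = record { oA = off D g g>0 g<N (proj₁ gap-cd)
         ; oB = off (D ℤ.- + 1) (N n ℤ.- g) (lia 2 (λ N g → g :< N ⇒ ⊢ # 0 :< N :- g) (N n) g g<N) (lia 2 (λ N g → # 0 :< g ⇒ ⊢ N :- g :< N) (N n) g g>0) (proj₂ gap-cd)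
         ; abs≤ = ℕP.<⇒≤ st
         ; neg-iff = (λ h → ⊥-elim (lia 1 (λ D → # 2 :≤ D ⇒ D :< # 0 ⇒ ⊢ :⊥) D D≥2 h)) , (λ h → ⊥-elim (lia 1 (λ D → # 2 :≤ D ⇒ D :- # 1 :< # 0 ⇒ ⊢ :⊥) D D≥2 h))
         ; one-iff = (λ h → ⊥-elim (lia 1 (λ D → # 2 :≤ D ⇒ D :< # 1 ⇒ ⊢ :⊥) D D≥2 h)) , (λ h → ⊥-elim (lia 1 (λ D → # 2 :≤ D ⇒ D :- # 1 :< # 1 ⇒ ⊢ :⊥) D D≥2 h)) } , st
        where
        st : ∣ D ℤ.- + 1 ∣ ℕ.< ∣ D ∣
        st = ℤP.drop‿+<+ (subst₂ ℤ._<_ (sym (ℤP.0≤i⇒+∣i∣≡i (lia 1 (λ D → # 2 :≤ D ⇒ ⊢ # 0 :≤ D :- # 1) D D≥2))) (sym (ℤP.0≤i⇒+∣i∣≡i (lia 1 (λ D → # 2 :≤ D ⇒ ⊢ # 0 :≤ D) D D≥2)))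
             (lia 1 (λ D → ⊢ D :- # 1 :< D) D))

      -- For the opposite root the floor rises from -D - 1 to -D. Both are negative once D is
      -- positive, so neither height 0 nor height 1 is crossed.
      close-down : + 1 ℤ.≤ D → Σ (Close d c) Strict
      close-down D≥1 = record { oA = off (ℤ.- D ℤ.- + 1) (N n ℤ.- g) (lia 2 (λ N g → g :< N ⇒ ⊢ # 0 :< N :- g) (N n) g g<N) (lia 2 (λ N g → # 0 :< g ⇒ ⊢ N :- g :< N) (N n) g g>0)
                (trans (sw (X μ c) (X μ d)) (trans (cong ℤ.-_ (proj₁ gap-cd)) (lia 3 (λ N g D → ⊢ :- (g :+ N :* D) := N :- g :+ N :* (:- D :- # 1)) (N n) g D)))
         ; oB = off (ℤ.- D) g g>0 g<N (trans (sw (P′ c ℤ.- N n ℤ.* ext μ c) (P′ d ℤ.- N n ℤ.* ext μ d)) (trans (cong ℤ.-_ (proj₂ gap-cd)) (lia 3 (λ N g D → ⊢ :- (N :- g :+ N :* (D :- # 1)) := g :+ N :* (:- D)) (N n) g D)))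
         ; abs≤ = ℕP.<⇒≤ st
         ; neg-iff = (λ _ → lia 1 (λ D → # 1 :≤ D ⇒ ⊢ :- D :< # 0) D D≥1) , (λ _ → lia 1 (λ D → # 1 :≤ D ⇒ ⊢ :- D :- # 1 :< # 0) D D≥1)
         ; one-iff = (λ _ → lia 1 (λ D → # 1 :≤ D ⇒ ⊢ :- D :< # 1) D D≥1) , (λ _ → lia 1 (λ D → # 1 :≤ D ⇒ ⊢ :- D :- # 1 :< # 1) D D≥1) } , st
        where
        sw : ∀ a b → a ℤ.- b ≡ ℤ.- (b ℤ.- a)
        sw = lia 2 (λ a b → ⊢ a :- b := :- (b :- a))
        st : ∣ ℤ.- D ∣ ℕ.< ∣ ℤ.- D ℤ.- + 1 ∣
        st = subst₂ ℕ._<_ (sym (ℤP.∣-i∣≡∣i∣ D)) (trans (sym (ℤP.∣-i∣≡∣i∣ (D ℤ.+ + 1))) (cong ∣_∣ (lia 1 (λ D → ⊢ :- (D :+ # 1) := :- D :- # 1) D)))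
          (ℤP.drop‿+<+ (subst₂ ℤ._<_ (sym (ℤP.0≤i⇒+∣i∣≡i (lia 1 (λ D → # 1 :≤ D ⇒ ⊢ # 0 :≤ D) D D≥1))) (sym (ℤP.0≤i⇒+∣i∣≡i (lia 1 (λ D → # 1 :≤ D ⇒ ⊢ # 0 :≤ D :+ # 1) D D≥1)))
             (lia 1 (λ D → ⊢ D :< D :+ # 1) D)))

      same-fl : ∀ {s t} (k q q' : ℤ) → + 0 ℤ.< q → q ℤ.< N n → + 0 ℤ.< q' → q' ℤ.< N n → proj₁ (gap s t) ≡ q ℤ.+ N n ℤ.* k → proj₂ (gap s t) ≡ q' ℤ.+ N n ℤ.* k → Close s t
      same-fl k q q' a b a' b' e e' = record { oA = off k q a b e ; oB = off k q' a' b' e' ; abs≤ = ℕP.≤-refl ; neg-iff = id , id ; one-iff = id , id }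

      close-other : ∀ {s t} → Valid n s t → s ℤ.< t → (+ 0 ℤ.< P′ t ℤ.- P′ s) × (P′ t ℤ.- P′ s ℤ.< N n) → Close s t × Close t s
      close-other {s} {t} v s<t (h₀ , h₁) =
          same-fl {s} {t} (ext μ s ℤ.- ext μ t) (pt n t ℤ.- pt n s) (P′ t ℤ.- P′ s) d₀ d₁ h₀ h₁
            (lia 5 (λ p q N x y → ⊢ (q :- N :* y) :- (p :- N :* x) := q :- p :+ N :* (x :- y)) (pt n s) (pt n t) (N n) (ext μ s) (ext μ t))
            (lia 5 (λ p q N x y → ⊢ (q :- N :* y) :- (p :- N :* x) := q :- p :+ N :* (x :- y)) (P′ s) (P′ t) (N n) (ext μ s) (ext μ t))
        , same-fl {t} {s} (ext μ t ℤ.- ext μ s ℤ.- + 1) (N n ℤ.- (pt n t ℤ.- pt n s)) (N n ℤ.- (P′ t ℤ.- P′ s)) (sub₀ d₁) (sub₁ d₀) (sub₀ h₁) (sub₁ h₀)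
            (lia 5 (λ p q N x y → ⊢ (p :- N :* x) :- (q :- N :* y) := N :- (q :- p) :+ N :* (y :- x :- # 1)) (pt n s) (pt n t) (N n) (ext μ s) (ext μ t))
            (lia 5 (λ p q N x y → ⊢ (p :- N :* x) :- (q :- N :* y) := N :- (q :- p) :+ N :* (y :- x :- # 1)) (P′ s) (P′ t) (N n) (ext μ s) (ext μ t))
        where
        d₀ = lia 2 (λ p q → p :< q ⇒ ⊢ # 0 :< q :- p) (pt n s) (pt n t) (pt-mono (vs v) (vt v) s<t)
        d₁ = lia 3 (λ p q N → # 2 :* q :< N ⇒ :- N :< # 2 :* p ⇒ ⊢ q :- p :< N) (pt n s) (pt n t) (N n) (proj₁ (pt-bound (vt v))) (proj₂ (pt-bound (vs v)))
        sub₀ : ∀ {x} → x ℤ.< N n → + 0 ℤ.< N n ℤ.- x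
        sub₀ {x} h = lia 2 (λ N x → x :< N ⇒ ⊢ # 0 :< N :- x) (N n) x h
        sub₁ : ∀ {x} → + 0 ℤ.< x → N n ℤ.- x ℤ.< N n
        sub₁ {x} h = lia 2 (λ N x → # 0 :< x ⇒ ⊢ N :- x :< N) (N n) x h

      module _ (bad : pt n (ext w d) ℤ.- pt n (ext w c) ℤ.+ N n ℤ.* (+ 1 ℤ.- D) ℤ.≤ + 0) where
        private
          cd = wall-valid W
          wcd = valid-ext hw cd

        D≥1 : + 1 ℤ.≤ D
        D≥1 = lia 1 (λ D → # 1 :- D :< # 1 ⇒ ⊢ # 1 :≤ D) D (N-cancel< n {+ 1 ℤ.- D} {+ 1} (lia 4 (λ p q N D → q :- p :+ N :* (# 1 :- D) :≤ # 0 ⇒ :- N :< # 2 :* q ⇒ # 2 :* p :< N ⇒ ⊢ N :* (# 1 :- D) :< N :* # 1)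
               (pt n (ext w c)) (pt n (ext w d)) (N n) D bad (proj₂ (pt-bound (vt wcd))) (proj₁ (pt-bound (vs wcd)))))

        -- If the image root is positive, the base values contribute a positive amount to the left
        -- side of `bad`, which the multiple of N has to outweigh.
        D≥2 : ext w c ℤ.< ext w d → + 2 ℤ.≤ D
        D≥2 h = lia 1 (λ D → # 1 :- D :< # 0 ⇒ ⊢ # 2 :≤ D) D (N-cancel< n {+ 1 ℤ.- D} {+ 0} (lia 4 (λ p q N D → q :- p :+ N :* (# 1 :- D) :≤ # 0 ⇒ p :< q ⇒ ⊢ N :* (# 1 :- D) :< N :* # 0)
               (pt n (ext w c)) (pt n (ext w d)) (N n) D bad (pt-mono (vs wcd) (vt wcd) h)))

        flip< : ∀ {s t} → ext w (ℤ.- t) ℤ.< ext w (ℤ.- s) → ext w s ℤ.< ext w t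
        flip< {s} {t} h = lia 4 (λ a b a' b' → a' := :- a ⇒ b' := :- b ⇒ b' :< a' ⇒ ⊢ a :< b) (ext w s) (ext w t) (ext w (ℤ.- s)) (ext w (ℤ.- t)) (ext-odd w s) (ext-odd w t) h

        close-exc : ∀ {s t} → Exceptional s t → ext w s ℤ.< ext w t → Close s t
        close-exc (inj₁ (refl , refl)) h = proj₁ (close-up (D≥2 h))
        close-exc (inj₂ (inj₁ (refl , refl))) h = closer-cong (sym (proj₁ (gap-flip c d))) (sym (proj₂ (gap-flip c d))) (proj₁ (close-up (D≥2 (flip< {c} {d} h))))
        close-exc (inj₂ (inj₂ (inj₁ (refl , refl)))) h = proj₁ (close-down D≥1)
        close-exc (inj₂ (inj₂ (inj₂ (refl , refl)))) h = closer-cong (sym (proj₁ (gap-flip d c))) (sym (proj₂ (gap-flip d c))) (proj₁ (close-down D≥1))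

        exc-swap : ∀ {s t} → Exceptional s t → Exceptional t s
        exc-swap (inj₁ (p , q)) = inj₂ (inj₂ (inj₁ (q , p)))
        exc-swap (inj₂ (inj₁ (p , q))) = inj₂ (inj₂ (inj₂ (q , p)))
        exc-swap (inj₂ (inj₂ (inj₁ (p , q)))) = inj₁ (q , p)
        exc-swap (inj₂ (inj₂ (inj₂ (p , q)))) = inj₂ (inj₁ (q , p))

        close : ∀ {s t} → Valid n s t → ext w s ℤ.< ext w t → Close s t
        close v h with valid-cases v
        ... | inj₁ s<t with others v s<t
        ...   | inj₁ e = close-exc e h
        ...   | inj₂ q = proj₁ (close-other v s<t q)
        close v h | inj₂ t<s with others (valid-swap v) t<s
        ...   | inj₁ e = close-exc (exc-swap e) h
        ...   | inj₂ q = proj₂ (close-other (valid-swap v) t<s q)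

        pairing : ∀ {s t} → Valid n s t → (proj₁ (gap s t) ≡ ext (ptS a) (ext w t) ℤ.- ext (ptS a) (ext w s)) × (proj₂ (gap s t) ≡ ext (ptS reflected) (ext w t) ℤ.- ext (ptS reflected) (ext w s))
        pairing v = sym (cong₂ ℤ._-_ (frame {a = a} {μ} hw f (vt v)) (frame {a = a} {μ} hw f (vs v))) , sym (cong₂ ℤ._-_ (Z-value (vt v)) (Z-value (vs v)))

        close-root : ∀ r → Closer n ⟪ ptS a , rootVec r ⟫ ⟪ ptS reflected , rootVec r ⟫
        close-root r = go (valid-preimage hw (root-valid r))
          where
          go : (∃ λ s → ∃ λ t → Valid n s t × ext w s ≡ lo r × ext w t ≡ hi r) → Closer n ⟪ ptS a , rootVec r ⟫ ⟪ ptS reflected , rootVec r ⟫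
          go (s , t , v , e , e') = closer-cong (eq (ptS a) (proj₁ (pairing v))) (eq (ptS reflected) (proj₂ (pairing v))) (close v (subst₂ ℤ._<_ (sym e) (sym e') (lo<hi r)))
            where
            eq : ∀ {z} (x : Vecℤ n) → z ≡ ext x (ext w t) ℤ.- ext x (ext w s) → z ≡ ⟪ x , rootVec r ⟫
            eq x q = trans q (trans (cong₂ (λ u v → ext x u ℤ.- ext x v) e' e) (sym (⟪root⟫ x r)))

        strict-root : ∃ λ r → ∣ flr n ⟪ ptS reflected , rootVec r ⟫ ∣ ℕ.< ∣ flr n ⟪ ptS a , rootVec r ⟫ ∣
        strict-root = go (valid-cases wcd)
          where
          fin : ∀ {s t} → Valid n s t → (cl : Σ (Close s t) Strict) → (ρ : RootOf n (ext w s) (ext w t)) → ∣ flr n ⟪ ptS reflected , rootVec (root ρ) ⟫ ∣ ℕ.< ∣ flr n ⟪ ptS a , rootVec (root ρ) ⟫ ∣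
          fin v (cl , st) ρ = subst₂ (λ u v → ∣ u ∣ ℕ.< ∣ v ∣)
            (trans (sym (flr≡ (Closer.oB cl))) (cong (flr n) (trans (proj₂ (pairing v)) (sym (root-pairing ρ (ptS reflected))))))
            (trans (sym (flr≡ (Closer.oA cl))) (cong (flr n) (trans (proj₁ (pairing v)) (sym (root-pairing ρ (ptS a)))))) st
          go : (ext w c ℤ.< ext w d) ⊎ (ext w d ℤ.< ext w c) → _
          go (inj₁ h) = root (rootOf wcd h) , fin cd (close-up (D≥2 h)) (rootOf wcd h)
          go (inj₂ h) = root (rootOf (valid-swap wcd) h) , fin (valid-swap cd) (close-down D≥1) (rootOf (valid-swap wcd) h)

        -- Multiplication on the right by the reflection changes the floor of a single root, that of
        -- the wall, and brings it one step closer to zero; the hypothesis `bad` ensures that this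
        -- step stays inside the region.
        not-minimal : ShiMin a → ⊥
        not-minimal (_ , min) = ℕP.<⇒≱ (sumℕ-strict _ _ (posRoots n) le′ (posRoots-complete (proj₁ strict-root)) (proj₂ strict-root)) (min reflected reflected-affine same)
          where
          le′ : ∀ r → ∣ flr n ⟪ ptS reflected , rootVec r ⟫ ∣ ℕ.≤ ∣ flr n ⟪ ptS a , rootVec r ⟫ ∣
          le′ r = subst₂ (λ u v → ∣ u ∣ ℕ.≤ ∣ v ∣) (sym (flr≡ (Closer.oB (close-root r)))) (sym (flr≡ (Closer.oA (close-root r)))) (Closer.abs≤ (close-root r))
          same : SameShiRegion a reflected
          same r = Iff-trans (off-neg⇔ (Closer.oA (close-root r))) (Closer.neg-iff (close-root r)) (off-neg⇔ (Closer.oB (close-root r)))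
                 , Iff-trans (off-N⇔ (Closer.oA (close-root r))) (Closer.one-iff (close-root r)) (off-N⇔ (Closer.oB (close-root r)))

open Reflections using (Reflection; not-minimal)

-- The reflections in the walls of A∘, and the converse for minimal alcoves.

module Descent where

  ext-zero : ∀ {n t} → SIdx n t → ext {n} (λ _ → + 0) t ≡ + 0
  ext-zero (ps i) = ext-pos (λ _ → + 0) i
  ext-zero zr = refl
  ext-zero (ng i) = ext-neg (λ _ → + 0) i

  involution : ∀ {n} {σ τ : SP n} → (∀ i → ext σ (τ i) ≡ pos i) → ∀ {t} → SIdx n t → ext σ (ext τ t) ≡ t
  involution {σ = σ} {τ} h st = trans (sym (ext-comp σ τ st)) (trans (ext-cong h st) (ext-id st))

  -- u is the image of t under the transposition of c and c + 1, extended to negative indices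
  data Swap (c t u : ℤ) : Set where
    vd  : t ≡ c ℤ.+ + 1 → u ≡ c → Swap c t u
    vc  : t ≡ c → u ≡ c ℤ.+ + 1 → Swap c t u
    vd⁻ : t ≡ ℤ.- (c ℤ.+ + 1) → u ≡ ℤ.- c → Swap c t u
    vc⁻ : t ≡ ℤ.- c → u ≡ ℤ.- (c ℤ.+ + 1) → Swap c t u
    ve  : t ≢ c → t ≢ c ℤ.+ + 1 → t ≢ ℤ.- c → t ≢ ℤ.- (c ℤ.+ + 1) → u ≡ t → Swap c t u

  swap-neg : ∀ {c t u} → Swap c t u → Swap c (ℤ.- t) (ℤ.- u)
  swap-neg (vd refl refl) = vd⁻ refl refl
  swap-neg (vc refl refl) = vc⁻ refl refl
  swap-neg (vd⁻ refl refl) = vd (ℤP.neg-involutive _) (ℤP.neg-involutive _)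
  swap-neg (vc⁻ refl refl) = vc (ℤP.neg-involutive _) (ℤP.neg-involutive _)
  swap-neg {c} (ve a b a' b' refl) = ve (λ q → a' (trans (sym (ℤP.neg-involutive _)) (cong ℤ.-_ q))) (λ q → b' (trans (sym (ℤP.neg-involutive _)) (cong ℤ.-_ q)))
     (a ∘ ℤP.neg-injective) (b ∘ ℤP.neg-injective) refl

  -- Transposing two neighbours reverses only their own pair and its mirror. The bound on c keeps
  -- -(c + 1), -c, c, c + 1 distinct and in this order; opposite indices, which may also change
  -- places, are excluded as they span no root.
  swap-mono : ∀ {c s t u v} → + 1 ℤ.≤ c → Swap c s u → Swap c t v → s ℤ.< t → s ≢ ℤ.- t →
    ((s ≡ c × t ≡ c ℤ.+ + 1) ⊎ (s ≡ ℤ.- (c ℤ.+ + 1) × t ≡ ℤ.- c)) ⊎ (u ℤ.< v)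
  swap-mono {c} p (vd refl refl) (vd refl refl) h n = ⊥-elim (ℤP.<-irrefl refl h)
  swap-mono {c} p (vd refl refl) (vc refl refl) h n = ⊥-elim (lia 1 (λ c → c :+ # 1 :< c ⇒ ⊢ :⊥) c h)
  swap-mono {c} p (vd refl refl) (vd⁻ refl refl) h n = ⊥-elim (lia 1 (λ c → # 1 :≤ c ⇒ c :+ # 1 :< :- (c :+ # 1) ⇒ ⊢ :⊥) c p h)
  swap-mono {c} p (vd refl refl) (vc⁻ refl refl) h n = ⊥-elim (lia 1 (λ c → # 1 :≤ c ⇒ c :+ # 1 :< :- c ⇒ ⊢ :⊥) c p h)
  swap-mono {c} p (vd refl refl) (ve _ _ _ _ refl) h n = inj₂ (lia 2 (λ c t → c :+ # 1 :< t ⇒ ⊢ c :< t) c _ h)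
  swap-mono {c} p (vc refl refl) (vd refl refl) h n = inj₁ (inj₁ (refl , refl))
  swap-mono {c} p (vc refl refl) (vc refl refl) h n = ⊥-elim (ℤP.<-irrefl refl h)
  swap-mono {c} p (vc refl refl) (vd⁻ refl refl) h n = ⊥-elim (lia 1 (λ c → # 1 :≤ c ⇒ c :< :- (c :+ # 1) ⇒ ⊢ :⊥) c p h)
  swap-mono {c} p (vc refl refl) (vc⁻ refl refl) h n = ⊥-elim (lia 1 (λ c → # 1 :≤ c ⇒ c :< :- c ⇒ ⊢ :⊥) c p h)
  swap-mono {c} p (vc refl refl) (ve _ q _ _ refl) h n = inj₂ (ℤP.≤∧≢⇒< (lia 2 (λ c t → c :< t ⇒ ⊢ c :+ # 1 :≤ t) c _ h) (q ∘ sym))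
  swap-mono {c} p (vd⁻ refl refl) (vd refl refl) h n = ⊥-elim (n refl)
  swap-mono {c} p (vd⁻ refl refl) (vc refl refl) h n = inj₂ (lia 1 (λ c → # 1 :≤ c ⇒ ⊢ :- c :< c :+ # 1) c p)
  swap-mono {c} p (vd⁻ refl refl) (vd⁻ refl refl) h n = ⊥-elim (ℤP.<-irrefl refl h)
  swap-mono {c} p (vd⁻ refl refl) (vc⁻ refl refl) h n = inj₁ (inj₂ (refl , refl))
  swap-mono {c} p (vd⁻ refl refl) (ve _ _ q _ refl) h n = inj₂ (ℤP.≤∧≢⇒< (lia 2 (λ c t → :- (c :+ # 1) :< t ⇒ ⊢ :- c :≤ t) c _ h) (q ∘ sym))
  swap-mono {c} p (vc⁻ refl refl) (vd refl refl) h n = inj₂ (lia 1 (λ c → # 1 :≤ c ⇒ ⊢ :- (c :+ # 1) :< c) c p)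
  swap-mono {c} p (vc⁻ refl refl) (vc refl refl) h n = ⊥-elim (n refl)
  swap-mono {c} p (vc⁻ refl refl) (vd⁻ refl refl) h n = ⊥-elim (lia 1 (λ c → :- c :< :- (c :+ # 1) ⇒ ⊢ :⊥) c h)
  swap-mono {c} p (vc⁻ refl refl) (vc⁻ refl refl) h n = ⊥-elim (ℤP.<-irrefl refl h)
  swap-mono {c} p (vc⁻ refl refl) (ve _ _ _ _ refl) h n = inj₂ (lia 2 (λ c t → :- c :< t ⇒ ⊢ :- (c :+ # 1) :< t) c _ h)
  swap-mono {c} p (ve q _ _ _ refl) (vd refl refl) h n = inj₂ (ℤP.≤∧≢⇒< (lia 2 (λ c t → t :< c :+ # 1 ⇒ ⊢ t :≤ c) c _ h) q)
  swap-mono {c} p (ve _ _ _ _ refl) (vc refl refl) h n = inj₂ (lia 2 (λ c t → t :< c ⇒ ⊢ t :< c :+ # 1) c _ h)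
  swap-mono {c} p (ve _ _ _ _ refl) (vd⁻ refl refl) h n = inj₂ (lia 2 (λ c t → t :< :- (c :+ # 1) ⇒ ⊢ t :< :- c) c _ h)
  swap-mono {c} p (ve _ _ _ q refl) (vc⁻ refl refl) h n = inj₂ (ℤP.≤∧≢⇒< (lia 2 (λ c t → t :< :- c ⇒ ⊢ t :≤ :- (c :+ # 1)) c _ h) q)
  swap-mono p (ve _ _ _ _ refl) (ve _ _ _ _ refl) h n = inj₂ h

  module _ {m : ℕ} where
    private n = suc (suc m)

    P′-bounds : ∀ {u v} {y z : ℤ} → SIdx n u → SIdx n v → u ℤ.< v → y ≡ + 0 → z ≡ + 0 →
      (+ 0 ℤ.< (pt n v ℤ.+ N n ℤ.* z) ℤ.- (pt n u ℤ.+ N n ℤ.* y)) × ((pt n v ℤ.+ N n ℤ.* z) ℤ.- (pt n u ℤ.+ N n ℤ.* y) ℤ.< N n)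
    P′-bounds {u} {v} su sv h refl refl = lia 3 (λ p q N → p :< q ⇒ ⊢ # 0 :< (q :+ N :* # 0) :- (p :+ N :* # 0)) (pt n u) (pt n v) (N n) (pt-mono su sv h)
      , lia 3 (λ p q N → # 2 :* q :< N ⇒ :- N :< # 2 :* p ⇒ ⊢ (q :+ N :* # 0) :- (p :+ N :* # 0) :< N) (pt n u) (pt n v) (N n) (proj₁ (pt-bound sv)) (proj₂ (pt-bound su))

    module SimpleRefl (j : Fin (suc m)) where
      A B : Fin n
      A = inject₁ j
      B = fs j
      c = + suc (toℕ j)
      σ τ : SP n
      σ i = pos (transpose A B i)
      τ i = pos (transpose B A i)
      A≡ : pos A ≡ c
      A≡ = cong (λ z → + suc z) (FP.toℕ-inject₁ j)
      B≡ : pos B ≡ c ℤ.+ + 1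
      B≡ = lia 1 (λ j → ⊢ # 2 :+ j := # 1 :+ j :+ # 1) (+ toℕ j)
      view-pos : ∀ i → Swap c (pos i) (τ i)
      view-pos i with i FP.≟ B
      ... | yes refl = vd B≡ A≡
      ... | no q with i FP.≟ A
      ...   | yes refl = vc A≡ B≡
      ...   | no r = ve (λ e → r (pos-inj (trans e (sym A≡)))) (λ e → q (pos-inj (trans e (sym B≡)))) (λ ()) ne refl
        where ne : pos i ≢ ℤ.- (c ℤ.+ + 1)
              ne e = lia 2 (λ i j → # 1 :+ i := :- (# 1 :+ j :+ # 1) ⇒ # 0 :≤ i ⇒ # 0 :≤ j ⇒ ⊢ :⊥) (+ toℕ i) (+ toℕ j) e (0≤ _) (0≤ _)
      view : ∀ {t} → SIdx n t → Swap c t (ext τ t)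
      view (ps i) = subst (Swap c (pos i)) (sym (ext-pos τ i)) (view-pos i)
      view zr = ve (λ ()) (λ ()) (λ ()) (λ ()) refl
      view (ng i) = subst (Swap c (neg i)) (sym (ext-neg τ i)) (swap-neg (view-pos i))
      σ-sp : SPerm σ
      σ-sp = sperm ((λ i → s≤s z≤n , FP.toℕ<n _) , λ i k q → trans (sym (transpose-inverse B A)) (trans (cong (transpose B A) (FP.toℕ-injective (ℕP.suc-injective q))) (transpose-inverse B A)))
      sc : SIdx n c
      sc = subst (SIdx n) A≡ (ps A)
      sd : SIdx n (c ℤ.+ + 1)
      sd = subst (SIdx n) B≡ (ps B)
      τd : ext τ (c ℤ.+ + 1) ≡ c
      τd with view sd
      ... | vd _ e = e
      ... | vc e _ = ⊥-elim (lia 1 (λ c → c :+ # 1 := c ⇒ ⊢ :⊥) c e)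
      ... | vd⁻ () _
      ... | vc⁻ () _
      ... | ve _ q _ _ _ = ⊥-elim (q refl)
      τc : ext τ c ≡ c ℤ.+ + 1
      τc with view sc
      ... | vd e _ = ⊥-elim (lia 1 (λ c → c := c :+ # 1 ⇒ ⊢ :⊥) c e)
      ... | vc _ e = e
      ... | vd⁻ () _
      ... | vc⁻ () _
      ... | ve q _ _ _ _ = ⊥-elim (q refl)

      reflection : Reflection {m} c (c ℤ.+ + 1) (+ 0)
      reflection = record { σ = σ ; τ = τ ; σ-sp = σ-sp ; τ-idx = λ i → ps _
        ; στ = involution (λ i → trans (ext-pos σ (transpose B A i)) (cong pos (transpose-inverse A B)))
        ; y = λ _ → + 0 ; yQ = + 0 , Σ-zero n _ (λ _ → refl)
        ; flipped = trans (cong₂ (λ u v → pt n u ℤ.+ N n ℤ.* ext {n} (λ _ → + 0) (c ℤ.+ + 1) ℤ.- (pt n v ℤ.+ N n ℤ.* ext {n} (λ _ → + 0) c) ℤ.+ N n ℤ.* + 0) τd τc)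
            (trans (cong₂ (λ u v → pt n c ℤ.+ N n ℤ.* u ℤ.- (pt n (c ℤ.+ + 1) ℤ.+ N n ℤ.* v) ℤ.+ N n ℤ.* + 0) (ext-zero sd) (ext-zero sc))
              (lia 3 (λ p q N → ⊢ p :+ N :* # 0 :- (q :+ N :* # 0) :+ N :* # 0 := :- (q :- p :+ N :* # 0)) (pt n c) (pt n (c ℤ.+ + 1)) (N n)))
        ; others = oth }
        where
        oth : ∀ {s t} → Valid n s t → s ℤ.< t → _
        oth v h with swap-mono (+≤+ (s≤s z≤n)) (view (vs v)) (view (vt v)) h (s≢-t v)
        ... | inj₁ (inj₁ e) = inj₁ (inj₁ e)
        ... | inj₁ (inj₂ e) = inj₁ (inj₂ (inj₁ e))
        ... | inj₂ l = inj₂ (P′-bounds (ext-sidx (λ i → ps _) (vs v)) (ext-sidx (λ i → ps _) (vt v)) l (ext-zero (vs v)) (ext-zero (vt v)))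

    module ShortRefl where
      σ : SP n
      σ fz = neg {n} fz
      σ (fs i) = pos {n} (fs i)

      data Flip (t u : ℤ) : Set where
        f⁺ : t ≡ + 1 → u ≡ -[1+ 0 ] → Flip t u
        f⁻ : t ≡ -[1+ 0 ] → u ≡ + 1 → Flip t u
        fe : t ≢ + 1 → t ≢ -[1+ 0 ] → u ≡ t → Flip t u
      view : ∀ {t} → SIdx n t → Flip t (ext σ t)
      view (ps fz) = f⁺ refl (ext-pos σ fz)
      view (ps (fs i)) = fe (λ ()) (λ ()) (ext-pos σ (fs i))
      view zr = fe (λ ()) (λ ()) refl
      view (ng fz) = f⁻ refl (ext-neg σ fz)
      view (ng (fs i)) = fe (λ ()) (λ ()) (ext-neg σ (fs i))
      flip-mono : ∀ {s t u v} → Flip s u → Flip t v → s ℤ.< t → s ≢ ℤ.- t → ((s ≡ + 0 × t ≡ + 1) ⊎ (s ≡ -[1+ 0 ] × t ≡ + 0)) ⊎ (u ℤ.< v)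
      flip-mono (f⁺ refl refl) (f⁺ refl refl) h n = ⊥-elim (ℤP.<-irrefl refl h)
      flip-mono (f⁺ refl refl) (f⁻ refl refl) () n
      flip-mono (f⁺ refl refl) (fe _ _ refl) h n = inj₂ (lia 1 (λ t → # 1 :< t ⇒ ⊢ con -[1+ 0 ] :< t) _ h)
      flip-mono (f⁻ refl refl) (f⁺ refl refl) h n = ⊥-elim (n refl)
      flip-mono (f⁻ refl refl) (f⁻ refl refl) h n = ⊥-elim (ℤP.<-irrefl refl h)
      flip-mono {t = t} (f⁻ refl refl) (fe a b refl) h n with t ℤP.≟ + 0
      ... | yes q = inj₁ (inj₂ (refl , q))
      ... | no q = inj₂ (ℤP.≤∧≢⇒< (lia 1 (λ t → # 0 :< t ⇒ ⊢ # 1 :≤ t) t (ℤP.≤∧≢⇒< (lia 1 (λ t → con -[1+ 0 ] :< t ⇒ ⊢ # 0 :≤ t) t h) (q ∘ sym))) (a ∘ sym))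
      flip-mono {s = s} (fe a b refl) (f⁺ refl refl) h n with s ℤP.≟ + 0
      ... | yes q = inj₁ (inj₁ (q , refl))
      ... | no q = inj₂ (ℤP.≤∧≢⇒< (lia 1 (λ t → t :< # 0 ⇒ ⊢ t :≤ con -[1+ 0 ]) s (ℤP.≤∧≢⇒< (lia 1 (λ t → t :< # 1 ⇒ ⊢ t :≤ # 0) s h) q)) b)
      flip-mono (fe a b refl) (f⁻ refl refl) h n = inj₂ (lia 1 (λ t → t :< con -[1+ 0 ] ⇒ ⊢ t :< # 1) _ h)
      flip-mono (fe a b refl) (fe _ _ refl) h n = inj₂ h
      σ-idx : ∀ i → SIdx n (σ i)
      σ-idx fz = ng fz
      σ-idx (fs i) = ps (fs i)
      σ-abs : ∀ i → ∣ σ i ∣ ≡ suc (toℕ i)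
      σ-abs fz = refl
      σ-abs (fs i) = refl
      σ-sp : SPerm σ
      σ-sp = sperm ((λ i → subst (1 ℕ.≤_) (sym (σ-abs i)) (s≤s z≤n) , subst (ℕ._≤ n) (sym (σ-abs i)) (FP.toℕ<n i)) , λ i j q → FP.toℕ-injective (ℕP.suc-injective (trans (sym (σ-abs i)) (trans q (σ-abs j)))))
      σσ : ∀ i → ext σ (σ i) ≡ pos i
      σσ fz = ext-neg σ fz
      σσ (fs i) = ext-pos σ (fs i)
      reflection : Reflection {m} (+ 0) (+ 1) (+ 0)
      reflection = record { σ = σ ; τ = σ ; σ-sp = σ-sp ; τ-idx = σ-idx ; στ = involution σσ
        ; y = λ _ → + 0 ; yQ = + 0 , Σ-zero n _ (λ _ → refl)
        ; flipped = trans (cong₂ (λ u v → pt n u ℤ.+ N n ℤ.* v ℤ.- (pt n (+ 0) ℤ.+ N n ℤ.* + 0) ℤ.+ N n ℤ.* + 0) (ext-pos σ fz) (ext-zero {n} (ps fz)))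
            (lia 4 (λ p q z N → q := :- p ⇒ z := # 0 ⇒ ⊢ q :+ N :* # 0 :- (z :+ N :* # 0) :+ N :* # 0 := :- (p :- z :+ N :* # 0)) (pt n (+ 1)) (pt n -[1+ 0 ]) (pt n (+ 0)) (N n) refl refl)
        ; others = oth }
        where
        oth : ∀ {s t} → Valid n s t → s ℤ.< t → _
        oth v h with flip-mono (view (vs v)) (view (vt v)) h (s≢-t v)
        ... | inj₁ (inj₁ e) = inj₁ (inj₁ e)
        ... | inj₁ (inj₂ e) = inj₁ (inj₂ (inj₁ e))
        ... | inj₂ l = inj₂ (P′-bounds (ext-sidx σ-idx (vs v)) (ext-sidx σ-idx (vt v)) l (ext-zero (vs v)) (ext-zero (vt v)))

    module HighRefl where
      A B : Fin n
      A = inject₁ (fromℕ m)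
      B = fs (fromℕ m)
      A≡ : pos A ≡ + suc m
      A≡ = cong (λ z → + suc z) (trans (FP.toℕ-inject₁ (fromℕ m)) (FP.toℕ-fromℕ m))
      B≡ : pos B ≡ + n
      B≡ = cong (λ z → + suc (suc z)) (FP.toℕ-fromℕ m)
      -- The linear reflection in the highest root exchanges eₙ₋₁ with -eₙ; followed by the
      -- translation `y` by that root it fixes the hyperplane at height one.
      σ : SP n
      σ i with i FP.≟ A
      ... | yes _ = neg B
      ... | no _ with i FP.≟ B
      ...   | yes _ = neg A
      ...   | no _ = pos i
      y : Vecℤ n
      y = highest n
      A≢B : A ≢ B
      A≢B q = ℕP.1+n≢n (sym (ℤP.+-injective (trans (sym A≡) (trans (cong pos q) B≡))))
      yA : y A ≡ + 1
      yA = subst₂ (λ u v → Defs.e {n} u A ℤ.+ Defs.e {n} v A ≡ + 1) A≡ B≡ (cong₂ ℤ._+_ (e-pos-same A) (e-pos-diff B A (A≢B ∘ sym)))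
      yB : y B ≡ + 1
      yB = subst₂ (λ u v → Defs.e {n} u B ℤ.+ Defs.e {n} v B ≡ + 1) A≡ B≡ (cong₂ ℤ._+_ (e-pos-diff A B A≢B) (e-pos-same B))
      yE : ∀ i → i ≢ A → i ≢ B → y i ≡ + 0
      yE i a b = subst₂ (λ u v → Defs.e {n} u i ℤ.+ Defs.e {n} v i ≡ + 0) A≡ B≡ (cong₂ ℤ._+_ (e-pos-diff A i (a ∘ sym)) (e-pos-diff B i (b ∘ sym)))
      Σy : Σf n y ≡ + 2 ℤ.* + 1
      Σy = trans (Σ-+ n (Defs.e (+ suc m)) (Defs.e (+ n))) (subst₂ (λ u v → Σf n (Defs.e u) ℤ.+ Σf n (Defs.e v) ≡ + 2) A≡ B≡
         (cong₂ ℤ._+_ (trans (Σ-δ n _ A (λ j q → e-pos-diff A j (q ∘ sym))) (e-pos-same A)) (trans (Σ-δ n _ B (λ j q → e-pos-diff B j (q ∘ sym))) (e-pos-same B))))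
      M = + m
      data High (t u z : ℤ) : Set where
        hA : t ≡ + suc m → u ≡ -[1+ suc m ] → z ≡ + 1 → High t u z
        hB : t ≡ + n → u ≡ -[1+ m ] → z ≡ + 1 → High t u z
        hA⁻ : t ≡ -[1+ m ] → u ≡ + n → z ≡ -[1+ 0 ] → High t u z
        hB⁻ : t ≡ -[1+ suc m ] → u ≡ + suc m → z ≡ -[1+ 0 ] → High t u z
        he : t ℤ.< + suc m → -[1+ m ] ℤ.< t → u ≡ t → z ≡ + 0 → High t u z
      high-neg : ∀ {t u z} → High t u z → High (ℤ.- t) (ℤ.- u) (ℤ.- z)
      high-neg (hA refl refl refl) = hA⁻ refl refl refl
      high-neg (hB refl refl refl) = hB⁻ refl refl refl
      high-neg (hA⁻ refl refl refl) = hA refl refl refl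
      high-neg (hB⁻ refl refl refl) = hB refl refl refl
      high-neg {t} (he a b refl refl) = he (lia 2 (λ m t → :- (# 1 :+ m) :< t ⇒ ⊢ :- t :< # 1 :+ m) M t b) (lia 2 (λ m t → t :< # 1 :+ m ⇒ ⊢ :- (# 1 :+ m) :< :- t) M t a) refl refl
      view-pos : ∀ i → High (pos i) (σ i) (y i)
      view-pos i with i FP.≟ A
      ... | yes refl = hA A≡ (cong ℤ.-_ B≡) yA
      ... | no q with i FP.≟ B
      ...   | yes refl = hB B≡ (cong ℤ.-_ A≡) yB
      ...   | no r = he (ℤP.≤∧≢⇒< (lia 2 (λ m i → # 1 :+ i :< # 2 :+ m ⇒ ⊢ # 1 :+ i :≤ # 1 :+ m) M (+ toℕ i) (ℤP.≤∧≢⇒< (+≤+ (FP.toℕ<n i)) (λ e → r (pos-inj (trans e (sym B≡)))))) (λ e → q (pos-inj (trans e (sym A≡))))) -<+ refl (yE i q r)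
      view : ∀ {t} → SIdx n t → High t (ext σ t) (ext y t)
      view (ps i) = subst₂ (High (pos i)) (sym (ext-pos σ i)) (sym (ext-pos y i)) (view-pos i)
      view zr = he (+<+ (s≤s z≤n)) -<+ refl refl
      view (ng i) = subst₂ (High (neg i)) (sym (ext-neg σ i)) (sym (ext-neg y i)) (high-neg (view-pos i))
      σA : σ A ≡ neg B
      σA with A FP.≟ A
      ... | yes _ = refl
      ... | no q = ⊥-elim (q refl)
      σB : σ B ≡ neg A
      σB with B FP.≟ A
      ... | yes q = ⊥-elim (A≢B (sym q))
      ... | no _ with B FP.≟ B
      ...   | yes _ = refl
      ...   | no q = ⊥-elim (q refl)
      σE : ∀ i → i ≢ A → i ≢ B → σ i ≡ pos i
      σE i a b with i FP.≟ A
      ... | yes q = ⊥-elim (a q)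
      ... | no _ with i FP.≟ B
      ...   | yes q = ⊥-elim (b q)
      ...   | no _ = refl
      σσ : ∀ i → ext σ (σ i) ≡ pos i
      σσ i = go (i FP.≟ A) (i FP.≟ B)
        where
        go : Dec (i ≡ A) → Dec (i ≡ B) → ext σ (σ i) ≡ pos i
        go (yes refl) _ = trans (cong (ext σ) σA) (trans (ext-neg σ B) (cong ℤ.-_ σB))
        go (no q) (yes refl) = trans (cong (ext σ) σB) (trans (ext-neg σ A) (cong ℤ.-_ σA))
        go (no q) (no r) = trans (cong (ext σ) (σE i q r)) (trans (ext-pos σ i) (σE i q r))
      σ-idx : ∀ i → SIdx n (σ i)
      σ-idx i with i FP.≟ A
      ... | yes _ = ng B
      ... | no _ with i FP.≟ B
      ...   | yes _ = ng A
      ...   | no _ = ps i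
      σ-nz : ∀ i → 1 ℕ.≤ ∣ σ i ∣
      σ-nz i with i FP.≟ A
      ... | yes _ = s≤s z≤n
      ... | no _ with i FP.≟ B
      ...   | yes _ = s≤s z≤n
      ...   | no _ = s≤s z≤n
      σ-sp : SPerm σ
      σ-sp = sperm ((λ i → σ-nz i , sidx-bound (σ-idx i)) , inj)
        where
        inj : ∀ i j → ∣ σ i ∣ ≡ ∣ σ j ∣ → i ≡ j
        inj i j q with abs-cases (σ i) q
        ... | inj₁ r = inj' (abs-cases (σ j) {∣ σ j ∣} refl)
          where
          inj' : (σ j ≡ + ∣ σ j ∣) ⊎ (σ j ≡ ℤ.- (+ ∣ σ j ∣)) → i ≡ j
          inj' (inj₁ s) = pos-inj (trans (sym (σσ i)) (trans (cong (ext σ) (trans r (sym s))) (σσ j)))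
          inj' (inj₂ s) = ⊥-elim (pos≢neg (trans (sym (σσ i)) (trans (cong (ext σ) (trans r (trans (sym (ℤP.neg-involutive _)) (cong ℤ.-_ (sym s))))) (trans (ext-odd σ (σ j)) (cong ℤ.-_ (σσ j))))))
            where pos≢neg : pos i ≢ neg j
                  pos≢neg ()
        ... | inj₂ r = inj' (abs-cases (σ j) {∣ σ j ∣} refl)
          where
          inj' : (σ j ≡ + ∣ σ j ∣) ⊎ (σ j ≡ ℤ.- (+ ∣ σ j ∣)) → i ≡ j
          inj' (inj₂ s) = pos-inj (trans (sym (σσ i)) (trans (cong (ext σ) (trans r (sym s))) (σσ j)))
          inj' (inj₁ s) = ⊥-elim (pos≢neg (trans (sym (σσ i)) (trans (cong (ext σ) (trans r (cong ℤ.-_ (sym s)))) (trans (ext-odd σ (σ j)) (cong ℤ.-_ (σσ j))))))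
            where pos≢neg : pos i ≢ neg j
                  pos≢neg ()

      P : ℤ → ℤ
      P t = pt n (ext σ t) ℤ.+ N n ℤ.* ext y t
      Nn : N n ≡ + 4 ℤ.+ + 4 ℤ.* (+ 2 ℤ.+ M)
      Nn = N-def n
      pn : pt n (+ n) ≡ + 2 ℤ.* (+ 2 ℤ.+ M) ℤ.- + 1
      pn = pt-n
      pn-1 : pt n (+ suc m) ≡ + 2 ℤ.* (+ 1 ℤ.+ M) ℤ.- + 1
      pn-1 = pt-n-1
      -- The reflected base point has the coordinates N - (2n - 1) = 9 + 2m and N - (2n - 3) = 11 +
      -- 2m at n - 1 and n. The remaining ones are those of p and stay within 2m in absolute value,
      -- a bound that also holds for m = 0.
      data Value (t v : ℤ) : Set where
        wA : t ≡ + suc m → v ≡ + 9 ℤ.+ + 2 ℤ.* M → Value t v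
        wB : t ≡ + n → v ≡ + 11 ℤ.+ + 2 ℤ.* M → Value t v
        wA⁻ : t ≡ -[1+ m ] → v ≡ ℤ.- (+ 9 ℤ.+ + 2 ℤ.* M) → Value t v
        wB⁻ : t ≡ -[1+ suc m ] → v ≡ ℤ.- (+ 11 ℤ.+ + 2 ℤ.* M) → Value t v
        we : t ℤ.< + suc m → -[1+ m ] ℤ.< t → v ≡ pt n t → v ℤ.≤ + 2 ℤ.* M → ℤ.- (+ 2 ℤ.* M) ℤ.≤ v → Value t v
      value : ∀ {t} → SIdx n t → Value t (P t)
      value {t} st with view st
      ... | hA e e' z = wA e (trans (cong₂ (λ u v → pt n u ℤ.+ N n ℤ.* v) e' z) (lia 4 (λ p p' N m → p := # 2 :* (# 2 :+ m) :- # 1 ⇒ p' := :- p ⇒ N := # 4 :+ # 4 :* (# 2 :+ m) ⇒ ⊢ p' :+ N :* # 1 := # 9 :+ # 2 :* m) (pt n (+ n)) (pt n -[1+ suc m ]) (N n) M pn (ext-odd (pS {n}) (+ n)) Nn))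
      ... | hB e e' z = wB e (trans (cong₂ (λ u v → pt n u ℤ.+ N n ℤ.* v) e' z) (lia 4 (λ p p' N m → p := # 2 :* (# 1 :+ m) :- # 1 ⇒ p' := :- p ⇒ N := # 4 :+ # 4 :* (# 2 :+ m) ⇒ ⊢ p' :+ N :* # 1 := # 11 :+ # 2 :* m) (pt n (+ suc m)) (pt n -[1+ m ]) (N n) M pn-1 (ext-odd (pS {n}) (+ suc m)) Nn))
      ... | hA⁻ e e' z = wA⁻ e (trans (cong₂ (λ u v → pt n u ℤ.+ N n ℤ.* v) e' z) (lia 3 (λ p N m → p := # 2 :* (# 2 :+ m) :- # 1 ⇒ N := # 4 :+ # 4 :* (# 2 :+ m) ⇒ ⊢ p :+ N :* con -[1+ 0 ] := :- (# 9 :+ # 2 :* m)) (pt n (+ n)) (N n) M pn Nn))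
      ... | hB⁻ e e' z = wB⁻ e (trans (cong₂ (λ u v → pt n u ℤ.+ N n ℤ.* v) e' z) (lia 3 (λ p N m → p := # 2 :* (# 1 :+ m) :- # 1 ⇒ N := # 4 :+ # 4 :* (# 2 :+ m) ⇒ ⊢ p :+ N :* con -[1+ 0 ] := :- (# 11 :+ # 2 :* m)) (pt n (+ suc m)) (N n) M pn-1 Nn))
      ... | he a b e' z = we a b e'' (subst (ℤ._≤ + 2 ℤ.* M) (sym e'') (up≤ (ptView st))) (subst (ℤ.- (+ 2 ℤ.* M) ℤ.≤_) (sym e'') (lo≤ (ptView st)))
        where
        e'' : P t ≡ pt n t
        e'' = trans (cong₂ (λ u v → pt n u ℤ.+ N n ℤ.* v) e' z) (lia 2 (λ p N → ⊢ p :+ N :* # 0 := p) (pt n t) (N n))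
        up≤ : PtView n t → pt n t ℤ.≤ + 2 ℤ.* M
        up≤ (isPos _ _ q) = lia 3 (λ p t m → p := # 2 :* t :- # 1 ⇒ t :< # 1 :+ m ⇒ ⊢ p :≤ # 2 :* m) (pt n t) t M q a
        up≤ (isZero _ q) = lia 2 (λ p m → p := # 0 ⇒ # 0 :≤ m ⇒ ⊢ p :≤ # 2 :* m) (pt n t) M q (0≤ m)
        up≤ (isNeg h _ q) = lia 3 (λ p t m → p := # 2 :* t :+ # 1 ⇒ t :≤ con -[1+ 0 ] ⇒ # 0 :≤ m ⇒ ⊢ p :≤ # 2 :* m) (pt n t) t M q h (0≤ m)
        lo≤ : PtView n t → ℤ.- (+ 2 ℤ.* M) ℤ.≤ pt n t
        lo≤ (isPos h _ q) = lia 3 (λ p t m → p := # 2 :* t :- # 1 ⇒ # 1 :≤ t ⇒ # 0 :≤ m ⇒ ⊢ :- (# 2 :* m) :≤ p) (pt n t) t M q h (0≤ m)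
        lo≤ (isZero _ q) = lia 2 (λ p m → p := # 0 ⇒ # 0 :≤ m ⇒ ⊢ :- (# 2 :* m) :≤ p) (pt n t) M q (0≤ m)
        lo≤ (isNeg _ _ q) = lia 3 (λ p t m → p := # 2 :* t :+ # 1 ⇒ :- (# 1 :+ m) :< t ⇒ ⊢ :- (# 2 :* m) :≤ p) (pt n t) t M q b

      Exc : ℤ → ℤ → Set
      Exc s t = (s ≡ -[1+ suc m ] × t ≡ + suc m) ⊎ (s ≡ -[1+ m ] × t ≡ + n)
      Between : ℤ → ℤ → Set
      Between x y = (+ 0 ℤ.< y ℤ.- x) × (y ℤ.- x ℤ.< N n)
      compare : ∀ {s t x y} → Valid n s t → s ℤ.< t → Value s x → Value t y → Exc s t ⊎ Between x y
      compare v h (wA refl refl) (wB refl refl) = inj₂ (lia 1 (λ m → ⊢ # 0 :< # 11 :+ # 2 :* m :- (# 9 :+ # 2 :* m)) M , lia 2 (λ m N → N := # 4 :+ # 4 :* (# 2 :+ m) ⇒ # 0 :≤ m ⇒ ⊢ # 11 :+ # 2 :* m :- (# 9 :+ # 2 :* m) :< N) M (N n) Nn (0≤ m))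
      compare v h (wA refl _) (wA refl _) = ⊥-elim (ℤP.<-irrefl refl h)
      compare v () (wA refl _) (wA⁻ refl _)
      compare v () (wA refl _) (wB⁻ refl _)
      compare v h (wA refl _) (we a _ _ _ _) = ⊥-elim (ℤP.<-asym h a)
      compare v h (wB refl _) (wA refl _) = ⊥-elim (lia 1 (λ m → # 2 :+ m :< # 1 :+ m ⇒ ⊢ :⊥) M h)
      compare v h (wB refl _) (wB refl _) = ⊥-elim (ℤP.<-irrefl refl h)
      compare v () (wB refl _) (wA⁻ refl _)
      compare v () (wB refl _) (wB⁻ refl _)
      compare {t = t} v h (wB refl _) (we a _ _ _ _) = ⊥-elim (lia 2 (λ m t → # 2 :+ m :< t ⇒ t :< # 1 :+ m ⇒ ⊢ :⊥) M t h a)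
      compare v h (wA⁻ refl _) (wA refl _) = ⊥-elim (s≢-t v refl)
      compare v h (wA⁻ refl _) (wB refl _) = inj₁ (inj₂ (refl , refl))
      compare v h (wA⁻ refl _) (wA⁻ refl _) = ⊥-elim (ℤP.<-irrefl refl h)
      compare v h (wA⁻ refl _) (wB⁻ refl _) = ⊥-elim (lia 1 (λ m → :- (# 1 :+ m) :< :- (# 2 :+ m) ⇒ ⊢ :⊥) M h)
      compare {y = y} v h (wA⁻ refl refl) (we _ _ _ a b) = inj₂ (lia 2 (λ m y → :- (# 2 :* m) :≤ y ⇒ ⊢ # 0 :< y :- (:- (# 9 :+ # 2 :* m))) M y b , lia 3 (λ m N y → N := # 4 :+ # 4 :* (# 2 :+ m) ⇒ y :≤ # 2 :* m ⇒ ⊢ y :- (:- (# 9 :+ # 2 :* m)) :< N) M (N n) y Nn a)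
      compare v h (wB⁻ refl _) (wA refl _) = inj₁ (inj₁ (refl , refl))
      compare v h (wB⁻ refl _) (wB refl _) = ⊥-elim (s≢-t v refl)
      compare v h (wB⁻ refl refl) (wA⁻ refl refl) = inj₂ (lia 1 (λ m → ⊢ # 0 :< (:- (# 9 :+ # 2 :* m)) :- (:- (# 11 :+ # 2 :* m))) M , lia 2 (λ m N → N := # 4 :+ # 4 :* (# 2 :+ m) ⇒ # 0 :≤ m ⇒ ⊢ (:- (# 9 :+ # 2 :* m)) :- (:- (# 11 :+ # 2 :* m)) :< N) M (N n) Nn (0≤ m))
      compare v h (wB⁻ refl _) (wB⁻ refl _) = ⊥-elim (ℤP.<-irrefl refl h)
      compare {y = y} v h (wB⁻ refl refl) (we _ _ _ a b) = inj₂ (lia 2 (λ m y → :- (# 2 :* m) :≤ y ⇒ ⊢ # 0 :< y :- (:- (# 11 :+ # 2 :* m))) M y b , lia 3 (λ m N y → N := # 4 :+ # 4 :* (# 2 :+ m) ⇒ y :≤ # 2 :* m ⇒ ⊢ y :- (:- (# 11 :+ # 2 :* m)) :< N) M (N n) y Nn a)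
      compare {x = x} v h (we _ _ _ a b) (wA refl refl) = inj₂ (lia 2 (λ m x → x :≤ # 2 :* m ⇒ ⊢ # 0 :< # 9 :+ # 2 :* m :- x) M x a , lia 3 (λ m N x → N := # 4 :+ # 4 :* (# 2 :+ m) ⇒ :- (# 2 :* m) :≤ x ⇒ ⊢ # 9 :+ # 2 :* m :- x :< N) M (N n) x Nn b)
      compare {x = x} v h (we _ _ _ a b) (wB refl refl) = inj₂ (lia 2 (λ m x → x :≤ # 2 :* m ⇒ ⊢ # 0 :< # 11 :+ # 2 :* m :- x) M x a , lia 3 (λ m N x → N := # 4 :+ # 4 :* (# 2 :+ m) ⇒ :- (# 2 :* m) :≤ x ⇒ ⊢ # 11 :+ # 2 :* m :- x :< N) M (N n) x Nn b)
      compare v h (we _ a _ _ _) (wA⁻ refl _) = ⊥-elim (ℤP.<-asym h a)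
      compare {s} v h (we _ a _ _ _) (wB⁻ refl _) = ⊥-elim (lia 2 (λ m s → s :< :- (# 2 :+ m) ⇒ :- (# 1 :+ m) :< s ⇒ ⊢ :⊥) M s h a)
      compare {s} {t} v h (we _ _ refl _ _) (we _ _ refl _ _) = inj₂ (lia 2 (λ p q → p :< q ⇒ ⊢ # 0 :< q :- p) (pt n s) (pt n t) (pt-mono (vs v) (vt v) h)
         , lia 3 (λ p q N → # 2 :* q :< N ⇒ :- N :< # 2 :* p ⇒ ⊢ q :- p :< N) (pt n s) (pt n t) (N n) (proj₁ (pt-bound (vt v))) (proj₂ (pt-bound (vs v))))

      P-n-1 : P (+ suc m) ≡ + 9 ℤ.+ + 2 ℤ.* M
      P-n-1 with value in-n-1
      ... | wA _ e = e
      ... | wB q _ = ⊥-elim (ℕP.1+n≢n (sym (ℤP.+-injective q)))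
      ... | wA⁻ () _
      ... | wB⁻ () _
      ... | we a _ _ _ _ = ⊥-elim (ℤP.<-irrefl refl a)
      P--n : P -[1+ suc m ] ≡ ℤ.- (+ 11 ℤ.+ + 2 ℤ.* M)
      P--n with value (sidx-neg in-n)
      ... | wA () _
      ... | wB () _
      ... | wA⁻ q _ = ⊥-elim (ℕP.1+n≢n (ℤP.-[1+-injective q))
      ... | wB⁻ _ e = e
      ... | we _ a _ _ _ = ⊥-elim (lia 1 (λ m → :- (# 1 :+ m) :< :- (# 2 :+ m) ⇒ ⊢ :⊥) M a)

      reflection : Reflection {m} (+ suc m) -[1+ suc m ] (+ 1)
      reflection = record { σ = σ ; τ = σ ; σ-sp = σ-sp ; τ-idx = σ-idx ; στ = involution σσ
        ; y = y ; yQ = + 1 , Σy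
        ; flipped = lia 7 (λ a b p q q' N m → a := # 9 :+ # 2 :* m ⇒ b := :- (# 11 :+ # 2 :* m) ⇒ p := # 2 :* (# 1 :+ m) :- # 1 ⇒ q := # 2 :* (# 2 :+ m) :- # 1 ⇒ q' := :- q ⇒ N := # 4 :+ # 4 :* (# 2 :+ m) ⇒ ⊢ b :- a :+ N :* # 1 := :- (q' :- p :+ N :* # 1))
            (P (+ suc m)) (P -[1+ suc m ]) (pt n (+ suc m)) (pt n (+ n)) (pt n -[1+ suc m ]) (N n) M P-n-1 P--n pn-1 pn (ext-odd (pS {n}) (+ n)) Nn
        ; others = oth }
        where
        oth : ∀ {s t} → Valid n s t → s ℤ.< t → _
        oth v h with compare v h (value (vs v)) (value (vt v))
        ... | inj₁ (inj₁ e) = inj₁ (inj₂ (inj₂ (inj₁ e)))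
        ... | inj₁ (inj₂ e) = inj₁ (inj₂ (inj₂ (inj₂ e)))
        ... | inj₂ l = inj₂ l

    -- Contraposition, wall by wall: a violated inequality of the dilated alcove is the hypothesis
    -- `bad` of `not-minimal` for the reflection in the corresponding wall.
    ShiMin⇒low : ∀ {a μ} → Framed {m} a μ → ShiMin a → Low (lin a) μ
    ShiMin⇒low {a} {μ} f S@(ia , _) = alcove-walls simple high
      where
      w = lin a
      R = simplexPt w μ
      hw : SPerm w
      hw = sperm (proj₁ ia)
      step : ∀ c → (sc : SIdx n c) (sd : SIdx n (c ℤ.+ + 1)) → Reflection {m} c (c ℤ.+ + 1) (+ 0) → + 0 ℤ.< ext R (c ℤ.+ + 1) ℤ.- ext R c
      step c sc sd ρ = ℤP.≰⇒> λ q → not-minimal ia f (up sc sd) ρ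
        (lia 8 (λ c u v p q N x y → v :- u :≤ # 0 ⇒ u := p :+ N :* (x :+ c) ⇒ v := q :+ N :* (y :+ (c :+ # 1)) ⇒ ⊢ q :- p :+ N :* (# 1 :- (x :- y :- # 0)) :≤ # 0)
          c (ext R c) (ext R (c ℤ.+ + 1)) (pt n (ext w c)) (pt n (ext w (c ℤ.+ + 1))) (N n) (ext μ c) (ext μ (c ℤ.+ + 1)) q (ext-simplexPt w μ sc) (ext-simplexPt w μ sd)) S
      refl-at : ∀ k → Reflection {m} (+ toℕ k) (+ toℕ k ℤ.+ + 1) (+ 0)
      refl-at fz = ShortRefl.reflection
      refl-at (fs j) = SimpleRefl.reflection j
      simple : ∀ k → + 0 ℤ.< ⟪ R , simpleRoot k ⟫
      simple k = subst (+ 0 ℤ.<_) (trans (cong (λ z → ext R z ℤ.- ext R (+ toℕ k)) eq) (sym (⟪simple⟫ R k))) (step (+ toℕ k) (sidx (+ toℕ k) (ℕP.<⇒≤ (FP.toℕ<n k))) (subst (SIdx n) (sym eq) (ps k)) (refl-at k))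
        where eq : + toℕ k ℤ.+ + 1 ≡ pos k
              eq = ℤP.+-comm (+ toℕ k) (+ 1)
      high : ⟪ R , highest n ⟫ ℤ.< bigM {m}
      high = subst (ℤ._< bigM {m}) (sym (⟪highest⟫ R)) (ℤP.≰⇒> λ h → not-minimal ia f fork₁ HighRefl.reflection
        (lia 9 (λ m u v p q q' N x y → N :* (# 1 :+ # 2 :* (# 2 :+ m)) :≤ u :+ v ⇒ u := p :+ N :* (x :+ (# 1 :+ m)) ⇒ v := q :+ N :* (y :+ (# 2 :+ m)) ⇒ q' := :- q ⇒ ⊢ q' :- p :+ N :* (# 1 :- (x :- (:- y) :- # 1)) :≤ # 0)
          (+ m) (ext R (+ suc m)) (ext R (+ n)) (pt n (ext w (+ suc m))) (pt n (ext w (+ n))) (pt n (ext w -[1+ suc m ])) (N n) (ext μ (+ suc m)) (ext μ (+ n))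
          h (ext-simplexPt w μ in-n-1) (ext-simplexPt w μ in-n) (trans (cong (pt n) (ext-odd w (+ n))) (ext-odd (pS {n}) (ext w (+ n))))) S)

open Descent using (ShiMin⇒low)

-- The area vector of a vertically labelled path is low.

module Representative where

  -- The recursions behind piList and rises are local to their where blocks; unification recovers them as goPi and goRise.
  mutual
    goPi : ℕ → Word → List ℕ
    goPi = _

    goPi-eq : ∀ w → goPi 0 w ≡ piList w
    goPi-eq w with 0
    ... | c = refl

  mutual
    goRise : ℕ → Word → List ℕ
    goRise = _

    goRise-eq : ∀ w → goRise 0 w ≡ rises w
    goRise-eq w with 0
    ... | c = refl

  goPi-≥ : ∀ c w k → suc k ℕ.≤ countN w → c ℕ.≤ nthℕ (goPi c w) (suc k)
  goPi-≥ c (Nl ∷ w) zero h = ℕP.≤-refl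
  goPi-≥ c (Nl ∷ w) (suc k) (s≤s h) = goPi-≥ c w k h
  goPi-≥ c (El ∷ w) k h = ℕP.≤-trans (ℕP.n≤1+n c) (goPi-≥ (suc c) w k h)

  goPi-step : ∀ c w k → suc (suc k) ℕ.≤ countN w → nthℕ (goPi c w) (suc k) ℕ.≤ nthℕ (goPi c w) (suc (suc k))
  goPi-step c (Nl ∷ w) zero (s≤s h) = goPi-≥ c w 0 h
  goPi-step c (Nl ∷ w) (suc k) (s≤s h) = goPi-step c w k h
  goPi-step c (El ∷ w) k h = goPi-step (suc c) w k h

  goPi-≤ : ∀ c w k → nthℕ (goPi c w) k ℕ.≤ c ℕ.+ countE w
  goPi-≤ c [] k = z≤n
  goPi-≤ c (Nl ∷ w) zero = z≤n
  goPi-≤ c (Nl ∷ w) (suc zero) = ℕP.m≤m+n c _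
  goPi-≤ c (Nl ∷ w) (suc (suc k)) = goPi-≤ c w (suc k)
  goPi-≤ c (El ∷ w) k = subst (nthℕ (goPi (suc c) w) k ℕ.≤_) (sym (ℕP.+-suc c (countE w))) (goPi-≤ (suc c) w k)

  -- An E between the two N's would raise the later count by `goPi-≥`, so equal counts force the N's
  -- to be consecutive.
  goRise-∈ : ∀ c j w k → suc (suc k) ℕ.≤ countN w → nthℕ (goPi c w) (suc k) ≡ nthℕ (goPi c w) (suc (suc k)) → (j ℕ.+ suc k) ∈ goRise j w
  goRise-∈ c j (El ∷ w) k h e = goRise-∈ (suc c) j w k h e
  goRise-∈ c j (Nl ∷ Nl ∷ w) zero h e = here (ℕP.+-comm j 1)
  goRise-∈ c j (Nl ∷ Nl ∷ w) (suc k) (s≤s h) e = there (subst (_∈ goRise (suc j) (Nl ∷ w)) (sym (ℕP.+-suc j (suc k))) (goRise-∈ c (suc j) (Nl ∷ w) k h e))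
  goRise-∈ c j (Nl ∷ El ∷ w) zero (s≤s h) e = ⊥-elim (ℕP.1+n≰n (subst (suc c ℕ.≤_) (sym e) (goPi-≥ (suc c) w 0 h)))
  goRise-∈ c j (Nl ∷ El ∷ w) (suc k) (s≤s h) e = subst (_∈ goRise (suc j) w) (sym (ℕP.+-suc j (suc k))) (goRise-∈ c (suc j) (El ∷ w) k h e)
  goRise-∈ c j (Nl ∷ []) zero (s≤s ()) e
  goRise-∈ c j (Nl ∷ []) (suc k) (s≤s ()) e

  piAt-first : ∀ w → 1 ℕ.≤ countN w → piAt w 1 ≡ 0 → ∃ λ w' → w ≡ Nl ∷ w'
  piAt-first (Nl ∷ w) h e = w , refl
  piAt-first (El ∷ w) h e = ⊥-elim (ℕP.1+n≰n (subst (1 ℕ.≤_) e (goPi-≥ 1 w 0 h)))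

  even-true : ∀ m → evenℕ m ≡ true → Even (+ m)
  even-true m h with m ℕ.% 2 in e
  ... | zero = + (m ℕ./ 2) , trans (cong +_ (trans (ℕD.m≡m%n+[m/n]*n m 2) (cong (ℕ._+ (m ℕ./ 2 ℕ.* 2)) e))) (trans (ℤP.pos-* (m ℕ./ 2) 2) (ℤP.*-comm (+ (m ℕ./ 2)) (+ 2)))
  even-true m () | suc _

  even-false : ∀ m → evenℕ m ≡ false → Even (+ m ℤ.- + 1)
  even-false m h with m ℕ.% 2 in e | ℕD.m%n<n m 2
  ... | suc zero | _ = + (m ℕ./ 2) , lia 2 (λ m q → m := # 1 :+ q ⇒ ⊢ m :- # 1 := q) (+ m) (+ 2 ℤ.* + (m ℕ./ 2)) (trans (cong +_ (trans (ℕD.m≡m%n+[m/n]*n m 2) (cong (ℕ._+ (m ℕ./ 2 ℕ.* 2)) e)))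
        (cong (λ z → + 1 ℤ.+ z) (trans (ℤP.pos-* (m ℕ./ 2) 2) (ℤP.*-comm (+ (m ℕ./ 2)) (+ 2)))))
  ... | suc (suc _) | s≤s (s≤s ())

  even-abs : ∀ z → Even (+ ∣ z ∣) → Even z
  even-abs (+ k) h = h
  even-abs -[1+ k ] (q , p) = ℤ.- q , lia 2 (λ k q → # 1 :+ k := # 2 :* q ⇒ ⊢ :- (# 1 :+ k) := # 2 :* (:- q)) (+ k) q p

  even-abs-odd : ∀ z → Even (+ ∣ z ∣ ℤ.- + 1) → Even (z ℤ.- + 1)
  even-abs-odd (+ k) h = h
  even-abs-odd -[1+ k ] (q , p) = ℤ.- q ℤ.- + 1 , lia 2 (λ k q → # 1 :+ k :- # 1 := # 2 :* q ⇒ ⊢ :- (# 1 :+ k) :- # 1 := # 2 :* (:- q :- # 1)) (+ k) q p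

  not-both : ∀ {z} → Even z → Even (z ℤ.- + 1) → ⊥
  not-both {z} (k , p) (l , q) = odd-not-even {0} (k ℤ.- l) (lia 3 (λ z k l → z := # 2 :* k ⇒ z :- # 1 := # 2 :* l ⇒ ⊢ # 1 := # 2 :* (k :- l)) z k l p q)

  evenℕ-abs-true : ∀ z → Even z → evenℕ ∣ z ∣ ≡ true
  evenℕ-abs-true z h with evenℕ ∣ z ∣ in e
  ... | true = refl
  ... | false = ⊥-elim (not-both h (even-abs-odd z (even-false ∣ z ∣ e)))

  evenℕ-abs-false : ∀ z → Even (z ℤ.- + 1) → evenℕ ∣ z ∣ ≡ false
  evenℕ-abs-false z h with evenℕ ∣ z ∣ in e
  ... | false = refl
  ... | true = ⊥-elim (not-both (even-abs z (even-true ∣ z ∣ e)) h)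

  Σ-snoc : ∀ n (f : Fin (suc n) → ℤ) → Σf (suc n) f ≡ Σf n (f ∘ inject₁) ℤ.+ f (fromℕ n)
  Σ-snoc zero f = trans (Σ-suc 0 f) (ℤP.+-comm (f fz) (+ 0))
  Σ-snoc (suc n) f = trans (Σ-suc (suc n) f) (trans (cong (ℤ._+_ (f fz)) (Σ-snoc n (f ∘ fs)))
    (trans (sym (ℤP.+-assoc (f fz) _ _)) (cong (ℤ._+ f (fromℕ (suc n))) (sym (Σ-suc n (f ∘ inject₁))))))

  Σ-upTo : ∀ n (g : ℕ → ℕ) → Σf n (λ i → + g (toℕ i)) ≡ + sumℕ (map g (upTo n))
  Σ-upTo n g = trans (go n g) (cong (λ l → + sumℕ l) (sym (LP.map-upTo g n)))
    where
    go : ∀ n (g : ℕ → ℕ) → Σf n (λ i → + g (toℕ i)) ≡ + sumℕ (applyUpTo g n)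
    go zero g = refl
    go (suc n) g = trans (Σ-suc n (λ i → + g (toℕ i))) (cong (ℤ._+_ (+ g 0)) (go n (g ∘ suc)))

  Σ-pos : ∀ n → + 2 ℤ.* Σf n pos ≡ + n ℤ.* (+ 1 ℤ.+ + n)
  Σ-pos zero = refl
  Σ-pos (suc n) = lia 4 (λ n s t p → t := s :+ p ⇒ p := # 1 :+ n ⇒ # 2 :* s := n :* (# 1 :+ n) ⇒ ⊢ # 2 :* t := (# 1 :+ n) :* (# 1 :+ (# 1 :+ n))) (+ n) (Σf n pos) (Σf (suc n) pos) (pos (fromℕ n))
    (trans (Σ-snoc n pos) (cong (ℤ._+ pos (fromℕ n)) (Σ-cong n (λ i → cong (λ z → + suc z) (FP.toℕ-inject₁ i))))) (cong (λ z → + suc z) (FP.toℕ-fromℕ n)) (Σ-pos n)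

  -- whether 1 + 2 + ⋯ + n is even, decided from n mod 4
  data Mod4 (n : ℕ) : Set where
    even4 : (n ℕ.% 4 ≡ 0) ⊎ (n ℕ.% 4 ≡ 3) → Even (Σf n pos) → Mod4 n
    odd4  : n ℕ.% 4 ≢ 0 → n ℕ.% 4 ≢ 3 → Even (Σf n pos ℤ.- + 1) → Mod4 n

  Σ-pos-mod4 : ∀ n r → n ℕ.% 4 ≡ r → + 2 ℤ.* Σf n pos ≡ (+ r ℤ.+ + (n ℕ./ 4) ℤ.* + 4) ℤ.* (+ 1 ℤ.+ (+ r ℤ.+ + (n ℕ./ 4) ℤ.* + 4))
  Σ-pos-mod4 n r h = trans (Σ-pos n) (cong (λ z → z ℤ.* (+ 1 ℤ.+ z))
    (trans (cong +_ (trans (ℕD.m≡m%n+[m/n]*n n 4) (cong (ℕ._+ (n ℕ./ 4 ℕ.* 4)) h))) (cong (ℤ._+_ (+ r)) (ℤP.pos-* (n ℕ./ 4) 4))))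

  mod4 : ∀ n → Mod4 n
  mod4 n = go (n ℕ.% 4) refl (ℕD.m%n<n n 4)
    where
    k = + (n ℕ./ 4)
    go : ∀ r → n ℕ.% 4 ≡ r → r ℕ.< 4 → Mod4 n
    go 0 h _ = even4 (inj₁ h) (k ℤ.* (+ 4 ℤ.* k ℤ.+ + 1) , lia 2 (λ s k → # 2 :* s := (# 0 :+ k :* # 4) :* (# 1 :+ (# 0 :+ k :* # 4)) ⇒ ⊢ s := # 2 :* (k :* (# 4 :* k :+ # 1))) (Σf n pos) k (Σ-pos-mod4 n 0 h))
    go 1 h _ = odd4 (λ r → ℕP.1+n≢0 (trans (sym h) r)) (λ r → ℕP.1+n≢0 (sym (ℕP.suc-injective (trans (sym h) r)))) (+ 4 ℤ.* k ℤ.* k ℤ.+ + 3 ℤ.* k , lia 2 (λ s k → # 2 :* s := (# 1 :+ k :* # 4) :* (# 1 :+ (# 1 :+ k :* # 4)) ⇒ ⊢ s :- # 1 := # 2 :* (# 4 :* k :* k :+ # 3 :* k)) (Σf n pos) k (Σ-pos-mod4 n 1 h))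
    go 2 h _ = odd4 (λ r → ℕP.1+n≢0 (trans (sym h) r)) (λ r → ℕP.1+n≢n (sym (trans (sym h) r))) (+ 4 ℤ.* k ℤ.* k ℤ.+ + 5 ℤ.* k ℤ.+ + 1 , lia 2 (λ s k → # 2 :* s := (# 2 :+ k :* # 4) :* (# 1 :+ (# 2 :+ k :* # 4)) ⇒ ⊢ s :- # 1 := # 2 :* (# 4 :* k :* k :+ # 5 :* k :+ # 1)) (Σf n pos) k (Σ-pos-mod4 n 2 h))
    go 3 h _ = even4 (inj₂ h) ((+ 4 ℤ.* k ℤ.+ + 3) ℤ.* (k ℤ.+ + 1) , lia 2 (λ s k → # 2 :* s := (# 3 :+ k :* # 4) :* (# 1 :+ (# 3 :+ k :* # 4)) ⇒ ⊢ s := # 2 :* ((# 4 :* k :+ # 3) :* (k :+ # 1))) (Σf n pos) k (Σ-pos-mod4 n 3 h))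
    go (suc (suc (suc (suc _)))) h (s≤s (s≤s (s≤s (s≤s ()))))

  ltℕ-yes : ∀ {a b} → a ℕ.< b → ltℕ a b ≡ true
  ltℕ-yes {a} {b} = dec-true (suc a ℕ.≤? b)

  ltℕ-no : ∀ {a b} → ¬ (a ℕ.< b) → ltℕ a b ≡ false
  ltℕ-no {a} {b} = dec-false (suc a ℕ.≤? b)

  module _ {m : ℕ} (π : Word) (v : SP (suc (suc m))) (inV : InVert (suc (suc m)) π v) where
    private
      n = suc (suc m)
      hN = proj₁ (proj₁ inV)
      hE = proj₂ (proj₁ inV)
    hv : SPerm v
    hv = sperm (proj₁ (proj₂ inV))

    qs : ℕ → ℤ
    qs i = + piAt π i

    qs-first : qs 1 ≡ + 0 → + 0 ℤ.< v fz
    qs-first h with piAt-first π (subst (1 ℕ.≤_) (sym hN) (s≤s z≤n)) (ℤP.+-injective h)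
    ... | w , r = proj₂ (proj₂ (proj₂ inV)) w r fz refl

    qs-step : ∀ k → suc (suc k) ℕ.≤ n → qs (suc k) ℤ.≤ qs (suc (suc k))
    qs-step k h = +≤+ (goPi-step 0 π k (subst (suc (suc k) ℕ.≤_) (sym hN) h))

    qs-rise : ∀ (i j : Fin n) → toℕ j ≡ suc (toℕ i) → qs (suc (toℕ i)) ≡ qs (suc (suc (toℕ i))) → v i ℤ.< v j
    qs-rise i j r h = proj₁ (proj₂ (proj₂ inV)) i j r (goRise-∈ 0 0 π (toℕ i) (subst₂ ℕ._≤_ (cong suc r) (sym hN) (FP.toℕ<n j)) (ℤP.+-injective h))

    qs-≤ : ∀ k → qs k ℤ.≤ + n
    qs-≤ k = +≤+ (subst (piAt π k ℕ.≤_) hE (goPi-≤ 0 π k))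

    last : Fin n
    last = fromℕ (suc m)

    toℕ-last : toℕ last ≡ suc m
    toℕ-last = FP.toℕ-fromℕ (suc m)

    data Row (i : Fin n) : Set where
      low-row : suc (toℕ i) ℕ.< n → Row i
      last-row : i ≡ last → Row i

    row? : ∀ i → Row i
    row? i with suc (toℕ i) ℕ.<? n
    ... | yes h = low-row h
    ... | no h = last-row (FP.toℕ-injective (trans (ℕP.≤-antisym (ℕP.≤-pred (FP.toℕ<n i)) (ℕP.≤-pred (ℕP.≮⇒≥ h))) (sym toℕ-last)))

    ltℕ-last : ltℕ (suc (toℕ last)) n ≡ false
    ltℕ-last = ltℕ-no {suc (toℕ last)} {n} (λ h → ℕP.1+n≰n (subst (λ z → suc (suc z) ℕ.≤ n) toℕ-last h))

    lam-low : ∀ i → suc (toℕ i) ℕ.< n → lam n π i ≡ qs (suc (toℕ i))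
    lam-low i h rewrite ltℕ-yes h = refl

    lam-last : lam n π last ≡ lamLast n π
    lam-last = cong (λ b → if b then + piAt π (suc (toℕ last)) else lamLast n π) ltℕ-last

    mu-low : ∀ i → suc (toℕ i) ℕ.< n → mu n π i ≡ qs (suc (toℕ i)) ℤ.- pos i
    mu-low i h rewrite ltℕ-yes h = refl

    u-low : ∀ i → suc (toℕ i) ℕ.< n → uSP n π v i ≡ v i
    u-low i h rewrite ltℕ-yes h = refl

    S : ℕ
    S = sumℕ (map (λ k → piAt π (suc k)) (upTo m))

    -- the sign rule of d_B for the entry from row n
    signed : Fin n × ℤ → ℤ
    signed (j , x) = if eqℕ (suc (toℕ j)) n
                  then (if evenℕ ∣ ix (mu n π) (n ℕ.∸ 1) ℤ.+ ix (mu n π) n ∣ then ℤ.- x else x)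
                  else x

    w′ : SP n
    w′ i = signed (i , v i)

    w′-low : ∀ i → suc (toℕ i) ℕ.< n → ∀ x → signed (i , x) ≡ x
    w′-low i h x rewrite eqℕ-no {suc (toℕ i)} {n} (ℕP.<⇒≢ h) = refl

    signed-last : ∀ x → signed (last , x) ≡ (if evenℕ ∣ ix (mu n π) (suc m) ℤ.+ ix (mu n π) n ∣ then ℤ.- x else x)
    signed-last x = cong (λ b → if b then (if evenℕ ∣ ix (mu n π) (suc m) ℤ.+ ix (mu n π) n ∣ then ℤ.- x else x) else x)
      (trans (cong (λ z → eqℕ (suc z) n) toℕ-last) (eqℕ-refl n))

    signed-neg : ∀ j x → signed (j , ℤ.- x) ≡ ℤ.- signed (j , x)
    signed-neg j x with eqℕ (suc (toℕ j)) n | evenℕ ∣ ix (mu n π) (n ℕ.∸ 1) ℤ.+ ix (mu n π) n ∣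
    ... | false | _ = refl
    ... | true | true = refl
    ... | true | false = refl

    signed-abs : ∀ j x → ∣ signed (j , x) ∣ ≡ ∣ x ∣
    signed-abs j x with eqℕ (suc (toℕ j)) n | evenℕ ∣ ix (mu n π) (n ℕ.∸ 1) ℤ.+ ix (mu n π) n ∣
    ... | false | _ = refl
    ... | true | true = ℤP.∣-i∣≡∣i∣ x
    ... | true | false = refl

    w′-sp : SPerm w′
    w′-sp = sperm ((λ i → subst (1 ℕ.≤_) (sym (signed-abs i (v i))) (proj₁ (bd hv i)) , subst (ℕ._≤ n) (sym (signed-abs i (v i))) (proj₂ (bd hv i)))
      , λ i j r → sp-inj hv i j (trans (sym (signed-abs i (v i))) (trans r (signed-abs j (v j)))))

    pen : Fin n
    pen = inject₁ (fromℕ m)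

    toℕ-pen : toℕ pen ≡ m
    toℕ-pen = trans (FP.toℕ-inject₁ (fromℕ m)) (FP.toℕ-fromℕ m)

    pen-low : suc (toℕ pen) ℕ.< n
    pen-low = subst (λ z → suc z ℕ.< n) (sym toℕ-pen) ℕP.≤-refl

    ix-pen : ∀ (x : Vecℤ n) → ix x (suc m) ≡ x pen
    ix-pen x = trans (cong (λ z → ix x (suc z)) (sym toℕ-pen)) (ix-lookup x pen)

    ix-last : ∀ (x : Vecℤ n) → ix x n ≡ x last
    ix-last x = trans (cong (λ z → ix x (suc z)) (sym toℕ-last)) (ix-lookup x last)

    pos-last : pos last ≡ + n
    pos-last = cong (λ z → + suc z) toℕ-last

    pos-pen : pos pen ≡ + suc m
    pos-pen = cong (λ z → + suc z) toℕ-pen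

    lam-pen : lam n π pen ≡ qs (suc m)
    lam-pen = trans (lam-low pen pen-low) (cong (λ z → qs (suc z)) toℕ-pen)

    mu-pen : mu n π pen ≡ qs (suc m) ℤ.- + suc m
    mu-pen = trans (mu-low pen pen-low) (cong₂ (λ y z → qs (suc y) ℤ.- z) toℕ-pen pos-pen)

    data LamCase : Set where
      lam-even : Even (+ S) → lam n π last ≡ + 2 ℤ.* qs n ℤ.- qs (suc m) → LamCase
      lam-odd : Even (+ S ℤ.- + 1) → lam n π last ≡ + 1 ℤ.+ + 2 ℤ.* + n ℤ.- + 2 ℤ.* qs n ℤ.+ qs (suc m) → LamCase

    lamCase : LamCase
    lamCase = go (evenℕ S) refl
      where
      double : ∀ k → + (2 ℕ.* k) ≡ + 2 ℤ.* + k
      double k = ℤP.pos-* 2 k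
      go : ∀ b → evenℕ S ≡ b → LamCase
      go true h = lam-even (even-true S h) (trans lam-last (trans (cong (λ b → if b then + (2 ℕ.* piAt π n) ℤ.- qs (suc m) else (+ (suc (2 ℕ.* n)) ℤ.- + (2 ℕ.* piAt π n) ℤ.+ qs (suc m))) h) (cong (ℤ._- qs (suc m)) (double (piAt π n)))))
      go false h = lam-odd (even-false S h) (trans lam-last (trans (cong (λ b → if b then + (2 ℕ.* piAt π n) ℤ.- qs (suc m) else (+ (suc (2 ℕ.* n)) ℤ.- + (2 ℕ.* piAt π n) ℤ.+ qs (suc m))) h)
        (cong₂ (λ y z → + 1 ℤ.+ y ℤ.- z ℤ.+ qs (suc m)) (double n) (double (piAt π n)))))

    data MuCase : Set where
      mu-keep : Even (Σf n pos) → mu n π last ≡ lam n π last ℤ.- + n → MuCase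
      mu-flip : Even (Σf n pos ℤ.- + 1) → mu n π last ≡ + 1 ℤ.+ + n ℤ.- lam n π last → MuCase

    mu-last : mu n π last ≡ (if eqℕ (n ℕ.% 4) 0 then lam n π last ℤ.- + n else (if eqℕ (n ℕ.% 4) 3 then lam n π last ℤ.- + n else + suc n ℤ.- lam n π last))
    mu-last = cong (λ b → if b then lam n π last ℤ.- + suc (toℕ last) else (if eqℕ (n ℕ.% 4) 0 then lam n π last ℤ.- + n else (if eqℕ (n ℕ.% 4) 3 then lam n π last ℤ.- + n else + suc n ℤ.- lam n π last))) ltℕ-last

    muCase : MuCase
    muCase with mod4 n
    ... | even4 (inj₁ h) E = mu-keep E (trans mu-last (cong (λ b → if b then lam n π last ℤ.- + n else (if eqℕ (n ℕ.% 4) 3 then lam n π last ℤ.- + n else + suc n ℤ.- lam n π last)) (trans (cong (λ z → eqℕ z 0) h) refl)))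
    ... | even4 (inj₂ h) E = mu-keep E (trans mu-last (cong₂ (λ b c → if b then lam n π last ℤ.- + n else (if c then lam n π last ℤ.- + n else + suc n ℤ.- lam n π last)) (trans (cong (λ z → eqℕ z 0) h) refl) (trans (cong (λ z → eqℕ z 3) h) refl)))
    ... | odd4 h h' E = mu-flip E (trans mu-last (cong₂ (λ b c → if b then lam n π last ℤ.- + n else (if c then lam n π last ℤ.- + n else + suc n ℤ.- lam n π last)) (eqℕ-no h) (eqℕ-no h')))

    ν-last : ℤ
    ν-last = mu n π last ℤ.+ + n

    -- Together, the parities of π₁ + ... + πₙ₋₂ and of 1 + ... + n leave two shapes for the last
    -- row. In the straight one the last rise is the wall between n - 1 and n, and the bound πₙ ≤ n
    -- is the top wall; in the twisted one these two conditions exchange their roles.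
    data LastCase : Set where
      straight : ν-last ≡ + 2 ℤ.* qs n ℤ.- qs (suc m) → w′ last ≡ v last → LastCase
      twisted  : ν-last ≡ + 1 ℤ.+ + 2 ℤ.* + n ℤ.- + 2 ℤ.* qs n ℤ.+ qs (suc m) → w′ last ≡ ℤ.- v last → LastCase

    lastCase : LastCase
    lastCase = go lamCase muCase
      where
      sum≡ : ix (mu n π) (suc m) ℤ.+ ix (mu n π) n ≡ qs (suc m) ℤ.- + suc m ℤ.+ (ν-last ℤ.- + n)
      sum≡ = cong₂ ℤ._+_ (trans (ix-pen (mu n π)) mu-pen) (trans (ix-last (mu n π)) (lia 2 (λ x n → ⊢ x := x :+ n :- n) (mu n π last) (+ n)))
      -- The sum of μₙ₋₁ and μₙ is odd in the straight shape and even in the twisted one, so the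
      -- sign rule of d_B is a test for the twist.
      str : ν-last ≡ + 2 ℤ.* qs n ℤ.- qs (suc m) → LastCase
      str h = straight h (trans (signed-last (v last)) (cong (λ b → if b then ℤ.- v last else v last) (evenℕ-abs-false (ix (mu n π) (suc m) ℤ.+ ix (mu n π) n)
        (qs n ℤ.- + n , lia 5 (λ m x y z s → s := y :- (# 1 :+ m) :+ (z :- (# 2 :+ m)) ⇒ z := # 2 :* x :- y ⇒ ⊢ s :- # 1 := # 2 :* (x :- (# 2 :+ m))) (+ m) (qs n) (qs (suc m)) ν-last (ix (mu n π) (suc m) ℤ.+ ix (mu n π) n) sum≡ h))))
      tw : ν-last ≡ + 1 ℤ.+ + 2 ℤ.* + n ℤ.- + 2 ℤ.* qs n ℤ.+ qs (suc m) → LastCase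
      tw h = twisted h (trans (signed-last (v last)) (cong (λ b → if b then ℤ.- v last else v last) (evenℕ-abs-true (ix (mu n π) (suc m) ℤ.+ ix (mu n π) n)
        (qs (suc m) ℤ.- qs n ℤ.+ + 1 , lia 5 (λ m x y z s → s := y :- (# 1 :+ m) :+ (z :- (# 2 :+ m)) ⇒ z := # 1 :+ # 2 :* (# 2 :+ m) :- # 2 :* x :+ y ⇒ ⊢ s := # 2 :* (y :- x :+ # 1)) (+ m) (qs n) (qs (suc m)) ν-last (ix (mu n π) (suc m) ℤ.+ ix (mu n π) n) sum≡ h))))
      go : LamCase → MuCase → LastCase
      go (lam-even _ e) (mu-keep _ f) = str (lia 5 (λ l u n x y → l := # 2 :* x :- y ⇒ u := l :- n ⇒ ⊢ u :+ n := # 2 :* x :- y) (lam n π last) (mu n π last) (+ n) (qs n) (qs (suc m)) e f)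
      go (lam-even _ e) (mu-flip _ f) = tw (lia 5 (λ l u n x y → l := # 2 :* x :- y ⇒ u := # 1 :+ n :- l ⇒ ⊢ u :+ n := # 1 :+ # 2 :* n :- # 2 :* x :+ y) (lam n π last) (mu n π last) (+ n) (qs n) (qs (suc m)) e f)
      go (lam-odd _ e) (mu-keep _ f) = tw (lia 5 (λ l u n x y → l := # 1 :+ # 2 :* n :- # 2 :* x :+ y ⇒ u := l :- n ⇒ ⊢ u :+ n := # 1 :+ # 2 :* n :- # 2 :* x :+ y) (lam n π last) (mu n π last) (+ n) (qs n) (qs (suc m)) e f)
      go (lam-odd _ e) (mu-flip _ f) = str (lia 5 (λ l u n x y → l := # 1 :+ # 2 :* n :- # 2 :* x :+ y ⇒ u := # 1 :+ n :- l ⇒ ⊢ u :+ n := # 2 :* x :- y) (lam n π last) (mu n π last) (+ n) (qs n) (qs (suc m)) e f)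

    u-last : uSP n π v last ≡ (if evenℕ ∣ ix (lam n π) (suc m) ℤ.+ ix (lam n π) n ∣ then v last else ℤ.- v last)
    u-last = cong (λ b → if b then v last else (if evenℕ ∣ ix (lam n π) (suc m) ℤ.+ ix (lam n π) n ∣ then v last else ℤ.- v last)) ltℕ-last

    -- Whether λₙ and the last entry of u are flipped against νₙ and the last entry of `w′` depends
    -- on n modulo 4 alone, because the parity of π₁ + ... + πₙ₋₂ enters both sides and cancels. The
    -- flip matches the one that w̃_f makes in its last coordinate.
    data DiagCase : Set where
      diag-keep : Even (Σf n pos) → lam n π last ≡ ν-last → uSP n π v last ≡ w′ last → DiagCase
      diag-flip : Even (Σf n pos ℤ.- + 1) → lam n π last ≡ + 1 ℤ.+ + 2 ℤ.* + n ℤ.- ν-last → uSP n π v last ≡ ℤ.- w′ last → DiagCase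

    u-case : (Even (+ S) × uSP n π v last ≡ v last × lam n π last ≡ + 2 ℤ.* qs n ℤ.- qs (suc m)) ⊎ (Even (+ S ℤ.- + 1) × uSP n π v last ≡ ℤ.- v last × lam n π last ≡ + 1 ℤ.+ + 2 ℤ.* + n ℤ.- + 2 ℤ.* qs n ℤ.+ qs (suc m))
    u-case with lamCase
    ... | lam-even E h = inj₁ (E , trans u-last (cong (λ b → if b then v last else ℤ.- v last) (evenℕ-abs-true (ix (lam n π) (suc m) ℤ.+ ix (lam n π) n) (qs n ,
           trans (cong₂ ℤ._+_ (trans (ix-pen (lam n π)) lam-pen) (trans (ix-last (lam n π)) h)) (lia 2 (λ x y → ⊢ y :+ (# 2 :* x :- y) := # 2 :* x) (qs n) (qs (suc m)))))) , h)
    ... | lam-odd E h = inj₂ (E , trans u-last (cong (λ b → if b then v last else ℤ.- v last) (evenℕ-abs-false (ix (lam n π) (suc m) ℤ.+ ix (lam n π) n) (+ n ℤ.- qs n ℤ.+ qs (suc m) ,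
           trans (cong (ℤ._- + 1) (cong₂ ℤ._+_ (trans (ix-pen (lam n π)) lam-pen) (trans (ix-last (lam n π)) h))) (lia 3 (λ x y n → ⊢ y :+ (# 1 :+ # 2 :* n :- # 2 :* x :+ y) :- # 1 := # 2 :* (n :- x :+ y)) (qs n) (qs (suc m)) (+ n))))) , h)

    -- The two expressions add up to the odd number 2n + 1.
    shape-distinct : + 2 ℤ.* qs n ℤ.- qs (suc m) ≢ + 1 ℤ.+ + 2 ℤ.* + n ℤ.- + 2 ℤ.* qs n ℤ.+ qs (suc m)
    shape-distinct h = odd-not-even {0} (+ 2 ℤ.* qs n ℤ.- qs (suc m) ℤ.- + n) (lia 3 (λ x y n → # 2 :* x :- y := # 1 :+ # 2 :* n :- # 2 :* x :+ y ⇒ ⊢ # 1 := # 2 :* (# 2 :* x :- y :- n)) (qs n) (qs (suc m)) (+ n) h)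

    diagCase : DiagCase
    diagCase = go muCase u-case lastCase
      where
      nn = ℤP.neg-involutive
      keep : mu n π last ≡ lam n π last ℤ.- + n → lam n π last ≡ ν-last
      keep f = lia 3 (λ u l n → u := l :- n ⇒ ⊢ l := u :+ n) (mu n π last) (lam n π last) (+ n) f
      flip : mu n π last ≡ + 1 ℤ.+ + n ℤ.- lam n π last → lam n π last ≡ + 1 ℤ.+ + 2 ℤ.* + n ℤ.- ν-last
      flip f = lia 3 (λ u l n → u := # 1 :+ n :- l ⇒ ⊢ l := # 1 :+ # 2 :* n :- (u :+ n)) (mu n π last) (lam n π last) (+ n) f
      go : MuCase → _ → LastCase → DiagCase
      go (mu-keep E f) (inj₁ (_ , u , l)) (straight h w) = diag-keep E (keep f) (trans u (sym w))
      go (mu-keep E f) (inj₂ (_ , u , l)) (twisted h w) = diag-keep E (keep f) (trans u (sym w))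
      go (mu-keep E f) (inj₁ (_ , u , l)) (twisted h w) = ⊥-elim (shape-distinct (trans (sym l) (trans (keep f) h)))
      go (mu-keep E f) (inj₂ (_ , u , l)) (straight h w) = ⊥-elim (shape-distinct (sym (trans (sym l) (trans (keep f) h))))
      go (mu-flip E f) (inj₁ (_ , u , l)) (twisted h w) = diag-flip E (flip f) (trans u (trans (sym (nn (v last))) (cong ℤ.-_ (sym w))))
      go (mu-flip E f) (inj₂ (_ , u , l)) (straight h w) = diag-flip E (flip f) (trans u (cong ℤ.-_ (sym w)))
      go (mu-flip E f) (inj₁ (_ , u , l)) (straight h w) = ⊥-elim (shape-distinct (lia 5 (λ l z x y n → l := # 2 :* x :- y ⇒ z := # 2 :* x :- y ⇒ l := # 1 :+ # 2 :* n :- z ⇒ ⊢ # 2 :* x :- y := # 1 :+ # 2 :* n :- # 2 :* x :+ y) (lam n π last) ν-last (qs n) (qs (suc m)) (+ n) l h (flip f)))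
      go (mu-flip E f) (inj₂ (_ , u , l)) (twisted h w) = ⊥-elim (shape-distinct (lia 5 (λ l z x y n → l := # 1 :+ # 2 :* n :- # 2 :* x :+ y ⇒ z := # 1 :+ # 2 :* n :- # 2 :* x :+ y ⇒ l := # 1 :+ # 2 :* n :- z ⇒ ⊢ # 2 :* x :- y := # 1 :+ # 2 :* n :- # 2 :* x :+ y) (lam n π last) ν-last (qs n) (qs (suc m)) (+ n) l h (flip f)))

    -- The coordinate sum is S + πₙ₋₁ + νₙ - T with T = 1 + ... + n. The shape is straight when S
    -- and T have equal parity and twisted otherwise, and then the odd constant 2n + 1 in νₙ
    -- restores evenness.
    mu-InQ : InQ (mu n π)
    mu-InQ = go lamCase muCase
      where
      T = Σf n pos
      ν : Vecℤ n
      ν i = mu n π i ℤ.+ pos i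
      low-value : (i : Fin m) → ν (inject₁ (inject₁ i)) ≡ + piAt π (suc (toℕ i))
      low-value i = trans (cong (ℤ._+ pos (inject₁ (inject₁ i))) (mu-low (inject₁ (inject₁ i)) (subst (λ z → suc z ℕ.< n) (sym r) (s≤s (ℕP.≤-trans (FP.toℕ<n i) (ℕP.n≤1+n m))))))
        (trans (lia 2 (λ a b → ⊢ a :- b :+ b := a) (qs (suc (toℕ (inject₁ (inject₁ i))))) (pos (inject₁ (inject₁ i)))) (cong (λ z → qs (suc z)) r))
        where r : toℕ (inject₁ (inject₁ i)) ≡ toℕ i
              r = trans (FP.toℕ-inject₁ (inject₁ i)) (FP.toℕ-inject₁ i)
      Σν : Σf n ν ≡ + S ℤ.+ qs (suc m) ℤ.+ ν-last
      Σν = trans (Σ-snoc (suc m) ν) (cong₂ ℤ._+_ (trans (Σ-snoc m (ν ∘ inject₁)) (cong₂ ℤ._+_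
           (trans (Σ-cong m low-value) (Σ-upTo m (λ k → piAt π (suc k))))
           (trans (cong₂ ℤ._+_ mu-pen pos-pen) (lia 2 (λ a b → ⊢ a :- b :+ b := a) (qs (suc m)) (+ suc m)))))
         (cong (ℤ._+_ (mu n π last)) pos-last))
      sum : Σf n (mu n π) ℤ.+ T ≡ + S ℤ.+ qs (suc m) ℤ.+ (mu n π last ℤ.+ + n)
      sum = trans (sym (Σ-+ n (mu n π) pos)) Σν
      go : LamCase → MuCase → InQ (mu n π)
      go (lam-even (k , a) e) (mu-keep (t , b) f) = k ℤ.+ qs n ℤ.- t , lia 10 (λ s T S l u n x y k t → s :+ T := S :+ y :+ (u :+ n) ⇒ S := # 2 :* k ⇒ T := # 2 :* t ⇒ l := # 2 :* x :- y ⇒ u := l :- n ⇒ ⊢ s := # 2 :* (k :+ x :- t))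
          (Σf n (mu n π)) T (+ S) (lam n π last) (mu n π last) (+ n) (qs n) (qs (suc m)) k t sum a b e f
      go (lam-even (k , a) e) (mu-flip (t , b) f) = k ℤ.+ qs (suc m) ℤ.+ + n ℤ.- qs n ℤ.- t , lia 10 (λ s T S l u n x y k t → s :+ T := S :+ y :+ (u :+ n) ⇒ S := # 2 :* k ⇒ T :- # 1 := # 2 :* t ⇒ l := # 2 :* x :- y ⇒ u := # 1 :+ n :- l ⇒ ⊢ s := # 2 :* (k :+ y :+ n :- x :- t))
          (Σf n (mu n π)) T (+ S) (lam n π last) (mu n π last) (+ n) (qs n) (qs (suc m)) k t sum a b e f
      go (lam-odd (k , a) e) (mu-keep (t , b) f) = k ℤ.+ + 1 ℤ.+ qs (suc m) ℤ.+ + n ℤ.- qs n ℤ.- t , lia 10 (λ s T S l u n x y k t → s :+ T := S :+ y :+ (u :+ n) ⇒ S :- # 1 := # 2 :* k ⇒ T := # 2 :* t ⇒ l := # 1 :+ # 2 :* n :- # 2 :* x :+ y ⇒ u := l :- n ⇒ ⊢ s := # 2 :* (k :+ # 1 :+ y :+ n :- x :- t))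
          (Σf n (mu n π)) T (+ S) (lam n π last) (mu n π last) (+ n) (qs n) (qs (suc m)) k t sum a b e f
      go (lam-odd (k , a) e) (mu-flip (t , b) f) = k ℤ.+ qs n ℤ.- t , lia 10 (λ s T S l u n x y k t → s :+ T := S :+ y :+ (u :+ n) ⇒ S :- # 1 := # 2 :* k ⇒ T :- # 1 := # 2 :* t ⇒ l := # 1 :+ # 2 :* n :- # 2 :* x :+ y ⇒ u := # 1 :+ n :- l ⇒ ⊢ s := # 2 :* (k :+ x :- t))
          (Σf n (mu n π)) T (+ S) (lam n π last) (mu n π last) (+ n) (qs n) (qs (suc m)) k t sum a b e f

    private
      R = simplexPt w′ (mu n π)
      pv : Fin n → ℤ
      pv i = pt n (v i)

    R-low : ∀ i → suc (toℕ i) ℕ.< n → R i ≡ pv i ℤ.+ N n ℤ.* qs (suc (toℕ i))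
    R-low i h = cong₂ (λ y z → pt n y ℤ.+ N n ℤ.* z) (w′-low i h (v i)) (trans (cong (ℤ._+ pos i) (mu-low i h)) (lia 2 (λ a b → ⊢ a :- b :+ b := a) (qs (suc (toℕ i))) (pos i)))

    R-last : R last ≡ pt n (w′ last) ℤ.+ N n ℤ.* ν-last
    R-last = cong (λ z → pt n (w′ last) ℤ.+ N n ℤ.* (mu n π last ℤ.+ z)) pos-last

    R-pen : R pen ≡ pv pen ℤ.+ N n ℤ.* qs (suc m)
    R-pen = trans (R-low pen pen-low) (cong (λ z → pv pen ℤ.+ N n ℤ.* qs (suc z)) toℕ-pen)

    -- Either the level increases and N outweighs the base values, or it stays and the labels at the
    -- rise decide.
    rise-gap : ∀ i j {q q'} → q ℤ.≤ q' → (q ≡ q' → v i ℤ.< v j) → + 0 ℤ.< pv j ℤ.- pv i ℤ.+ N n ℤ.* (q' ℤ.- q)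
    rise-gap i j {q} {q'} h r with q ℤP.≟ q'
    ... | yes refl = lia 4 (λ a b N q → a :< b ⇒ ⊢ # 0 :< b :- a :+ N :* (q :- q)) (pv i) (pv j) (N n) q (pt-mono (sp-sidx hv i) (sp-sidx hv j) (r refl))
    ... | no ne = lia 4 (λ a b N x → :- N :< # 2 :* b ⇒ # 2 :* a :< N ⇒ N :* # 1 :≤ N :* x ⇒ ⊢ # 0 :< b :- a :+ N :* x) (pv i) (pv j) (N n) (q' ℤ.- q)
        (proj₂ (pt-bound (sp-sidx hv j))) (proj₁ (pt-bound (sp-sidx hv i))) (Npos-mono n (lia 2 (λ a b → a :< b ⇒ ⊢ # 1 :≤ b :- a) q q' (ℤP.≤∧≢⇒< h ne)))

    pen-last-rise : + 0 ℤ.< pv last ℤ.- pv pen ℤ.+ N n ℤ.* (qs n ℤ.- qs (suc m))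
    pen-last-rise = rise-gap pen last (qs-step m ℕP.≤-refl) (λ h → qs-rise pen last (trans toℕ-last (cong suc (sym toℕ-pen)))
      (subst (λ z → qs (suc z) ≡ qs (suc (suc z))) (sym toℕ-pen) h))

    -- The conditions on a vertical labelling are the walls: the start condition gives the short
    -- simple root, the rises the long ones, and πₙ ≤ n the highest root, the last two conditions
    -- being exchanged in the twisted shape.
    candidate-low : Low w′ (mu n π)
    candidate-low = alcove-walls simple high
      where
      B = pt-bound
      first : + 0 ℤ.< R fz
      first = subst (+ 0 ℤ.<_) (sym (R-low fz (s≤s (s≤s z≤n)))) (go (qs 1 ℤP.≟ + 0))
        where
        go : Dec (qs 1 ≡ + 0) → + 0 ℤ.< pv fz ℤ.+ N n ℤ.* qs 1
        go (yes h) = subst (λ z → + 0 ℤ.< pv fz ℤ.+ N n ℤ.* z) (sym h) (lia 2 (λ a N → # 0 :< a ⇒ ⊢ # 0 :< a :+ N :* # 0) (pv fz) (N n) (pt-mono {n} zr (sp-sidx hv fz) (qs-first h)))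
        go (no h) = lia 3 (λ a N x → :- N :< # 2 :* a ⇒ N :* # 1 :≤ N :* x ⇒ # 0 :< N ⇒ ⊢ # 0 :< a :+ N :* x) (pv fz) (N n) (qs 1) (proj₂ (B (sp-sidx hv fz)))
            (Npos-mono n (lia 1 (λ x → # 0 :< x ⇒ ⊢ # 1 :≤ x) (qs 1) (ℤP.≤∧≢⇒< (0≤ _) (h ∘ sym)))) (N-pos n)
      vl = sp-sidx hv last
      vp = sp-sidx hv pen
      pv-neg : w′ last ≡ ℤ.- v last → pt n (w′ last) ≡ ℤ.- pv last
      pv-neg h = trans (cong (pt n) h) (ext-odd (pS {n}) (v last))
      penult : LastCase → + 0 ℤ.< R last ℤ.- R pen
      penult (straight h k) = lia 8 (λ N a b a' r s z x → # 0 :< b :- a :+ N :* x ⇒ # 0 :≤ N :* x ⇒ r := a :+ N :* s ⇒ a' := b ⇒ z := b :+ N :* (s :+ x :+ x) ⇒ ⊢ # 0 :< z :- r)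
         (N n) (pv pen) (pv last) (pt n (w′ last)) (R pen) (qs (suc m)) (R last) (qs n ℤ.- qs (suc m)) pen-last-rise
         (subst (ℤ._≤ N n ℤ.* (qs n ℤ.- qs (suc m))) (ℤP.*-zeroʳ (N n)) (Npos-mono n (ℤP.i≤j⇒0≤j-i (qs-step m ℕP.≤-refl)))) R-pen (cong (pt n) k)
         (trans R-last (cong₂ (λ y z → y ℤ.+ N n ℤ.* z) (cong (pt n) k) (trans h (lia 2 (λ x y → ⊢ # 2 :* x :- y := y :+ (x :- y) :+ (x :- y)) (qs n) (qs (suc m))))))
      penult (twisted h k) = lia 8 (λ N a b n q r s z → r := a :+ N :* s ⇒ z := (:- b) :+ N :* (# 1 :+ # 2 :* n :- # 2 :* q :+ s) ⇒ # 2 :* a :< N ⇒ # 2 :* b :< N ⇒ N :* q :≤ N :* n ⇒ ⊢ # 0 :< z :- r)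
         (N n) (pv pen) (pv last) (+ n) (qs n) (R pen) (qs (suc m)) (R last) R-pen
         (trans R-last (cong₂ (λ y z → y ℤ.+ N n ℤ.* z) (pv-neg k) h)) (proj₁ (B vp)) (proj₁ (B vl)) (Npos-mono n (qs-≤ n))
      simple : ∀ k → + 0 ℤ.< ⟪ R , simpleRoot k ⟫
      simple fz = subst (+ 0 ℤ.<_) (sym (trans (⟪simple⟫ R fz) (trans (ℤP.+-identityʳ _) (ext-pos R fz)))) first
      simple (fs k) = subst (+ 0 ℤ.<_) (sym (trans (⟪simple⟫ R (fs k)) (cong₂ ℤ._-_ (ext-pos R (fs k)) (trans (cong (λ z → ext R (+ suc z)) (sym (FP.toℕ-inject₁ k))) (ext-pos R (inject₁ k)))))) (go (row? (fs k)))
        where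
        go : Row (fs k) → + 0 ℤ.< R (fs k) ℤ.- R (inject₁ k)
        go (low-row h) = lia 7 (λ N a b x y r s → r := b :+ N :* y ⇒ s := a :+ N :* x ⇒ # 0 :< b :- a :+ N :* (y :- x) ⇒ ⊢ # 0 :< r :- s) (N n) (pv (inject₁ k)) (pv (fs k)) (qs (suc (toℕ k))) (qs (suc (suc (toℕ k)))) (R (fs k)) (R (inject₁ k))
            (R-low (fs k) h) (trans (R-low (inject₁ k) (subst (λ z → suc z ℕ.< n) (sym (FP.toℕ-inject₁ k)) (ℕP.<-trans ℕP.≤-refl h))) (cong (λ z → pv (inject₁ k) ℤ.+ N n ℤ.* qs (suc z)) (FP.toℕ-inject₁ k)))
            (rise-gap (inject₁ k) (fs k) (qs-step (toℕ k) (ℕP.<⇒≤ h)) (λ q → qs-rise (inject₁ k) (fs k) (cong suc (sym (FP.toℕ-inject₁ k))) (subst (λ z → qs (suc z) ≡ qs (suc (suc z))) (sym (FP.toℕ-inject₁ k)) q)))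
        go (last-row h) = subst₂ (λ i j → + 0 ℤ.< R i ℤ.- R j) (sym h) (cong inject₁ (sym (FP.suc-injective h))) (penult lastCase)
      high : ⟪ R , highest n ⟫ ℤ.< bigM {m}
      high = subst (ℤ._< bigM {m}) (sym (trans (⟪highest⟫ R) (cong₂ ℤ._+_ (ix-pen R) (ix-last R)))) (go lastCase)
        where
        go : LastCase → R pen ℤ.+ R last ℤ.< bigM {m}
        go (straight h k) = lia 8 (λ N a b n q r s z → r := a :+ N :* s ⇒ z := b :+ N :* (# 2 :* q :- s) ⇒ # 2 :* a :< N ⇒ # 2 :* b :< N ⇒ N :* q :≤ N :* n ⇒ ⊢ r :+ z :< N :* (# 1 :+ # 2 :* n))
           (N n) (pv pen) (pv last) (+ n) (qs n) (R pen) (qs (suc m)) (R last) R-pen (trans R-last (cong₂ (λ y z → y ℤ.+ N n ℤ.* z) (cong (pt n) k) h)) (proj₁ (B vp)) (proj₁ (B vl)) (Npos-mono n (qs-≤ n))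
        go (twisted h k) = lia 8 (λ N a b n q r s z → r := a :+ N :* s ⇒ z := (:- b) :+ N :* (# 1 :+ # 2 :* n :- # 2 :* q :+ s) ⇒ # 0 :< b :- a :+ N :* (q :- s) ⇒ # 0 :≤ N :* (q :- s) ⇒ ⊢ r :+ z :< N :* (# 1 :+ # 2 :* n))
           (N n) (pv pen) (pv last) (+ n) (qs n) (R pen) (qs (suc m)) (R last) R-pen (trans R-last (cong₂ (λ y z → y ℤ.+ N n ℤ.* z) (pv-neg k) h)) pen-last-rise
           (subst (ℤ._≤ N n ℤ.* (qs n ℤ.- qs (suc m))) (ℤP.*-zeroʳ (N n)) (Npos-mono n (ℤP.i≤j⇒0≤j-i (qs-step m ℕP.≤-refl))))

open Representative

-- The element w̃_f, and the single minimal alcove of an Anderson class.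

module Uniqueness where

  N-cancel≡ : ∀ n {a b} → N n ℤ.* a ≡ N n ℤ.* b → a ≡ b
  N-cancel≡ n {a} {b} h = ℤP.*-cancelˡ-≡ (N n) a b h

  pos-sp : ∀ {n} → SPerm (pos {n})
  pos-sp = sperm ((λ i → s≤s z≤n , FP.toℕ<n i) , λ i j q → FP.toℕ-injective (ℕP.suc-injective q))

  actV-id : ∀ {n} (x : Vecℤ n) → actV pos x ≈v x
  actV-id x i = trans (sym (ext-pos (actV pos x) i)) (ext-actV pos-sp x i)

  InQ-+ : ∀ {n} {x y : Vecℤ n} → InQ x → InQ y → InQ (x +v y)
  InQ-+ {n} {x} {y} (k , p) (l , q) = k ℤ.+ l , trans (Σ-+ n x y) (trans (cong₂ ℤ._+_ p q) (sym (ℤP.*-distribˡ-+ (+ 2) k l)))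

  Σ-neg : ∀ n (f : Fin n → ℤ) → Σf n (λ i → ℤ.- f i) ≡ ℤ.- Σf n f
  Σ-neg n f = trans (Σ-cong n (λ i → sym (ℤP.-1*i≡-i (f i)))) (trans (Σ-* n -[1+ 0 ] f) (ℤP.-1*i≡-i _))

  InQ-neg : ∀ {n} {x : Vecℤ n} → InQ x → InQ (negv x)
  InQ-neg {n} {x} (k , p) = ℤ.- k , trans (Σ-neg n x) (lia 2 (λ s k → s := # 2 :* k ⇒ ⊢ :- s := # 2 :* (:- k)) (Σf n x) k p)

  module _ {m : ℕ} where
    private n = suc (suc m)

    end : Fin n
    end = fromℕ (suc m)

    pos-end : pos end ≡ + n
    pos-end = cong (λ z → + suc z) (FP.toℕ-fromℕ (suc m))

    -- wf⁻¹(0) = -ρ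
    ρ-of : AffW n → Vecℤ n
    ρ-of wf i = ext (tr wf) (lin wf i)

    -- The alcove of w̃_f is A∘ + (1, ..., n). When this vector is outside the coroot lattice, w̃_f
    -- also performs the symmetry of A∘ sending xₙ to 1 - xₙ, which moves the translation in the
    -- last coordinate to n + 1 and reverses its sign in the frame.
    record WfShape (ρ : Vecℤ n) : Set where
      field
        ρ-low : ∀ i → i ≢ end → ρ i ≡ pos i
        ρ-end : (Even (Σf n pos) × ρ end ≡ + n) ⊎ (Even (Σf n pos ℤ.- + 1) × ρ end ≡ ℤ.- (+ 1 ℤ.+ + n))

    private
      -- The image of the scaled base point under the symmetry of A∘ that reverses the last
      -- coordinate.
      p̂ : Vecℤ n
      p̂ i with i FP.≟ end
      ... | yes _ = N n ℤ.- pS i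
      ... | no _ = pS i
      p̂-end : p̂ end ≡ N n ℤ.- pS end
      p̂-end with end FP.≟ end
      ... | yes _ = refl
      ... | no q = ⊥-elim (q refl)
      p̂-low : ∀ i → i ≢ end → p̂ i ≡ pS i
      p̂-low i q with i FP.≟ end
      ... | yes r = ⊥-elim (q r)
      ... | no _ = refl
      flip-end : SP n
      flip-end i with i FP.≟ end
      ... | yes _ = neg i
      ... | no _ = pos i
      flip-at : flip-end end ≡ neg end
      flip-at with end FP.≟ end
      ... | yes _ = refl
      ... | no q = ⊥-elim (q refl)
      flip-low : ∀ i → i ≢ end → flip-end i ≡ pos i
      flip-low i q with i FP.≟ end
      ... | yes r = ⊥-elim (q r)
      ... | no _ = refl
      flip-abs : ∀ i → ∣ flip-end i ∣ ≡ suc (toℕ i)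
      flip-abs i with i FP.≟ end
      ... | yes _ = refl
      ... | no _ = refl
      flip-sp : SPerm flip-end
      flip-sp = sperm ((λ i → subst (1 ℕ.≤_) (sym (flip-abs i)) (s≤s z≤n) , subst (ℕ._≤ n) (sym (flip-abs i)) (FP.toℕ<n i)) , λ i j q → FP.toℕ-injective (ℕP.suc-injective (trans (sym (flip-abs i)) (trans q (flip-abs j)))))

      pS-val : ∀ i → pS {n} i ≡ + 1 ℤ.+ + 2 ℤ.* + toℕ i
      pS-val i = lia 1 (λ i → ⊢ # 1 :+ (i :+ (i :+ # 0)) := # 1 :+ # 2 :* i) (+ toℕ i)

      pS-end : pS {n} end ≡ + 3 ℤ.+ + 2 ℤ.* + m
      pS-end = trans (pS-val end) (trans (cong (λ z → + 1 ℤ.+ + 2 ℤ.* + z) (FP.toℕ-fromℕ (suc m))) (lia 1 (λ m → ⊢ # 1 :+ # 2 :* (# 1 :+ m) := # 3 :+ # 2 :* m) (+ m)))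

      simple-coord : ∀ (x : Vecℤ n) k → ⟪ x , simpleRoot (fs k) ⟫ ≡ x (fs k) ℤ.- x (inject₁ k)
      simple-coord x k = trans (⟪simple⟫ x (fs k)) (cong₂ ℤ._-_ (ext-pos x (fs k)) (trans (cong (λ z → ext x (+ suc z)) (sym (FP.toℕ-inject₁ k))) (ext-pos x (inject₁ k))))

      simple-first : ∀ (x : Vecℤ n) → ⟪ x , simpleRoot fz ⟫ ≡ x fz
      simple-first x = trans (⟪simple⟫ x fz) (trans (ℤP.+-identityʳ _) (ext-pos x fz))

      highest-coord : ∀ (x : Vecℤ n) → ⟪ x , highest n ⟫ ≡ x (inject₁ (fromℕ m)) ℤ.+ x end
      highest-coord x = trans (⟪highest⟫ x) (cong₂ ℤ._+_ (trans (cong (λ z → ext x (+ suc z)) (sym (trans (FP.toℕ-inject₁ (fromℕ m)) (FP.toℕ-fromℕ m)))) (ext-pos x (inject₁ (fromℕ m))))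
         (trans (cong (ext x) (sym pos-end)) (ext-pos x end)))

      pS-pen : pS {n} (inject₁ (fromℕ m)) ≡ + 1 ℤ.+ + 2 ℤ.* + m
      pS-pen = trans (pS-val (inject₁ (fromℕ m))) (cong (λ z → + 1 ℤ.+ + 2 ℤ.* + z) (trans (FP.toℕ-inject₁ (fromℕ m)) (FP.toℕ-fromℕ m)))

      inject≢end : ∀ (k : Fin (suc m)) → inject₁ k ≢ end
      inject≢end k q = ℕP.<⇒≢ (FP.toℕ<n k) (trans (sym (FP.toℕ-inject₁ k)) (trans (cong toℕ q) (FP.toℕ-fromℕ (suc m))))

      pS-step : ∀ (k : Fin (suc m)) → pS {n} (fs k) ≡ pS {n} (inject₁ k) ℤ.+ + 2
      pS-step k = trans (pS-val (fs k)) (trans (lia 1 (λ k → ⊢ # 1 :+ # 2 :* (# 1 :+ k) := # 1 :+ # 2 :* k :+ # 2) (+ toℕ k))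
         (cong (ℤ._+ + 2) (sym (trans (pS-val (inject₁ k)) (cong (λ z → + 1 ℤ.+ + 2 ℤ.* + z) (FP.toℕ-inject₁ k))))))

      p-alcove : Alcove (N n) (pS {n})
      p-alcove = alcove-walls simple (subst (ℤ._< N n) (sym (highest-coord pS)) (lia 4 (λ a b N m → a := # 1 :+ # 2 :* m ⇒ b := # 3 :+ # 2 :* m ⇒ N := # 4 :+ # 4 :* (# 2 :+ m) ⇒ ⊢ a :+ b :< N)
          (pS (inject₁ (fromℕ m))) (pS end) (N n) (+ m) pS-pen pS-end (N-def n)))
        where
        simple : ∀ k → + 0 ℤ.< ⟪ pS , simpleRoot k ⟫
        simple fz = subst (+ 0 ℤ.<_) (sym (simple-first pS)) (+<+ (s≤s z≤n))
        simple (fs k) = subst (+ 0 ℤ.<_) (sym (simple-coord pS k)) (lia 2 (λ a b → a := b :+ # 2 ⇒ ⊢ # 0 :< a :- b) (pS {n} (fs k)) (pS {n} (inject₁ k)) (pS-step k))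

      p̂-alcove : Alcove (N n) p̂
      p̂-alcove = alcove-walls simple (subst (ℤ._< N n) (sym (trans (highest-coord p̂) (cong₂ ℤ._+_ (p̂-low _ (inject≢end (fromℕ m))) p̂-end)))
          (lia 4 (λ a b N m → a := # 1 :+ # 2 :* m ⇒ b := # 3 :+ # 2 :* m ⇒ ⊢ a :+ (N :- b) :< N) (pS (inject₁ (fromℕ m))) (pS end) (N n) (+ m) pS-pen pS-end))
        where
        simple : ∀ k → + 0 ℤ.< ⟪ p̂ , simpleRoot k ⟫
        simple fz = subst (+ 0 ℤ.<_) (sym (trans (simple-first p̂) (p̂-low fz (λ ())))) (+<+ (s≤s z≤n))
        simple (fs k) with fs k FP.≟ end
        ... | no q = subst (+ 0 ℤ.<_) (sym (trans (simple-coord p̂ k) (cong₂ ℤ._-_ (p̂-low (fs k) q) (p̂-low (inject₁ k) (inject≢end k))))) (lia 2 (λ a b → a := b :+ # 2 ⇒ ⊢ # 0 :< a :- b) (pS {n} (fs k)) (pS {n} (inject₁ k)) (pS-step k))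
        ... | yes q = subst (+ 0 ℤ.<_) (sym (trans (simple-coord p̂ k) (cong₂ ℤ._-_ (trans (cong p̂ q) p̂-end) (p̂-low (inject₁ k) (inject≢end k)))))
             (lia 5 (λ a b c N m → a := b :+ # 2 ⇒ a := c ⇒ c := # 3 :+ # 2 :* m ⇒ N := # 4 :+ # 4 :* (# 2 :+ m) ⇒ # 0 :≤ m ⇒ ⊢ # 0 :< N :- c :- b) (pS {n} (fs k)) (pS {n} (inject₁ k)) (pS {n} end) (N n) (+ m) (pS-step k) (cong pS q) pS-end (N-def n) (0≤ m))

    module _ (wf : AffW n) (iw : IsWf wf) where
      private
        g = lin wf
        t = tr wf
        hg : SPerm g
        hg = sperm (proj₁ (proj₁ iw))
        -- The vector (1, ..., n) pairs to 1 with every simple root and to 2n - 1 = h - 1 with the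
        -- highest one. Subtracting it therefore turns the inequalities that define w̃_f into those
        -- of A∘.
        Q₁ : Vecℤ n
        Q₁ = ptS wf +v ((ℤ.- N n) ·v pos)
        pos-step : ∀ (k : Fin (suc m)) → pos (fs k) ≡ pos (inject₁ k) ℤ.+ + 1
        pos-step k = trans (lia 1 (λ k → ⊢ # 2 :+ k := # 1 :+ k :+ # 1) (+ toℕ k)) (cong (λ z → + suc z ℤ.+ + 1) (sym (FP.toℕ-inject₁ k)))
        Q₁-alcove : Alcove (N n) Q₁
        Q₁-alcove = alcove-walls simple (subst (ℤ._< N n) (sym (highest-coord Q₁)) (lia 7 (λ a b h N m u v → h := a :+ b ⇒ h :< (# 2 :* (# 2 :+ m)) :* N ⇒ u := # 1 :+ m ⇒ v := # 2 :+ m ⇒ ⊢ a :+ (:- N) :* (# 1 :+ m) :+ (b :+ (:- N) :* (# 2 :+ m)) :< N)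
            (ptS wf (inject₁ (fromℕ m))) (ptS wf end) ⟪ ptS wf , highest n ⟫ (N n) (+ m) (pos (inject₁ (fromℕ m))) (pos end) (highest-coord (ptS wf))
            (subst (⟪ ptS wf , highest n ⟫ ℤ.<_) (trans (ℤP.pos-* (cox n) (Nsc n)) (cong (ℤ._* N n) (ℤP.pos-* 2 n))) (proj₂ (proj₂ iw))) posA pos-end
            |> subst₂ (λ u v → ptS wf (inject₁ (fromℕ m)) ℤ.+ (ℤ.- N n) ℤ.* u ℤ.+ (ptS wf end ℤ.+ (ℤ.- N n) ℤ.* v) ℤ.< N n) (sym posA) (sym pos-end)))
          where
          infixl 1 _|>_
          _|>_ : ∀ {A B : Set} → A → (A → B) → B
          x |> f = f x
          posA : pos (inject₁ (fromℕ m)) ≡ + suc m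
          posA = cong (λ z → + suc z) (trans (FP.toℕ-inject₁ (fromℕ m)) (FP.toℕ-fromℕ m))
          simple : ∀ k → + 0 ℤ.< ⟪ Q₁ , simpleRoot k ⟫
          simple fz = subst (+ 0 ℤ.<_) (sym (simple-first Q₁)) (lia 2 (λ a N → N :< a ⇒ ⊢ # 0 :< a :+ (:- N) :* # 1) (ptS wf fz) (N n) (subst (N n ℤ.<_) (simple-first (ptS wf)) (proj₁ (proj₂ iw) fz)))
          simple (fs k) = subst (+ 0 ℤ.<_) (sym (simple-coord Q₁ k)) (subst (λ z → + 0 ℤ.< ptS wf (fs k) ℤ.+ (ℤ.- N n) ℤ.* z ℤ.- (ptS wf (inject₁ k) ℤ.+ (ℤ.- N n) ℤ.* pos (inject₁ k))) (sym (pos-step k))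
             (lia 4 (λ a b N x → N :< a :- b ⇒ ⊢ # 0 :< a :+ (:- N) :* (x :+ # 1) :- (b :+ (:- N) :* x)) (ptS wf (fs k)) (ptS wf (inject₁ k)) (N n) (pos (inject₁ k)) (subst (N n ℤ.<_) (simple-coord (ptS wf) k) (proj₁ (proj₂ iw) (fs k)))))
        pt-at : ∀ i → ext (ptS wf) (g i) ≡ pS i ℤ.+ N n ℤ.* ρ-of wf i
        pt-at i = trans (ext-ptS wf (sp-sidx hg i)) (cong (ℤ._+ N n ℤ.* ρ-of wf i) (ext-actV hg pS i))
        solve-ρ : ∀ i d → ext (ptS wf) (g i) ≡ pS i ℤ.+ N n ℤ.* d → ρ-of wf i ≡ d
        solve-ρ i d h = N-cancel≡ n (lia 5 (λ a b c d N → a := b :+ N :* c ⇒ a := b :+ N :* d ⇒ ⊢ N :* c := N :* d) (ext (ptS wf) (g i)) (pS {n} i) (ρ-of wf i) d (N n) (pt-at i) h)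

      wf-shape : WfShape (ρ-of wf)
      wf-shape with mod4 n
      ... | even4 _ E = record { ρ-low = λ i _ → ρ= i ; ρ-end = inj₁ (E , trans (ρ= end) pos-end) }
        where
        z : Vecℤ n
        z = pos +v negv t
        fact : ∀ i → (g i ≡ pos i) × (pS i ≡ Q₁ i)
        fact = fundamental {z = z} (N-pos n) hg pos-sp p-alcove Q₁-alcove (InQ-+ {x = pos} {y = negv t} E (InQ-neg {x = t} (proj₂ (proj₁ iw))))
          (λ i → trans (lia 4 (λ a N t x → ⊢ a := a :+ N :* t :+ (:- N) :* x :+ N :* (x :+ (:- t))) (actV g pS i) (N n) (t i) (pos i)) (cong (ℤ._+ N n ℤ.* z i) (sym (actV-id Q₁ i))))
        ρ= : ∀ i → ρ-of wf i ≡ pos i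
        ρ= i = solve-ρ i (pos i) ((trans (cong (ext (ptS wf)) (proj₁ (fact i))) (trans (ext-pos (ptS wf) i)
            (lia 4 (λ a p N x → p := a :+ (:- N) :* x ⇒ ⊢ a := p :+ N :* x) (ptS wf i) (pS i) (N n) (pos i) (proj₂ (fact i))))))
      ... | odd4 _ _ E = record { ρ-low = ρ=low ; ρ-end = inj₂ (E , ρ=end) }
        where
        -- Undoing the flip of the last coordinate costs N times the image of eₙ, whose coordinate
        -- sum is odd; this repairs the parity of (1, ..., n).
        z : Vecℤ n
        z = (pos +v negv t) +v negv (Defs.e (g end))
        zQ : InQ z
        zQ = go (Σe-odd (sp-sidx hg end) (proj₁ (bd hg end))) E (proj₂ (proj₁ iw))
          where
          Σz : Σf n z ≡ Σf n pos ℤ.- Σf n t ℤ.- Σf n (Defs.e (g end))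
          Σz = trans (Σ-+ n (pos +v negv t) (negv (Defs.e (g end)))) (cong₂ ℤ._+_ (trans (Σ-+ n pos (negv t)) (cong (ℤ._+_ (Σf n pos)) (Σ-neg n t))) (Σ-neg n (Defs.e (g end))))
          go : (Σf n (Defs.e (g end)) ≡ + 1) ⊎ (Σf n (Defs.e (g end)) ≡ -[1+ 0 ]) → Even (Σf n pos ℤ.- + 1) → InQ t → InQ z
          go (inj₁ u) (k , p) (l , q) = k ℤ.- l , lia 6 (λ z T t e k l → z := T :- t :- e ⇒ e := # 1 ⇒ T :- # 1 := # 2 :* k ⇒ t := # 2 :* l ⇒ ⊢ z := # 2 :* (k :- l)) (Σf n z) (Σf n pos) (Σf n t) _ k l Σz u p q
          go (inj₂ u) (k , p) (l , q) = k ℤ.- l ℤ.+ + 1 , lia 6 (λ z T t e k l → z := T :- t :- e ⇒ e := con -[1+ 0 ] ⇒ T :- # 1 := # 2 :* k ⇒ t := # 2 :* l ⇒ ⊢ z := # 2 :* (k :- l :+ # 1)) (Σf n z) (Σf n pos) (Σf n t) _ k l Σz u p q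
        g′ = compSP g flip-end
        hg′ : SPerm g′
        hg′ = compSP-isSP hg flip-sp
        unflip : actV g′ p̂ ≈v (actV g pS +v ((ℤ.- N n) ·v Defs.e (g end)))
        unflip = ≈-via hg (λ i → trans (lhs i (i FP.≟ end)) (sym (rhs i (i FP.≟ end))))
          where
          val : Fin n → ℤ
          val i with i FP.≟ end
          ... | yes _ = pS i ℤ.- N n
          ... | no _ = pS i
          rhs : ∀ i → Dec (i ≡ end) → ext (actV g pS +v ((ℤ.- N n) ·v Defs.e (g end))) (g i) ≡ val i
          rhs i d = trans (ext-+ (actV g pS) ((ℤ.- N n) ·v Defs.e (g end)) (sp-sidx hg i)) (trans (cong₂ ℤ._+_ (ext-actV hg pS i) (ext-· (ℤ.- N n) (Defs.e (g end)) (sp-sidx hg i))) (fin d))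
            where
            fin : Dec (i ≡ end) → pS i ℤ.+ (ℤ.- N n) ℤ.* ext (Defs.e (g end)) (g i) ≡ val i
            fin _ with i FP.≟ end
            ... | yes refl = trans (cong (λ y → pS i ℤ.+ (ℤ.- N n) ℤ.* y) (ext-e-same (sp-sidx hg i) (proj₁ (bd hg i)))) (lia 2 (λ a N → ⊢ a :+ (:- N) :* # 1 := a :- N) (pS {n} i) (N n))
            ... | no q = trans (cong (λ y → pS i ℤ.+ (ℤ.- N n) ℤ.* y) (ext-e-diff (sp-sidx hg end) (sp-sidx hg i) (λ r → q (sym (sp-inj hg end i r))))) (lia 2 (λ a N → ⊢ a :+ (:- N) :* # 0 := a) (pS {n} i) (N n))
          lhs : ∀ i → Dec (i ≡ end) → ext (actV g′ p̂) (g i) ≡ val i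
          lhs i _ with i FP.≟ end
          ... | no q = trans (cong (ext (actV g′ p̂)) (sym (trans (cong (ext g) (flip-low i q)) (ext-pos g i)))) (trans (ext-actV hg′ p̂ i) (p̂-low i q))
          ... | yes refl = trans (cong (ext (actV g′ p̂)) (sym (trans (cong ℤ.-_ (trans (cong (ext g) flip-at) (ext-neg g end))) (ℤP.neg-involutive (g end)))))
               (trans (ext-odd (actV g′ p̂) (g′ end)) (trans (cong ℤ.-_ (trans (ext-actV hg′ p̂ end) p̂-end)) (lia 2 (λ N p → ⊢ :- (N :- p) := p :- N) (N n) (pS {n} end))))
        fact : ∀ i → (g′ i ≡ pos i) × (p̂ i ≡ Q₁ i)
        fact = fundamental {z = z} (N-pos n) hg′ pos-sp p̂-alcove Q₁-alcove zQ
          (λ i → trans (unflip i) (trans (lia 5 (λ a N t x e → ⊢ a :+ (:- N) :* e := a :+ N :* t :+ (:- N) :* x :+ N :* (x :+ (:- t) :+ (:- e))) (actV g pS i) (N n) (t i) (pos i) (Defs.e (g end) i)) (cong (ℤ._+ N n ℤ.* z i) (sym (actV-id Q₁ i)))))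
        ρ=low : ∀ i → i ≢ end → ρ-of wf i ≡ pos i
        ρ=low i q = solve-ρ i (pos i) ((trans (cong (ext (ptS wf)) gi) (trans (ext-pos (ptS wf) i)
            (lia 4 (λ a p N x → p := a :+ (:- N) :* x ⇒ ⊢ a := p :+ N :* x) (ptS wf i) (pS i) (N n) (pos i) (trans (sym (p̂-low i q)) (proj₂ (fact i)))))))
          where gi : g i ≡ pos i
                gi = trans (sym (trans (cong (ext g) (flip-low i q)) (ext-pos g i))) (proj₁ (fact i))
        ρ=end : ρ-of wf end ≡ ℤ.- (+ 1 ℤ.+ + n)
        ρ=end = solve-ρ end (ℤ.- (+ 1 ℤ.+ + n)) ((trans (cong (ext (ptS wf)) ge) (trans (ext-neg (ptS wf) end)
            (lia 5 (λ a p N x n → N :- p := a :+ (:- N) :* x ⇒ N :* x := N :* n ⇒ ⊢ :- a := p :+ N :* (:- (# 1 :+ n))) (ptS wf end) (pS end) (N n) (pos end) (+ n) (trans (sym p̂-end) (proj₂ (fact end))) (cong (N n ℤ.*_) pos-end)))))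
          where ge : g end ≡ neg end
                ge = trans (sym (ℤP.neg-involutive (g end))) (cong ℤ.-_ (trans (sym (trans (cong (ext g) flip-at) (ext-neg g end))) (proj₁ (fact end))))

    -- In the second case n + (n + 1) = 2n + 1, so ρ agrees with (1, ..., n) modulo 2n + 1. The
    -- quotient is then eₙ, which lies outside the coroot lattice.
    shapeκ : ∀ {ρ} → WfShape ρ → Σ (Vecℤ n) λ κ → ∀ i → pos i ℤ.- ρ i ≡ (+ 1 ℤ.+ + 2 ℤ.* + n) ℤ.* κ i
    shapeκ {ρ} W = go (WfShape.ρ-end W)
      where
      go : _ → Σ (Vecℤ n) λ κ → ∀ i → pos i ℤ.- ρ i ≡ (+ 1 ℤ.+ + 2 ℤ.* + n) ℤ.* κ i
      go (inj₁ (_ , h)) = (λ _ → + 0) , λ i → trans (ℤP.i≡j⇒i-j≡0 (eq i (i FP.≟ end))) (sym (ℤP.*-zeroʳ (+ 1 ℤ.+ + 2 ℤ.* + n)))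
        where eq : ∀ i → Dec (i ≡ end) → pos i ≡ ρ i
              eq i (yes refl) = trans pos-end (sym h)
              eq i (no q) = sym (WfShape.ρ-low W i q)
      go (inj₂ (_ , h)) = Defs.e (pos end) , λ i → eq i (i FP.≟ end)
        where eq : ∀ i → Dec (i ≡ end) → pos i ℤ.- ρ i ≡ (+ 1 ℤ.+ + 2 ℤ.* + n) ℤ.* Defs.e (pos end) i
              eq i (yes refl) = trans (cong₂ ℤ._-_ pos-end h) (trans (lia 1 (λ n → ⊢ n :- (:- (# 1 :+ n)) := (# 1 :+ # 2 :* n) :* # 1) (+ n)) (cong ((+ 1 ℤ.+ + 2 ℤ.* + n) ℤ.*_) (sym (e-pos-same end))))
              eq i (no q) = trans (ℤP.i≡j⇒i-j≡0 (sym (WfShape.ρ-low W i q))) (sym (trans (cong ((+ 1 ℤ.+ + 2 ℤ.* + n) ℤ.*_) (e-pos-diff end i (q ∘ sym))) (ℤP.*-zeroʳ (+ 1 ℤ.+ + 2 ℤ.* + n))))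

    anderson : AffW n → AffW n → Vecℤ n
    anderson wf a = negv (act a (negv (actV (invSP (lin wf)) (tr wf))))

    ext-anderson : ∀ {wf a μ} → SPerm (lin wf) → SPerm (lin a) → Framed {m} a μ → ∀ i → ext (anderson wf a) (lin a i) ≡ μ i ℤ.+ ρ-of wf i
    ext-anderson {wf} {a} {μ} hg ha f i = trans (ext-negv (act a y) (sp-sidx ha i)) (trans (cong ℤ.-_ (trans (ext-+ (actV (lin a) y) (tr a) (sp-sidx ha i)) (cong₂ ℤ._+_ (ext-actV ha y i) (f i))))
       (trans (cong (λ z → ℤ.- (ℤ.- z ℤ.+ ℤ.- μ i)) (actV-invSP hg (tr wf) i)) (lia 2 (λ r u → ⊢ :- ((:- r) :+ (:- u)) := u :+ r) (ρ-of wf i) (μ i))))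
      where y = negv (actV (invSP (lin wf)) (tr wf))

    -- `split` writes the point of the dilated alcove as p plus N times the Anderson vector plus
    -- `bigM` times an image of κ. The vector κ may lie outside the coroot lattice, but its images
    -- under the two linear parts have sums of equal parity, so their difference lies in it and
    -- `fundamental` applies.
    low-unique : ∀ {wf a b μ μ′ z} → IsWf wf → SPerm (lin a) → SPerm (lin b) → Framed {m} a μ → Framed {m} b μ′ → Low (lin a) μ → Low (lin b) μ′ → InQ z →
      (∀ i → anderson wf a i ≡ anderson wf b i ℤ.+ (+ 1 ℤ.+ + 2 ℤ.* + n) ℤ.* z i) → ∀ i → (lin a i ≡ lin b i) × (μ i ≡ μ′ i)
    low-unique {wf} {a} {b} {μ} {μ′} {z} iw ha hb fa fb La Lb zQ h i = proj₁ (fact i) , N-cancel≡ n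
        (lia 7 (λ p q N x y u v → p :+ N :* (x :+ u) := q :+ N :* (y :+ u) ⇒ p := q ⇒ ⊢ N :* x := N :* y) (pt n (lin a i)) (pt n (lin b i)) (N n) (μ i) (μ′ i) (pos i) (+ 0) (proj₂ (fact i)) (cong (pt n) (proj₁ (fact i))))
      where
      hg : SPerm (lin wf)
      hg = sperm (proj₁ (proj₁ iw))
      κs = shapeκ (wf-shape wf iw)
      κ = proj₁ κs
      split : ∀ {a μ} → SPerm (lin a) → Framed {m} a μ → actV (lin a) (simplexPt (lin a) μ) ≈v ((pS +v (N n ·v anderson wf a)) +v (bigM {m} ·v actV (lin a) κ))
      split {a} {μ} ha f = ≈-via ha (λ i → trans (ext-actV ha (simplexPt (lin a) μ) i) (sym (begin
         ext ((pS +v (N n ·v anderson wf a)) +v (bigM {m} ·v actV (lin a) κ)) (lin a i) ≡⟨ ext-+ (pS +v (N n ·v anderson wf a)) (bigM {m} ·v actV (lin a) κ) (sp-sidx ha i) ⟩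
         ext (pS +v (N n ·v anderson wf a)) (lin a i) ℤ.+ ext (bigM {m} ·v actV (lin a) κ) (lin a i) ≡⟨ cong₂ ℤ._+_ (ext-+ pS (N n ·v anderson wf a) (sp-sidx ha i)) (trans (ext-· (bigM {m}) (actV (lin a) κ) (sp-sidx ha i)) (cong (bigM {m} ℤ.*_) (ext-actV ha κ i))) ⟩
         pt n (lin a i) ℤ.+ ext (N n ·v anderson wf a) (lin a i) ℤ.+ bigM {m} ℤ.* κ i ≡⟨ cong (λ y → pt n (lin a i) ℤ.+ y ℤ.+ bigM {m} ℤ.* κ i) (trans (ext-· (N n) (anderson wf a) (sp-sidx ha i)) (cong (N n ℤ.*_) (ext-anderson {wf} {a} {μ} hg ha f i))) ⟩
         pt n (lin a i) ℤ.+ N n ℤ.* (μ i ℤ.+ ρ-of wf i) ℤ.+ bigM {m} ℤ.* κ i ≡⟨ lia 7 (λ p N x r h k y → N :* y := N :* (h :* k) ⇒ y := y ⇒ ⊢ p :+ N :* (x :+ r) :+ (N :* h) :* k := p :+ N :* (x :+ (r :+ y))) (pt n (lin a i)) (N n) (μ i) (ρ-of wf i) (+ 1 ℤ.+ + 2 ℤ.* + n) (κ i) (pos i ℤ.- ρ-of wf i) (cong (N n ℤ.*_) (proj₂ κs i)) refl ⟩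
         pt n (lin a i) ℤ.+ N n ℤ.* (μ i ℤ.+ (ρ-of wf i ℤ.+ (pos i ℤ.- ρ-of wf i))) ≡⟨ lia 5 (λ p N x r y → ⊢ p :+ N :* (x :+ (r :+ (y :- r))) := p :+ N :* (x :+ y)) (pt n (lin a i)) (N n) (μ i) (ρ-of wf i) (pos i) ⟩
         simplexPt (lin a) μ i ∎)))
         where open ≡-Reasoning
      z′ : Vecℤ n
      z′ = z +v (actV (lin a) κ +v negv (actV (lin b) κ))
      z′Q : InQ z′
      z′Q = InQ-+ {x = z} {y = actV (lin a) κ +v negv (actV (lin b) κ)} zQ (go (actV-even ha κ) (actV-even hb κ))
        where
        go : Even (Σf n (actV (lin a) κ) ℤ.- Σf n κ) → Even (Σf n (actV (lin b) κ) ℤ.- Σf n κ) → InQ (actV (lin a) κ +v negv (actV (lin b) κ))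
        go (k , p) (l , q) = k ℤ.- l , trans (trans (Σ-+ n (actV (lin a) κ) (negv (actV (lin b) κ))) (cong (ℤ._+_ (Σf n (actV (lin a) κ))) (Σ-neg n (actV (lin b) κ))))
           (lia 5 (λ a b c k l → a :- c := # 2 :* k ⇒ b :- c := # 2 :* l ⇒ ⊢ a :+ (:- b) := # 2 :* (k :- l)) (Σf n (actV (lin a) κ)) (Σf n (actV (lin b) κ)) (Σf n κ) k l p q)
      bigM>0 : + 0 ℤ.< bigM {m}
      bigM>0 = lia 2 (λ N y → # 0 :< N ⇒ N :* # 0 :≤ N :* y ⇒ ⊢ # 0 :< N :* (# 1 :+ y)) (N n) (+ 2 ℤ.* + n) (N-pos n) (Npos-mono n (subst (+ 0 ℤ.≤_) (ℤP.pos-* 2 n) (0≤ (2 ℕ.* n))))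
      fact : ∀ i → (lin a i ≡ lin b i) × (simplexPt (lin a) μ i ≡ simplexPt (lin b) μ′ i)
      fact = fundamental {z = z′} bigM>0 ha hb La Lb z′Q (λ i → trans (split {a} {μ} ha fa i) (trans
          (lia 8 (λ p N x y h z u v → x := y :+ h :* z ⇒ N :* x := N :* (y :+ h :* z) ⇒ ⊢ p :+ N :* x :+ (N :* h) :* u := p :+ N :* y :+ (N :* h) :* v :+ (N :* h) :* (z :+ (u :+ (:- v))))
            (pS i) (N n) (anderson wf a i) (anderson wf b i) (+ 1 ℤ.+ + 2 ℤ.* + n) (z i) (actV (lin a) κ i) (actV (lin b) κ i) (h i) (cong (N n ℤ.*_) (h i)))
          (cong (ℤ._+ bigM {m} ℤ.* z′ i) (sym (split {b} {μ′} hb fb i)))))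

  module _ {m : ℕ} (π : Word) (v : SP (suc (suc m))) (inV : InVert (suc (suc m)) π v) where
    private
      n = suc (suc m)
      W = w′ π v inV
      M = mu n π
      hW = w′-sp π v inV
      en = last π v inV

    candidate : AffW n
    candidate = aff W (actV W (negv M))

    candidate-framed : Framed {m} candidate M
    candidate-framed i = ext-actV hW (negv M) i

    candidate-affine : IsAffW candidate
    candidate-affine = isSP hW , InQ-actV hW {negv M} (InQ-neg {x = M} (mu-InQ π v inV))

    candidate-ShiMin : ShiMin candidate
    candidate-ShiMin = low⇒ShiMin {a = candidate} {M} candidate-affine candidate-framed (candidate-low π v inV)

    -- Equality holds and not only congruence: the flip between u·λ and the frame of the candidate
    -- and the flip inside w̃_f are decided by the same parity, that of 1 + ... + n.
    anderson-candidate : ∀ {wf} → IsWf wf → anderson wf candidate ≈v psi n π v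
    anderson-candidate {wf} iw = ≈-via hW (λ i → trans (ext-anderson {wf = wf} {candidate} {M} (sperm (proj₁ (proj₁ iw))) hW candidate-framed i) (sym (at i (row? π v inV i))))
      where
      Sh = wf-shape wf iw
      u = uSP n π v
      L = lam n π
      u-abs : ∀ i → ∣ u i ∣ ≡ ∣ v i ∣
      u-abs i = go (row? π v inV i)
        where
        go : Row π v inV i → ∣ u i ∣ ≡ ∣ v i ∣
        go (low-row h) = cong ∣_∣ (u-low π v inV i h)
        go (last-row refl) with u-case π v inV
        ... | inj₁ (_ , h , _) = cong ∣_∣ h
        ... | inj₂ (_ , h , _) = trans (cong ∣_∣ h) (ℤP.∣-i∣≡∣i∣ (v i))
      hu : SPerm u
      hu = sperm ((λ i → subst (1 ℕ.≤_) (sym (u-abs i)) (proj₁ (bd (hv π v inV) i)) , subst (ℕ._≤ n) (sym (u-abs i)) (proj₂ (bd (hv π v inV) i)))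
         , λ i j q → sp-inj (hv π v inV) i j (trans (sym (u-abs i)) (trans q (u-abs j))))
      at : ∀ i → Row π v inV i → ext (psi n π v) (W i) ≡ M i ℤ.+ ρ-of wf i
      at i (low-row h) = trans (cong (ext (psi n π v)) (trans (w′-low π v inV i h (v i)) (sym (u-low π v inV i h)))) (trans (ext-actV hu L i)
          (trans (lam-low π v inV i h) (trans (lia 2 (λ a b → ⊢ a := a :- b :+ b) (qs π v inV (suc (toℕ i))) (pos i)) (cong₂ ℤ._+_ (sym (mu-low π v inV i h)) (sym (WfShape.ρ-low Sh i ne))))))
        where ne : i ≢ end
              ne q = ℕP.<⇒≢ h (trans (cong (suc ∘ toℕ) q) (cong suc (FP.toℕ-fromℕ (suc m))))
      at i (last-row refl) = go (diagCase π v inV) (WfShape.ρ-end Sh)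
        where
        go : DiagCase π v inV → _ → ext (psi n π v) (W en) ≡ M en ℤ.+ ρ-of wf en
        go (diag-keep _ l e) (inj₁ (_ , r)) = trans (cong (ext (psi n π v)) (sym e)) (trans (ext-actV hu L en) (trans l (cong (ℤ._+_ (M en)) (sym r))))
        go (diag-flip _ l e) (inj₂ (_ , r)) = trans (cong (ext (psi n π v)) (trans (sym (ℤP.neg-involutive (W en))) (cong ℤ.-_ (sym e)))) (trans (ext-odd (psi n π v) (u en)) (trans (cong ℤ.-_ (ext-actV hu L en))
            (lia 4 (λ l x n r → l := # 1 :+ # 2 :* n :- (x :+ n) ⇒ r := :- (# 1 :+ n) ⇒ ⊢ :- l := x :+ r) (L en) (M en) (+ n) (ρ-of wf en) l r)))
        go (diag-keep E _ _) (inj₂ (E' , _)) = ⊥-elim (not-both E E')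
        go (diag-flip E' _ _) (inj₁ (E , _)) = ⊥-elim (not-both E E')

    candidate-anderson : ∀ {wf} → IsWf wf → AndersonIs wf candidate (psi n π v)
    candidate-anderson {wf} iw = (λ _ → + 0) , (+ 0 , Σ-zero n _ (λ _ → refl)) , λ i → trans (ℤP.i≡j⇒i-j≡0 (anderson-candidate {wf} iw i)) (sym (ℤP.*-zeroʳ (+ suc (cox n))))

    anderson-unique : ∀ {wf a} → IsWf wf → ShiMin a → AndersonIs wf a (psi n π v) → (∀ i → lin a i ≡ W i) × Framed {m} a M
    anderson-unique {wf} {a} iw S (z , zQ , h) = (λ i → proj₁ (fact i)) , (λ i → trans (sym (ℤP.neg-involutive _)) (cong ℤ.-_ (proj₂ (fact i))))
      where
      μ : Vecℤ n
      μ i = ℤ.- ext (tr a) (lin a i)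
      ha : SPerm (lin a)
      ha = sperm (proj₁ (proj₁ S))
      fr : Framed {m} a μ
      fr i = sym (ℤP.neg-involutive _)
      fact : ∀ i → (lin a i ≡ W i) × (μ i ≡ M i)
      fact = low-unique {wf = wf} {a} {candidate} {μ} {M} {z} iw ha hW fr candidate-framed (ShiMin⇒low {a = a} {μ} fr S) (candidate-low π v inV) zQ
        (λ i → trans (lia 3 (λ a b c → a :- b := c ⇒ ⊢ a := b :+ c) (anderson wf a i) (psi n π v i) (+ suc (cox n) ℤ.* z i) (h i)) (cong₂ (λ x y → x ℤ.+ y ℤ.* z i) (sym (anderson-candidate {wf} iw i)) (cong (ℤ._+_ (+ 1)) (ℤP.pos-* 2 n))))

open Uniqueness using (candidate; candidate-ShiMin; candidate-anderson; anderson-unique)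

-- The signed rows sorted by X, and the permutation d_B.

module RowOrder where

  AllPairs-concatMap : ∀ {I A : Set} {Q : I → I → Set} {R : A → A → Set} (B : I → List A) →
    (∀ i → AllPairs R (B i)) → (∀ {i j a b} → Q i j → a ∈ B i → b ∈ B j → R a b) → ∀ {is} → AllPairs Q is → AllPairs R (concatMap B is)
  AllPairs-concatMap B h g [] = []
  AllPairs-concatMap {Q = Q} {R} B h g {i ∷ is} (q ∷ qs) = APP.++⁺ (h i) (AllPairs-concatMap B h g qs)
    (All.tabulate λ {a} ma → All.tabulate λ {b} mb → cross ma (∈P.∈-concatMap⁻ B mb) q)
    where
    cross : ∀ {a b is} → a ∈ B i → Any ((b ∈_) ∘ B) is → All (Q i) is → R a b
    cross ma (here mb) (q ∷ _) = g q ma mb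
    cross ma (there mb) (_ ∷ qs) = cross ma mb qs

  AllPairs-reverse : ∀ {A : Set} {R : A → A → Set} {xs : List A} → AllPairs R xs → AllPairs (λ a b → R b a) (reverse xs)
  AllPairs-reverse [] = []
  AllPairs-reverse {R = R} {x ∷ xs} (q ∷ qs) = subst (AllPairs (λ a b → R b a)) (sym (LP.unfold-reverse x xs))
    (APP.++⁺ (AllPairs-reverse qs) ([] ∷ []) (All.tabulate λ m → All.lookup q (AnyP.reverse⁻ m) ∷ []))

  allFin-sorted : ∀ n → AllPairs (λ (i j : Fin n) → toℕ i ℕ.< toℕ j) (allFin n)
  allFin-sorted n = APP.tabulate⁺-< id

  lookup-pairs : ∀ {A : Set} {R : A → A → Set} {xs : List A} → AllPairs R xs → ∀ i j → toℕ i ℕ.< toℕ j → R (lookup xs i) (lookup xs j)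
  lookup-pairs (q ∷ qs) fz (fs j) h = All.lookup q (∈P.∈-lookup j)
  lookup-pairs (q ∷ qs) (fs i) (fs j) (s≤s h) = lookup-pairs qs i j h

  nthℤ-lookup : ∀ {A : Set} (f : A → ℤ) xs (i : Fin (length xs)) → nthℤ (map f xs) (toℕ i) ≡ f (lookup xs i)
  nthℤ-lookup f (x ∷ xs) fz = refl
  nthℤ-lookup f (x ∷ xs) (fs i) = nthℤ-lookup f xs i

  -- Sortedness by an irreflexive relation excludes repetitions and completeness excludes omissions;
  -- each gives one bound by the pigeonhole principle.
  enum-length : ∀ {n} {R : Fin n → Fin n → Set} (xs : List (Fin n)) → AllPairs R xs → (∀ i → ¬ R i i) → (∀ i → i ∈ xs) → length xs ≡ n
  enum-length {n} {R} xs s irr c = ℕP.≤-antisym (FP.injective⇒≤ {f = lookup xs} inj₁′) (FP.injective⇒≤ {f = λ i → Any.index (c i)} inj₂′)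
    where
    inj₁′ : ∀ {i j} → lookup xs i ≡ lookup xs j → i ≡ j
    inj₁′ {i} {j} q with ℕP.<-cmp (toℕ i) (toℕ j)
    ... | tri< h _ _ = ⊥-elim (irr (lookup xs j) (subst (λ z → R z (lookup xs j)) q (lookup-pairs s i j h)))
    ... | tri≈ _ h _ = FP.toℕ-injective h
    ... | tri> _ _ h = ⊥-elim (irr (lookup xs j) (subst (λ z → R (lookup xs j) z) q (lookup-pairs s j i h)))
    inj₂′ : ∀ {i j} → Any.index (c i) ≡ Any.index (c j) → i ≡ j
    inj₂′ {i} {j} q = trans (AnyP.lookup-index (c i)) (trans (cong (lookup xs) q) (sym (AnyP.lookup-index (c j))))

  eqℤ-sound : ∀ {a b} → eqℤ a b ≡ true → a ≡ b
  eqℤ-sound {a} {b} h with a ℤP.≟ b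
  ... | yes q = q
  eqℤ-sound () | no _

  eqℤ-complete : ∀ {a b} → a ≡ b → eqℤ a b ≡ true
  eqℤ-complete {a} refl = eqℤ-refl a

  only : ∀ {A : Set} → Bool → A → List A
  only b x = if b then x ∷ [] else []

  only-∈ : ∀ {A : Set} {b} {x y : A} → y ∈ only b x → (b ≡ true) × (y ≡ x)
  only-∈ {b = true} (here q) = refl , q

  only-in : ∀ {A : Set} {b} {x : A} → b ≡ true → x ∈ only b x
  only-in refl = here refl

  only-sorted : ∀ {A : Set} {R : A → A → Set} b (x : A) → AllPairs R (only b x)
  only-sorted true x = [] ∷ []
  only-sorted false x = []

  ∈-emit : ∀ {I A : Set} (F : I → List A) {is a i} → i ∈ is → a ∈ F i → a ∈ concatMap F is
  ∈-emit F mi ma = ∈P.∈-concatMap⁺ F (Any.map (λ { refl → ma }) mi)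

  ∈-emit⁻ : ∀ {I A : Set} (F : I → List A) is {a} → a ∈ concatMap F is → ∃ λ i → i ∈ is × a ∈ F i
  ∈-emit⁻ F is m = locate (∈P.∈-concatMap⁻ F m)
    where
    locate : ∀ {is a} → Any ((a ∈_) ∘ F) is → ∃ λ i → i ∈ is × a ∈ F i
    locate (here q) = _ , here refl , q
    locate (there q) with locate q
    ... | i , mi , ma = i , there mi , ma

  -- With these bounds the rounds i = 0, ..., 2n of d_B, and likewise the sweeps of the zeta map,
  -- reach every row.
  low-bounds : ∀ {m} {w : SP (suc (suc m))} {μ} → SPerm w → Low {m} w μ → ∀ i → (ℤ.- (+ suc (suc m)) ℤ.≤ μ i) × (μ i ℤ.≤ + 2 ℤ.* + suc (suc m))
  low-bounds {m} {w} {μ} hw L i = lia 3 (λ u x n → # 0 :- # 1 :< u :+ x ⇒ x :≤ n ⇒ ⊢ :- n :≤ u) (μ i) (pos i) (+ n) lo′ (+≤+ (FP.toℕ<n i))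
    , lia 3 (λ u x n → u :+ x :< # 2 :* n :+ # 2 ⇒ # 1 :≤ x ⇒ ⊢ u :≤ # 2 :* n) (μ i) (pos i) (+ n) hi′ (+≤+ (s≤s z≤n))
    where
    n = suc (suc m)
    lo′ : + 0 ℤ.- + 1 ℤ.< μ i ℤ.+ pos i
    lo′ = N-cancel< n {+ 0 ℤ.- + 1} {μ i ℤ.+ pos i} (lia 3 (λ p N x → # 0 :< p :+ N :* x ⇒ # 2 :* p :< N ⇒ # 0 :< N ⇒ ⊢ N :* (# 0 :- # 1) :< N :* x) (pt n (w i)) (N n) (μ i ℤ.+ pos i) (pos>0 L i) (proj₁ (pt-bound (sp-sidx hw i))) (N-pos n))
    hi′ : μ i ℤ.+ pos i ℤ.< + 2 ℤ.* + n ℤ.+ + 2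
    hi′ = N-cancel< n {μ i ℤ.+ pos i} {+ 2 ℤ.* + n ℤ.+ + 2} (lia 4 (λ p N x n → p :+ N :* x :< N :* (# 1 :+ # 2 :* n) ⇒ :- N :< # 2 :* p ⇒ # 0 :< N ⇒ ⊢ N :* x :< N :* (# 2 :* n :+ # 2)) (pt n (w i)) (N n) (μ i ℤ.+ pos i) (+ n) (x<M L i) (proj₂ (pt-bound (sp-sidx hw i))) (N-pos n))

  module _ {m : ℕ} (μ : Vecℤ (suc (suc m))) (μ-lo : ∀ i → ℤ.- (+ suc (suc m)) ℤ.≤ μ i) (μ-hi : ∀ i → μ i ℤ.≤ + 2 ℤ.* + suc (suc m)) where
    private n = suc (suc m)

    p₊ : Fin n → ℤ
    p₊ i = pt n (pos i)

    p₊-bounds : ∀ i → (+ 0 ℤ.< p₊ i) × (+ 2 ℤ.* p₊ i ℤ.< N n)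
    p₊-bounds i = pt-mono {n} zr (ps i) (+<+ (s≤s z≤n)) , proj₁ (pt-bound (ps i))

    p₊-mono : ∀ {i j} → toℕ i ℕ.< toℕ j → p₊ i ℤ.< p₊ j
    p₊-mono h = pt-mono (ps _) (ps _) (+<+ (s≤s h))

    X-pos : ∀ i {k} → μ i ≡ k → X μ (pos i) ≡ p₊ i ℤ.- N n ℤ.* k
    X-pos i q = cong (λ z → p₊ i ℤ.- N n ℤ.* z) (trans (ext-pos μ i) q)

    X-neg : ∀ i {k} → μ i ≡ k → X μ (neg i) ≡ N n ℤ.* k ℤ.- p₊ i
    X-neg i {k} q = trans (X-odd μ (pos i)) (trans (cong ℤ.-_ (X-pos i q)) (lia 3 (λ p N k → ⊢ :- (p :- N :* k) := N :* k :- p) (p₊ i) (N n) k))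

    -- Of the two signs of a row, the one at which X is positive; this works because p lies between
    -- 0 and N/2 at positive indices.
    signedRow : ℤ → Fin n → ℤ
    signedRow (+ suc _) j = neg j
    signedRow _ j = pos j

    srow : Fin n → ℤ
    srow j = signedRow (μ j) j

    srow-neg : ∀ j {k} → μ j ≡ + suc k → srow j ≡ neg j
    srow-neg j q = cong (λ z → signedRow z j) q

    srow-pos : ∀ j {k} → μ j ≡ ℤ.- (+ k) → srow j ≡ pos j
    srow-pos j {zero} q = cong (λ z → signedRow z j) q
    srow-pos j {suc k} q = cong (λ z → signedRow z j) q

    incr decr block : ℕ → List (Fin n)
    incr i = concatMap (λ j → only (eqℤ (μ j) (ℤ.- (+ i))) j) (allFin n)
    decr i = concatMap (λ j → only (eqℤ (μ j) (+ suc i)) j) (reverse (allFin n))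
    block i = incr i ++ decr i

    in-incr : ∀ i {j} → μ j ≡ ℤ.- (+ i) → j ∈ incr i
    in-incr i {j} q = ∈-emit (λ j → only (eqℤ (μ j) (ℤ.- (+ i))) j) (∈P.∈-allFin j) (only-in (eqℤ-complete q))

    incr-∈ : ∀ i {j} → j ∈ incr i → μ j ≡ ℤ.- (+ i)
    incr-∈ i h with ∈-emit⁻ (λ j → only (eqℤ (μ j) (ℤ.- (+ i))) j) (allFin n) h
    ... | k , _ , h' with only-∈ {b = eqℤ (μ k) (ℤ.- (+ i))} h'
    ... | b , refl = eqℤ-sound b

    decr-∈ : ∀ i {j} → j ∈ decr i → μ j ≡ + suc i
    decr-∈ i h with ∈-emit⁻ (λ j → only (eqℤ (μ j) (+ suc i)) j) (reverse (allFin n)) h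
    ... | k , _ , h' with only-∈ {b = eqℤ (μ k) (+ suc i)} h'
    ... | b , refl = eqℤ-sound b

    key : Fin n → ℤ
    key j = X μ (srow j)

    key-incr : ∀ i {j} → μ j ≡ ℤ.- (+ i) → key j ≡ p₊ j ℤ.+ N n ℤ.* + i
    key-incr i {j} q = trans (cong (X μ) (srow-pos j {i} q)) (trans (X-pos j q) (lia 3 (λ p N i → ⊢ p :- N :* (:- i) := p :+ N :* i) (p₊ j) (N n) (+ i)))

    key-decr : ∀ i {j} → μ j ≡ + suc i → key j ≡ N n ℤ.* (+ 1 ℤ.+ + i) ℤ.- p₊ j
    key-decr i {j} q = trans (cong (X μ) (srow-neg j q)) (X-neg j q)

    -- Block i fills the strip from N i to N (i + 1). Rows with μ = -i lie in its lower half at N i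
    -- + p, rows with μ = i + 1 in its upper half at N (i + 1) - p, which is why they are read in
    -- decreasing order.
    key-range : ∀ i {j} → j ∈ block i → (N n ℤ.* + i ℤ.< key j) × (key j ℤ.< N n ℤ.* (+ 1 ℤ.+ + i))
    key-range i {j} h with ∈P.∈-++⁻ (incr i) h
    ... | inj₁ h' = subst (λ z → (N n ℤ.* + i ℤ.< z) × (z ℤ.< N n ℤ.* (+ 1 ℤ.+ + i))) (sym (key-incr i (incr-∈ i h')))
        (lia 3 (λ p N i → # 0 :< p ⇒ ⊢ N :* i :< p :+ N :* i) (p₊ j) (N n) (+ i) (proj₁ (p₊-bounds j))
        , lia 3 (λ p N i → # 2 :* p :< N ⇒ # 0 :< p ⇒ ⊢ p :+ N :* i :< N :* (# 1 :+ i)) (p₊ j) (N n) (+ i) (proj₂ (p₊-bounds j)) (proj₁ (p₊-bounds j)))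
    ... | inj₂ h' = subst (λ z → (N n ℤ.* + i ℤ.< z) × (z ℤ.< N n ℤ.* (+ 1 ℤ.+ + i))) (sym (key-decr i (decr-∈ i h')))
        (lia 3 (λ p N i → # 2 :* p :< N ⇒ # 0 :< p ⇒ ⊢ N :* i :< N :* (# 1 :+ i) :- p) (p₊ j) (N n) (+ i) (proj₂ (p₊-bounds j)) (proj₁ (p₊-bounds j))
        , lia 3 (λ p N i → # 0 :< p ⇒ ⊢ N :* (# 1 :+ i) :- p :< N :* (# 1 :+ i)) (p₊ j) (N n) (+ i) (proj₁ (p₊-bounds j)))

    _≺_ : Fin n → Fin n → Set
    a ≺ b = key a ℤ.< key b

    block-sorted : ∀ i → AllPairs _≺_ (block i)
    block-sorted i = APP.++⁺ (AllPairs-concatMap _ (λ j → only-sorted _ j) inc (allFin-sorted n)) (AllPairs-concatMap _ (λ j → only-sorted _ j) dec (AllPairs-reverse (allFin-sorted n)))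
       (All.tabulate λ {a} ma → All.tabulate λ {b} mb → subst₂ ℤ._<_ (sym (key-incr i (incr-∈ i ma))) (sym (key-decr i (decr-∈ i mb)))
          (lia 4 (λ p q N i → # 2 :* p :< N ⇒ # 2 :* q :< N ⇒ ⊢ p :+ N :* i :< N :* (# 1 :+ i) :- q) (p₊ a) (p₊ b) (N n) (+ i) (proj₂ (p₊-bounds a)) (proj₂ (p₊-bounds b))))
      where
      inc : ∀ {k l a b} → toℕ k ℕ.< toℕ l → a ∈ only (eqℤ (μ k) (ℤ.- (+ i))) k → b ∈ only (eqℤ (μ l) (ℤ.- (+ i))) l → a ≺ b
      inc {k} {l} h ma mb with only-∈ {b = eqℤ (μ k) (ℤ.- (+ i))} ma | only-∈ {b = eqℤ (μ l) (ℤ.- (+ i))} mb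
      ... | u , refl | v , refl = subst₂ ℤ._<_ (sym (key-incr i (eqℤ-sound u))) (sym (key-incr i (eqℤ-sound v))) (ℤP.+-monoˡ-< (N n ℤ.* + i) (p₊-mono h))
      dec : ∀ {k l a b} → toℕ l ℕ.< toℕ k → a ∈ only (eqℤ (μ k) (+ suc i)) k → b ∈ only (eqℤ (μ l) (+ suc i)) l → a ≺ b
      dec {k} {l} h ma mb with only-∈ {b = eqℤ (μ k) (+ suc i)} ma | only-∈ {b = eqℤ (μ l) (+ suc i)} mb
      ... | u , refl | v , refl = subst₂ ℤ._<_ (sym (key-decr i (eqℤ-sound u))) (sym (key-decr i (eqℤ-sound v)))
          (lia 3 (λ p q M → q :< p ⇒ ⊢ M :- p :< M :- q) (p₊ k) (p₊ l) (N n ℤ.* (+ 1 ℤ.+ + i)) (p₊-mono h))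

    private
      2n : + cox n ≡ + 2 ℤ.* + n
      2n = ℤP.pos-* 2 n

    order-complete′ : ∀ j → j ∈ concatMap block (upTo (suc (cox n)))
    order-complete′ j = go (μ j) refl
      where
      go : ∀ z → μ j ≡ z → j ∈ concatMap block (upTo (suc (cox n)))
      go (+ zero) q = ∈-emit block (∈P.∈-upTo⁺ {suc (cox n)} {0} (s≤s z≤n)) (∈P.∈-++⁺ˡ (in-incr 0 q))
      go (+ suc i) q = ∈-emit block (∈P.∈-upTo⁺ {suc (cox n)} {i} (ℕP.≤-trans (ℤP.drop‿+≤+ (subst₂ ℤ._≤_ q (sym 2n) (μ-hi j))) (ℕP.n≤1+n (cox n))))
         (∈P.∈-++⁺ʳ (incr i) (∈-emit (λ j → only (eqℤ (μ j) (+ suc i)) j) (AnyP.reverse⁺ (∈P.∈-allFin j)) (only-in (eqℤ-complete q))))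
      go -[1+ i ] q = ∈-emit block (∈P.∈-upTo⁺ {suc (cox n)} {suc i} (s≤s (ℤP.drop‿+≤+ (lia 4 (λ u i n c → u := :- (# 1 :+ i) ⇒ :- n :≤ u ⇒ c := # 2 :* n ⇒ # 0 :≤ n ⇒ ⊢ # 1 :+ i :≤ c) (μ j) (+ i) (+ n) (+ cox n) q (μ-lo j) 2n (0≤ n)))))
         (∈P.∈-++⁺ˡ (in-incr (suc i) q))

    -- kept abstract so that the type checker never unfolds the list
    abstract
      order : List (Fin n)
      order = concatMap block (upTo (suc (cox n)))

      order-def : order ≡ concatMap block (upTo (suc (cox n)))
      order-def = refl

    order-complete : ∀ j → j ∈ order
    order-complete j = subst (j ∈_) (sym order-def) (order-complete′ j)

    order-sorted : AllPairs _≺_ order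
    order-sorted = subst (AllPairs _≺_) (sym order-def) (AllPairs-concatMap block block-sorted cross (APP.applyUpTo⁺₁ id (suc (cox n)) (λ h _ → h)))
      where
      cross : ∀ {i i' a b} → i ℕ.< i' → a ∈ block i → b ∈ block i' → a ≺ b
      cross {i} {i'} {a} {b} h ma mb = lia 5 (λ u v N i i' → u :< N :* (# 1 :+ i) ⇒ N :* i' :< v ⇒ N :* (# 1 :+ i) :≤ N :* i' ⇒ ⊢ u :< v) (key a) (key b) (N n) (+ i) (+ i')
         (proj₂ (key-range i ma)) (proj₁ (key-range i' mb)) (Npos-mono n {+ 1 ℤ.+ + i} {+ i'} (+≤+ h))

    order-length : length order ≡ n
    order-length = enum-length order order-sorted (λ i h → ℤP.<-irrefl refl h) order-complete

    nth : Fin n → Fin n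
    nth k = lookup order (cast (sym order-length) k)

    τ : SP n
    τ k = srow (nth k)

    srow-abs : ∀ j → ∣ srow j ∣ ≡ suc (toℕ j)
    srow-abs j with μ j
    ... | + zero = refl
    ... | + suc _ = refl
    ... | -[1+ _ ] = refl

    τ-mono : ∀ {k l} → toℕ k ℕ.< toℕ l → X μ (τ k) ℤ.< X μ (τ l)
    τ-mono {k} {l} h = lookup-pairs order-sorted (cast (sym order-length) k) (cast (sym order-length) l) (subst₂ ℕ._<_ (sym (FP.toℕ-cast (sym order-length) k)) (sym (FP.toℕ-cast (sym order-length) l)) h)

    τ-abs : ∀ k → ∣ τ k ∣ ≡ suc (toℕ (nth k))
    τ-abs k = srow-abs (nth k)

    τ-inj : ∀ k l → ∣ τ k ∣ ≡ ∣ τ l ∣ → k ≡ l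
    τ-inj k l q = go (ℕP.<-cmp (toℕ k) (toℕ l))
      where
      same : nth k ≡ nth l
      same = FP.toℕ-injective (ℕP.suc-injective (trans (sym (τ-abs k)) (trans q (τ-abs l))))
      eq : X μ (τ k) ≡ X μ (τ l)
      eq = cong (λ j → X μ (srow j)) same
      go : Tri (toℕ k ℕ.< toℕ l) (toℕ k ≡ toℕ l) (toℕ l ℕ.< toℕ k) → k ≡ l
      go (tri< h _ _) = ⊥-elim (ℤP.<-irrefl eq (τ-mono {k} {l} h))
      go (tri≈ _ h _) = FP.toℕ-injective h
      go (tri> _ _ h) = ⊥-elim (ℤP.<-irrefl (sym eq) (τ-mono {l} {k} h))

    τ-range : ∀ k → (1 ℕ.≤ ∣ τ k ∣) × (∣ τ k ∣ ℕ.≤ n)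
    τ-range k = subst (1 ℕ.≤_) (sym (τ-abs k)) (s≤s z≤n) , subst (ℕ._≤ n) (sym (τ-abs k)) (FP.toℕ<n (nth k))

    τ-sp : SPerm τ
    τ-sp = sperm (τ-range , τ-inj)

    key-pos : ∀ j → + 0 ℤ.< key j
    key-pos j = go (∈-emit⁻ block (upTo (suc (cox n))) (order-complete′ j))
      where
      go : (∃ λ i → i ∈ upTo (suc (cox n)) × j ∈ block i) → + 0 ℤ.< key j
      go (i , _ , h) = ℤP.≤-<-trans (subst (ℤ._≤ N n ℤ.* + i) (ℤP.*-zeroʳ (N n)) (Npos-mono n (0≤ i))) (proj₁ (key-range i h))

    -- T lists the signed rows in increasing order of X; P is its inverse
    T P : ℤ → ℤ
    T u = ext τ u
    P t = ext (invSP τ) t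

    T-sidx : ∀ {u} → SIdx n u → SIdx n (T u)
    T-sidx = ext-sidx (sp-sidx τ-sp)

    P-sidx : ∀ {t} → SIdx n t → SIdx n (P t)
    P-sidx = ext-sidx (sp-sidx (invSP-isSP τ-sp))

    XT : Vecℤ n
    XT k = X μ (τ k)

    ext-XT : ∀ {u} → SIdx n u → ext XT u ≡ X μ (T u)
    ext-XT (ps k) = trans (ext-pos XT k) (cong (X μ) (sym (ext-pos τ k)))
    ext-XT zr = lia 1 (λ N → ⊢ # 0 := # 0 :- N :* # 0) (N n)
    ext-XT (ng k) = trans (ext-neg XT k) (trans (sym (X-odd μ (τ k))) (cong (X μ) (sym (ext-neg τ k))))

    -- In the order τ the values X are positive and increasing; later this places the alcove in the
    -- chamber of d_B.
    XT-chamber : ∀ k → + 0 ℤ.< ⟪ XT , simpleRoot k ⟫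
    XT-chamber fz = subst (+ 0 ℤ.<_) (sym (trans (⟪simple⟫ XT fz) (trans (ℤP.+-identityʳ _) (ext-pos XT fz)))) (key-pos (nth fz))
    XT-chamber (fs k) = subst (+ 0 ℤ.<_) (sym (trans (⟪simple⟫ XT (fs k)) (cong₂ ℤ._-_ (ext-pos XT (fs k)) (trans (cong (λ z → ext XT (+ suc z)) (sym (FP.toℕ-inject₁ k))) (ext-pos XT (inject₁ k))))))
       (lia 2 (λ a b → a :< b ⇒ ⊢ # 0 :< b :- a) (XT (inject₁ k)) (XT (fs k)) (τ-mono {inject₁ k} {fs k} (s≤s (ℕP.≤-reflexive (FP.toℕ-inject₁ k)))))

    T-mono : ∀ {u v} → SIdx n u → SIdx n v → u ℤ.< v → X μ (T u) ℤ.< X μ (T v)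
    T-mono su sv h = subst₂ ℤ._<_ (ext-XT su) (ext-XT sv) (steps-mono XT XT-chamber su sv h)

    TP : ∀ {t} → SIdx n t → T (P t) ≡ t
    TP = ext-ext-invSP τ-sp

    PT : ∀ {u} → SIdx n u → P (T u) ≡ u
    PT = ext-invSP-ext τ-sp

    X⇒P : ∀ {s t} → SIdx n s → SIdx n t → X μ s ℤ.< X μ t → P s ℤ.< P t
    X⇒P {s} {t} ss st h = go (ℤP.<-cmp (P s) (P t))
      where
      go : Tri (P s ℤ.< P t) (P s ≡ P t) (P t ℤ.< P s) → P s ℤ.< P t
      go (tri< q _ _) = q
      go (tri≈ _ q _) = ⊥-elim (ℤP.<-irrefl (cong (X μ) (trans (sym (TP ss)) (trans (cong T q) (TP st)))) h)
      go (tri> _ _ q) = ⊥-elim (ℤP.<-asym h (subst₂ ℤ._<_ (cong (X μ) (TP st)) (cong (X μ) (TP ss)) (T-mono (P-sidx st) (P-sidx ss) q)))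

    P-odd : ∀ t → P (ℤ.- t) ≡ ℤ.- P t
    P-odd = ext-odd (invSP τ)

    private
      incrPairs decrPairs pairsAt : SP n → ℕ → List (Fin n × ℤ)
      incrPairs v i = concatMap (λ j → if eqℤ (μ j) (ℤ.- (+ i)) then (j , v j) ∷ [] else []) (allFin n)
      decrPairs v i = concatMap (λ j → if eqℤ (μ j) (+ suc i) then (j , ℤ.- v j) ∷ [] else []) (reverse (allFin n))
      pairsAt v i = incrPairs v i ++ decrPairs v i

    module _ (v w : SP n) (f : Fin n × ℤ → ℤ) (f-pos : ∀ j → f (j , v j) ≡ w j) (f-neg : ∀ j → f (j , ℤ.- v j) ≡ ℤ.- w j) where
      private
        entry : Fin n → ℤ
        entry j = ext w (srow j)

        entries : ∀ (c : Fin n → Bool) (x : Fin n → ℤ) → (∀ j → c j ≡ true → f (j , x j) ≡ entry j) → ∀ js →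
          map f (concatMap (λ j → if c j then (j , x j) ∷ [] else []) js) ≡ map entry (concatMap (λ j → only (c j) j) js)
        entries c x h [] = refl
        entries c x h (j ∷ js) = trans (LP.map-++ f (if c j then (j , x j) ∷ [] else []) _) (trans (cong₂ _++_ (here′ (c j) (h j)) (entries c x h js)) (sym (LP.map-++ entry (only (c j) j) _)))
          where
          here′ : ∀ b → (b ≡ true → f (j , x j) ≡ entry j) → map f (if b then (j , x j) ∷ [] else []) ≡ map entry (only b j)
          here′ true q = cong (_∷ []) (q refl)
          here′ false q = refl

        steps : ∀ is → map f (concatMap (pairsAt v) is) ≡ map entry (concatMap block is)
        steps [] = refl
        steps (i ∷ is) = trans (LP.map-++ f (pairsAt v i) (concatMap (pairsAt v) is)) (trans (cong₂ _++_ (trans (LP.map-++ f (incrPairs v i) (decrPairs v i)) (trans (cong₂ _++_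
              (entries (λ j → eqℤ (μ j) (ℤ.- (+ i))) v (λ j h → trans (f-pos j) (trans (sym (ext-pos w j)) (cong (ext w) (sym (srow-pos j {i} (eqℤ-sound h)))))) (allFin n))
              (entries (λ j → eqℤ (μ j) (+ suc i)) (λ j → ℤ.- v j) (λ j h → trans (f-neg j) (trans (sym (ext-neg w j)) (cong (ext w) (sym (srow-neg j (eqℤ-sound h)))))) (reverse (allFin n))))
              (sym (LP.map-++ entry (incr i) (decr i))))) (steps is))
            (sym (LP.map-++ entry (block i) (concatMap block is))))

      -- `f` stands for the sign correction local to `dB`. By its two hypotheses a negated label is
      -- corrected to the negated entry of `w`, that is, to the value of `w` at the negative row.
      order-values : ∀ k → nthℤ (map f (concatMap (pairsAt v) (upTo (suc (cox n))))) (toℕ k) ≡ ext w (τ k)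
      order-values k = trans (cong (λ l → nthℤ l (toℕ k)) (trans (steps (upTo (suc (cox n)))) (cong (map entry) (sym order-def))))
         (trans (cong (nthℤ (map entry order)) (sym (FP.toℕ-cast (sym order-length) k))) (nthℤ-lookup entry order (cast (sym order-length) k)))

  module _ {m : ℕ} (π : Word) (v : SP (suc (suc m))) (inV : InVert (suc (suc m)) π v) where
    private
      n = suc (suc m)
      μ = mu n π
      W = w′ π v inV
    μ-lo : ∀ i → ℤ.- (+ n) ℤ.≤ μ i
    μ-lo i = proj₁ (low-bounds {μ = μ} (w′-sp π v inV) (candidate-low π v inV) i)
    μ-hi : ∀ i → μ i ℤ.≤ + 2 ℤ.* + n
    μ-hi i = proj₂ (low-bounds {μ = μ} (w′-sp π v inV) (candidate-low π v inV) i)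

    dB-value : ∀ k → dB n π v k ≡ ext W (τ μ μ-lo μ-hi k)
    dB-value k = trans (cong (λ l → nthℤ l (toℕ k)) (LP.map-cong (λ { (j , x) → refl }) (dBpairs n π v)))
       (order-values μ μ-lo μ-hi v W (signed π v inV) (λ _ → refl) (λ j → signed-neg π v inV j (v j)) k)

open RowOrder

-- The word of the zeta map with its letters tagged by signed rows.

module Letters where

  either : ∀ {A : Set} → Bool → A → Bool → A → List A
  either b x c y = if b then x ∷ [] else (if c then y ∷ [] else [])

  either-∈ : ∀ {A : Set} b c {x y z : A} → z ∈ either b x c y → (b ≡ true × z ≡ x) ⊎ (c ≡ true × z ≡ y)
  either-∈ true c (here q) = inj₁ (refl , q)
  either-∈ false true (here q) = inj₂ (refl , q)

  either-fst : ∀ {A : Set} {b} c {x y : A} → b ≡ true → x ∈ either b x c y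
  either-fst c refl = here refl

  either-snd : ∀ {A : Set} {b c} {x y : A} → b ≡ false → c ≡ true → y ∈ either b x c y
  either-snd refl refl = here refl

  either-sorted : ∀ {A : Set} {R : A → A → Set} b c (x y : A) → AllPairs R (either b x c y)
  either-sorted true c x y = [] ∷ []
  either-sorted false true x y = [] ∷ []
  either-sorted false false x y = []

  map-either : ∀ {A B : Set} (f : A → B) b c x y → map f (either b x c y) ≡ either b (f x) c (f y)
  map-either f true c x y = refl
  map-either f false true x y = refl
  map-either f false false x y = refl

  map-emit : ∀ {I A B : Set} (f : A → B) (F : I → List A) (G : I → List B) → (∀ i → map f (F i) ≡ G i) → ∀ is → map f (concatMap F is) ≡ concatMap G is
  map-emit f F G h [] = refl
  map-emit f F G h (i ∷ is) = trans (LP.map-++ f (F i) (concatMap F is)) (cong₂ _++_ (h i) (map-emit f F G h is))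

  dropLast-++ : ∀ xs y ys → dropLast (xs ++ y ∷ ys) ≡ xs ++ dropLast (y ∷ ys)
  dropLast-++ [] y ys = refl
  dropLast-++ (x ∷ []) y ys = refl
  dropLast-++ (x ∷ x' ∷ xs) y ys = cong (x ∷_) (dropLast-++ (x' ∷ xs) y ys)

  module _ {m : ℕ} (μ : Vecℤ (suc (suc m))) (μ-lo : ∀ i → ℤ.- (+ suc (suc m)) ℤ.≤ μ i) (μ-hi : ∀ i → μ i ℤ.≤ + 2 ℤ.* + suc (suc m)) where
    private
      n = suc (suc m)
      p⁺ : Fin n → ℤ
      p⁺ = p₊ μ μ-lo μ-hi
      pb = p₊-bounds μ μ-lo μ-hi

    -- A letter of ζ_B(π) together with the signed row that produced it: E comes from the row with
    -- X = key, N from the row with X + N = key.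
    Tagged : Set
    Tagged = Letter × ℤ

    kof : Tagged → ℤ
    kof (El , t) = X μ t
    kof (Nl , t) = X μ t ℤ.+ N n

    -- Within sweep j the key of a letter from row r is N (j + 1) + p(r) or N (j + 1) - p(r),
    -- depending on the direction of reading but not on the letter. So every pass over the rows is
    -- sorted.
    emit⁻ emit⁺ : ℕ → Fin n → List Tagged
    emit⁻ j r = either (eqℤ (μ r) (ℤ.- (+ j))) (Nl , pos r) (eqℤ (μ r) (ℤ.- (+ suc j))) (El , pos r)
    emit⁺ j r = either (eqℤ (μ r) (+ j)) (Nl , neg r) (eqℤ (μ r) (+ suc j)) (El , neg r)

    left right sweep : ℕ → List Tagged
    left j = concatMap (emit⁻ j) (reverse (allFin n))
    right j = concatMap (emit⁺ j) (allFin n)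
    sweep j = left j ++ right j

    levels : List ℕ
    levels = map (λ k → cox n ℕ.∸ k) (upTo (cox n))

    -- The extra N in the definition of ζ_B, tagged with row 0. As X(0) = 0, its key N separates the
    -- two passes of the lowest sweep.
    centre : Tagged
    centre = Nl , + 0

    tail : List Tagged
    tail = left 0 ++ centre ∷ right 0

    word : List Tagged
    word = concatMap sweep levels ++ tail

    emit⁻-key : ∀ j r {z} → z ∈ emit⁻ j r → SIdx n (proj₂ z) × kof z ≡ N n ℤ.* (+ 1 ℤ.+ + j) ℤ.+ p⁺ r
    emit⁻-key j r h with either-∈ (eqℤ (μ r) (ℤ.- (+ j))) (eqℤ (μ r) (ℤ.- (+ suc j))) h
    ... | inj₁ (b , refl) = ps r , trans (cong (ℤ._+ N n) (X-pos μ μ-lo μ-hi r (eqℤ-sound b))) (lia 3 (λ p N j → ⊢ p :- N :* (:- j) :+ N := N :* (# 1 :+ j) :+ p) (p⁺ r) (N n) (+ j))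
    ... | inj₂ (b , refl) = ps r , trans (X-pos μ μ-lo μ-hi r (eqℤ-sound b)) (lia 3 (λ p N j → ⊢ p :- N :* (:- (# 1 :+ j)) := N :* (# 1 :+ j) :+ p) (p⁺ r) (N n) (+ j))

    emit⁺-key : ∀ j r {z} → z ∈ emit⁺ j r → SIdx n (proj₂ z) × kof z ≡ N n ℤ.* (+ 1 ℤ.+ + j) ℤ.- p⁺ r
    emit⁺-key j r h with either-∈ (eqℤ (μ r) (+ j)) (eqℤ (μ r) (+ suc j)) h
    ... | inj₁ (b , refl) = ng r , trans (cong (ℤ._+ N n) (X-neg μ μ-lo μ-hi r (eqℤ-sound b))) (lia 3 (λ p N j → ⊢ N :* j :- p :+ N := N :* (# 1 :+ j) :- p) (p⁺ r) (N n) (+ j))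
    ... | inj₂ (b , refl) = ng r , X-neg μ μ-lo μ-hi r (eqℤ-sound b)

    _≻_ : Tagged → Tagged → Set
    a ≻ b = kof b ℤ.< kof a

    record LeftOf (j : ℕ) (z : Tagged) : Set where
      field
        l-idx : SIdx n (proj₂ z)
        row : Fin n
        l-key : kof z ≡ N n ℤ.* (+ 1 ℤ.+ + j) ℤ.+ p⁺ row

    record RightOf (j : ℕ) (z : Tagged) : Set where
      field
        r-idx : SIdx n (proj₂ z)
        row : Fin n
        r-key : kof z ≡ N n ℤ.* (+ 1 ℤ.+ + j) ℤ.- p⁺ row

    left-∈ : ∀ j {z} → z ∈ left j → LeftOf j z
    left-∈ j {z} h = go (∈-emit⁻ (emit⁻ j) (reverse (allFin n)) h)
      where go : (∃ λ r → r ∈ reverse (allFin n) × z ∈ emit⁻ j r) → LeftOf j z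
            go (r , _ , h') = record { l-idx = proj₁ (emit⁻-key j r h') ; row = r ; l-key = proj₂ (emit⁻-key j r h') }

    right-∈ : ∀ j {z} → z ∈ right j → RightOf j z
    right-∈ j {z} h = go (∈-emit⁻ (emit⁺ j) (allFin n) h)
      where go : (∃ λ r → r ∈ allFin n × z ∈ emit⁺ j r) → RightOf j z
            go (r , _ , h') = record { r-idx = proj₁ (emit⁺-key j r h') ; row = r ; r-key = proj₂ (emit⁺-key j r h') }

    -- The open strip of width N around N (j + 1); strips of different sweeps do not meet. The
    -- doubling avoids the fraction N/2.
    Within : ℕ → Tagged → Set
    Within j z = SIdx n (proj₂ z) × (N n ℤ.* (+ 1 ℤ.+ + 2 ℤ.* + j) ℤ.< + 2 ℤ.* kof z) × (+ 2 ℤ.* kof z ℤ.< N n ℤ.* (+ 3 ℤ.+ + 2 ℤ.* + j))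

    left-above : ∀ j {z} → z ∈ left j → N n ℤ.* (+ 1 ℤ.+ + j) ℤ.< kof z
    left-above j {z} h = lia 3 (λ M p k → k := M :+ p ⇒ # 0 :< p ⇒ ⊢ M :< k) (N n ℤ.* (+ 1 ℤ.+ + j)) (p⁺ row) (kof z) l-key (proj₁ (pb row))
      where open LeftOf (left-∈ j h)

    right-below : ∀ j {z} → z ∈ right j → kof z ℤ.< N n ℤ.* (+ 1 ℤ.+ + j)
    right-below j {z} h = lia 3 (λ M p k → k := M :- p ⇒ # 0 :< p ⇒ ⊢ k :< M) (N n ℤ.* (+ 1 ℤ.+ + j)) (p⁺ row) (kof z) r-key (proj₁ (pb row))
      where open RightOf (right-∈ j h)

    left-within : ∀ j {z} → z ∈ left j → Within j z
    left-within j {z} h = l-idx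
        , lia 4 (λ N j p k → k := N :* (# 1 :+ j) :+ p ⇒ # 0 :< p ⇒ # 0 :< N ⇒ ⊢ N :* (# 1 :+ # 2 :* j) :< # 2 :* k) (N n) (+ j) (p⁺ row) (kof z) l-key (proj₁ (pb row)) (N-pos n)
        , lia 4 (λ N j p k → k := N :* (# 1 :+ j) :+ p ⇒ # 2 :* p :< N ⇒ ⊢ # 2 :* k :< N :* (# 3 :+ # 2 :* j)) (N n) (+ j) (p⁺ row) (kof z) l-key (proj₂ (pb row))
      where open LeftOf (left-∈ j h)

    right-within : ∀ j {z} → z ∈ right j → Within j z
    right-within j {z} h = r-idx
        , lia 4 (λ N j p k → k := N :* (# 1 :+ j) :- p ⇒ # 2 :* p :< N ⇒ ⊢ N :* (# 1 :+ # 2 :* j) :< # 2 :* k) (N n) (+ j) (p⁺ row) (kof z) r-key (proj₂ (pb row))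
        , lia 4 (λ N j p k → k := N :* (# 1 :+ j) :- p ⇒ # 0 :< p ⇒ # 0 :< N ⇒ ⊢ # 2 :* k :< N :* (# 3 :+ # 2 :* j)) (N n) (+ j) (p⁺ row) (kof z) r-key (proj₁ (pb row)) (N-pos n)
      where open RightOf (right-∈ j h)

    sweep-within : ∀ j {z} → z ∈ sweep j → Within j z
    sweep-within j {z} h = go (∈P.∈-++⁻ (left j) h)
      where go : z ∈ left j ⊎ z ∈ right j → Within j z
            go (inj₁ h) = left-within j h
            go (inj₂ h) = right-within j h

    left-sorted : ∀ j → AllPairs _≻_ (left j)
    left-sorted j = AllPairs-concatMap (emit⁻ j) (λ r → either-sorted (eqℤ (μ r) (ℤ.- (+ j))) (eqℤ (μ r) (ℤ.- (+ suc j))) (Nl , pos r) (El , pos r)) cross (AllPairs-reverse (allFin-sorted n))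
      where
      cross : ∀ {k l a b} → toℕ l ℕ.< toℕ k → a ∈ emit⁻ j k → b ∈ emit⁻ j l → a ≻ b
      cross {k} {l} {a} {b} h ma mb = subst₂ ℤ._<_ (sym (proj₂ (emit⁻-key j l mb))) (sym (proj₂ (emit⁻-key j k ma))) (ℤP.+-monoʳ-< (N n ℤ.* (+ 1 ℤ.+ + j)) (p₊-mono μ μ-lo μ-hi {l} {k} h))

    right-sorted : ∀ j → AllPairs _≻_ (right j)
    right-sorted j = AllPairs-concatMap (emit⁺ j) (λ r → either-sorted (eqℤ (μ r) (+ j)) (eqℤ (μ r) (+ suc j)) (Nl , neg r) (El , neg r)) cross (allFin-sorted n)
      where
      cross : ∀ {k l a b} → toℕ k ℕ.< toℕ l → a ∈ emit⁺ j k → b ∈ emit⁺ j l → a ≻ b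
      cross {k} {l} {a} {b} h ma mb = subst₂ ℤ._<_ (sym (proj₂ (emit⁺-key j l mb))) (sym (proj₂ (emit⁺-key j k ma)))
        (lia 3 (λ p q M → p :< q ⇒ ⊢ M :- q :< M :- p) (p⁺ k) (p⁺ l) (N n ℤ.* (+ 1 ℤ.+ + j)) (p₊-mono μ μ-lo μ-hi {k} {l} h))

    sweep-sorted : ∀ j → AllPairs _≻_ (sweep j)
    sweep-sorted j = APP.++⁺ (left-sorted j) (right-sorted j) (All.tabulate λ ma → All.tabulate λ mb → ℤP.<-trans (right-below j mb) (left-above j ma))

    centre-key : kof centre ≡ N n
    centre-key = lia 1 (λ N → ⊢ # 0 :- N :* # 0 :+ N := N) (N n)

    tail-sorted : AllPairs _≻_ tail
    tail-sorted = APP.++⁺ (left-sorted 0) ((All.tabulate λ {b} mb → subst (kof b ℤ.<_) (sym centre-key) (subst (kof b ℤ.<_) (ℤP.*-identityʳ (N n)) (right-below 0 mb))) ∷ right-sorted 0)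
       (All.tabulate λ {a} ma → subst (ℤ._< kof a) (trans (ℤP.*-identityʳ (N n)) (sym centre-key)) (left-above 0 ma) ∷ All.tabulate λ mb → ℤP.<-trans (right-below 0 mb) (left-above 0 ma))

    tail-within : ∀ {z} → z ∈ tail → Within 0 z
    tail-within {z} h = go (∈P.∈-++⁻ (left 0) h)
      where
      go : z ∈ left 0 ⊎ z ∈ (centre ∷ right 0) → Within 0 z
      go (inj₁ h) = left-within 0 h
      go (inj₂ (here refl)) = zr , lia 2 (λ N k → k := N ⇒ # 0 :< N ⇒ ⊢ N :* (# 1 :+ # 0) :< # 2 :* k) (N n) (kof centre) centre-key (N-pos n)
            , lia 2 (λ N k → k := N ⇒ # 0 :< N ⇒ ⊢ # 2 :* k :< N :* (# 3 :+ # 0)) (N n) (kof centre) centre-key (N-pos n)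
      go (inj₂ (there h)) = right-within 0 h

    levels-sorted : AllPairs (λ i j → j ℕ.< i) levels
    levels-sorted = APP.map⁺ {f = λ k → cox n ℕ.∸ k} (APP.applyUpTo⁺₁ id (cox n) (λ {i} {j} h h' → ℕP.∸-monoʳ-< {cox n} {j} {i} h (ℕP.<⇒≤ h')))

    within-cross : ∀ {i j a b} → j ℕ.< i → Within i a → Within j b → a ≻ b
    within-cross {i} {j} {a} {b} h (_ , u , _) (_ , _ , v) = lia 5 (λ x y N i j → N :* (# 1 :+ # 2 :* i) :< # 2 :* x ⇒ # 2 :* y :< N :* (# 3 :+ # 2 :* j) ⇒ N :* (# 1 :+ j) :≤ N :* i ⇒ ⊢ y :< x) (kof a) (kof b) (N n) (+ i) (+ j) u v
       (Npos-mono n {+ 1 ℤ.+ + j} {+ i} (+≤+ h))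

    levels-pos : ∀ {j} → j ∈ levels → 0 ℕ.< j
    levels-pos {j} h = go (∈P.∈-map⁻ (λ k → cox n ℕ.∸ k) h)
      where go : (∃ λ k → k ∈ upTo (cox n) × j ≡ cox n ℕ.∸ k) → 0 ℕ.< j
            go (k , hk , q) = subst (0 ℕ.<_) (sym q) (ℕP.m<n⇒0<n∸m {k} {cox n} (∈P.∈-upTo⁻ hk))

    upper-∈ : ∀ {z} → z ∈ concatMap sweep levels → ∃ λ j → 0 ℕ.< j × z ∈ sweep j
    upper-∈ {z} h = go (∈-emit⁻ sweep levels h)
      where go : (∃ λ j → j ∈ levels × z ∈ sweep j) → ∃ λ j → 0 ℕ.< j × z ∈ sweep j
            go (j , hj , hz) = j , levels-pos hj , hz

    word-sorted : AllPairs _≻_ word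
    word-sorted = APP.++⁺ (AllPairs-concatMap sweep sweep-sorted (λ {i} {j} {a} {b} h ma mb → within-cross {i} {j} {a} {b} h (sweep-within i ma) (sweep-within j mb)) levels-sorted) tail-sorted
      (All.tabulate λ ma → All.tabulate λ mb → cross (upper-∈ ma) mb)
      where
      cross : ∀ {a b} → (∃ λ j → 0 ℕ.< j × a ∈ sweep j) → b ∈ tail → a ≻ b
      cross {a} {b} (j , h , ma) mb = within-cross {j} {0} {a} {b} h (sweep-within j ma) (tail-within mb)

    -- Together with `word-E` and `word-N` this describes the word completely: it holds every tagged
    -- letter whose key exceeds N/2, and no other.
    word-∈ : ∀ {z} → z ∈ word → SIdx n (proj₂ z) × (N n ℤ.< + 2 ℤ.* kof z)
    word-∈ {z} h = go (∈P.∈-++⁻ (concatMap sweep levels) h)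
      where
      wide : ∀ j → Within j z → SIdx n (proj₂ z) × (N n ℤ.< + 2 ℤ.* kof z)
      wide j (s , u , _) = s , lia 3 (λ N j k → N :* (# 1 :+ # 2 :* j) :< k ⇒ N :* # 0 :≤ N :* j ⇒ ⊢ N :< k) (N n) (+ j) (+ 2 ℤ.* kof z) u (Npos-mono n (0≤ j))
      go : z ∈ concatMap sweep levels ⊎ z ∈ tail → SIdx n (proj₂ z) × (N n ℤ.< + 2 ℤ.* kof z)
      go (inj₁ h) = up′ (upper-∈ h)
        where up′ : (∃ λ j → 0 ℕ.< j × z ∈ sweep j) → SIdx n (proj₂ z) × (N n ℤ.< + 2 ℤ.* kof z)
              up′ (j , _ , hz) = wide j (sweep-within j hz)
      go (inj₂ h) = wide 0 (tail-within h)

    in-levels : ∀ j → suc j ℕ.≤ cox n → suc j ∈ levels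
    in-levels j h = subst (_∈ levels) (ℕP.m∸[m∸n]≡n h) (∈P.∈-map⁺ (λ k → cox n ℕ.∸ k) (∈P.∈-upTo⁺ (ℕP.∸-monoʳ-< {cox n} {suc j} {0} (s≤s z≤n) h)))

    sweep⊆word : ∀ j → j ℕ.≤ cox n → ∀ {z} → z ∈ sweep j → z ∈ word
    sweep⊆word zero h {z} hz = ∈P.∈-++⁺ʳ (concatMap sweep levels) (go (∈P.∈-++⁻ (left 0) hz))
      where go : z ∈ left 0 ⊎ z ∈ right 0 → z ∈ tail
            go (inj₁ h) = ∈P.∈-++⁺ˡ h
            go (inj₂ h) = ∈P.∈-++⁺ʳ (left 0) (there h)
    sweep⊆word (suc j) h hz = ∈P.∈-++⁺ˡ (∈-emit sweep (in-levels j h) hz)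

    in-left : ∀ j r {z} → z ∈ emit⁻ j r → z ∈ sweep j
    in-left j r h = ∈P.∈-++⁺ˡ (∈-emit (emit⁻ j) (AnyP.reverse⁺ (∈P.∈-allFin r)) h)

    in-right : ∀ j r {z} → z ∈ emit⁺ j r → z ∈ sweep j
    in-right j r h = ∈P.∈-++⁺ʳ (left j) (∈-emit (emit⁺ j) (∈P.∈-allFin r) h)

    private
      2n : + cox n ≡ + 2 ℤ.* + n
      2n = ℤP.pos-* 2 n
      down : ∀ r j → μ r ≡ -[1+ j ] → suc j ℕ.≤ cox n
      down r j q = ℤP.drop‿+≤+ (lia 4 (λ u i n c → u := :- (# 1 :+ i) ⇒ :- n :≤ u ⇒ c := # 2 :* n ⇒ # 0 :≤ n ⇒ ⊢ # 1 :+ i :≤ c) (μ r) (+ j) (+ n) (+ cox n) q (μ-lo r) 2n (0≤ n))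
      upb : ∀ r j → μ r ≡ + j → j ℕ.≤ cox n
      upb r j q = ℤP.drop‿+≤+ (subst₂ ℤ._≤_ q (sym 2n) (μ-hi r))
      ≢step : ∀ {a b} j → a ≡ ℤ.- (+ suc j) → b ≡ ℤ.- (+ j) → a ≢ b
      ≢step j p q r = lia 3 (λ a b j → a := :- (# 1 :+ j) ⇒ b := :- j ⇒ a := b ⇒ ⊢ :⊥) _ _ (+ j) p q r

    word-E : ∀ {t} → SIdx n t → N n ℤ.< + 2 ℤ.* X μ t → (El , t) ∈ word
    word-E (ps r) h = go (μ r) refl
      where
      go : ∀ z → μ r ≡ z → (El , pos r) ∈ word
      go (+ k) q = ⊥-elim (lia 4 (λ N p k x → N :< # 2 :* x ⇒ x := p :- N :* k ⇒ # 2 :* p :< N ⇒ N :* # 0 :≤ N :* k ⇒ ⊢ :⊥) (N n) (p⁺ r) (+ k) (X μ (pos r)) h (X-pos μ μ-lo μ-hi r q) (proj₂ (pb r)) (Npos-mono n (0≤ k)))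
      go -[1+ j ] q = sweep⊆word j (ℕP.≤-trans (ℕP.n≤1+n j) (down r j q)) (in-left j r (either-snd (eqℤ-no (≢step j q refl)) (eqℤ-complete q)))
    word-E zr h = ⊥-elim (lia 2 (λ N x → N :< # 2 :* x ⇒ x := # 0 :- N :* # 0 ⇒ # 0 :< N ⇒ ⊢ :⊥) (N n) (X μ (+ 0)) h refl (N-pos n))
    word-E (ng r) h = go (μ r) refl
      where
      go : ∀ z → μ r ≡ z → (El , neg r) ∈ word
      go (+ zero) q = ⊥-elim (lia 3 (λ N p x → N :< # 2 :* x ⇒ x := N :* # 0 :- p ⇒ # 0 :< p ⇒ # 0 :< N ⇒ ⊢ :⊥) (N n) (p⁺ r) (X μ (neg r)) h (X-neg μ μ-lo μ-hi r q) (proj₁ (pb r)) (N-pos n))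
      go (+ suc j) q = sweep⊆word j (ℕP.≤-trans (ℕP.n≤1+n j) (upb r (suc j) q)) (in-right j r (either-snd (eqℤ-no (λ e → ℕP.1+n≢n (ℤP.+-injective (trans (sym q) e)))) (eqℤ-complete q)))
      go -[1+ j ] q = ⊥-elim (lia 4 (λ N p j x → N :< # 2 :* x ⇒ x := N :* (:- (# 1 :+ j)) :- p ⇒ # 0 :< p ⇒ # 0 :< N ⇒ N :* # 0 :≤ N :* j ⇒ ⊢ :⊥) (N n) (p⁺ r) (+ j) (X μ (neg r)) h (X-neg μ μ-lo μ-hi r q) (proj₁ (pb r)) (N-pos n) (Npos-mono n (0≤ j)))

    word-N : ∀ {t} → SIdx n t → ℤ.- N n ℤ.< + 2 ℤ.* X μ t → (Nl , t) ∈ word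
    word-N (ps r) h = go (μ r) refl
      where
      go : ∀ z → μ r ≡ z → (Nl , pos r) ∈ word
      go (+ zero) q = sweep⊆word 0 z≤n (in-left 0 r (either-fst _ (eqℤ-complete q)))
      go (+ suc k) q = ⊥-elim (lia 4 (λ N p k x → :- N :< # 2 :* x ⇒ x := p :- N :* (# 1 :+ k) ⇒ # 2 :* p :< N ⇒ N :* # 0 :≤ N :* k ⇒ ⊢ :⊥) (N n) (p⁺ r) (+ k) (X μ (pos r)) h (X-pos μ μ-lo μ-hi r q) (proj₂ (pb r)) (Npos-mono n (0≤ k)))
      go -[1+ j ] q = sweep⊆word (suc j) (down r j q) (in-left (suc j) r (either-fst _ (eqℤ-complete q)))
    word-N zr h = ∈P.∈-++⁺ʳ (concatMap sweep levels) (∈P.∈-++⁺ʳ (left 0) (here refl))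
    word-N (ng r) h = go (μ r) refl
      where
      go : ∀ z → μ r ≡ z → (Nl , neg r) ∈ word
      go (+ j) q = sweep⊆word j (upb r j q) (in-right j r (either-fst _ (eqℤ-complete q)))
      go -[1+ j ] q = ⊥-elim (lia 4 (λ N p j x → :- N :< # 2 :* x ⇒ x := N :* (:- (# 1 :+ j)) :- p ⇒ # 0 :< p ⇒ # 0 :< N ⇒ N :* # 0 :≤ N :* j ⇒ ⊢ :⊥) (N n) (p⁺ r) (+ j) (X μ (neg r)) h (X-neg μ μ-lo μ-hi r q) (proj₁ (pb r)) (N-pos n) (Npos-mono n (0≤ j)))

    private
      ms : List ℤ
      ms = map μ (allFin n)

    erase-right : ∀ j → map proj₁ (right j) ≡ sweepR⁺ j ms
    erase-right j = trans (map-emit proj₁ (emit⁺ j) (λ r → either (eqℤ (μ r) (+ j)) Nl (eqℤ (μ r) (+ suc j)) El) (λ r → map-either proj₁ (eqℤ (μ r) (+ j)) (eqℤ (μ r) (+ suc j)) (Nl , neg r) (El , neg r)) (allFin n))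
       (sym (LP.concatMap-map (λ x → either (eqℤ x (+ j)) Nl (eqℤ x (+ suc j)) El) μ (allFin n)))

    erase-left : ∀ j → map proj₁ (left j) ≡ sweepL⁻ j ms
    erase-left j = trans (map-emit proj₁ (emit⁻ j) (λ r → g (μ r)) (λ r → map-either proj₁ (eqℤ (μ r) (ℤ.- (+ j))) (eqℤ (μ r) (ℤ.- (+ suc j))) (Nl , pos r) (El , pos r)) (reverse (allFin n)))
       (trans (sym (LP.concatMap-map g μ (reverse (allFin n)))) (cong (concatMap g) (LP.reverse-map μ (allFin n))))
      where g : ℤ → List Letter
            g x = either (eqℤ x (ℤ.- (+ j))) Nl (eqℤ x (ℤ.- (+ suc j))) El

    swept : List Letter
    swept = concatMap (λ j → sweepL⁻ j ms ++ sweepR⁺ j ms) levels ++ sweepL⁻ 0 ms ++ dropLast (Nl ∷ sweepR⁺ 0 ms)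

    -- The deleted letter is the last one of a factor that contains the central N; as this factor is
    -- nonempty, deletion there is deletion at the end of the whole word.
    swept≡ : swept ≡ dropLast (map proj₁ word)
    swept≡ = sym (trans (cong dropLast (trans erase-word (sym (LP.++-assoc A (sweepL⁻ 0 ms) (Nl ∷ sweepR⁺ 0 ms))))) (trans (dropLast-++ (A ++ sweepL⁻ 0 ms) Nl (sweepR⁺ 0 ms)) (LP.++-assoc A (sweepL⁻ 0 ms) (dropLast (Nl ∷ sweepR⁺ 0 ms)))))
      where
      A = concatMap (λ j → sweepL⁻ j ms ++ sweepR⁺ j ms) levels
      erase-word : map proj₁ word ≡ A ++ sweepL⁻ 0 ms ++ Nl ∷ sweepR⁺ 0 ms
      erase-word = trans (LP.map-++ proj₁ (concatMap sweep levels) tail) (cong₂ _++_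
         (map-emit proj₁ sweep (λ j → sweepL⁻ j ms ++ sweepR⁺ j ms) (λ j → trans (LP.map-++ proj₁ (left j) (right j)) (cong₂ _++_ (erase-left j) (erase-right j))) levels)
         (trans (LP.map-++ proj₁ (left 0) (centre ∷ right 0)) (cong₂ (λ x y → x ++ Nl ∷ y) (erase-left 0) (erase-right 0))))

open Letters using (dropLast-++; kof; swept; swept≡; word; word-E; word-N; word-sorted; word-∈)

-- Valleys as consecutive letters, compared with floors at height one.

module ValleyPairs where

  -- the local functions of valleys; their first argument is the ambient word
  mutual
    goVal : Word → ℕ → ℕ → Word → List (ℕ × ℕ)
    goVal = _

    lastE : Word → Word → Bool
    lastE = _

    goVal-eq : ∀ x w → goVal (Nl ∷ x ∷ w) 0 1 (x ∷ w) ++ (if lastE (Nl ∷ x ∷ w) (x ∷ w) then (countE (x ∷ w) , suc (suc (countN (x ∷ w)))) ∷ [] else [])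
      ≡ valleys (Nl ∷ x ∷ w)
    goVal-eq x w with _++_ {A = ℕ × ℕ} | if_then_else_ {A = List (ℕ × ℕ)} | (Word ∋ (Nl ∷ x ∷ w)) | 0 | 1
    ... | f | g | β | c | k with Word ∋ (x ∷ w)
    ...   | v = refl

  valleys-unfold : ∀ β → valleys β ≡ goVal β 0 0 β ++ (if lastE β β then (countE β , suc (countN β)) ∷ [] else [])
  valleys-unfold β = refl

  data Desc : ℤ → List ℤ → Set where
    dnil  : ∀ {a} → Desc a []
    dcons : ∀ {a x xs} → x ≡ a → Desc (a ℤ.- + 1) xs → Desc a (x ∷ xs)

  desc-prefix : ∀ xs {ys a} → Desc a (xs ++ ys) → Desc a xs
  desc-prefix [] d = dnil
  desc-prefix (x ∷ xs) (dcons q d) = dcons q (desc-prefix xs d)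

  -- Upward closure puts a itself into the list, sortedness puts it at the head, and the tail
  -- satisfies the same hypotheses with a - 1.
  consec : ∀ xs a → AllPairs (λ x y → y ℤ.< x) xs → (∀ {v} → v ∈ xs → v ℤ.≤ a) → (∀ {v u} → v ∈ xs → v ℤ.≤ u → u ℤ.≤ a → u ∈ xs) → Desc a xs
  consec [] a s b c = dnil
  consec (x ∷ xs) a (q ∷ s) b c = dcons x≡a (consec xs (a ℤ.- + 1) s
      (λ {v} h → lia 3 (λ v x a → v :< x ⇒ x := a ⇒ ⊢ v :≤ a :- # 1) v x a (All.lookup q h) x≡a)
      (λ {v} {u} h v≤u u≤a → below u≤a (c (there h) v≤u (lia 2 (λ u a → u :≤ a :- # 1 ⇒ ⊢ u :≤ a) u a u≤a))))
    where
    head-max : ∀ {v} → v ∈ (x ∷ xs) → v ℤ.≤ x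
    head-max (here refl) = ℤP.≤-refl
    head-max (there h) = ℤP.<⇒≤ (All.lookup q h)
    x≡a : x ≡ a
    x≡a = ℤP.≤-antisym (b (here refl)) (head-max (c (here refl) (b (here refl)) ℤP.≤-refl))
    below : ∀ {u} → u ℤ.≤ a ℤ.- + 1 → u ∈ (x ∷ xs) → u ∈ xs
    below {u} h (here refl) = ⊥-elim (lia 2 (λ x a → x :≤ a :- # 1 ⇒ x := a ⇒ ⊢ :⊥) x a h x≡a)
    below h (there r) = r

  letE letN : List (Letter × ℤ) → List ℤ
  letE [] = []
  letE ((El , t) ∷ l) = t ∷ letE l
  letE ((Nl , _) ∷ l) = letE l
  letN [] = []
  letN ((Nl , t) ∷ l) = t ∷ letN l
  letN ((El , _) ∷ l) = letN l

  letE-++ : ∀ l l' → letE (l ++ l') ≡ letE l ++ letE l'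
  letE-++ [] l' = refl
  letE-++ ((El , t) ∷ l) l' = cong (t ∷_) (letE-++ l l')
  letE-++ ((Nl , t) ∷ l) l' = letE-++ l l'

  letN-++ : ∀ l l' → letN (l ++ l') ≡ letN l ++ letN l'
  letN-++ [] l' = refl
  letN-++ ((Nl , t) ∷ l) l' = cong (t ∷_) (letN-++ l l')
  letN-++ ((El , t) ∷ l) l' = letN-++ l l'

  letE-∈ : ∀ {l t} → t ∈ letE l → (El , t) ∈ l
  letE-∈ {(El , _) ∷ l} (here refl) = here refl
  letE-∈ {(El , _) ∷ l} (there h) = there (letE-∈ h)
  letE-∈ {(Nl , _) ∷ l} h = there (letE-∈ h)

  letN-∈ : ∀ {l t} → t ∈ letN l → (Nl , t) ∈ l
  letN-∈ {(Nl , _) ∷ l} (here refl) = here refl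
  letN-∈ {(Nl , _) ∷ l} (there h) = there (letN-∈ h)
  letN-∈ {(El , _) ∷ l} h = there (letN-∈ h)

  ∈-letE : ∀ {l t} → (El , t) ∈ l → t ∈ letE l
  ∈-letE (here refl) = here refl
  ∈-letE {(El , _) ∷ l} (there h) = there (∈-letE h)
  ∈-letE {(Nl , _) ∷ l} (there h) = ∈-letE h

  ∈-letN : ∀ {l t} → (Nl , t) ∈ l → t ∈ letN l
  ∈-letN (here refl) = here refl
  ∈-letN {(Nl , _) ∷ l} (there h) = there (∈-letN h)
  ∈-letN {(El , _) ∷ l} (there h) = ∈-letN h

  -- The row of the next N if the word were continued below N/2. If the deleted letter is an N, it
  -- is that letter. If it is an E, its X is the least one above N/2, so the next N has the greatest
  -- X below -N/2, and this is the mirror row.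
  mate : Letter × ℤ → ℤ
  mate (Nl , s) = s
  mate (El , s) = ℤ.- s

  -- valleys of the erased list l; a final E is matched with the letter z that was deleted after it
  pairs : List (Letter × ℤ) → Letter × ℤ → List (ℤ × ℤ)
  pairs [] z = []
  pairs ((El , t) ∷ []) z = (t , mate z) ∷ []
  pairs ((Nl , _) ∷ []) z = []
  pairs ((El , t) ∷ (Nl , s) ∷ l) z = (t , s) ∷ pairs ((Nl , s) ∷ l) z
  pairs ((El , _) ∷ (El , t) ∷ l) z = pairs ((El , t) ∷ l) z
  pairs ((Nl , _) ∷ y ∷ l) z = pairs (y ∷ l) z

  pairs-cons : ∀ x y l z {q} → q ∈ pairs (y ∷ l) z → q ∈ pairs (x ∷ y ∷ l) z
  pairs-cons (El , t) (Nl , s) l z h = there h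
  pairs-cons (El , t) (El , s) l z h = h
  pairs-cons (Nl , t) y l z h = h

  ∷ʳ-≢ : ∀ {A : Set} {x : A} l {a b : A} {l'} → x ∷ [] ≢ l ++ a ∷ b ∷ l'
  ∷ʳ-≢ [] ()
  ∷ʳ-≢ (_ ∷ []) ()
  ∷ʳ-≢ (_ ∷ _ ∷ _) ()

  inner-∈ : ∀ l z l₁ {t s l₂} → l ++ z ∷ [] ≡ l₁ ++ (El , t) ∷ (Nl , s) ∷ l₂ → (t , s) ∈ pairs l z
  inner-∈ [] z l₁ q = ⊥-elim (∷ʳ-≢ l₁ q)
  inner-∈ (x ∷ []) z [] refl = here refl
  inner-∈ (x ∷ []) z (_ ∷ l₁) q = ⊥-elim (∷ʳ-≢ l₁ (LP.∷-injectiveʳ q))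
  inner-∈ (x ∷ y ∷ l) z [] refl = here refl
  inner-∈ (x ∷ y ∷ l) z (_ ∷ l₁) q = pairs-cons x y l z (inner-∈ (y ∷ l) z l₁ (LP.∷-injectiveʳ q))

  outer-∈ : ∀ l₁ z {t} → (t , mate z) ∈ pairs (l₁ ++ (El , t) ∷ []) z
  outer-∈ [] z = here refl
  outer-∈ (x ∷ []) z = pairs-cons x _ [] z (outer-∈ [] z)
  outer-∈ (x ∷ y ∷ l) z = pairs-cons x y _ z (outer-∈ (y ∷ l) z)

  -- `Inner` refers to the word before deletion and so covers a final E whose deleted successor is
  -- an N; what remains for `Outer` is a deleted E.
  Inner Outer : List (Letter × ℤ) → Letter × ℤ → ℤ → ℤ → Set
  Inner l z t s = ∃ λ l₁ → ∃ λ l₂ → l ++ z ∷ [] ≡ l₁ ++ (El , t) ∷ (Nl , s) ∷ l₂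
  Outer l z t s = ∃ λ l₁ → l ≡ l₁ ++ (El , t) ∷ [] × s ≡ mate z

  cons-out : ∀ {x l z t s} → Inner l z t s ⊎ Outer l z t s → Inner (x ∷ l) z t s ⊎ Outer (x ∷ l) z t s
  cons-out {x} (inj₁ (l₁ , l₂ , q)) = inj₁ (x ∷ l₁ , l₂ , cong (x ∷_) q)
  cons-out {x} (inj₂ (l₁ , q , r)) = inj₂ (x ∷ l₁ , cong (x ∷_) q , r)

  pairs-out : ∀ l z {t s} → (t , s) ∈ pairs l z → Inner l z t s ⊎ Outer l z t s
  pairs-out ((El , t) ∷ []) z (here refl) = inj₂ ([] , refl , refl)
  pairs-out ((El , t) ∷ (Nl , s) ∷ l) z (here refl) = inj₁ ([] , l ++ z ∷ [] , refl)
  pairs-out ((El , t) ∷ (Nl , s) ∷ l) z (there h) = cons-out (pairs-out ((Nl , s) ∷ l) z h)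
  pairs-out ((El , _) ∷ (El , t) ∷ l) z h = cons-out (pairs-out ((El , t) ∷ l) z h)
  pairs-out ((Nl , _) ∷ y ∷ l) z h = cons-out (pairs-out (y ∷ l) z h)

  module Sorted {A : Set} (k : A → ℤ) where
    _≻ₖ_ : A → A → Set
    a ≻ₖ b = k b ℤ.< k a

    no-between : ∀ l₁ {x y l₂} → AllPairs _≻ₖ_ (l₁ ++ x ∷ y ∷ l₂) → ∀ {u} → u ∈ (l₁ ++ x ∷ y ∷ l₂) → k y ℤ.< k u → k u ℤ.< k x → ⊥
    no-between [] s (here refl) p q = ℤP.<-irrefl refl q
    no-between [] s (there (here refl)) p q = ℤP.<-irrefl refl p
    no-between [] (_ ∷ (r ∷ s)) (there (there h)) p q = ℤP.<-asym p (All.lookup r h)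
    no-between (a ∷ l₁) (r ∷ s) (here refl) p q = ℤP.<-asym q (All.lookup r (∈P.∈-++⁺ʳ l₁ (here refl)))
    no-between (a ∷ l₁) (r ∷ s) (there h) p q = no-between l₁ s h p q

    adjacent : ∀ l {x y} → AllPairs _≻ₖ_ l → x ∈ l → y ∈ l → k y ℤ.< k x → (∀ {u} → u ∈ l → k y ℤ.< k u → k u ℤ.< k x → ⊥) →
      ∃ λ l₁ → ∃ λ l₂ → l ≡ l₁ ++ x ∷ y ∷ l₂
    adjacent (a ∷ l) (r ∷ s) (here refl) (here refl) h nb = ⊥-elim (ℤP.<-irrefl refl h)
    adjacent (a ∷ b ∷ l) (r ∷ s) (here refl) (there (here refl)) h nb = [] , l , refl
    adjacent (a ∷ b ∷ l) (r ∷ (r' ∷ s)) (here refl) (there (there hy)) h nb = ⊥-elim (nb (there (here refl)) (All.lookup r' hy) (All.lookup r (here refl)))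
    adjacent (a ∷ l) (r ∷ s) (there hx) (here refl) h nb = ⊥-elim (ℤP.<-asym h (All.lookup r hx))
    adjacent (a ∷ l) {x} {y} (r ∷ s) (there hx) (there hy) h nb = go (adjacent l s hx hy h (λ hu → nb (there hu)))
      where go : (∃ λ l₁ → ∃ λ l₂ → l ≡ l₁ ++ x ∷ y ∷ l₂) → ∃ λ l₁ → ∃ λ l₂ → a ∷ l ≡ l₁ ++ x ∷ y ∷ l₂
            go (l₁ , l₂ , q) = a ∷ l₁ , l₂ , cong (a ∷_) q

    last-least : ∀ l {z} → AllPairs _≻ₖ_ (l ++ z ∷ []) → ∀ {y} → y ∈ l → k z ℤ.< k y
    last-least (a ∷ l) (r ∷ s) (here refl) = All.lookup r (∈P.∈-++⁺ʳ l (here refl))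
    last-least (a ∷ l) (r ∷ s) (there h) = last-least l s h

    init-sorted : ∀ l {z} → AllPairs _≻ₖ_ (l ++ z ∷ []) → AllPairs _≻ₖ_ l
    init-sorted [] s = []
    init-sorted (a ∷ l) (r ∷ s) = All.tabulate (λ h → All.lookup r (∈P.∈-++⁺ˡ h)) ∷ init-sorted l s

    least-last : ∀ l {z} → AllPairs _≻ₖ_ (l ++ z ∷ []) → ∀ {y} → y ∈ (l ++ z ∷ []) → (∀ {u} → u ∈ (l ++ z ∷ []) → k u ℤ.< k y → ⊥) → y ≡ z
    least-last l {z} s {y} h m = go (∈P.∈-++⁻ l h)
      where
      go : y ∈ l ⊎ y ∈ (z ∷ []) → y ≡ z
      go (inj₁ h') = ⊥-elim (m (∈P.∈-++⁺ʳ l (here refl)) (last-least l s h'))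
      go (inj₂ (here q)) = q

  dropLast-snoc : ∀ xs y → dropLast (xs ++ y ∷ []) ≡ xs
  dropLast-snoc xs y = trans (dropLast-++ xs y []) (LP.++-identityʳ xs)

  labelOf : ℕ → ℤ → ℕ
  labelOf n (+ p) = suc n ℕ.∸ p
  labelOf n -[1+ q ] = suc n ℕ.+ suc q

  labelOf-ℤ : ∀ n {z} → z ℤ.≤ + n → + labelOf n z ≡ + suc n ℤ.- z
  labelOf-ℤ n {+ p} (+≤+ h) = trans (sym (ℤP.⊖-≥ (ℕP.≤-trans h (ℕP.n≤1+n n)))) (sym (ℤP.m-n≡m⊖n (suc n) p))
  labelOf-ℤ n { -[1+ q ]} _ = lia 2 (λ n q → ⊢ # 1 :+ n :+ (# 1 :+ q) := # 1 :+ n :- (:- (# 1 :+ q))) (+ n) (+ q)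

  labelOf-at : ∀ n e → labelOf n (+ n ℤ.- + e) ≡ suc e
  labelOf-at n e = ℤP.+-injective (trans (labelOf-ℤ n (lia 2 (λ n e → # 0 :≤ e ⇒ ⊢ n :- e :≤ n) (+ n) (+ e) (0≤ e))) (lia 2 (λ n e → ⊢ # 1 :+ n :- (n :- e) := # 1 :+ e) (+ n) (+ e)))

  module _ (n : ℕ) (P : ℤ → ℤ) where
    labels : ℤ × ℤ → ℕ × ℕ
    labels (t , s) = labelOf n (P t) , labelOf n (P s)

    private
      next : ∀ {e xs} → Desc (+ n ℤ.- + e ℤ.- + 1) xs → Desc (+ n ℤ.- + suc e) xs
      next {e} {xs} = subst (λ a → Desc a xs) (lia 2 (λ n e → ⊢ n :- e :- # 1 := n :- (# 1 :+ e)) (+ n) (+ e))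

      final : Word → ℕ → ℕ → Word → List (ℕ × ℕ)
      final β e k w = if lastE β w then (e ℕ.+ countE w , suc (k ℕ.+ countN w)) ∷ [] else []

      final-E : ∀ β e k x w → final β e k (El ∷ x ∷ w) ≡ final β (suc e) k (x ∷ w)
      final-E β e k x w = cong (λ z → if lastE β (x ∷ w) then (z , suc (k ℕ.+ countN (x ∷ w))) ∷ [] else []) (ℕP.+-suc e (countE (x ∷ w)))

      final-N : ∀ β e k x w → final β e k (Nl ∷ x ∷ w) ≡ final β e (suc k) (x ∷ w)
      final-N β e k x w = cong (λ z → if lastE β (x ∷ w) then (e ℕ.+ countE (x ∷ w) , suc z) ∷ [] else []) (ℕP.+-suc k (countN (x ∷ w)))

    -- The rows of the E's occupy the positions n, n - 1, ... in the sorted order, and so do the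
    -- rows of the N's when the mate is appended. Hence counting letters and reading off positions
    -- give the same labels; the mate accounts for the additional valley of a path ending with E.
    valley-labels : ∀ β l z e k → Desc (+ n ℤ.- + e) (map P (letE l)) → Desc (+ n ℤ.- + k) (map P (letN l ++ mate z ∷ [])) →
      goVal β e k (map proj₁ l) ++ (if lastE β (map proj₁ l) then (e ℕ.+ countE (map proj₁ l) , suc (k ℕ.+ countN (map proj₁ l))) ∷ [] else []) ≡ map labels (pairs l z)
    valley-labels β [] z e k dE dN = refl
    valley-labels β ((El , t) ∷ []) z e k (dcons p _) (dcons q _) = cong (_∷ []) (cong₂ _,_ (trans (ℕP.+-comm e 1) (sym (trans (cong (labelOf n) p) (labelOf-at n e))))
        (trans (cong suc (ℕP.+-identityʳ k)) (sym (trans (cong (labelOf n) q) (labelOf-at n k)))))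
    valley-labels β ((Nl , s) ∷ []) z e k dE dN = refl
    valley-labels β ((El , t) ∷ (Nl , s) ∷ l) z e k (dcons p dE) (dcons q dN) = cong₂ _∷_ (cong₂ _,_ (sym (trans (cong (labelOf n) p) (labelOf-at n e))) (sym (trans (cong (labelOf n) q) (labelOf-at n k))))
        (trans (cong (goVal β (suc e) k (Nl ∷ map proj₁ l) ++_) (final-E β e k Nl (map proj₁ l))) (valley-labels β ((Nl , s) ∷ l) z (suc e) k (next dE) (dcons q dN)))
    valley-labels β ((El , _) ∷ (El , t) ∷ l) z e k (dcons p dE) dN =
        trans (cong (goVal β (suc e) k (El ∷ map proj₁ l) ++_) (final-E β e k El (map proj₁ l))) (valley-labels β ((El , t) ∷ l) z (suc e) k (next dE) dN)
    valley-labels β ((Nl , _) ∷ (x , t) ∷ l) z e k dE (dcons q dN) =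
        trans (cong (goVal β e (suc k) (x ∷ map proj₁ l) ++_) (final-N β e k x (map proj₁ l))) (valley-labels β ((x , t) ∷ l) z e (suc k) dE (next dN))

  module Valleys {m : ℕ} (μ : Vecℤ (suc (suc m))) (μ-lo : ∀ i → ℤ.- (+ suc (suc m)) ℤ.≤ μ i) (μ-hi : ∀ i → μ i ℤ.≤ + 2 ℤ.* + suc (suc m))
    (S : Steps {m} μ) (P T : ℤ → ℤ) (P-idx : ∀ {t} → SIdx (suc (suc m)) t → SIdx (suc (suc m)) (P t)) (T-idx : ∀ {u} → SIdx (suc (suc m)) u → SIdx (suc (suc m)) (T u))
    (TP≡ : ∀ {t} → SIdx (suc (suc m)) t → T (P t) ≡ t) (PT≡ : ∀ {u} → SIdx (suc (suc m)) u → P (T u) ≡ u)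
    (X<⇒P< : ∀ {s t} → SIdx (suc (suc m)) s → SIdx (suc (suc m)) t → X μ s ℤ.< X μ t → P s ℤ.< P t)
    (T<⇒X< : ∀ {u v} → SIdx (suc (suc m)) u → SIdx (suc (suc m)) v → u ℤ.< v → X μ (T u) ℤ.< X μ (T v)) where
    private
      n = suc (suc m)
      x : ℤ → ℤ
      x = X μ
      w = word μ μ-lo μ-hi
      val : Letter × ℤ → ℤ
      val = kof μ μ-lo μ-hi
      sorted = word-sorted μ μ-lo μ-hi
    open Sorted val

    X-odd′ : ∀ t → x (ℤ.- t) ≡ ℤ.- x t
    X-odd′ = X-odd μ

    X-injective : ∀ {s t} → SIdx n s → SIdx n t → x s ≡ x t → s ≡ t
    X-injective {s} {t} ss st e = go (ℤP.<-cmp (P s) (P t))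
      where
      go : Tri (P s ℤ.< P t) (P s ≡ P t) (P t ℤ.< P s) → s ≡ t
      go (tri< h _ _) = ⊥-elim (ℤP.<-irrefl e (subst₂ ℤ._<_ (cong x (TP≡ ss)) (cong x (TP≡ st)) (T<⇒X< (P-idx ss) (P-idx st) h)))
      go (tri≈ _ h _) = trans (sym (TP≡ ss)) (trans (cong T h) (TP≡ st))
      go (tri> _ _ h) = ⊥-elim (ℤP.<-irrefl (sym e) (subst₂ ℤ._<_ (cong x (TP≡ st)) (cong x (TP≡ ss)) (T<⇒X< (P-idx st) (P-idx ss) h)))

    -- Equality would make twice a base value an odd multiple of N, against |2p| < N.
    half : ∀ {t} → SIdx n t → N n ℤ.≤ + 2 ℤ.* x t → N n ℤ.< + 2 ℤ.* x t
    half {t} st h = lia 3 (λ N p y → :- N :< # 2 :* p ⇒ N :* (# 1 :+ # 2 :* y) :≤ N :* (# 0 :- # 1) ⇒ ⊢ N :< # 2 :* (p :- N :* y)) (N n) (pt n t) (ext μ t) (proj₂ (pt-bound st))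
       (Npos-mono n {+ 1 ℤ.+ + 2 ℤ.* ext μ t} { -[1+ 0 ]} (lia 1 (λ y → y :< # 0 ⇒ ⊢ # 1 :+ # 2 :* y :≤ # 0 :- # 1) (ext μ t)
          (lia 1 (λ y → # 1 :+ # 2 :* y :< # 1 ⇒ ⊢ y :< # 0) (ext μ t) y<0)))
      where
      y<0 : + 1 ℤ.+ + 2 ℤ.* ext μ t ℤ.< + 1
      y<0 = N-cancel< n {+ 1 ℤ.+ + 2 ℤ.* ext μ t} {+ 1} (lia 3 (λ N p y → N :≤ # 2 :* (p :- N :* y) ⇒ # 2 :* p :< N ⇒ ⊢ N :* (# 1 :+ # 2 :* y) :< N :* # 1) (N n) (pt n t) (ext μ t) h (proj₁ (pt-bound st)))

    half-not : ∀ {t} → SIdx n t → ¬ (N n ℤ.< + 2 ℤ.* x t) → + 2 ℤ.* x t ℤ.< N n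
    half-not st q = ℤP.≰⇒> (λ h → q (half st h))

    half-not⁻ : ∀ {t} → SIdx n t → ¬ (ℤ.- N n ℤ.< + 2 ℤ.* x t) → + 2 ℤ.* x t ℤ.< ℤ.- N n
    half-not⁻ {t} st q = lia 3 (λ N a b → b := :- a ⇒ N :< # 2 :* b ⇒ ⊢ # 2 :* a :< :- N) (N n) (x t) (x (ℤ.- t)) (X-odd′ t) (half (sidx-neg st)
       (lia 3 (λ N a b → b := :- a ⇒ # 2 :* a :≤ :- N ⇒ ⊢ N :≤ # 2 :* b) (N n) (x t) (x (ℤ.- t)) (X-odd′ t) (ℤP.≮⇒≥ q)))

    El-big : ∀ {t} → (El , t) ∈ w → SIdx n t × (N n ℤ.< + 2 ℤ.* x t)
    El-big h = word-∈ μ μ-lo μ-hi h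

    Nl-big : ∀ {t} → (Nl , t) ∈ w → SIdx n t × (ℤ.- N n ℤ.< + 2 ℤ.* x t)
    Nl-big {t} h = proj₁ (word-∈ μ μ-lo μ-hi h) , lia 2 (λ N a → N :< # 2 :* (a :+ N) ⇒ ⊢ :- N :< # 2 :* a) (N n) (x t) (proj₂ (word-∈ μ μ-lo μ-hi h))

    in-E : ∀ {t} → SIdx n t → N n ℤ.< + 2 ℤ.* x t → (El , t) ∈ w
    in-E = word-E μ μ-lo μ-hi

    in-N : ∀ {t} → SIdx n t → ℤ.- N n ℤ.< + 2 ℤ.* x t → (Nl , t) ∈ w
    in-N = word-N μ μ-lo μ-hi

    -- pairs (c, d) spanning a wall of the alcove that is a floor at height one
    Wall₁ : ℤ → ℤ → Set
    Wall₁ c d = ∃ λ κ → WallPair {m} c d κ × drop μ c d κ ≡ + 1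

    -- A pair and its mirror span the same root, and a valley may exhibit either of them.
    Link : ℤ → ℤ → Set
    Link c d = Wall₁ c d ⊎ Wall₁ (ℤ.- d) (ℤ.- c)

    link-flip : ∀ {c d} → Link c d → Link (ℤ.- d) (ℤ.- c)
    link-flip (inj₁ h) = inj₂ (subst₂ Wall₁ (sym (ℤP.neg-involutive _)) (sym (ℤP.neg-involutive _)) h)
    link-flip (inj₂ h) = inj₁ h

    wall-gap₁ : ∀ {c d} → Wall₁ c d → Valid n c d × (x c ℤ.+ N n ℤ.< x d)
    wall-gap₁ {c} {d} (κ , W , e) = wall-valid W , lia 6 (λ N p q y z κ → # 0 :< q :- p :+ N :* κ ⇒ N :* (y :- z :- κ) := N ⇒ ⊢ p :- N :* y :+ N :< q :- N :* z) (N n) (pt n c) (pt n d) (ext μ c) (ext μ d) κ (proj₁ (wall-gap W))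
       (trans (cong (N n ℤ.*_) e) (ℤP.*-identityʳ (N n)))

    link-valid : ∀ {c d} → Link c d → Valid n c d × (x c ℤ.+ N n ℤ.< x d)
    link-valid (inj₁ h) = wall-gap₁ h
    link-valid {c} {d} (inj₂ h) = valid-pair (subst (SIdx n) (ℤP.neg-involutive c) (sidx-neg (vt v))) (subst (SIdx n) (ℤP.neg-involutive d) (sidx-neg (vs v)))
        (λ q → s≢t v (cong ℤ.-_ (sym q))) (λ q → s≢-t v (trans (sym q) (sym (ℤP.neg-involutive c))))
      , lia 5 (λ a b a' b' N → a' := :- a ⇒ b' := :- b ⇒ b' :+ N :< a' ⇒ ⊢ a :+ N :< b) (x c) (x d) (x (ℤ.- c)) (x (ℤ.- d)) (N n) (X-odd′ c) (X-odd′ d) (proj₂ (wall-gap₁ h))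
      where v = proj₁ (wall-gap₁ h)

    Found : ℤ → ℤ → Set
    Found s t = ∃ λ c → ∃ λ d → (c ≡ s ⊎ x s ℤ.< x c) × (d ≡ t ⊎ x d ℤ.< x t) × Link c d

    -- This is `find-chain` for one level, applied to the mirror pair when the target is -n. The
    -- excluded pair from n to -n is its own mirror, so that passing to the mirror gains nothing.
    found : ∀ {s t} → SIdx n s → SIdx n t → x s ℤ.+ N n ℤ.< x t → ¬ (s ≡ + n × t ≡ -[1+ suc m ]) → Found s t
    found {s} {t} ss st h ne = go (t ℤP.≟ -[1+ suc m ])
      where
      N>0 = N-pos n
      s≢t′ : s ≢ t
      s≢t′ q = ℤP.<-asym h (subst (λ z → x z ℤ.< x s ℤ.+ N n) q (lia 2 (λ a N → # 0 :< N ⇒ ⊢ a :< a :+ N) (x s) (N n) N>0))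
      gap : ∀ {s t} → x s ℤ.+ N n ℤ.< x t → N n ℤ.* + 1 ℤ.< x t ℤ.- x s
      gap {s} {t} h = lia 3 (λ a b N → a :+ N :< b ⇒ ⊢ N :* # 1 :< b :- a) (x s) (x t) (N n) h
      conv : ∀ {s t} → Chain {m} μ s t (+ 1) → Found s t
      conv {s} {t} (chain {c} {d} {κ} W e af be) = c , d , bef be , af , inj₁ (κ , W , e)
        where
        bef : (c ≡ s × + 1 ≡ + 1) ⊎ (Cyclic s c × N n ℤ.* (+ 1 ℤ.- + 1) ℤ.< X μ c ℤ.- X μ s) → c ≡ s ⊎ x s ℤ.< x c
        bef (inj₁ (q , _)) = inj₁ q
        bef (inj₂ (_ , q)) = inj₂ (lia 3 (λ a b N → N :* (# 1 :- # 1) :< b :- a ⇒ ⊢ a :< b) (x s) (x c) (N n) q)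
      cyc : ∀ {s t} → s ≢ t → t ≢ -[1+ suc m ] → Cyclic {m} s t
      cyc {s} {t} p q with ℤP.<-cmp s t
      ... | tri< l _ _ = inj₁ l
      ... | tri≈ _ l _ = ⊥-elim (p l)
      ... | tri> _ _ l = inj₂ (l , q)
      flip : Found (ℤ.- t) (ℤ.- s) → Found s t
      flip (c , d , p , q , l) = ℤ.- d , ℤ.- c , left′ q , right′ p , link-flip l
        where
        left′ : d ≡ ℤ.- s ⊎ x d ℤ.< x (ℤ.- s) → ℤ.- d ≡ s ⊎ x s ℤ.< x (ℤ.- d)
        left′ (inj₁ r) = inj₁ (trans (cong ℤ.-_ r) (ℤP.neg-involutive s))
        left′ (inj₂ r) = inj₂ (lia 4 (λ a b a' b' → a' := :- a ⇒ b' := :- b ⇒ b :< a' ⇒ ⊢ a :< b') (x s) (x d) (x (ℤ.- s)) (x (ℤ.- d)) (X-odd′ s) (X-odd′ d) r)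
        right′ : c ≡ ℤ.- t ⊎ x (ℤ.- t) ℤ.< x c → ℤ.- c ≡ t ⊎ x (ℤ.- c) ℤ.< x t
        right′ (inj₁ r) = inj₁ (trans (cong ℤ.-_ r) (ℤP.neg-involutive t))
        right′ (inj₂ r) = inj₂ (lia 4 (λ a b a' b' → a' := :- a ⇒ b' := :- b ⇒ a' :< b ⇒ ⊢ b' :< a) (x t) (x c) (x (ℤ.- t)) (x (ℤ.- c)) (X-odd′ t) (X-odd′ c) r)
      go : Dec (t ≡ -[1+ suc m ]) → Found s t
      go (no q) = conv (find-chain S ss st (cyc s≢t′ q) ℤP.≤-refl (gap {s} {t} h))
      go (yes q) = flip (conv (find-chain S (sidx-neg st) (sidx-neg ss) (cyc (λ r → s≢t′ (sym (ℤP.neg-injective r))) (λ r → ne (ℤP.neg-injective {s} {+ n} r , q))) ℤP.≤-refl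
          (gap {ℤ.- t} {ℤ.- s} (lia 5 (λ a b a' b' N → a' := :- a ⇒ b' := :- b ⇒ a :+ N :< b ⇒ ⊢ b' :+ N :< a') (x s) (x t) (x (ℤ.- s)) (x (ℤ.- t)) (N n) (X-odd′ s) (X-odd′ t) h))))

    private
      -- Neighbouring base values leave no room between them. At the forks the two crossing pairs
      -- interleave: p(n) - N lies between p(n - 1) - N and -p(n), and -p(n) lies between p(n) - N
      -- and -p(n - 1).
      wall-slot : ∀ {c d κ} → WallPair {m} c d κ → ∀ {u} → SIdx n u → ∀ k → pt n c ℤ.- N n ℤ.* κ ℤ.< pt n u ℤ.- N n ℤ.* k → pt n u ℤ.- N n ℤ.* k ℤ.< pt n d →
        (c ≡ + suc m × d ≡ -[1+ suc m ] × κ ≡ + 1 × u ≡ + n × k ≡ + 1) ⊎ (c ≡ + n × d ≡ -[1+ m ] × κ ≡ + 1 × u ≡ -[1+ suc m ] × k ≡ + 0)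
      wall-slot {c} (up sc sd) {u} su k h₁ h₂ = ⊥-elim (lia 2 (λ c u → c :< u ⇒ u :< c :+ # 1 ⇒ ⊢ :⊥) c u c<u u<d)
        where
        k0 : k ≡ + 0
        k0 = mul-small (N-pos n)
          (lia 4 (λ N p q y → p :- N :* # 0 :< q :- y ⇒ # 2 :* q :< N ⇒ :- N :< # 2 :* p ⇒ ⊢ y :< N) (N n) (pt n c) (pt n u) (N n ℤ.* k) h₁ (proj₁ (pt-bound su)) (proj₂ (pt-bound sc)))
          (lia 4 (λ N p q y → q :- y :< p ⇒ # 2 :* p :< N ⇒ :- N :< # 2 :* q ⇒ ⊢ :- N :< y) (N n) (pt n (c ℤ.+ + 1)) (pt n u) (N n ℤ.* k) h₂ (proj₁ (pt-bound sd)) (proj₂ (pt-bound su)))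
        Nk : N n ℤ.* k ≡ + 0
        Nk = trans (cong (N n ℤ.*_) k0) (ℤP.*-zeroʳ (N n))
        c<u : c ℤ.< u
        c<u = ℤP.≰⇒> λ q → ℤP.<⇒≱ (lia 4 (λ N p q y → p :- N :* # 0 :< q :- y ⇒ y := # 0 ⇒ ⊢ p :< q) (N n) (pt n c) (pt n u) (N n ℤ.* k) h₁ Nk) (mono≤′ su sc q)
          where
          mono≤′ : ∀ {s t} → SIdx n s → SIdx n t → s ℤ.≤ t → pt n s ℤ.≤ pt n t
          mono≤′ {s} {t} a b q with s ℤP.≟ t
          ... | yes refl = ℤP.≤-refl
          ... | no r = ℤP.<⇒≤ (pt-mono a b (ℤP.≤∧≢⇒< q r))
        u<d : u ℤ.< c ℤ.+ + 1
        u<d = ℤP.≰⇒> λ q → ℤP.<⇒≱ (lia 3 (λ p q y → q :- y :< p ⇒ y := # 0 ⇒ ⊢ q :< p) (pt n (c ℤ.+ + 1)) (pt n u) (N n ℤ.* k) h₂ Nk) (mono≤′ sd su q)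
          where
          mono≤′ : ∀ {s t} → SIdx n s → SIdx n t → s ℤ.≤ t → pt n s ℤ.≤ pt n t
          mono≤′ {s} {t} a b q with s ℤP.≟ t
          ... | yes refl = ℤP.≤-refl
          ... | no r = ℤP.<⇒≤ (pt-mono a b (ℤP.≤∧≢⇒< q r))
      wall-slot fork₁ {u} su k h₁ h₂ = inj₁ (refl , refl , refl , u≡n , k1)
        where
        -pn : pt n -[1+ suc m ] ≡ ℤ.- pt n (+ n)
        -pn = ext-odd (pS {n}) (+ n)
        le-n : pt n u ℤ.≤ pt n (+ n)
        le-n with u ℤP.≟ + n
        ... | yes refl = ℤP.≤-refl
        ... | no r = ℤP.<⇒≤ (pt-mono su in-n (ℤP.≤∧≢⇒< (sidx-hi su) r))
        ge-n : ℤ.- pt n (+ n) ℤ.≤ pt n u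
        ge-n with u ℤP.≟ -[1+ suc m ]
        ... | yes refl = ℤP.≤-reflexive (sym -pn)
        ... | no r = ℤP.<⇒≤ (subst (ℤ._< pt n u) -pn (pt-mono (sidx-neg in-n) su (ℤP.≤∧≢⇒< (sidx-lo su) (r ∘ sym))))
        k>0 : + 0 ℤ.< k
        k>0 = N-cancel< n {+ 0} {k} (lia 5 (λ N q p p' y → q :- y :< p' ⇒ p' := :- p ⇒ :- p :≤ q ⇒ ⊢ N :* # 0 :< y) (N n) (pt n u) (pt n (+ n)) (pt n -[1+ suc m ]) (N n ℤ.* k) h₂ -pn ge-n)
        k<2 : k ℤ.< + 2
        k<2 = N-cancel< n {k} {+ 2} (lia 6 (λ N q p p' y m → p' :- N :* # 1 :< q :- y ⇒ q :≤ p ⇒ p := # 2 :* (# 2 :+ m) :- # 1 ⇒ p' := # 2 :* (# 1 :+ m) :- # 1 ⇒ # 12 :≤ N ⇒ ⊢ y :< N :* # 2) (N n) (pt n u) (pt n (+ n)) (pt n (+ suc m)) (N n ℤ.* k) (+ m) h₁ le-n pt-n pt-n-1 (N≥12 {m}))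
        k1 : k ≡ + 1
        k1 = lia 1 (λ k → # 0 :< k ⇒ k :< # 2 ⇒ ⊢ k := # 1) k k>0 k<2
        u≡n : u ≡ + n
        u≡n = ℤP.≤-antisym (sidx-hi su) (lia 2 (λ m u → # 1 :+ m :< u ⇒ ⊢ # 2 :+ m :≤ u) (+ m) u (ℤP.≰⇒> λ q → ℤP.<⇒≱ (lia 4 (λ N q p y → p :- N :* # 1 :< q :- y ⇒ y := N ⇒ ⊢ p :< q) (N n) (pt n u) (pt n (+ suc m)) (N n ℤ.* k) h₁ (trans (cong (N n ℤ.*_) k1) (ℤP.*-identityʳ (N n)))) (le′ q)))
          where
          le′ : u ℤ.≤ + suc m → pt n u ℤ.≤ pt n (+ suc m)
          le′ q with u ℤP.≟ + suc m
          ... | yes refl = ℤP.≤-refl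
          ... | no r = ℤP.<⇒≤ (pt-mono su in-n-1 (ℤP.≤∧≢⇒< q r))
      wall-slot fork₂ {u} su k h₁ h₂ = inj₂ (refl , refl , refl , u≡-n , k0)
        where
        -pn : pt n -[1+ suc m ] ≡ ℤ.- pt n (+ n)
        -pn = ext-odd (pS {n}) (+ n)
        -pn-1 : pt n -[1+ m ] ≡ ℤ.- pt n (+ suc m)
        -pn-1 = ext-odd (pS {n}) (+ suc m)
        le-n : pt n u ℤ.≤ pt n (+ n)
        le-n with u ℤP.≟ + n
        ... | yes refl = ℤP.≤-refl
        ... | no r = ℤP.<⇒≤ (pt-mono su in-n (ℤP.≤∧≢⇒< (sidx-hi su) r))
        ge-n : ℤ.- pt n (+ n) ℤ.≤ pt n u
        ge-n with u ℤP.≟ -[1+ suc m ]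
        ... | yes refl = ℤP.≤-reflexive (sym -pn)
        ... | no r = ℤP.<⇒≤ (subst (ℤ._< pt n u) -pn (pt-mono (sidx-neg in-n) su (ℤP.≤∧≢⇒< (sidx-lo su) (r ∘ sym))))
        k>-1 : -[1+ 0 ] ℤ.< k
        k>-1 = N-cancel< n { -[1+ 0 ]} {k} (lia 7 (λ N q p p' p'' y m → q :- y :< p'' ⇒ p'' := :- p' ⇒ :- p :≤ q ⇒ p := # 2 :* (# 2 :+ m) :- # 1 ⇒ p' := # 2 :* (# 1 :+ m) :- # 1 ⇒ # 12 :≤ N ⇒ ⊢ N :* con -[1+ 0 ] :< y) (N n) (pt n u) (pt n (+ n)) (pt n (+ suc m)) (pt n -[1+ m ]) (N n ℤ.* k) (+ m) h₂ -pn-1 ge-n pt-n pt-n-1 (N≥12 {m}))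
        k<1 : k ℤ.< + 1
        k<1 = N-cancel< n {k} {+ 1} (lia 4 (λ N q p y → p :- N :* # 1 :< q :- y ⇒ q :≤ p ⇒ ⊢ y :< N :* # 1) (N n) (pt n u) (pt n (+ n)) (N n ℤ.* k) h₁ le-n)
        k0 : k ≡ + 0
        k0 = lia 1 (λ k → con -[1+ 0 ] :< k ⇒ k :< # 1 ⇒ ⊢ k := # 0) k k>-1 k<1
        u≡-n : u ≡ -[1+ suc m ]
        u≡-n = ℤP.≤-antisym (lia 2 (λ m u → u :< :- (# 1 :+ m) ⇒ ⊢ u :≤ :- (# 2 :+ m)) (+ m) u (ℤP.≰⇒> λ q → ℤP.<⇒≱ (lia 3 (λ q p y → q :- y :< p ⇒ y := # 0 ⇒ ⊢ q :< p) (pt n u) (pt n -[1+ m ]) (N n ℤ.* k) h₂ (trans (cong (N n ℤ.*_) k0) (ℤP.*-zeroʳ (N n)))) (le′ q))) (sidx-lo su)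
          where
          le′ : -[1+ m ] ℤ.≤ u → pt n -[1+ m ] ℤ.≤ pt n u
          le′ q with -[1+ m ] ℤP.≟ u
          ... | yes refl = ℤP.≤-refl
          ... | no r = ℤP.<⇒≤ (pt-mono (sidx-neg in-n-1) su (ℤP.≤∧≢⇒< q r))

    -- Only the mirror image of an endpoint can lie inside the gap of a wall; the parity of μₙ₋₁ + μₙ excludes the other candidates.
    betweenE : ∀ {c d} → Wall₁ c d → ∀ {u} → SIdx n u → x c ℤ.+ N n ℤ.< x u → x u ℤ.< x d → u ≡ ℤ.- c
    betweenE {c} {d} (κ , W , e) {u} su h₁ h₂ = go (wall-slot W su (ext μ u ℤ.- ext μ d)
         (lia 7 (λ N p q y z v κ → p :- N :* y :+ N :< q :- N :* v ⇒ N :* (y :- z :- κ) := N ⇒ ⊢ p :- N :* κ :< q :- N :* (v :- z)) (N n) (pt n c) (pt n u) (ext μ c) (ext μ d) (ext μ u) κ h₁ (trans (cong (N n ℤ.*_) e) (ℤP.*-identityʳ (N n))))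
         (lia 5 (λ N p q z v → q :- N :* v :< p :- N :* z ⇒ ⊢ q :- N :* (v :- z) :< p) (N n) (pt n d) (pt n u) (ext μ d) (ext μ u) h₂))
      where
      go : _ → u ≡ ℤ.- c
      go (inj₁ (refl , refl , refl , refl , q)) = ⊥-elim (odd-not-even {0} (ext μ (+ n)) (lia 2 (λ a b → a :- b := # 1 ⇒ b := :- a ⇒ ⊢ # 1 := # 2 :* a) (ext μ (+ n)) (ext μ -[1+ suc m ]) q (ext-odd μ (+ n))))
      go (inj₂ (refl , refl , refl , refl , _)) = refl

    betweenN : ∀ {c d} → Wall₁ c d → ∀ {u} → SIdx n u → x c ℤ.< x u → x u ℤ.+ N n ℤ.< x d → u ≡ ℤ.- d
    betweenN {c} {d} (κ , W , e) {u} su h₁ h₂ = go (wall-slot W su (ext μ u ℤ.- ext μ d ℤ.- + 1)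
         (lia 7 (λ N p q y z v κ → p :- N :* y :< q :- N :* v ⇒ N :* (y :- z :- κ) := N ⇒ ⊢ p :- N :* κ :< q :- N :* (v :- z :- # 1)) (N n) (pt n c) (pt n u) (ext μ c) (ext μ d) (ext μ u) κ h₁ (trans (cong (N n ℤ.*_) e) (ℤP.*-identityʳ (N n))))
         (lia 5 (λ N p q z v → q :- N :* v :+ N :< p :- N :* z ⇒ ⊢ q :- N :* (v :- z :- # 1) :< p) (N n) (pt n d) (pt n u) (ext μ d) (ext μ u) h₂))
        e
      where
      go : ∀ {κ} → (c ≡ + suc m × d ≡ -[1+ suc m ] × κ ≡ + 1 × u ≡ + n × ext μ u ℤ.- ext μ d ℤ.- + 1 ≡ + 1) ⊎ (c ≡ + n × d ≡ -[1+ m ] × κ ≡ + 1 × u ≡ -[1+ suc m ] × ext μ u ℤ.- ext μ d ℤ.- + 1 ≡ + 0) → drop μ c d κ ≡ + 1 → u ≡ ℤ.- d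
      go (inj₁ (refl , refl , refl , refl , q)) _ = refl
      go (inj₂ (refl , refl , refl , refl , q)) e = ⊥-elim (odd-not-even {0} (ext μ (+ suc m) ℤ.- + 1) (lia 4 (λ a b a' b' → a' :- b' :- # 1 := # 0 ⇒ a' := :- a ⇒ b' := :- b ⇒ a :- b' :- # 1 := # 1 ⇒ ⊢ # 1 := # 2 :* (b :- # 1)) (ext μ (+ n)) (ext μ (+ suc m)) (ext μ -[1+ suc m ]) (ext μ -[1+ m ]) q (ext-odd μ (+ n)) (ext-odd μ (+ suc m)) e))

    module _ {l : List (Letter × ℤ)} {z : Letter × ℤ} (split : w ≡ l ++ z ∷ []) where
      private
        sorted′ : AllPairs _≻ₖ_ (l ++ z ∷ [])
        sorted′ = subst (AllPairs _≻ₖ_) split sorted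
        toW : ∀ {u} → u ∈ (l ++ z ∷ []) → u ∈ w
        toW = subst (_ ∈_) (sym split)
        frW : ∀ {u} → u ∈ w → u ∈ (l ++ z ∷ [])
        frW = subst (_ ∈_) split

      -- `found` yields a floor between the two rows. If it were not this very pair, the letter of
      -- one of its ends would stand strictly between two consecutive letters.
      inner⇒link : ∀ {t s} → Inner l z t s → Link s t
      inner⇒link {t} {s} (l₁ , l₂ , q) = fin (found ss st gap ne)
        where
        sorted″ : AllPairs _≻ₖ_ (l₁ ++ (El , t) ∷ (Nl , s) ∷ l₂)
        sorted″ = subst (AllPairs _≻ₖ_) q sorted′
        tE = El-big {t} (toW (subst ((El , t) ∈_) (sym q) (∈P.∈-++⁺ʳ l₁ (here refl))))
        sN = Nl-big {s} (toW (subst ((Nl , s) ∈_) (sym q) (∈P.∈-++⁺ʳ l₁ (there (here refl)))))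
        ss = proj₁ sN
        st = proj₁ tE
        gap : x s ℤ.+ N n ℤ.< x t
        gap = pick l₁ sorted″
          where pick : ∀ l₁ → AllPairs _≻ₖ_ (l₁ ++ (El , t) ∷ (Nl , s) ∷ l₂) → x s ℤ.+ N n ℤ.< x t
                pick [] (r ∷ _) = All.lookup r (here refl)
                pick (_ ∷ l₁) (_ ∷ r) = pick l₁ r
        ne : ¬ (s ≡ + n × t ≡ -[1+ suc m ])
        ne (refl , refl) = lia 3 (λ a b N → :- N :< # 2 :* a ⇒ b := :- a ⇒ a :+ N :< b ⇒ ⊢ :⊥) (x (+ n)) (x -[1+ suc m ]) (N n) (proj₂ sN) (X-odd′ (+ n)) gap
        nb : ∀ {u} → u ∈ w → x s ℤ.+ N n ℤ.< val u → val u ℤ.< x t → ⊥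
        nb {u} h = no-between l₁ sorted″ (subst (u ∈_) q (frW h))
        fin : Found s t → Link s t
        fin (c , d , p , r , L) = go p r
          where
          v = proj₁ (link-valid L)
          gp = proj₂ (link-valid L)
          s≤c : c ≡ s ⊎ x s ℤ.< x c → x s ℤ.≤ x c
          s≤c (inj₁ refl) = ℤP.≤-refl
          s≤c (inj₂ h) = ℤP.<⇒≤ h
          go : c ≡ s ⊎ x s ℤ.< x c → d ≡ t ⊎ x d ℤ.< x t → Link s t
          go p (inj₂ h) = ⊥-elim (nb (in-E (vt v) (lia 4 (λ a c d N → :- N :< # 2 :* a ⇒ a :≤ c ⇒ c :+ N :< d ⇒ ⊢ N :< # 2 :* d) (x s) (x c) (x d) (N n) (proj₂ sN) (s≤c p) gp))
              (lia 4 (λ a c d N → a :≤ c ⇒ c :+ N :< d ⇒ ⊢ a :+ N :< d) (x s) (x c) (x d) (N n) (s≤c p) gp) h)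
          go (inj₂ h) (inj₁ refl) = ⊥-elim (nb (in-N (vs v) (lia 3 (λ a c N → :- N :< # 2 :* a ⇒ a :< c ⇒ ⊢ :- N :< # 2 :* c) (x s) (x c) (N n) (proj₂ sN) h)) (ℤP.+-monoˡ-< (N n) h) gp)
          go (inj₁ refl) (inj₁ refl) = L

      -- Every N of the word precedes the E of t, so the lower end of the floor found from -s′ to t
      -- lies below -N/2. Its mirror is then an E, and only the last letter s′ is small enough. The
      -- upper end must be t: if it were below N/2, its mirror would be an N placed too late.
      outer⇒link : ∀ {t} s′ → z ≡ (El , s′) → ∀ l₁ → l ≡ l₁ ++ (El , t) ∷ [] → Link (ℤ.- s′) t
      outer⇒link {t} s′ refl l₁ refl = fin (found (sidx-neg ss′) st gap ne)
        where
        W≡ : w ≡ l₁ ++ (El , t) ∷ (El , s′) ∷ []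
        W≡ = trans split (LP.++-assoc l₁ ((El , t) ∷ []) ((El , s′) ∷ []))
        sorted″ : AllPairs _≻ₖ_ (l₁ ++ (El , t) ∷ (El , s′) ∷ [])
        sorted″ = subst (AllPairs _≻ₖ_) W≡ sorted
        tE = El-big {t} (subst ((El , t) ∈_) (sym W≡) (∈P.∈-++⁺ʳ l₁ (here refl)))
        sE = El-big {s′} (subst ((El , s′) ∈_) (sym W≡) (∈P.∈-++⁺ʳ l₁ (there (here refl))))
        ss′ = proj₁ sE
        st = proj₁ tE
        x-s : x (ℤ.- s′) ≡ ℤ.- x s′
        x-s = X-odd′ s′
        gap : x (ℤ.- s′) ℤ.+ N n ℤ.< x t
        gap = lia 4 (λ a b c N → c := :- a ⇒ N :< # 2 :* a ⇒ N :< # 2 :* b ⇒ ⊢ c :+ N :< b) (x s′) (x t) (x (ℤ.- s′)) (N n) x-s (proj₂ sE) (proj₂ tE)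
        s′<t : x s′ ℤ.< x t
        s′<t = last-least (l₁ ++ (El , t) ∷ []) sorted′ (∈P.∈-++⁺ʳ l₁ (here refl))
        ne : ¬ (ℤ.- s′ ≡ + n × t ≡ -[1+ suc m ])
        ne (p , refl) = ℤP.<-irrefl (cong x (trans (sym (ℤP.neg-involutive s′)) (cong ℤ.-_ p))) s′<t
        nb : ∀ {u} → u ∈ w → x s′ ℤ.< val u → val u ℤ.< x t → ⊥
        nb {u} h = no-between l₁ sorted″ (subst (u ∈_) W≡ h)
        least : ∀ {u} → u ∈ w → val u ℤ.< x s′ → ⊥
        least {u} h q = go (∈P.∈-++⁻ (l₁ ++ (El , t) ∷ []) (frW h))
          where
          go : u ∈ (l₁ ++ (El , t) ∷ []) ⊎ u ∈ ((El , s′) ∷ []) → ⊥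
          go (inj₁ h') = ℤP.<-asym q (last-least (l₁ ++ (El , t) ∷ []) sorted′ h')
          go (inj₂ (here refl)) = ℤP.<-irrefl refl q
        gapE : ∀ {d} → SIdx n d → N n ℤ.< + 2 ℤ.* x d → d ≡ s′ ⊎ d ≡ t ⊎ x t ℤ.< x d
        gapE {d} sd big = go (ℤP.<-cmp (x d) (x s′)) (ℤP.<-cmp (x d) (x t))
          where
          go : Tri (x d ℤ.< x s′) (x d ≡ x s′) (x s′ ℤ.< x d) → Tri (x d ℤ.< x t) (x d ≡ x t) (x t ℤ.< x d) → d ≡ s′ ⊎ d ≡ t ⊎ x t ℤ.< x d
          go (tri< h _ _) _ = ⊥-elim (least (in-E sd big) h)
          go (tri≈ _ h _) _ = inj₁ (X-injective sd ss′ h)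
          go (tri> _ _ _) (tri≈ _ h _) = inj₂ (inj₁ (X-injective sd st h))
          go (tri> _ _ h) (tri< h' _ _) = ⊥-elim (nb (in-E sd big) h h')
          go (tri> _ _ _) (tri> _ _ h) = inj₂ (inj₂ h)
        gapN : ∀ {c} → SIdx n c → ℤ.- N n ℤ.< + 2 ℤ.* x c → x t ℤ.< x c ℤ.+ N n
        gapN {c} sc big = ℤP.≰⇒> λ q → go (∈P.∈-++⁻ l₁ (subst ((Nl , c) ∈_) W≡ (in-N sc big))) q
          where
          go : (Nl , c) ∈ l₁ ⊎ (Nl , c) ∈ ((El , t) ∷ (El , s′) ∷ []) → x c ℤ.+ N n ℤ.≤ x t → ⊥
          go (inj₁ h) q = ℤP.<⇒≱ (front l₁ sorted″ h) q
            where front : ∀ l₁ → AllPairs _≻ₖ_ (l₁ ++ (El , t) ∷ (El , s′) ∷ []) → (Nl , c) ∈ l₁ → x t ℤ.< x c ℤ.+ N n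
                  front (_ ∷ l₁) (r ∷ _) (here refl) = All.lookup r (∈P.∈-++⁺ʳ l₁ (here refl))
                  front (_ ∷ l₁) (_ ∷ r) (there h) = front l₁ r h
          go (inj₂ (there (there ()))) q
        fin : Found (ℤ.- s′) t → Link (ℤ.- s′) t
        fin (c , d , p , r , L) = go (ℤ.- N n ℤP.<? + 2 ℤ.* x c)
          where
          v = proj₁ (link-valid L)
          gp = proj₂ (link-valid L)
          xd≤ : d ≡ t ⊎ x d ℤ.< x t → x d ℤ.≤ x t
          xd≤ (inj₁ refl) = ℤP.≤-refl
          xd≤ (inj₂ h) = ℤP.<⇒≤ h
          s≤c : c ≡ ℤ.- s′ ⊎ x (ℤ.- s′) ℤ.< x c → x (ℤ.- s′) ℤ.≤ x c
          s≤c (inj₁ refl) = ℤP.≤-refl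
          s≤c (inj₂ h) = ℤP.<⇒≤ h
          go : Dec (ℤ.- N n ℤ.< + 2 ℤ.* x c) → Link (ℤ.- s′) t
          go (yes h) = ⊥-elim (lia 4 (λ c d t N → t :< c :+ N ⇒ c :+ N :< d ⇒ d :≤ t ⇒ ⊢ :⊥) (x c) (x d) (x t) (N n) (gapN (vs v) h) gp (xd≤ r))
          go (no h) = atC (gapE (sidx-neg (vs v)) (lia 3 (λ a b N → b := :- a ⇒ # 2 :* a :< :- N ⇒ ⊢ N :< # 2 :* b) (x c) (x (ℤ.- c)) (N n) (X-odd′ c) (half-not⁻ (vs v) h)))
            where
            small : x t ℤ.≤ x (ℤ.- c) → ⊥
            small q = lia 5 (λ a b c c' t → b := :- a ⇒ c' := :- c ⇒ b :≤ c ⇒ t :≤ c' ⇒ a :< t ⇒ ⊢ :⊥) (x s′) (x (ℤ.- s′)) (x c) (x (ℤ.- c)) (x t) x-s (X-odd′ c) (s≤c p) q s′<t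
            atC : ℤ.- c ≡ s′ ⊎ ℤ.- c ≡ t ⊎ x t ℤ.< x (ℤ.- c) → Link (ℤ.- s′) t
            atC (inj₂ (inj₁ q)) = ⊥-elim (small (ℤP.≤-reflexive (cong x (sym q))))
            atC (inj₂ (inj₂ q)) = ⊥-elim (small (ℤP.<⇒≤ q))
            atC (inj₁ q) = atD (N n ℤP.<? + 2 ℤ.* x d)
              where
              c≡ : c ≡ ℤ.- s′
              c≡ = trans (sym (ℤP.neg-involutive c)) (cong ℤ.-_ q)
              xc : x c ≡ ℤ.- x s′
              xc = trans (cong x c≡) x-s
              atD : Dec (N n ℤ.< + 2 ℤ.* x d) → Link (ℤ.- s′) t
              atD (yes big) = fin′ (gapE (vt v) big)
                where
                fin′ : d ≡ s′ ⊎ d ≡ t ⊎ x t ℤ.< x d → Link (ℤ.- s′) t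
                fin′ (inj₁ e) = ⊥-elim (s≢-t v (trans c≡ (cong ℤ.-_ (sym e))))
                fin′ (inj₂ (inj₁ e)) = subst₂ Link c≡ e L
                fin′ (inj₂ (inj₂ e)) = ⊥-elim (ℤP.<⇒≱ e (xd≤ r))
              atD (no nbig) = ⊥-elim (lia 6 (λ a c d d' t N → c := :- a ⇒ d' := :- d ⇒ c :+ N :< d ⇒ t :< d' :+ N ⇒ a :< t ⇒ ⊢ :⊥) (x s′) (x c) (x d) (x (ℤ.- d)) (x t) (N n) xc (X-odd′ d) gp
                 (gapN (sidx-neg (vt v)) (lia 3 (λ a b N → b := :- a ⇒ # 2 :* a :< N ⇒ ⊢ :- N :< # 2 :* b) (x d) (x (ℤ.- d)) (N n) (X-odd′ d) (half-not (vt v) nbig))) s′<t)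

      pairs⇒link : ∀ {t s} → (t , s) ∈ pairs l z → Link s t
      pairs⇒link {t} {s} h = go (pairs-out l z h) z refl
        where
        go : Inner l z t s ⊎ Outer l z t s → ∀ z′ → z ≡ z′ → Link s t
        go (inj₁ q) _ _ = inner⇒link q
        go (inj₂ (l₁ , q , r)) (El , s′) e = subst (λ y → Link y t) (sym (trans r (cong mate e))) (outer⇒link s′ e l₁ q)
        go (inj₂ (l₁ , q , r)) (Nl , s′) e = inner⇒link (l₁ , [] , trans (cong₂ (λ a b → a ++ b ∷ []) q (trans e (cong (Nl ,_) (sym (trans r (cong mate e)))))) (LP.++-assoc l₁ ((El , t) ∷ []) ((Nl , s) ∷ [])))

      private
        inner-pair : ∀ {t s} → (El , t) ∈ w → (Nl , s) ∈ w → x s ℤ.+ N n ℤ.< x t → (∀ {u} → u ∈ w → x s ℤ.+ N n ℤ.< val u → val u ℤ.< x t → ⊥) → (t , s) ∈ pairs l z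
        inner-pair {t} {s} ht hs g nb = go (adjacent (l ++ z ∷ []) sorted′ (frW ht) (frW hs) g (λ hu → nb (toW hu)))
          where go : (∃ λ l₁ → ∃ λ l₂ → l ++ z ∷ [] ≡ l₁ ++ (El , t) ∷ (Nl , s) ∷ l₂) → (t , s) ∈ pairs l z
                go (l₁ , l₂ , q) = inner-∈ l z l₁ q

        outer-pair : ∀ {t s} → (El , t) ∈ w → (El , s) ∈ w → x s ℤ.< x t → (∀ {u} → u ∈ w → val u ℤ.< x t → u ≡ (El , s)) → (t , ℤ.- s) ∈ pairs l z
        outer-pair {t} {s} ht hs g only-s = fin (∈P.∈-++⁻ l (frW ht))
          where
          z-last : (El , s) ≡ z
          z-last = least-last l sorted′ (frW hs) (λ {u} hu q → ℤP.<-irrefl (cong val (only-s {u} (toW hu) (ℤP.<-trans q g))) q)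
          fin : (El , t) ∈ l ⊎ (El , t) ∈ (z ∷ []) → (t , ℤ.- s) ∈ pairs l z
          fin (inj₂ (here q)) = ⊥-elim (ℤP.<-irrefl (cong val (trans z-last (sym q))) g)
          fin (inj₁ h) = go (initLast l) refl
            where
            go : ∀ {l′} → InitLast l′ → l ≡ l′ → (t , ℤ.- s) ∈ pairs l z
            go [] q = ⊥-elim (absurd (subst ((El , t) ∈_) q h))
              where absurd : ¬ ((El , t) ∈ [])
                    absurd ()
            go (l₁ ∷ʳ′ y) refl = subst (λ y → (t , ℤ.- s) ∈ pairs (l₁ ++ y ∷ []) z) y≡ (subst (λ z → (t , ℤ.- s) ∈ pairs (l₁ ++ (El , t) ∷ []) z) z-last (outer-∈ l₁ (El , s)))
              where
              y≡ : (El , t) ≡ y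
              y≡ = least-last l₁ (init-sorted (l₁ ++ y ∷ []) sorted′) h (λ {u} hu q → ℤP.<-irrefl (cong val (sym (trans (only-s {u} (toW (∈P.∈-++⁺ˡ hu)) q) z-last))) (last-least (l₁ ++ y ∷ []) sorted′ hu))

      -- The letters present in the word decide the form of the valley. If E of d and N of c both
      -- occur, they are consecutive; without E of d the mirror letters are. Without N of c, both E
      -- of d and E of -c occur and are the last two letters, the smaller one being deleted.
      wall⇒pairs : ∀ {c d} → Wall₁ c d → (d , c) ∈ pairs l z ⊎ (ℤ.- c , ℤ.- d) ∈ pairs l z
      wall⇒pairs {c} {d} W = go (N n ℤP.<? + 2 ℤ.* x d) (ℤ.- N n ℤP.<? + 2 ℤ.* x c)
        where
        v = proj₁ (wall-gap₁ W)
        gp = proj₂ (wall-gap₁ W)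
        sc = vs v
        sd = vt v
        oc = X-odd′ c
        od = X-odd′ d
        go : Dec (N n ℤ.< + 2 ℤ.* x d) → Dec (ℤ.- N n ℤ.< + 2 ℤ.* x c) → (d , c) ∈ pairs l z ⊎ (ℤ.- c , ℤ.- d) ∈ pairs l z
        go (yes hd) (yes hc) = inj₁ (inner-pair (in-E sd hd) (in-N sc hc) gp nb)
          where
          nb : ∀ {u} → u ∈ w → x c ℤ.+ N n ℤ.< val u → val u ℤ.< x d → ⊥
          nb {El , u} h p q = lia 4 (λ a b b' N → :- N :< # 2 :* a ⇒ b := :- a ⇒ b' := b ⇒ N :< # 2 :* b' ⇒ ⊢ :⊥) (x c) (x (ℤ.- c)) (x u) (N n) hc oc (cong x (betweenE W (proj₁ (El-big h)) p q)) (proj₂ (El-big h))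
          nb {Nl , u} h p q = lia 4 (λ a b b' N → N :< # 2 :* a ⇒ b := :- a ⇒ b' := b ⇒ :- N :< # 2 :* b' ⇒ ⊢ :⊥) (x d) (x (ℤ.- d)) (x u) (N n) hd od
             (cong x (betweenN W (proj₁ (Nl-big h)) (lia 3 (λ a b N → a :+ N :< b :+ N ⇒ ⊢ a :< b) (x c) (x u) (N n) p) q)) (proj₂ (Nl-big h))
        go (no hd) _ = inj₂ (inner-pair (in-E (sidx-neg sc) (lia 4 (λ c c' d N → c' := :- c ⇒ c :+ N :< d ⇒ # 2 :* d :< N ⇒ ⊢ N :< # 2 :* c') (x c) (x (ℤ.- c)) (x d) (N n) oc gp hd′))
             (in-N (sidx-neg sd) (lia 3 (λ d d' N → d' := :- d ⇒ # 2 :* d :< N ⇒ ⊢ :- N :< # 2 :* d') (x d) (x (ℤ.- d)) (N n) od hd′))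
             (lia 5 (λ c c' d d' N → c' := :- c ⇒ d' := :- d ⇒ c :+ N :< d ⇒ ⊢ d' :+ N :< c') (x c) (x (ℤ.- c)) (x d) (x (ℤ.- d)) (N n) oc od gp) nb)
          where
          hd′ = half-not sd hd
          nb : ∀ {u} → u ∈ w → x (ℤ.- d) ℤ.+ N n ℤ.< val u → val u ℤ.< x (ℤ.- c) → ⊥
          nb {El , u} h p q = lia 3 (λ a b N → a := b ⇒ N :< # 2 :* a ⇒ # 2 :* b :< N ⇒ ⊢ :⊥) (x u) (x d) (N n) (cong x (ℤP.neg-injective (betweenN W (sidx-neg (proj₁ (El-big h)))
               (lia 4 (λ c c' u u' → c' := :- c ⇒ u' := :- u ⇒ u :< c' ⇒ ⊢ c :< u') (x c) (x (ℤ.- c)) (x u) (x (ℤ.- u)) oc (X-odd′ u) q)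
               (lia 5 (λ d d' u u' N → d' := :- d ⇒ u' := :- u ⇒ d' :+ N :< u ⇒ ⊢ u' :+ N :< d) (x d) (x (ℤ.- d)) (x u) (x (ℤ.- u)) (N n) od (X-odd′ u) p)))) (proj₂ (El-big h)) hd′
          nb {Nl , u} h p q = lia 4 (λ u c d N → u := c ⇒ :- N :< # 2 :* u ⇒ c :+ N :< d ⇒ # 2 :* d :< N ⇒ ⊢ :⊥) (x u) (x c) (x d) (N n) (cong x (ℤP.neg-injective (betweenE W (sidx-neg (proj₁ (Nl-big h)))
               (lia 5 (λ c c' u u' N → c' := :- c ⇒ u' := :- u ⇒ u :+ N :< c' ⇒ ⊢ c :+ N :< u') (x c) (x (ℤ.- c)) (x u) (x (ℤ.- u)) (N n) oc (X-odd′ u) q)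
               (lia 5 (λ d d' u u' N → d' := :- d ⇒ u' := :- u ⇒ d' :+ N :< u :+ N ⇒ ⊢ u' :< d) (x d) (x (ℤ.- d)) (x u) (x (ℤ.- u)) (N n) od (X-odd′ u) p)))) (proj₂ (Nl-big h)) gp hd′
        go (yes hd) (no hc) = by-size (ℤP.<-cmp (x (ℤ.- c)) (x d))
          where
          hc′ = half-not⁻ sc hc
          hc″ : N n ℤ.< + 2 ℤ.* x (ℤ.- c)
          hc″ = lia 3 (λ c c' N → c' := :- c ⇒ # 2 :* c :< :- N ⇒ ⊢ N :< # 2 :* c') (x c) (x (ℤ.- c)) (N n) oc hc′
          by-size : Tri (x (ℤ.- c) ℤ.< x d) (x (ℤ.- c) ≡ x d) (x d ℤ.< x (ℤ.- c)) → (d , c) ∈ pairs l z ⊎ (ℤ.- c , ℤ.- d) ∈ pairs l z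
          by-size (tri≈ _ q _) = ⊥-elim (s≢-t v (trans (sym (ℤP.neg-involutive c)) (cong ℤ.-_ (X-injective (sidx-neg sc) sd q))))
          by-size (tri< q _ _) = inj₁ (subst (λ y → (d , y) ∈ pairs l z) (ℤP.neg-involutive c) (outer-pair (in-E sd hd) (in-E (sidx-neg sc) hc″) q below))
            where
            below : ∀ {u} → u ∈ w → val u ℤ.< x d → u ≡ (El , ℤ.- c)
            below {El , u} h p = cong (El ,_) (betweenE W (proj₁ (El-big h)) (lia 3 (λ c u N → # 2 :* c :< :- N ⇒ N :< # 2 :* u ⇒ ⊢ c :+ N :< u) (x c) (x u) (N n) hc′ (proj₂ (El-big h))) p)
            below {Nl , u} h p = ⊥-elim (lia 4 (λ d d' u N → d' := :- d ⇒ N :< # 2 :* d ⇒ u := d' ⇒ :- N :< # 2 :* u ⇒ ⊢ :⊥) (x d) (x (ℤ.- d)) (x u) (N n) od hd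
               (cong x (betweenN W (proj₁ (Nl-big h)) (lia 3 (λ c u N → # 2 :* c :< :- N ⇒ :- N :< # 2 :* u ⇒ ⊢ c :< u) (x c) (x u) (N n) hc′ (proj₂ (Nl-big h))) p)) (proj₂ (Nl-big h)))
          by-size (tri> _ _ q) = inj₂ (outer-pair (in-E (sidx-neg sc) hc″) (in-E sd hd) q below)
            where
            below : ∀ {u} → u ∈ w → val u ℤ.< x (ℤ.- c) → u ≡ (El , d)
            below {El , u} h p = cong (El ,_) (ℤP.neg-injective (betweenN W (sidx-neg (proj₁ (El-big h)))
               (lia 4 (λ c c' u u' → c' := :- c ⇒ u' := :- u ⇒ u :< c' ⇒ ⊢ c :< u') (x c) (x (ℤ.- c)) (x u) (x (ℤ.- u)) oc (X-odd′ u) p)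
               (lia 4 (λ d u u' N → u' := :- u ⇒ N :< # 2 :* u ⇒ N :< # 2 :* d ⇒ ⊢ u' :+ N :< d) (x d) (x u) (x (ℤ.- u)) (N n) (X-odd′ u) (proj₂ (El-big h)) hd)))
            below {Nl , u} h p = ⊥-elim (lia 3 (λ u c N → u := c ⇒ :- N :< # 2 :* u ⇒ # 2 :* c :< :- N ⇒ ⊢ :⊥) (x u) (x c) (N n) (cong x (ℤP.neg-injective (betweenE W (sidx-neg (proj₁ (Nl-big h)))
               (lia 5 (λ c c' u u' N → c' := :- c ⇒ u' := :- u ⇒ u :+ N :< c' ⇒ ⊢ c :+ N :< u') (x c) (x (ℤ.- c)) (x u) (x (ℤ.- u)) (N n) oc (X-odd′ u) p)
               (lia 4 (λ d u u' N → u' := :- u ⇒ :- N :< # 2 :* u ⇒ N :< # 2 :* d ⇒ ⊢ u' :< d) (x d) (x u) (x (ℤ.- u)) (N n) (X-odd′ u) (proj₂ (Nl-big h)) hd)))) (proj₂ (Nl-big h)) hc′)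

open ValleyPairs

-- Valleys of the path as roots in sorted positions.

module Labels where

  allPairs-∈ : ∀ {A : Set} {R Q : A → A → Set} {xs} → (∀ {a b} → a ∈ xs → b ∈ xs → R a b → Q a b) → AllPairs R xs → AllPairs Q xs
  allPairs-∈ h [] = []
  allPairs-∈ h (r ∷ rs) = All.tabulate (λ m → h (here refl) (there m) (All.lookup r m)) ∷ allPairs-∈ (λ a b → h (there a) (there b)) rs

  letE-pairs : ∀ {R : Letter × ℤ → Letter × ℤ → Set} {l} → AllPairs R l → AllPairs (λ s t → R (El , s) (El , t)) (letE l)
  letE-pairs [] = []
  letE-pairs {l = (El , _) ∷ _} (r ∷ rs) = All.tabulate (λ m → All.lookup r (letE-∈ m)) ∷ letE-pairs rs
  letE-pairs {l = (Nl , _) ∷ _} (r ∷ rs) = letE-pairs rs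

  letN-pairs : ∀ {R : Letter × ℤ → Letter × ℤ → Set} {l} → AllPairs R l → AllPairs (λ s t → R (Nl , s) (Nl , t)) (letN l)
  letN-pairs [] = []
  letN-pairs {l = (Nl , _) ∷ _} (r ∷ rs) = All.tabulate (λ m → All.lookup r (letN-∈ m)) ∷ letN-pairs rs
  letN-pairs {l = (El , _) ∷ _} (r ∷ rs) = letN-pairs rs

  pairs-E : ∀ l z {t s} → (t , s) ∈ pairs l z → (El , t) ∈ l
  pairs-E ((El , t) ∷ []) z (here refl) = here refl
  pairs-E ((El , t) ∷ (Nl , s) ∷ l) z (here refl) = here refl
  pairs-E ((El , t) ∷ (Nl , s) ∷ l) z (there h) = there (pairs-E ((Nl , s) ∷ l) z h)
  pairs-E ((El , _) ∷ (El , t) ∷ l) z h = there (pairs-E ((El , t) ∷ l) z h)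
  pairs-E ((Nl , _) ∷ y ∷ l) z h = there (pairs-E (y ∷ l) z h)

  e-odd : ∀ {n t} → SIdx n t → e {n} (ℤ.- t) ≈v negv (e t)
  e-odd (ps i) j = e-neg i j
  e-odd zr j = trans (e-zero j) (cong ℤ.-_ (sym (e-zero j)))
  e-odd (ng i) j = trans (sym (ℤP.neg-involutive _)) (cong ℤ.-_ (sym (e-neg i j)))

  -- Once the second index is read as a signed one, the three cases in the definition of α are b
  -- positive, zero and negative.
  alphaV-root : ∀ {n b} (i : Fin n) → SIdx n b → alphaV n (labelOf n (pos i)) (labelOf n b) ≈v (e (pos i) -v e b)
  alphaV-root {n} {b} i sb k = trans (cong (λ q → (if ltℕ J (suc n) then e (+ q) -v e (+ (suc n ℕ.∸ J)) else (if eqℕ J (suc n) then e (+ q) else e (+ q) +v e (+ (J ℕ.∸ suc n)))) k) (back i)) (go sb)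
    where
    J = labelOf n b
    back : ∀ i → suc n ℕ.∸ (suc n ℕ.∸ suc (toℕ i)) ≡ suc (toℕ i)
    back i = ℕP.m∸[m∸n]≡n (ℕP.≤-trans (FP.toℕ<n i) (ℕP.n≤1+n n))
    pick : ∀ {B : Bool} {x y : Vecℤ n} {c} → B ≡ c → (if B then x else y) k ≡ (if c then x else y) k
    pick refl = refl
    go : ∀ {b} → SIdx n b → (if ltℕ (labelOf n b) (suc n) then e (pos i) -v e (+ (suc n ℕ.∸ labelOf n b)) else (if eqℕ (labelOf n b) (suc n) then e (pos i) else e (pos i) +v e (+ (labelOf n b ℕ.∸ suc n)))) k ≡ (e (pos i) -v e b) k
    go (ps j) = trans (pick {c = true} (ltℕ-yes {labelOf n (pos j)} {suc n} (s≤s (ℕP.m∸n≤m n (toℕ j))))) (cong (λ q → (e (pos i) -v e (+ q)) k) (back j))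
    go zr = trans (pick {c = false} (ltℕ-no {suc n} {suc n} (ℕP.<-irrefl refl))) (trans (pick (eqℕ-refl (suc n))) (trans (sym (ℤP.+-identityʳ (e (pos i) k))) (cong (λ q → e (pos i) k ℤ.- q) (sym (e-zero {n} k)))))
    go (ng j) = trans (pick {c = false} (ltℕ-no {labelOf n (neg j)} {suc n} (λ h → ℕP.<⇒≱ h (ℕP.m≤m+n (suc n) (suc (toℕ j))))))
      (trans (pick {c = false} (eqℕ-no {labelOf n (neg j)} {suc n} (λ q → ℕP.m+1+n≢m (suc n) q)))
      (trans (cong (λ q → (e (pos i) +v e (+ q)) k) (ℕP.m+n∸m≡n (suc n) (suc (toℕ j)))) (cong (ℤ._+_ (e (pos i) k)) (trans (sym (ℤP.neg-involutive _)) (cong ℤ.-_ (sym (e-neg j k)))))))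

  module Labelled {m : ℕ} (μ : Vecℤ (suc (suc m))) (μ-lo : ∀ i → ℤ.- (+ suc (suc m)) ℤ.≤ μ i) (μ-hi : ∀ i → μ i ℤ.≤ + 2 ℤ.* + suc (suc m)) (S : Steps {m} μ) where
    private
      n = suc (suc m)
      x : ℤ → ℤ
      x = X μ
      w = word μ μ-lo μ-hi
      val : Letter × ℤ → ℤ
      val = kof μ μ-lo μ-hi
      P′ T′ : ℤ → ℤ
      P′ = P μ μ-lo μ-hi
      T′ = T μ μ-lo μ-hi
    open Valleys μ μ-lo μ-hi S P′ T′ (P-sidx μ μ-lo μ-hi) (T-sidx μ μ-lo μ-hi) (TP μ μ-lo μ-hi) (PT μ μ-lo μ-hi) (X⇒P μ μ-lo μ-hi) (T-mono μ μ-lo μ-hi) public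
    open Sorted val

    -- Closed upwards with respect to X, the list contains every row after its least one in the
    -- sorted order, so the positions run down from n without gaps.
    descend : ∀ {xs} → (∀ {t} → t ∈ xs → SIdx n t) → AllPairs (λ s t → x t ℤ.< x s) xs → (∀ {t u} → t ∈ xs → SIdx n u → x t ℤ.< x u → u ∈ xs) → Desc (+ n) (map P′ xs)
    descend {xs} si srt ups = consec (map P′ xs) (+ n) (APP.map⁺ (allPairs-∈ (λ a b h → X⇒P μ μ-lo μ-hi (si b) (si a) h) srt))
        (λ h → bound (∈P.∈-map⁻ P′ h)) (λ {v} {u} h v≤u u≤n → closed (∈P.∈-map⁻ P′ h) v≤u u≤n)
      where
      bound : ∀ {v} → (∃ λ t → t ∈ xs × v ≡ P′ t) → v ℤ.≤ + n
      bound (t , h , refl) = sidx-hi (P-sidx μ μ-lo μ-hi (si h))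
      closed : ∀ {v u} → (∃ λ t → t ∈ xs × v ≡ P′ t) → v ℤ.≤ u → u ℤ.≤ + n → u ∈ map P′ xs
      closed {_} {u} (t , h , refl) v≤u u≤n = go (P′ t ℤP.≟ u)
        where
        sP = P-sidx μ μ-lo μ-hi (si h)
        su : SIdx n u
        su = sidx-ℤ (ℤP.≤-trans (sidx-lo sP) v≤u) u≤n
        go : Dec (P′ t ≡ u) → u ∈ map P′ xs
        go (yes q) = subst (_∈ map P′ xs) q (∈P.∈-map⁺ P′ h)
        go (no q) = subst (_∈ map P′ xs) (PT μ μ-lo μ-hi su) (∈P.∈-map⁺ P′ (ups h (T-sidx μ μ-lo μ-hi su)
           (subst (λ y → x y ℤ.< x (T′ u)) (TP μ μ-lo μ-hi (si h)) (T-mono μ μ-lo μ-hi sP su (ℤP.≤∧≢⇒< v≤u q)))))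

    descE : Desc (+ n) (map P′ (letE w))
    descE = descend (λ h → proj₁ (El-big (letE-∈ h))) (letE-pairs (word-sorted μ μ-lo μ-hi))
       (λ {t} {u} h su q → ∈-letE (in-E su (ℤP.<-trans (proj₂ (El-big (letE-∈ h))) (lia 2 (λ a b → a :< b ⇒ ⊢ # 2 :* a :< # 2 :* b) (x t) (x u) q))))

    module _ {l : List (Letter × ℤ)} {z : Letter × ℤ} (split : w ≡ l ++ z ∷ []) where
      private
        sorted′ : AllPairs _≻ₖ_ (l ++ z ∷ [])
        sorted′ = subst (AllPairs _≻ₖ_) split (word-sorted μ μ-lo μ-hi)
        fromW : ∀ {u} → u ∈ w → u ∈ (l ++ z ∷ [])
        fromW = subst (_ ∈_) split
        toW : ∀ {u} → u ∈ (l ++ z ∷ []) → u ∈ w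
        toW = subst (_ ∈_) (sym split)

      nNorms : List ℤ
      nNorms = letN l ++ mate z ∷ []

      -- If the deleted letter is an E, appending its mirror row keeps the list closed upwards: a
      -- missing row above the mirror row would lie below -N/2, and its own mirror would be an E
      -- after the last letter.
      descN : Desc (+ n) (map P′ nNorms)
      descN = go z refl
        where
        up-N : ∀ {t u} → ℤ.- N n ℤ.< + 2 ℤ.* x t → SIdx n u → x t ℤ.< x u → u ∈ letN w
        up-N {t} {u} b su q = ∈-letN (in-N su (ℤP.<-trans b (lia 2 (λ a b → a :< b ⇒ ⊢ # 2 :* a :< # 2 :* b) (x t) (x u) q)))
        srtN : ∀ {l} → AllPairs _≻ₖ_ l → AllPairs (λ s t → x t ℤ.< x s) (letN l)
        srtN h = allPairs-∈ (λ {a} {b} _ _ q → lia 3 (λ a b N → b :+ N :< a :+ N ⇒ ⊢ b :< a) (x a) (x b) (N n) q) (letN-pairs h)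
        go : ∀ z′ → z ≡ z′ → Desc (+ n) (map P′ (letN l ++ mate z ∷ []))
        go (Nl , s) refl = subst (λ q → Desc (+ n) (map P′ q)) (trans (cong letN split) (letN-++ l ((Nl , s) ∷ [])))
          (descend (λ h → proj₁ (Nl-big (letN-∈ h))) (srtN (word-sorted μ μ-lo μ-hi)) (λ {t} h → up-N {t} (proj₂ (Nl-big (letN-∈ h)))))
        go (El , s) refl = descend si (APP.++⁺ (srtN (init-sorted l sorted′)) ([] ∷ []) (All.tabulate (λ {t} h → below {t} h ∷ []))) closed
          where
          sE = El-big {s} (toW (∈P.∈-++⁺ʳ l (here refl)))
          xs : x (ℤ.- s) ≡ ℤ.- x s
          xs = X-odd μ s
          letN-w : letN w ≡ letN l
          letN-w = trans (cong letN split) (trans (letN-++ l ((El , s) ∷ [])) (LP.++-identityʳ (letN l)))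
          nb : ∀ {t} → t ∈ letN l → SIdx n t × (ℤ.- N n ℤ.< + 2 ℤ.* x t)
          nb {t} h = Nl-big (toW (∈P.∈-++⁺ˡ {xs = l} (letN-∈ {l} h)))
          below : ∀ {t} → t ∈ letN l → x (ℤ.- s) ℤ.< x t
          below {t} h = lia 4 (λ a a' b N → a' := :- a ⇒ N :< # 2 :* a ⇒ :- N :< # 2 :* b ⇒ ⊢ a' :< b) (x s) (x (ℤ.- s)) (x t) (N n) xs (proj₂ sE) (proj₂ (nb h))
          si′ : ∀ {t} → t ∈ letN l ⊎ t ∈ (ℤ.- s ∷ []) → SIdx n t
          si′ (inj₁ h) = proj₁ (nb h)
          si′ (inj₂ (here refl)) = sidx-neg (proj₁ sE)
          si : ∀ {t} → t ∈ (letN l ++ ℤ.- s ∷ []) → SIdx n t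
          si h = si′ (∈P.∈-++⁻ (letN l) h)
          inN : ∀ {u} → u ∈ letN w → u ∈ (letN l ++ ℤ.- s ∷ [])
          inN h = ∈P.∈-++⁺ˡ (subst (_ ∈_) letN-w h)
          extend : ∀ {u} → SIdx n u → x (ℤ.- s) ℤ.< x u → Dec (ℤ.- N n ℤ.< + 2 ℤ.* x u) → u ∈ (letN l ++ ℤ.- s ∷ [])
          extend su q (yes h) = inN (∈-letN (in-N su h))
          extend {u} su q (no h) = ⊥-elim (contra (∈P.∈-++⁻ l (fromW (in-E (sidx-neg su) (lia 3 (λ a b N → b := :- a ⇒ # 2 :* a :< :- N ⇒ ⊢ N :< # 2 :* b) (x u) (x (ℤ.- u)) (N n) (X-odd μ u) (half-not⁻ su h))))))
            where
            small : x (ℤ.- u) ℤ.< x s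
            small = lia 4 (λ a a' b b' → a' := :- a ⇒ b' := :- b ⇒ a' :< b ⇒ ⊢ b' :< a) (x s) (x (ℤ.- s)) (x u) (x (ℤ.- u)) xs (X-odd μ u) q
            contra : (El , ℤ.- u) ∈ l ⊎ (El , ℤ.- u) ∈ ((El , s) ∷ []) → ⊥
            contra (inj₁ h′) = ℤP.<-asym small (last-least l sorted′ h′)
            contra (inj₂ (here r)) = ℤP.<-irrefl (cong val r) small
          closed′ : ∀ {t u} → t ∈ letN l ⊎ t ∈ (ℤ.- s ∷ []) → SIdx n u → x t ℤ.< x u → u ∈ (letN l ++ ℤ.- s ∷ [])
          closed′ {t} (inj₁ h) su q = inN (up-N {t} (proj₂ (nb h)) su q)
          closed′ {u = u} (inj₂ (here refl)) su q = extend su q (ℤ.- N n ℤP.<? + 2 ℤ.* x u)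
          closed : ∀ {t u} → t ∈ (letN l ++ ℤ.- s ∷ []) → SIdx n u → x t ℤ.< x u → u ∈ (letN l ++ ℤ.- s ∷ [])
          closed {t} {u} h = closed′ {t} {u} (∈P.∈-++⁻ (letN l) h)

      valleys-swept : valleys (swept μ μ-lo μ-hi) ≡ map (labels n P′) (pairs l z)
      valleys-swept = trans (cong valleys β≡) (trans (valleys-unfold (map proj₁ l)) (valley-labels n P′ (map proj₁ l) l z 0 0 (start dE) (start descN)))
        where
        β≡ : swept μ μ-lo μ-hi ≡ map proj₁ l
        β≡ = trans (swept≡ μ μ-lo μ-hi) (trans (cong (λ y → dropLast (map proj₁ y)) split) (trans (cong dropLast (LP.map-++ proj₁ l (z ∷ []))) (dropLast-snoc (map proj₁ l) (proj₁ z))))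
        start : ∀ {xs} → Desc (+ n) xs → Desc (+ n ℤ.- + 0) xs
        start {xs} = subst (λ a → Desc a xs) (sym (ℤP.+-identityʳ (+ n)))
        dE : Desc (+ n) (map P′ (letE l))
        dE = desc-prefix (map P′ (letE l)) (subst (Desc (+ n)) (trans (cong (map P′) (trans (cong letE split) (letE-++ l (z ∷ [])))) (LP.map-++ P′ (letE l) (letE (z ∷ [])))) descE)

      valley-root : ∀ {t s} → (t , s) ∈ pairs l z → alphaV n (labelOf n (P′ t)) (labelOf n (P′ s)) ≈v (e (P′ t) -v e (P′ s))
      valley-root {t} {s} h = go (proj₁ tE) refl
        where
        tE = El-big {t} (toW (∈P.∈-++⁺ˡ (pairs-E l z h)))
        v = link-valid (pairs⇒link split h)
        pos-P : + 0 ℤ.< P′ t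
        pos-P = X⇒P μ μ-lo μ-hi zr (proj₁ tE) (lia 3 (λ N a z → N :< # 2 :* a ⇒ # 0 :< N ⇒ z := :- z ⇒ ⊢ z :< a) (N n) (x t) (x (+ 0)) (proj₂ tE) (N-pos n) (X-odd μ (+ 0)))
        go : SIdx n t → ∀ {u} → u ≡ P′ t → alphaV n (labelOf n (P′ t)) (labelOf n (P′ s)) ≈v (e (P′ t) -v e (P′ s))
        go st q = at (P-sidx μ μ-lo μ-hi st) pos-P
          where
          at : ∀ {u} → SIdx n u → + 0 ℤ.< u → alphaV n (labelOf n u) (labelOf n (P′ s)) ≈v (e u -v e (P′ s))
          at (ps i) _ = alphaV-root i (P-sidx μ μ-lo μ-hi (vs (proj₁ v)))
          at zr (+<+ ())
          at (ng i) ()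

    private
      splitting : ∃ λ l → ∃ λ z → w ≡ l ++ z ∷ []
      splitting = go (initLast w) refl (in-N zr (lia 2 (λ N z → # 0 :< N ⇒ z := :- z ⇒ ⊢ :- N :< # 2 :* z) (N n) (x (+ 0)) (N-pos n) (X-odd μ (+ 0))))
        where
        go : ∀ {w′} → InitLast w′ → w ≡ w′ → (Nl , + 0) ∈ w → ∃ λ l → ∃ λ z → w ≡ l ++ z ∷ []
        go [] q h = ⊥-elim (absurd (subst ((Nl , + 0) ∈_) q h))
          where absurd : ¬ ((Nl , + 0) ∈ [])
                absurd ()
        go (l ∷ʳ′ z) q h = l , z , q

    -- Rows are replaced by their positions `P′`, that is, the root is transported to the dominant
    -- chamber in which Θ measures floors.
    WallRoot : PosRoot n → Set
    WallRoot r = ∃ λ c → ∃ λ d → Wall₁ c d × ((e (P′ d) -v e (P′ c)) ≈v rootVec r)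

    mirror-root : ∀ {c d} → SIdx n c → SIdx n d → (e {n} (P′ (ℤ.- c)) -v e (P′ (ℤ.- d))) ≈v (e (P′ d) -v e (P′ c))
    mirror-root {c} {d} sc sd i = trans (cong₂ (λ a b → e {n} a i ℤ.- e {n} b i) (P-odd μ μ-lo μ-hi c) (P-odd μ μ-lo μ-hi d))
      (trans (cong₂ ℤ._-_ (e-odd (P-sidx μ μ-lo μ-hi sc) i) (e-odd (P-sidx μ μ-lo μ-hi sd) i)) (lia 2 (λ a b → ⊢ (:- a) :- (:- b) := b :- a) (e {n} (P′ c) i) (e {n} (P′ d) i)))

    valleys⇔walls : ∀ r → Iff (WallRoot r) (Abeta n (swept μ μ-lo μ-hi) r)
    valleys⇔walls r = go splitting
      where
      go : (∃ λ l → ∃ λ z → w ≡ l ++ z ∷ []) → Iff (WallRoot r) (Abeta n (swept μ μ-lo μ-hi) r)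
      go (l , z , split) = to , fro
        where
        hit : ∀ {t s} → (t , s) ∈ pairs l z → (e (P′ t) -v e (P′ s)) ≈v rootVec r → Abeta n (swept μ μ-lo μ-hi) r
        hit {t} {s} h q = subst (Any _) (sym (valleys-swept split)) (AnyP.map⁺ (Any.map (λ { refl i → trans (valley-root split h i) (q i) }) h))
        to : WallRoot r → Abeta n (swept μ μ-lo μ-hi) r
        to (c , d , W , q) = pick (wall⇒pairs split W)
          where
          v = proj₁ (wall-gap₁ W)
          pick : (d , c) ∈ pairs l z ⊎ (ℤ.- c , ℤ.- d) ∈ pairs l z → Abeta n (swept μ μ-lo μ-hi) r
          pick (inj₁ h) = hit h q
          pick (inj₂ h) = hit h (λ i → trans (mirror-root (vs v) (vt v) i) (q i))
        wall-of : ∀ {t s} → (t , s) ∈ pairs l z → alphaV n (labelOf n (P′ t)) (labelOf n (P′ s)) ≈v rootVec r → WallRoot r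
        wall-of {t} {s} h q = pick (pairs⇒link split h)
          where
          v = proj₁ (link-valid (pairs⇒link split h))
          q′ : (e (P′ t) -v e (P′ s)) ≈v rootVec r
          q′ i = trans (sym (valley-root split h i)) (q i)
          pick : Link s t → WallRoot r
          pick (inj₁ W) = s , t , W , q′
          pick (inj₂ W) = ℤ.- t , ℤ.- s , W , λ i → trans (mirror-root (vs v) (vt v) i) (q′ i)
        fro : Abeta n (swept μ μ-lo μ-hi) r → WallRoot r
        fro h = found′ (AnyP.map⁻ (subst (Any _) (valleys-swept split) h))
          where
          found′ : Any (λ ts → alphaV n (labelOf n (P′ (proj₁ ts))) (labelOf n (P′ (proj₂ ts))) ≈v rootVec r) (pairs l z) → WallRoot r
          found′ a = at (find a)
            where
            at : (∃ λ ts → ts ∈ pairs l z × (alphaV n (labelOf n (P′ (proj₁ ts))) (labelOf n (P′ (proj₂ ts))) ≈v rootVec r)) → WallRoot r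
            at ((t , s) , h , q) = wall-of h q

open Labels

-- Floors of the alcove after moving it to the dominant chamber.

module FloorRoots where

  sperm-cong : ∀ {n} {w w′ : SP n} → (∀ i → w′ i ≡ w i) → SPerm w → SPerm w′
  sperm-cong {n} q h = sperm ((λ i → subst (λ z → (1 ℕ.≤ ∣ z ∣) × (∣ z ∣ ℕ.≤ n)) (sym (q i)) (bd h i)) , λ i j r → sp-inj h i j (trans (cong ∣_∣ (sym (q i))) (trans r (cong ∣_∣ (q j)))))

  actV-e : ∀ {n} {w : SP n} → (∀ i → SIdx n (w i)) → ∀ {t} → SIdx n t → actV w (e t) ≈v e (ext w t)
  actV-e {n} {w} hw (ps i) k = begin
    Σf n (λ j → e (pos i) j ℤ.* e (w j) k) ≡⟨ Σ-δ n _ i (λ j q → cong (ℤ._* e (w j) k) (e-pos-diff i j (λ r → q (sym r)))) ⟩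
    e (pos i) i ℤ.* e (w i) k ≡⟨ cong (ℤ._* e (w i) k) (e-pos-same i) ⟩
    + 1 ℤ.* e (w i) k ≡⟨ ℤP.*-identityˡ _ ⟩
    e (w i) k ≡⟨ cong (λ z → e z k) (sym (ext-pos w i)) ⟩
    e (ext w (pos i)) k ∎
    where open ≡-Reasoning
  actV-e {n} {w} hw zr k = trans (Σ-zero n _ (λ j → cong (ℤ._* e (w j) k) (e-zero j))) (sym (e-zero k))
  actV-e {n} {w} hw (ng i) k = begin
    actV w (e (neg i)) k ≡⟨ actV-cong {w = w} {x = e (neg i)} {negv (e (pos i))} (λ _ → refl) (e-neg i) k ⟩
    actV w (negv (e (pos i))) k ≡⟨ actV-neg w (e (pos i)) k ⟩
    ℤ.- actV w (e (pos i)) k ≡⟨ cong ℤ.-_ (actV-e hw (ps i) k) ⟩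
    ℤ.- e (ext w (pos i)) k ≡⟨ cong (λ z → ℤ.- e z k) (ext-pos w i) ⟩
    ℤ.- e (w i) k ≡⟨ sym (e-odd (hw i) k) ⟩
    e (ℤ.- w i) k ≡⟨ cong (λ z → e z k) (sym (ext-neg w i)) ⟩
    e (ext w (neg i)) k ∎
    where open ≡-Reasoning

  actV-- : ∀ {n} (w : SP n) x y → actV w (x -v y) ≈v (actV w x -v actV w y)
  actV-- w x y i = trans (actV-+ w x (negv y) i) (cong (ℤ._+_ (actV w x i)) (actV-neg w y i))

  simple-e : ∀ {n} (k : Fin n) → simpleRoot k ≈v (e (pos k) -v e (+ toℕ k))
  simple-e {suc n} fz j = trans (sym (ℤP.+-identityʳ (e (pos {suc n} fz) j))) (cong (λ z → e (pos {suc n} fz) j ℤ.- z) (sym (e-zero j)))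
  simple-e (fs k) j = cong (λ z → e (pos (fs k)) j ℤ.- e (+ suc z) j) (FP.toℕ-inject₁ k)

  module Floors {m : ℕ} (π : Word) (v : SP (suc (suc m))) (inV : InVert (suc (suc m)) π v) (a : AffW (suc (suc m)))
    (lin≗ : ∀ i → lin a i ≡ w′ π v inV i) (framed : Framed {m} a (mu (suc (suc m)) π)) where
    private
      n = suc (suc m)
      μ = mu n π
      lo′ = μ-lo π v inV
      hi′ = μ-hi π v inV
      W = w′ π v inV
      hW : SPerm W
      hW = w′-sp π v inV
      τ′ : SP n
      τ′ = τ μ lo′ hi′
      hτ : SPerm τ′
      hτ = τ-sp μ lo′ hi′
      P′ T′ : ℤ → ℤ
      P′ = P μ lo′ hi′
      T′ = T μ lo′ hi′
      P-idx : ∀ {t} → SIdx n t → SIdx n (P′ t)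
      P-idx = P-sidx μ lo′ hi′
      d : SP n
      d = dB n π v
      hd : SPerm d
      hd = sperm-cong (dB-value π v inV) (compSP-isSP hW hτ)
      ha : SPerm (lin a)
      ha = sperm-cong lin≗ hW

    open Labelled {m} μ lo′ hi′ (low-steps hW (candidate-low π v inV))

    private
      ext-d : ∀ {u} → SIdx n u → ext d u ≡ ext (lin a) (T′ u)
      ext-d su = trans (ext-cong (dB-value π v inV) su) (trans (ext-comp W τ′ su) (ext-cong (λ i → sym (lin≗ i)) (T-sidx μ lo′ hi′ su)))

      ext-d-P : ∀ {t} → SIdx n t → ext d (P′ t) ≡ ext (lin a) t
      ext-d-P st = trans (ext-d (P-idx st)) (cong (ext (lin a)) (TP μ lo′ hi′ st))

    dB-chamber : InChamber d a
    dB-chamber k = subst (+ 0 ℤ.<_) (sym (⟪⟫-cong {y = simpleRoot k} coords (λ _ → refl))) (XT-chamber μ lo′ hi′ k)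
      where
      coords : actV (invSP d) (ptS a) ≈v XT μ lo′ hi′
      coords i = trans (actV-invSP hd (ptS a) i) (trans (cong (ext (ptS a)) (trans (dB-value π v inV i) (sym (ext-cong lin≗ (sp-sidx hτ i))))) (frame {a = a} {μ} ha framed (sp-sidx hτ i)))

    b : AffW n
    b = aff (compSP (invSP d) (lin a)) (actV (invSP d) (tr a))

    private
      lin-b : ∀ i → lin b i ≡ invSP τ′ i
      lin-b i = begin
        ext (invSP d) (lin a i) ≡⟨ cong (ext (invSP d)) (trans (sym (ext-pos (lin a) i)) (sym (ext-d-P (ps i)))) ⟩
        ext (invSP d) (ext d (P′ (pos i))) ≡⟨ ext-invSP-ext hd (P-idx (ps i)) ⟩
        P′ (pos i) ≡⟨ ext-pos (invSP τ′) i ⟩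
        invSP τ′ i ∎
        where open ≡-Reasoning

      hb : SPerm (lin b)
      hb = sperm-cong lin-b (invSP-isSP hτ)

      ext-lin-b : ∀ {t} → SIdx n t → ext (lin b) t ≡ P′ t
      ext-lin-b = ext-cong lin-b

      ext-tr : ∀ {t} → SIdx n t → ext (tr b) (P′ t) ≡ ℤ.- ext μ t
      ext-tr {t} st = begin
        ext (tr b) (P′ t) ≡⟨ ext-cong (actV-invSP hd (tr a)) (P-idx st) ⟩
        ext (compSP (tr a) d) (P′ t) ≡⟨ ext-comp (tr a) d (P-idx st) ⟩
        ext (tr a) (ext d (P′ t)) ≡⟨ cong (ext (tr a)) (ext-d-P st) ⟩
        ext (tr a) (ext (lin a) t) ≡⟨ sym (ext-comp (tr a) (lin a) st) ⟩
        ext (compSP (tr a) (lin a)) t ≡⟨ ext-cong framed st ⟩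
        ext (negv μ) t ≡⟨ ext-negv μ st ⟩
        ℤ.- ext μ t ∎
        where open ≡-Reasoning

      framed-b : Framed {m} b μ
      framed-b i = trans (cong (ext (tr b)) (trans (sym (ext-pos (lin b) i)) (ext-lin-b (ps i)))) (trans (ext-tr (ps i)) (cong ℤ.-_ (ext-pos μ i)))

      ptS-b : ∀ {t} → SIdx n t → ext (ptS b) (P′ t) ≡ X μ t
      ptS-b st = trans (cong (ext (ptS b)) (sym (ext-lin-b st))) (frame {a = b} {μ} hb framed-b st)

      image : ∀ {t} → SIdx n t → actV (lin b) (e t) ≈v e (P′ t)
      image st i = trans (actV-e (sp-sidx hb) st i) (cong (λ z → e z i) (ext-lin-b st))

      spanRoot : ℤ → ℤ → Vecℤ n
      spanRoot c d = e (P′ d) -v e (P′ c)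

      ⟪span⟫ : ∀ (x : Vecℤ n) {c d} → SIdx n c → SIdx n d → ⟪ x , spanRoot c d ⟫ ≡ ext x (P′ d) ℤ.- ext x (P′ c)
      ⟪span⟫ x {c} {d} sc sd = trans (⟪⟫-- x (e (P′ d)) (e (P′ c))) (cong₂ ℤ._-_ (⟪,e⟫ x (P-idx sd)) (⟪,e⟫ x (P-idx sc)))

      -- Each wall of A∘ as an index pair with its level change, the highest wall being represented
      -- by `fork₁`.
      lowIdx highIdx height : Maybe (Fin n) → ℤ
      lowIdx (just k) = + toℕ k
      lowIdx nothing = + suc m
      highIdx (just k) = + toℕ k ℤ.+ + 1
      highIdx nothing = -[1+ suc m ]
      height (just _) = + 0
      height nothing = + 1

      next≡ : ∀ (k : Fin n) → pos k ≡ + toℕ k ℤ.+ + 1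
      next≡ k = cong +_ (ℕP.+-comm 1 (toℕ k))

      spans : ∀ V → WallPair {m} (lowIdx V) (highIdx V) (height V)
      spans (just k) = up (sidx (+ toℕ k) (ℕP.<⇒≤ (FP.toℕ<n k))) (subst (SIdx n) (next≡ k) (ps k))
      spans nothing = fork₁

      rootAt : Maybe (Fin n) → Vecℤ n
      rootAt V = spanRoot (lowIdx V) (highIdx V)

      dropAt : Maybe (Fin n) → ℤ
      dropAt V = drop μ (lowIdx V) (highIdx V) (height V)

      -- The sign is opposite for the highest wall, because `fork₁` spans -eₙ₋₁ - eₙ.
      Oriented : Maybe (Fin n) → Set
      Oriented V = (wallImgRoot b V ≈v rootAt V × wallImgConst b V ≡ dropAt V) ⊎ (wallImgRoot b V ≈v negv (rootAt V) × wallImgConst b V ≡ ℤ.- dropAt V)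

      tr-root : ∀ V → ⟪ tr b , rootAt V ⟫ ≡ dropAt V ℤ.+ height V
      tr-root V = trans (⟪span⟫ (tr b) (vs w) (vt w)) (trans (cong₂ ℤ._-_ (ext-tr (vt w)) (ext-tr (vs w))) (lia 3 (λ c d k → ⊢ (:- d) :- (:- c) := c :- d :- k :+ k) (ext μ (lowIdx V)) (ext μ (highIdx V)) (height V)))
        where w = wall-valid (spans V)

      oriented : ∀ V → Oriented V
      oriented (just k) = inj₁ (img , trans (ℤP.+-identityˡ _) (trans (⟪⟫-cong {x = tr b} (λ _ → refl) img) (trans (tr-root (just k)) (ℤP.+-identityʳ _))))
        where
        w = wall-valid (spans (just k))
        img : wallImgRoot b (just k) ≈v rootAt (just k)
        img i = begin
          actV (lin b) (simpleRoot k) i ≡⟨ actV-cong {w = lin b} (λ _ → refl) (simple-e k) i ⟩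
          actV (lin b) (e (pos k) -v e (+ toℕ k)) i ≡⟨ actV-- (lin b) (e (pos k)) (e (+ toℕ k)) i ⟩
          actV (lin b) (e (pos k)) i ℤ.- actV (lin b) (e (+ toℕ k)) i ≡⟨ cong₂ ℤ._-_ (trans (cong (λ z → actV (lin b) (e z) i) (next≡ k)) (image (vt w) i)) (image (vs w) i) ⟩
          rootAt (just k) i ∎
          where open ≡-Reasoning
      oriented nothing = inj₂ (img , trans (cong (ℤ._+_ (+ 1)) (trans (⟪⟫-cong {x = tr b} (λ _ → refl) img) (trans (⟪⟫-neg (tr b) (rootAt nothing)) (cong ℤ.-_ (tr-root nothing)))))
          (lia 1 (λ d → ⊢ # 1 :+ (:- (d :+ # 1)) := :- d) (dropAt nothing)))
        where
        img : wallImgRoot b nothing ≈v negv (rootAt nothing)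
        img i = begin
          actV (lin b) (e (+ suc m) +v e (+ n)) i ≡⟨ actV-+ (lin b) (e (+ suc m)) (e (+ n)) i ⟩
          actV (lin b) (e (+ suc m)) i ℤ.+ actV (lin b) (e (+ n)) i ≡⟨ cong₂ ℤ._+_ (image in-n-1 i) (image in-n i) ⟩
          e (P′ (+ suc m)) i ℤ.+ e (P′ (+ n)) i ≡⟨ lia 3 (λ a b c → c := :- b ⇒ ⊢ a :+ b := :- (c :- a)) (e {n} (P′ (+ suc m)) i) (e {n} (P′ (+ n)) i) (e {n} (P′ -[1+ suc m ]) i)
               (trans (cong (λ z → e {n} z i) (P-odd μ lo′ hi′ (+ n))) (e-odd (P-idx in-n) i)) ⟩
          ℤ.- rootAt nothing i ∎
          where open ≡-Reasoning

      ⟪ptS,span⟫ : ∀ V → ⟪ ptS b , rootAt V ⟫ ≡ X μ (highIdx V) ℤ.- X μ (lowIdx V)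
      ⟪ptS,span⟫ V = trans (⟪span⟫ (ptS b) (vs w) (vt w)) (cong₂ ℤ._-_ (ptS-b (vt w)) (ptS-b (vs w)))
        where w = wall-valid (spans V)

      -- the alcove lies beyond each of its walls by a positive amount, which fixes the orientation of a floor
      beyond : ∀ V → N n ℤ.* dropAt V ℤ.< ⟪ ptS b , rootAt V ⟫
      beyond V = subst (N n ℤ.* dropAt V ℤ.<_) (sym (⟪ptS,span⟫ V)) (lia 6 (λ N p q y z κ → # 0 :< q :- p :+ N :* κ ⇒ ⊢ N :* (y :- z :- κ) :< (q :- N :* z) :- (p :- N :* y))
         (N n) (pt n (lowIdx V)) (pt n (highIdx V)) (ext μ (lowIdx V)) (ext μ (highIdx V)) (height V) (proj₁ (wall-gap (spans V))))

      neg-neg : ∀ {x y : Vecℤ n} → x ≈v negv y → negv x ≈v y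
      neg-neg h i = trans (cong ℤ.-_ (h i)) (ℤP.neg-involutive _)

      floor⇒wall : ∀ r → IsFloor b (rootVec r) (+ 1) → WallRoot r
      floor⇒wall r ((V , H) , sep) = go H (oriented V) sep
        where
        good : rootVec r ≈v rootAt V → + 1 ≡ dropAt V → WallRoot r
        good p q = lowIdx V , highIdx V , (height V , spans V , sym q) , λ i → sym (p i)
        bad : rootVec r ≈v negv (rootAt V) → + 1 ≡ ℤ.- dropAt V → (+ Nsc n) ℤ.* + 1 ℤ.< ⟪ ptS b , rootVec r ⟫ → ⊥
        bad p q s = lia 3 (λ N D z → N :* # 1 :< :- z ⇒ N :* D :< z ⇒ N :* D := N :* (:- # 1) ⇒ ⊢ :⊥) (N n) (dropAt V) ⟪ ptS b , rootAt V ⟫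
          (subst (N n ℤ.* + 1 ℤ.<_) (trans (⟪⟫-cong {x = ptS b} (λ _ → refl) p) (⟪⟫-neg (ptS b) (rootAt V))) s) (beyond V)
          (cong (N n ℤ.*_) (lia 1 (λ d → # 1 := :- d ⇒ ⊢ d := :- # 1) (dropAt V) q))
        go : HypEq (rootVec r) (+ 1) (wallImgRoot b V) (wallImgConst b V) → Oriented V → _ → WallRoot r
        go _ _ (inj₂ (+<+ () , _))
        go (inj₁ (p , q)) (inj₁ (p′ , q′)) _ = good (λ i → trans (p i) (p′ i)) (trans q q′)
        go (inj₂ (p , q)) (inj₂ (p′ , q′)) _ = good (λ i → trans (p i) (neg-neg {y = rootAt V} p′ i)) (trans q (trans (cong ℤ.-_ q′) (ℤP.neg-involutive _)))
        go (inj₁ (p , q)) (inj₂ (p′ , q′)) (inj₁ (_ , s)) = ⊥-elim (bad (λ i → trans (p i) (p′ i)) (trans q q′) s)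
        go (inj₂ (p , q)) (inj₁ (p′ , q′)) (inj₁ (_ , s)) = ⊥-elim (bad (λ i → trans (p i) (cong ℤ.-_ (p′ i))) (trans q (cong ℤ.-_ q′)) s)

      Standard : ℤ → ℤ → Set
      Standard c d = ∃ λ V → dropAt V ≡ + 1 × (rootAt V ≈v spanRoot c d)

      mirror-drop : ∀ {c d κ} → drop μ (ℤ.- d) (ℤ.- c) κ ≡ drop μ c d κ
      mirror-drop {c} {d} {κ} = trans (cong₂ (λ u v → u ℤ.- v ℤ.- κ) (ext-odd μ d) (ext-odd μ c)) (lia 3 (λ a b k → ⊢ (:- b) :- (:- a) :- k := a :- b :- k) (ext μ c) (ext μ d) κ)

      upwards : ∀ j → suc j ℕ.≤ n → drop μ (+ j) (+ j ℤ.+ + 1) (+ 0) ≡ + 1 → Standard (+ j) (+ j ℤ.+ + 1)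
      upwards j h q = subst (λ j → drop μ (+ j) (+ j ℤ.+ + 1) (+ 0) ≡ + 1 → Standard (+ j) (+ j ℤ.+ + 1)) (FP.toℕ-fromℕ< h) (λ q → just (fromℕ< h) , q , λ _ → refl) q

      -- Steps below zero and `fork₂` are mirrors of the chosen representatives, and a mirror pair
      -- has the same drop and spans the same root.
      standard : ∀ {c d κ} → WallPair {m} c d κ → drop μ c d κ ≡ + 1 → Standard c d
      standard (up {+ j} sc sd) q = upwards j (subst (ℕ._≤ n) (ℕP.+-comm j 1) (sidx-bound sd)) q
      standard (up { -[1+ j ]} sc sd) q = flip (upwards j (sidx-bound sc) (trans (cong (λ z → drop μ z (+ j ℤ.+ + 1) (+ 0)) (sym end≡)) (trans (cong (λ z → drop μ (ℤ.- up-end) z (+ 0)) (cong +_ (ℕP.+-comm j 1))) (trans (mirror-drop { -[1+ j ]} {up-end} {+ 0}) q))))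
        where
        up-end = -[1+ j ] ℤ.+ + 1
        end≡ : ℤ.- up-end ≡ + j
        end≡ = lia 1 (λ j → ⊢ :- ((:- (# 1 :+ j)) :+ # 1) := j) (+ j)
        flip : Standard (+ j) (+ j ℤ.+ + 1) → Standard -[1+ j ] up-end
        flip (V , p , h) = V , p , λ i → trans (h i) (trans (cong₂ (λ u v → spanRoot u v i) (sym end≡) (cong +_ (ℕP.+-comm j 1))) (mirror-root sc sd i))
      standard fork₁ q = nothing , q , λ _ → refl
      standard fork₂ q = nothing , trans (mirror-drop {+ n} { -[1+ m ]} {+ 1}) q , mirror-root in-n (sidx-neg in-n-1)

      wall⇒floor : ∀ r → WallRoot r → IsFloor b (rootVec r) (+ 1)
      wall⇒floor r (c , d , (κ , Wp , q) , h) = go (standard Wp q)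
        where
        w = wall-gap₁ (κ , Wp , q)
        sep : (+ Nsc n) ℤ.* + 1 ℤ.< ⟪ ptS b , rootVec r ⟫
        sep = subst₂ ℤ._<_ (sym (ℤP.*-identityʳ (N n)))
           (trans (sym (trans (⟪span⟫ (ptS b) (vs (proj₁ w)) (vt (proj₁ w))) (cong₂ ℤ._-_ (ptS-b (vt (proj₁ w))) (ptS-b (vs (proj₁ w)))))) (⟪⟫-cong {x = ptS b} (λ _ → refl) h))
           (lia 3 (λ a b N → a :+ N :< b ⇒ ⊢ N :< b :- a) (X μ c) (X μ d) (N n) (proj₂ w))
        go : Standard c d → IsFloor b (rootVec r) (+ 1)
        go (V , p , s) = (V , eqn (oriented V)) , inj₁ (+<+ (s≤s z≤n) , sep)
          where
          root≈ : rootVec r ≈v rootAt V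
          root≈ i = trans (sym (h i)) (sym (s i))
          eqn : Oriented V → HypEq (rootVec r) (+ 1) (wallImgRoot b V) (wallImgConst b V)
          eqn (inj₁ (p′ , q′)) = inj₁ ((λ i → trans (root≈ i) (sym (p′ i))) , trans (sym p) (sym q′))
          eqn (inj₂ (p′ , q′)) = inj₂ ((λ i → trans (root≈ i) (sym (neg-neg {y = rootAt V} p′ i))) , trans (sym p) (trans (sym (ℤP.neg-involutive _)) (cong ℤ.-_ (sym q′))))

    -- Θ is met by the representative d_B itself: its chamber contains the alcove and the two sets
    -- of roots agree, so the list of reflections is empty.
    theta-inverse : ThetaInvIs a d (Abeta n (zetaB n π))
    theta-inverse = d , isSP hd , dB-chamber , (λ r → proj₁ (valleys⇔walls r) ∘ floor⇒wall r , wall⇒floor r ∘ proj₂ (valleys⇔walls r)) , [] , [] , λ x i → refl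

open FloorRoots

theorem6p21 : ∀ (n : ℕ) → 2 ≤ n → ∀ (π : Word) (v : SP n) → InVert n π v →
    ∀ (wf : AffW n) → IsWf wf →
    Σ (AffW n) (λ a → ShiMin a × AndersonIs wf a (psi n π v))
    × (∀ (a : AffW n) → ShiMin a → AndersonIs wf a (psi n π v) →
    ThetaInvIs a (dB n π v) (Abeta n (zetaB n π)))
theorem6p21 (suc (suc m)) (s≤s (s≤s z≤n)) π v inV wf iw =
  (candidate π v inV , candidate-ShiMin π v inV , candidate-anderson π v inV {wf} iw) ,
  -- Uniqueness identifies the linear part and the area vector of `a` only pointwise; the floor
  -- computation is therefore stated for any alcove with these values.
  λ a S A → let (l , f) = anderson-unique π v inV {wf} {a} iw S A in Floors.theta-inverse π v inV a l f
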